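{- Let $\Lambda$ be a superpartition of fermionic degree $m$ and let $\ell\ge1$. Then $$\bar s^*_\Lambda\,h_\ell=\sum_\Omega\bar s^*_\Omega ,$$ where the sum runs over all superpartitions $\Omega$ of fermionic degree $m$ such that (1) $\Omega^*/\Lambda^*$ is a horizontal $\ell$-strip, and (2) for each $i=1,\dots,m$, the $i$-th circle of $\Omega$ and the $i$-th circle of $\Lambda$ (counting circles starting from the first row and going down) lie either in the same row or in the same column; and if they lie in the same row $r$ with $r\ge2$, then the circle of $\Omega$ in row $r$ is not located past the end of row $r-1$ of $\Lambda$, i.e. its column index is at most $\Lambda^*_{r-1}$. Likewise, $$s_\Lambda\,e_\ell=\sum_\Omega s_\Omega ,$$ where the sum runs over all superpartitions $\Omega$ of fermionic degree $m$ such that (1') $\Omega^*/\Lambda^*$ is a vertical $\ell$-strip, and (2') for each $i$, the $i$-th circles of $\Omega$ and $\Lambda$ (counted from the first row going down) lie either in the same row or in the same column; and if they lie in the same column $c$ with $c\ge2$, then the circle of $\Omega$ in column $c$ is not located past the bottom of column $c-1$ of $\Lambda$, i.e. its row index is at most the number of cells of $\Lambda^*$ in column $c-1$.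
   Context: Let $x=(x_1,x_2,\dots)$ be commuting variables and $\theta=(\theta_1,\theta_2,\dots)$ anticommuting variables ($\theta_i\theta_j=-\theta_j\theta_i$, $\theta_i^2=0$, commuting with the $x_j$); symmetric functions in superspace are formal series over $\mathbb Q$ of bounded degree invariant under simultaneous permutations $x_i\leftrightarrow x_j,\theta_i\leftrightarrow\theta_j$. A superpartition $\Lambda$ of fermionic degree $m$ is $(\Lambda^a;\Lambda^s)=(\Lambda_1,\dots,\Lambda_m;\Lambda_{m+1},\dots)$ with $\Lambda_1>\dots>\Lambda_m\ge0$ and $\Lambda^s$ a partition. $\Lambda^*$ is the partition with the parts of $\Lambda^a$ and $\Lambda^s$; $\Lambda^\circledast$ the partition with parts $\Lambda_i+1$ ($i\le m$) and those of $\Lambda^s$; $\Lambda^\circledast/\Lambda^*$ has $m$ cells, no two in a row or column. The diagram of $\Lambda$ is the Ferrers diagram of $\Lambda^*$ (English convention: rows numbered from the top, row $i$ occupying columns $1,\dots,\Lambda^*_i$) with a circle in each cell of $\Lambda^\circledast/\Lambda^*$. For partitions $\mu\subseteq\nu$, $\nu/\mu$ is a horizontal (resp. vertical) $\ell$-strip if $|\nu|-|\mu|=\ell$ and no two of its cells lie in the same column (resp. row). Order: $\Omega\le\Lambda$ iff same fermionic degree, $|\Omega^*|=|\Lambda^*|$, $\Omega^*\le\Lambda^*$, $\Omega^\circledast\le\Lambda^\circledast$ (dominance). $m_\Lambda$ is the sum of all distinct monomials $\theta_{i_1}\cdots\theta_{i_m}x_{i_1}^{\Lambda_1}\cdots x_{i_m}^{\Lambda_m}x_{j_1}^{\Lambda_{m+1}}\cdots$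 (distinct indices); $e_r,h_r$ are the usual elementary and complete symmetric functions; $\tilde p_k=\sum_i\theta_ix_i^k$, $p_r=\sum_ix_i^r$, $p_\Lambda=\tilde p_{\Lambda_1}\cdots\tilde p_{\Lambda_m}p_{\Lambda_{m+1}}\cdots$; $\langle\!\langle p_\Lambda,p_\Omega\rangle\!\rangle=\delta_{\Lambda\Omega}z_{\Lambda^s}$, $z_\lambda=\prod_ii^{n_i}n_i!$. $P_\Lambda(q,t)$ is the unique family with $P_\Lambda=m_\Lambda+\sum_{\Omega<\Lambda}c_{\Lambda\Omega}m_\Omega$, pairwise orthogonal for $\langle\!\langle p_\Lambda,p_\Omega\rangle\!\rangle_{q,t}=\delta_{\Lambda\Omega}q^{|\Lambda^a|}z_{\Lambda^s}\prod_i\frac{1-q^{\Lambda^s_i}}{1-t^{\Lambda^s_i}}$. $s_\Lambda$, $\bar s_\Lambda$ are the limits of $P_\Lambda(q,t)$ as $q=t\to0$, resp. $q=t\to\infty$ (they exist and form bases); $\bar s^*_\Lambda$ is the basis dual to $\bar s_\Lambda$ for $\langle\!\langle\cdot,\cdot\rangle\!\rangle$. -}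

module Defs where

open import Data.Bool using (Bool; true; false; if_then_else_; _∧_; T)
open import Data.Nat as ℕ using (ℕ; zero; suc; _∸_; _≤ᵇ_; _<ᵇ_; _≡ᵇ_)
open import Data.Nat using (_!)
open import Data.Integer using (+_)
open import Data.Nat.ListAction using (sum)
open import Data.List using (List; []; _∷_; _++_; map; length; filter; foldr; take; concatMap; upTo; replicate)
open import Data.List.Relation.Unary.Unique.Propositional using (Unique)
open import Data.List.Membership.Propositional using (_∈_)
open import Data.List.Relation.Unary.All using (All)
import Data.List
import Data.Bool
open import Data.Product using (_×_; _,_; proj₁; proj₂; Σ; ∃)
open import Data.Sum using (_⊎_)
open import Data.Rational using (ℚ; 0ℚ; 1ℚ; _+_; _*_; _-_; -_; _÷_; ∣_∣; _<_; _/_; ≢-nonZero)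
open import Data.Rational.Properties using (_≟_)
open import Relation.Nullary using (¬_; yes; no)
open import Relation.Binary.PropositionalEquality using (_≡_; _≢_)
open import Function.Bundles using (_⇔_)
import Data.List.Properties as LP
import Data.Nat.Properties as NP
import Data.Product.Properties as PP

-- Superpartitions, raw representation
-- A (raw) superpartition is a pair (Λ^a , Λ^s) of lists of naturals.
-- It is a superpartition iff IsSP holds:
--   Λ^a strictly decreasing (parts ≥ 0), Λ^s weakly decreasing, positive.

SP : Set
SP = List ℕ × List ℕ

strictDec : List ℕ → Bool
strictDec []           = true
strictDec (x ∷ [])     = true
strictDec (x ∷ y ∷ xs) = (y <ᵇ x) ∧ strictDec (y ∷ xs)

weakDecPos : List ℕ → Bool
weakDecPos []           = true
weakDecPos (x ∷ [])     = 1 ≤ᵇ x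
weakDecPos (x ∷ y ∷ xs) = (y ≤ᵇ x) ∧ (1 ≤ᵇ x) ∧ weakDecPos (y ∷ xs)

isSP : SP → Bool
isSP (a , s) = strictDec a ∧ weakDecPos s

IsSP : SP → Set
IsSP Λ = T (isSP Λ)

fdeg : SP → ℕ
fdeg (a , s) = length a

_≟SP_ : (Λ Ω : SP) → Relation.Nullary.Dec (Λ ≡ Ω)
_≟SP_ = PP.≡-dec (LP.≡-dec NP._≟_) (LP.≡-dec NP._≟_)

-- Partitions as weakly decreasing lists (possibly with trailing zeros)

insertDesc : ℕ → List ℕ → List ℕ
insertDesc x []       = x ∷ []
insertDesc x (y ∷ ys) = if y ≤ᵇ x then x ∷ y ∷ ys else y ∷ insertDesc x ys

sortDesc : List ℕ → List ℕ
sortDesc = foldr insertDesc []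

star : SP → List ℕ
star (a , s) = sortDesc (a ++ s)

circledast : SP → List ℕ
circledast (a , s) = sortDesc (map suc a ++ s)

nth : List ℕ → ℕ → ℕ
nth []       _       = 0
nth (x ∷ xs) zero    = x
nth (x ∷ xs) (suc i) = nth xs i

-- length of row r (rows numbered from 1) and of column c (from 1)
rowLen : List ℕ → ℕ → ℕ
rowLen la r = nth la (r ∸ 1)

colLen : List ℕ → ℕ → ℕ
colLen la c = length (filter (λ x → c ℕ.≤? x) la)

Dom : List ℕ → List ℕ → Set
Dom mu la = ∀ k → sum (take k mu) ℕ.≤ sum (take k la)

_≤SP_ : SP → SP → Set
Ω ≤SP Λ = IsSP Ω × IsSP Λ × fdeg Ω ≡ fdeg Λ × sum (star Ω) ≡ sum (star Λ)
          × Dom (star Ω) (star Λ) × Dom (circledast Ω) (circledast Λ)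

_<SP_ : SP → SP → Set
Ω <SP Λ = Ω ≤SP Λ × Ω ≢ Λ

InSkew : List ℕ → List ℕ → ℕ → ℕ → Set
InSkew μ ν r c = 1 ℕ.≤ r × 1 ℕ.≤ c × c ℕ.≤ rowLen ν r × rowLen μ r ℕ.< c

Contained : List ℕ → List ℕ → Set
Contained μ ν = ∀ i → nth μ i ℕ.≤ nth ν i

HorizontalStrip : List ℕ → List ℕ → ℕ → Set
HorizontalStrip μ ν ℓ = Contained μ ν × sum ν ≡ sum μ ℕ.+ ℓ
  × (∀ r r' c → InSkew μ ν r c → InSkew μ ν r' c → r ≡ r')

VerticalStrip : List ℕ → List ℕ → ℕ → Set
VerticalStrip μ ν ℓ = Contained μ ν × sum ν ≡ sum μ ℕ.+ ℓ
  × (∀ r c c' → InSkew μ ν r c → InSkew μ ν r c' → c ≡ c')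

-- Circles.  The circle attached to the antisymmetric part a of Λ lies in
-- column a+1 and in the topmost row of Λ^* of length a, i.e. in row
-- 1 + #{parts of Λ^* strictly larger than a}.  Listing them along Λ^a
-- (decreasing) lists the circles from the first row going down.

circleRow : SP → ℕ → ℕ
circleRow (a , s) x = suc (length (filter (λ y → suc x ℕ.≤? y) (a ++ s)))

circle : SP → ℕ → ℕ × ℕ
circle Λ i = circleRow Λ (nth (proj₁ Λ) i) , suc (nth (proj₁ Λ) i)

CircleCondH : SP → SP → Set
CircleCondH Λ Ω = ∀ i → i ℕ.< fdeg Λ →
  let r  = proj₁ (circle Λ i) ; c  = proj₂ (circle Λ i)
      r' = proj₁ (circle Ω i) ; c' = proj₂ (circle Ω i)
  in (r ≡ r' ⊎ c ≡ c') × (r ≡ r' → 2 ℕ.≤ r → c' ℕ.≤ rowLen (star Λ) (r ∸ 1))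

CircleCondV : SP → SP → Set
CircleCondV Λ Ω = ∀ i → i ℕ.< fdeg Λ →
  let r  = proj₁ (circle Λ i) ; c  = proj₂ (circle Λ i)
      r' = proj₁ (circle Ω i) ; c' = proj₂ (circle Ω i)
  in (r ≡ r' ⊎ c ≡ c') × (c ≡ c' → 2 ℕ.≤ c → r' ℕ.≤ colLen (star Λ) (c ∸ 1))

PieriH : SP → ℕ → SP → Set
PieriH Λ ℓ Ω = IsSP Ω × fdeg Ω ≡ fdeg Λ × HorizontalStrip (star Λ) (star Ω) ℓ
               × CircleCondH Λ Ω

PieriV : SP → ℕ → SP → Set
PieriV Λ ℓ Ω = IsSP Ω × fdeg Ω ≡ fdeg Λ × VerticalStrip (star Λ) (star Ω) ℓ
               × CircleCondV Λ Ω

-- Symmetric functions in superspace, represented by their coefficients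
-- in the monomial basis: f = Σ_Λ f(Λ) m_Λ.  (Only values at genuine
-- superpartitions matter.)

SymF : Set
SymF = SP → ℚ

ℕ→ℚ : ℕ → ℚ
ℕ→ℚ n = (+ n) / 1

sgn : ℕ → ℚ
sgn zero    = 1ℚ
sgn (suc n) = - sgn n

sumℚ : List ℚ → ℚ
sumℚ = foldr _+_ 0ℚ

-- a monomial in variables x_1..x_N, θ_1..θ_N: for each variable its
-- x-exponent and whether θ_i occurs; θ's written in increasing index order.
Mono : Set
Mono = List (ℕ × Bool)

countᵇ : {A : Set} → (A → Bool) → List A → ℕ
countᵇ p []       = 0
countᵇ p (x ∷ xs) = (if p x then 1 else 0) ℕ.+ countᵇ p xs

invs : Mono → ℕ
invs []             = 0
invs ((e , b) ∷ xs) =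
  (if b then countᵇ (λ y → proj₂ y ∧ (e <ᵇ proj₁ y)) xs else 0) ℕ.+ invs xs

-- coefficient of a monomial in the symmetric function f:
-- the monomial θ_{i1}..θ_{ik} x^e (i1<..<ik) equals (-1)^{invs} times the
-- corresponding monomial of m_Λ, Λ = (sorted θ-exponents ; sorted other
-- nonzero exponents); coefficient 0 if this is not a superpartition.
keyOf : Mono → SP
keyOf mono = sortDesc (map proj₁ (Data.List.filterᵇ proj₂ mono))
           , sortDesc (Data.List.filterᵇ (λ e → 1 ≤ᵇ e)
                         (map proj₁ (Data.List.filterᵇ (λ y → Data.Bool.not (proj₂ y)) mono)))

coefMono : SymF → Mono → ℚ
coefMono f mono = if isSP (keyOf mono) then sgn (invs mono) * f (keyOf mono) else 0ℚ

canon : SP → Mono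
canon (a , s) = map (λ e → (e , true)) a ++ map (λ e → (e , false)) s

splits : Mono → List (Mono × Mono)
splits []             = ([] , []) ∷ []
splits ((e , b) ∷ xs) = concatMap (λ p → concatMap (λ x → choose x (e ∸ x) p) (upTo (suc e))) (splits xs)
  where
  choose : ℕ → ℕ → Mono × Mono → List (Mono × Mono)
  choose x y (fm , gm) = if b then ((x , true) ∷ fm , (y , false) ∷ gm) ∷ ((x , false) ∷ fm , (y , true) ∷ gm) ∷ []
                               else ((x , false) ∷ fm , (y , false) ∷ gm) ∷ []

-- sign of reordering θ_{S_f} θ_{S_g} into increasing order:
-- number of pairs (u ∈ S_f , v ∈ S_g) with u > v
shuf : Mono → Mono → ℕ
shuf ((_ , bf) ∷ fs) ((_ , bg) ∷ gs) = (if bg then countᵇ proj₂ fs else 0) ℕ.+ shuf fs gs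
shuf _ _ = 0

-- product of symmetric functions in superspace, in the monomial basis:
-- the coefficient of m_Γ in f·g is the coefficient of the canonical
-- monomial of Γ in f·g.
infixl 7 _⋆_
_⋆_ : SymF → SymF → SymF
(f ⋆ g) Γ = if isSP Γ
  then sumℚ (map (λ p → sgn (shuf (proj₁ p) (proj₂ p)) * coefMono f (proj₁ p) * coefMono g (proj₂ p))
                 (splits (canon Γ)))
  else 0ℚ

mono : SP → SymF
mono Λ Γ with Λ ≟SP Γ
... | yes _ = 1ℚ
... | no  _ = 0ℚ

h : ℕ → SymF
h ℓ (a , s) = if isSP (a , s) ∧ (length a ≡ᵇ 0) ∧ (sum s ≡ᵇ ℓ) then 1ℚ else 0ℚ

e : ℕ → SymF
e ℓ = mono ([] , replicate ℓ 1)

-- power sums: p̃_k = m_{(k;)}, p_r = m_{(;r)}, p_Λ = p̃_{Λ1}..p̃_{Λm} p_{Λm+1}..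
pSP : SP → SymF
pSP (a , s) = foldr (λ k acc → mono (k ∷ [] , []) ⋆ acc)
                    (foldr (λ r acc → mono ([] , r ∷ []) ⋆ acc) (mono ([] , [])) s) a

powℚ : ℚ → ℕ → ℚ
powℚ x zero    = 1ℚ
powℚ x (suc n) = x * powℚ x n

prodℚ : List ℚ → ℚ
prodℚ = foldr _*_ 1ℚ

-- division, with the (never used) convention x / 0 = 0
divℚ : ℚ → ℚ → ℚ
divℚ x y with y ≟ 0ℚ
... | yes _ = 0ℚ
... | no  p = _÷_ x y {{≢-nonZero p}}

mult : ℕ → List ℕ → ℕ
mult k = countᵇ (λ x → k ≡ᵇ x)

z : List ℕ → ℕ
z la = foldr ℕ._*_ 1 (map (λ k → (k ℕ.^ mult k la) ℕ.* ((mult k la) !)) (map suc (upTo (sum la))))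

-- ⟨⟨p_Λ,p_Λ⟩⟩_{q,t} = q^{|Λ^a|} z_{Λ^s} Π_i (1-q^{Λ^s_i})/(1-t^{Λ^s_i})
weightQT : ℚ → ℚ → SP → ℚ
weightQT q t (a , s) = powℚ q (sum a) * ℕ→ℚ (z s)
  * prodℚ (map (λ k → divℚ (1ℚ - powℚ q k) (1ℚ - powℚ t k)) s)

-- ⟨⟨p_Λ,p_Λ⟩⟩ = z_{Λ^s}
weight : SP → ℚ
weight (a , s) = ℕ→ℚ (z s)

PExp : SymF → List SP → (SP → ℚ) → Set
PExp f L c = Unique L × All IsSP L
  × (∀ Γ → IsSP Γ → f Γ ≡ sumℚ (map (λ Λ → c Λ * pSP Λ Γ) L))

-- ⟨⟨f , g⟩⟩_w = v   for the scalar product with ⟨⟨p_Λ,p_Ω⟩⟩ = δ_{ΛΩ} w(Λ)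
ScalarProd : (SP → ℚ) → SymF → SymF → ℚ → Set
ScalarProd w f g v = Σ (List SP) λ L → Σ (SP → ℚ) λ cf → Σ (SP → ℚ) λ cg →
  PExp f L cf × PExp g L cg × v ≡ sumℚ (map (λ Λ → cf Λ * cg Λ * w Λ) L)

size : SP → ℕ
size Λ = sum (star Λ)

-- P : Λ ↦ P_Λ is triangular (P_Λ = m_Λ + Σ_{Ω<Λ} c m_Ω) and pairwise
-- orthogonal for the scalar product w, on the superpartitions satisfying
-- A (below A is always a union of whole degrees (n|m)).
IsPFamilyOn : (SP → Set) → (SP → ℚ) → (SP → SymF) → Set
IsPFamilyOn A w P =
  (∀ Λ → IsSP Λ → A Λ → P Λ Λ ≡ 1ℚ × (∀ Ω → P Λ Ω ≢ 0ℚ → Ω ≡ Λ ⊎ Ω <SP Λ))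
  × (∀ Λ Ω → IsSP Λ → IsSP Ω → A Λ → A Ω → Λ ≢ Ω → ScalarProd w (P Λ) (P Ω) 0ℚ)

LimAt0⁺ : (ℚ → ℚ) → ℚ → Set
LimAt0⁺ φ L = ∀ ε → 0ℚ < ε → ∃ λ δ → 0ℚ < δ × (∀ t → 0ℚ < t → t < δ → ∣ φ t - L ∣ < ε)

LimAtInf : (ℚ → ℚ) → ℚ → Set
LimAtInf φ L = ∀ ε → 0ℚ < ε → ∃ λ T → (∀ t → T < t → ∣ φ t - L ∣ < ε)

-- s_Λ = lim_{q=t→0} P_Λ(q,t).  For each degree (n|m) and every rational
-- t with 0 < t < δ₀ n m, (P t Λ)_Λ of degree (n|m) is the family P_Λ(t,t),
-- i.e. triangular and orthogonal for ⟨⟨,⟩⟩_{t,t}; s_Λ is its coefficientwise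
-- limit as t → 0⁺.
IsSBasis : (SP → SymF) → Set
IsSBasis s = Σ (ℕ → ℕ → ℚ) λ δ₀ → Σ (ℚ → SP → SymF) λ P → (∀ n m → 0ℚ < δ₀ n m)
  × (∀ t → 0ℚ < t → IsPFamilyOn (λ Λ → t < δ₀ (size Λ) (fdeg Λ)) (weightQT t t) (P t))
  × (∀ Λ Γ → IsSP Λ → LimAt0⁺ (λ t → P t Λ Γ) (s Λ Γ))

-- s̄_Λ = lim_{q=t→∞} P_Λ(q,t)
IsSbarBasis : (SP → SymF) → Set
IsSbarBasis sb = Σ (ℕ → ℕ → ℚ) λ T₀ → Σ (ℚ → SP → SymF) λ P
  → (∀ t → IsPFamilyOn (λ Λ → T₀ (size Λ) (fdeg Λ) < t) (weightQT t t) (P t))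
  × (∀ Λ Γ → IsSP Λ → LimAtInf (λ t → P t Λ Γ) (sb Λ Γ))

δSP : SP → SP → ℚ
δSP Λ Ω with Λ ≟SP Ω
... | yes _ = 1ℚ
... | no  _ = 0ℚ

IsDual : (SP → SymF) → (SP → SymF) → Set
IsDual sd sb = ∀ Λ Ω → IsSP Λ → IsSP Ω → ScalarProd weight (sd Λ) (sb Ω) (δSP Λ Ω)

{-# OPTIONS --safe #-}
-- A symmetric function is represented by the functional it defines on words in the letters h_n and p̃_a, and
-- operators act on functionals by transposition. A word of rows (length k, with or without a circle) defines S_w
-- by composing the row operators Φ_k (circled) and B_k = D Φ_k (not circled), where Φ_k anticommutes with itself
-- and D² = 0. Commuting e_n, respectively h_n, through the row operators and straightening gives sums of S_v with
-- all coefficients one: these are the two Pieri rules, the second resting on Σ_{i+j=n} Φ_{k+i} B_{k+1+j} = B_{k+1+n} Φ_k.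
-- It remains to see that s_Λ = S_Λ and s̄*_Λ = S_Λ ∘ A, where A substitutes h̃_a = Σ p̃_i h_{a-i} for p̃_a.
-- P_Λ(t,t) is orthogonal to every function with smaller support in the monomial basis. For s_Λ the test functions are
-- p̃_{Γ^a} e_{(Γ^s)'} made monomially triangular; dividing by t^{|Γ^a|} and letting t → 0 leaves conditions that S_Λ
-- satisfies and that determine it. For s̄_Λ they are the products of column functions e_r and m_{(0;1^r)}: at t → ∞ the
-- latter become (-1)^r p̃_r, whose image under A is m_{(0;1^r)} again, and such products differ from S_w by smaller S_v.
module Submission where

open import Defs
open import Data.Nat using (ℕ; zero; suc; _≤_; _<_; z≤n; s≤s; _∸_; _≡ᵇ_; _≤ᵇ_; _<ᵇ_)
open import Data.Bool using (Bool; true; false; if_then_else_; T; _∧_; not)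
open import Data.Nat.ListAction using (sum)
open import Data.List using (List; []; _∷_; _++_; map; length; foldr; filter; concatMap; upTo; replicate)
open import Data.List.Relation.Unary.Unique.Propositional using (Unique)
open import Data.List.Membership.Propositional using (_∈_)
open import Data.List.Relation.Unary.All using (All; []; _∷_)
open import Data.Product using (_×_; _,_; Σ; ∃) renaming (proj₁ to fst; proj₂ to snd)
open import Data.Sum using (_⊎_) renaming (inj₁ to inl; inj₂ to inr)
open import Data.Empty using (⊥; ⊥-elim)
open import Data.Unit using (⊤; tt)
open import Data.Rational using (ℚ; ½) renaming (0ℚ to 0#; 1ℚ to 1#)
open import Function.Bundles using (_⇔_; Equivalence)
open import Relation.Nullary using (¬_; yes; no)
open import Relation.Binary.PropositionalEquality using (_≡_; _≢_; refl; sym; trans; cong; cong₂; subst; subst₂; module ≡-Reasoning)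
import Data.Nat as ℕ
open import Data.Nat.Solver renaming (module +-*-Solver to ℕ-Solver)
open ℕ-Solver using () renaming (solve to ℕ-solve; _:+_ to _⊕_; _:=_ to _⊜_)
open import Data.List.Membership.Propositional.Properties using (∈-map⁺; ∈-++⁺ˡ; ∈-++⁺ʳ; ∈-concatMap⁺)
open import Induction.WellFounded using (Acc; acc)
open import Relation.Binary.Definitions using (tri<; tri≈; tri>)
import Data.Nat.Properties as ℕP
open ℕP using (+-cancelˡ-≡; +-cancelˡ-≤; +-mono-≤; +-monoʳ-≤; +-monoˡ-≤; +-suc; 1+n≢0; 1+n≢n; 1+n≰n; <-asym; <-cmp; <-irrefl; <-trans; <-≤-trans; <ᵇ⇒<; <⇒<ᵇ; <⇒≢; <⇒≤; <⇒≱; >⇒≢; m<m+n; m≢1+n+m; m≤m+n; m≤n+m; m≤n⇒m<n∨m≡n; m≤n⇒m≤1+n; n<1+n; n≤1+n; n≮0; suc-injective; ≡ᵇ⇒≡; ≤-<-trans; ≤-antisym; ≤-pred; ≤-refl; ≤-reflexive; ≤-trans; ≤ᵇ⇒≤; ≤⇒≤ᵇ; ≤⇒≤′; ≮⇒≥; ≰⇒>)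
import Data.Rational as ℚ
import Data.Rational.Properties as ℚP
open import Data.Maybe using (Maybe; just; nothing)
import Data.List.Relation.Unary.All as All
import Data.List.Relation.Unary.All.Properties as AllP
import Data.List.Relation.Unary.Any as Any
import Data.List.Properties as LP
open import Algebra.Bundles using (CommutativeRing)
open import Algebra.Structures using (IsCommutativeRing)
open import Algebra.Solver.Ring.AlmostCommutativeRing using (fromCommutativeRing; _-Raw-AlmostCommutative⟶_)
import Algebra.Solver.Ring
open import Relation.Nullary.Decidable using (dec⇒maybe)
open import Data.List.Membership.Propositional.Properties using (∈-map⁻; ∈-++⁻; ∈-∃++; ∈-upTo⁺)
open import Data.List.Relation.Unary.AllPairs using ([]; _∷_)
import Data.List.Relation.Unary.Unique.Propositional.Properties as UniqueP
open import Data.List using (applyUpTo)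
import Data.Integer as ℤ
import Data.Integer.Properties as ℤP
import Data.Rational.Unnormalised as ℚᵘ
import Data.Rational.Unnormalised.Properties as ℚᵘP
import Data.Nat.ListAction as ListAction
import Data.Nat.ListAction.Properties as ListActionP

open ≡-Reasoning

-- No algebra is constructed as a quotient. A functional on words (`Fn`) stands for a function
-- through the scalar product, a `Lin` functional on `Fn` stands for a finite combination of words,
-- and the commutation relations appear only as the predicate `Symm`. The operators Φ_k split off
-- one variable: Σ_i θ_i x_i^k times the function of the other variables. Their anticommutation is
-- that of the θ_i, and the rules for e_n and h_n come from restoring x_i in e_n and h_n. At q = t
-- the deformed scalar product differs from ⟨⟨ , ⟩⟩ only by the factor t^{|Λ^a|}, the twist `sc t`.
-- The twist replaces the parameter 1 of Φ by t but the parameter 1 of ẽ by 1/t. This is why the two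
-- limits call for two families of test functions, each with parameter tending to 0. The bases are
-- known only as coefficientwise limits, so they are identified by uniqueness: in each degree
-- finitely many vanishing conditions pass to the limit and leave one solution. The eliminations run
-- along the total order `≺` on words, a refinement of the order on superpartitions; it is well
-- founded on valid words.

-- ℚ's operations unfold on arguments, which blocks unification; opaque copies
-- behave like injective symbols.
opaque
  infixl 6 _+_
  infixl 7 _*_
  infix 8 -_

  _+_ _*_ : ℚ → ℚ → ℚ
  _+_ = ℚ._+_
  _*_ = ℚ._*_

  -_ : ℚ → ℚ
  -_ = ℚ.-_

infixl 6 _-_
_-_ : ℚ → ℚ → ℚ
x - y = x + - y

opaque
  unfolding _+_ _*_ -_

  +-raw : ∀ x y → x + y ≡ x ℚ.+ y
  +-raw x y = refl

  *-raw : ∀ x y → x * y ≡ x ℚ.* y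
  *-raw x y = refl

  neg-raw : ∀ x → - x ≡ ℚ.- x
  neg-raw x = refl

  isCommutativeRing : IsCommutativeRing _≡_ _+_ _*_ -_ 0# 1#
  isCommutativeRing = ℚP.+-*-isCommutativeRing

ℚ-ring : CommutativeRing _ _
ℚ-ring = record { isCommutativeRing = isCommutativeRing }

open CommutativeRing ℚ-ring public using
  (+-assoc; +-comm; +-identityˡ; +-identityʳ; *-assoc; *-comm; *-identityˡ; *-identityʳ; distribˡ; distribʳ; zeroˡ; zeroʳ; -‿inverseʳ; -‿inverseˡ)

raw⟶ring : ℚ.+-*-rawRing -Raw-AlmostCommutative⟶ fromCommutativeRing ℚ-ring
raw⟶ring ._-Raw-AlmostCommutative⟶_.⟦_⟧ x = x
raw⟶ring ._-Raw-AlmostCommutative⟶_.+-homo x y = sym (+-raw x y)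
raw⟶ring ._-Raw-AlmostCommutative⟶_.*-homo x y = sym (*-raw x y)
raw⟶ring ._-Raw-AlmostCommutative⟶_.-‿homo x = sym (neg-raw x)
raw⟶ring ._-Raw-AlmostCommutative⟶_.0-homo = refl
raw⟶ring ._-Raw-AlmostCommutative⟶_.1-homo = refl

module Solver = Algebra.Solver.Ring ℚ.+-*-rawRing (fromCommutativeRing ℚ-ring) raw⟶ring
  (λ x y → dec⇒maybe (x ℚP.≟ y))

open Solver public using (solve; _:+_; _:*_; _:-_; :-_; _:=_; con)

infixr 5 _∙_
_∙_ : ∀ {A : Set} {x y z : A} → x ≡ y → y ≡ z → x ≡ z
_∙_ = trans

*0 : ∀ {a x} → x ≡ 0# → a * x ≡ 0#
*0 {a} p = cong (a *_) p ∙ zeroʳ a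

0* : ∀ {x a} → x ≡ 0# → x * a ≡ 0#
0* {_} {a} p = cong (_* a) p ∙ zeroˡ a

0+ : ∀ {x y} → x ≡ 0# → x + y ≡ y
0+ p = cong (_+ _) p ∙ +-identityˡ _

+0 : ∀ {x y} → y ≡ 0# → x + y ≡ x
+0 p = cong (_ +_) p ∙ +-identityʳ _

0+0 : ∀ {x y} → x ≡ 0# → y ≡ 0# → x + y ≡ 0#
0+0 p q = 0+ p ∙ q

0-0 : ∀ {x y} → x ≡ 0# → y ≡ 0# → x - y ≡ 0#
0-0 p q = cong₂ _-_ p q ∙ -‿inverseʳ 0#

-1# : ℚ
-1# = ℚ.- 1#

Letter : Set
Letter = ℕ × Bool

pattern bos n = n , false
pattern fer a = a , true

Fn : Set
Fn = Mono → ℚ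

double-injective : ∀ {x y : ℚ} → x + x ≡ y + y → x ≡ y
double-injective {x} {y} p = half x ∙ cong (½ *_) p ∙ sym (half y)
  where
  half : ∀ x → x ≡ ½ * (x + x)
  half = solve 1 (λ x → x := con ½ :* (x :+ x)) refl

antisymmetric⇒0 : ∀ {x : ℚ} → x ≡ - x → x ≡ 0#
antisymmetric⇒0 {x} p = double-injective (cong (x +_) p ∙ -‿inverseʳ x ∙ sym (+-identityˡ 0#))

-- Sums over i + j = n.

conv : ℕ → (ℕ → ℕ → ℚ) → ℚ
conv zero F = F 0 0
conv (suc n) F = F 0 (suc n) + conv n (λ i j → F (suc i) j)

conv-cong : ∀ n {F G : ℕ → ℕ → ℚ} → (∀ i j → i ℕ.+ j ≡ n → F i j ≡ G i j) → conv n F ≡ conv n G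
conv-cong zero p = p 0 0 refl
conv-cong (suc n) p = cong₂ _+_ (p 0 (suc n) refl) (conv-cong n (λ i j q → p (suc i) j (cong suc q)))

conv-+ : ∀ n (F G : ℕ → ℕ → ℚ) → conv n (λ i j → F i j + G i j) ≡ conv n F + conv n G
conv-+ zero F G = refl
conv-+ (suc n) F G = cong (F 0 (suc n) + G 0 (suc n) +_) (conv-+ n _ _) ∙
  solve 4 (λ a b c d → (a :+ b) :+ (c :+ d) := (a :+ c) :+ (b :+ d)) refl _ _ _ _

conv-* : ∀ n c (F : ℕ → ℕ → ℚ) → conv n (λ i j → c * F i j) ≡ c * conv n F
conv-* zero c F = refl
conv-* (suc n) c F = cong (c * F 0 (suc n) +_) (conv-* n c _) ∙ sym (distribˡ c _ _)

neg-as-* : ∀ x → - x ≡ -1# * x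
neg-as-* = solve 1 (λ x → :- x := con -1# :* x) refl

conv-neg : ∀ n (F : ℕ → ℕ → ℚ) → conv n (λ i j → - F i j) ≡ - conv n F
conv-neg n F = conv-cong n (λ i j _ → neg-as-* (F i j)) ∙
  conv-* n (-1#) F ∙ sym (neg-as-* _)

conv-0 : ∀ n (F : ℕ → ℕ → ℚ) → (∀ i j → i ℕ.+ j ≡ n → F i j ≡ 0#) → conv n F ≡ 0#
conv-0 zero F p = p 0 0 refl
conv-0 (suc n) F p = cong₂ _+_ (p 0 (suc n) refl) (conv-0 n _ (λ i j q → p (suc i) j (cong suc q))) ∙ +-identityˡ 0#

conv-last : ∀ n (F : ℕ → ℕ → ℚ) → conv (suc n) F ≡ conv n (λ i j → F i (suc j)) + F (suc n) 0
conv-last zero F = refl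
conv-last (suc n) F = cong (F 0 (suc (suc n)) +_) (conv-last n (λ i j → F (suc i) j)) ∙
  sym (+-assoc (F 0 (suc (suc n))) _ _)

conv-flip : ∀ n (F : ℕ → ℕ → ℚ) → conv n F ≡ conv n (λ i j → F j i)
conv-flip zero F = refl
conv-flip (suc n) F = cong (F 0 (suc n) +_) (conv-flip n (λ i j → F (suc i) j)) ∙
  +-comm (F 0 (suc n)) _ ∙ sym (conv-last n (λ i j → F j i))

conv-antisymmetric : ∀ n (F : ℕ → ℕ → ℚ) → (∀ i j → F i j ≡ - F j i) → conv n F ≡ 0#
conv-antisymmetric n F p = antisymmetric⇒0
  (conv-cong n (λ i j _ → p i j) ∙ conv-neg n _ ∙ cong -_ (sym (conv-flip n F)))

-- Linear functionals as finite combinations of evaluations.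

Comb : Set
Comb = List (ℚ × Mono)

ev : Comb → Fn → ℚ
ev [] f = 0#
ev ((c , v) ∷ C) f = c * f v + ev C f

-- Storing the combination itself, rather than additivity and homogeneity, also gives invariance
-- under pointwise equality without function extensionality (`lin-cong`), interchange with finite
-- sums (`lin-conv`, `lin-ev`) and later passage to the limit (`Lim-Lin`).
Lin : (Fn → ℚ) → Set
Lin ξ = Σ Comb λ C → ∀ f → ξ f ≡ ev C f

LinOp : (Fn → Fn) → Set
LinOp O = ∀ w → Lin (λ f → O f w)

ev-cong : ∀ C {f g : Fn} → (∀ v → f v ≡ g v) → ev C f ≡ ev C g
ev-cong [] p = refl
ev-cong ((c , v) ∷ C) p = cong₂ _+_ (cong (c *_) (p v)) (ev-cong C p)

ev-++ : ∀ C C' f → ev (C ++ C') f ≡ ev C f + ev C' f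
ev-++ [] C' f = sym (+-identityˡ _)
ev-++ ((c , v) ∷ C) C' f = cong (c * f v +_) (ev-++ C C' f) ∙ sym (+-assoc _ _ _)

scaleComb : ℚ → Comb → Comb
scaleComb a = map (λ p → a * fst p , snd p)

ev-scale : ∀ a C f → ev (scaleComb a C) f ≡ a * ev C f
ev-scale a [] f = sym (zeroʳ a)
ev-scale a ((c , v) ∷ C) f = cong (a * c * f v +_) (ev-scale a C f) ∙
  solve 4 (λ a c x y → a :* c :* x :+ a :* y := a :* (c :* x :+ y)) refl a c _ _

ev-+ : ∀ C (f g : Fn) → ev C (λ v → f v + g v) ≡ ev C f + ev C g
ev-+ [] f g = sym (+-identityˡ 0#)
ev-+ ((c , v) ∷ C) f g = cong (c * (f v + g v) +_) (ev-+ C f g) ∙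
  solve 5 (λ c x y a b → c :* (x :+ y) :+ (a :+ b) := (c :* x :+ a) :+ (c :* y :+ b)) refl c _ _ _ _

ev-* : ∀ C a (f : Fn) → ev C (λ v → a * f v) ≡ a * ev C f
ev-* [] a f = sym (zeroʳ a)
ev-* ((c , v) ∷ C) a f = cong (c * (a * f v) +_) (ev-* C a f) ∙
  solve 4 (λ a c x y → c :* (a :* x) :+ a :* y := a :* (c :* x :+ y)) refl a c _ _

module _ {ξ : Fn → ℚ} (L : Lin ξ) where
  private C = fst L ; r = snd L

  lin-cong : ∀ {f g : Fn} → (∀ v → f v ≡ g v) → ξ f ≡ ξ g
  lin-cong {f} {g} p = r f ∙ ev-cong C p ∙ sym (r g)

  lin-+ : ∀ (f g : Fn) → ξ (λ v → f v + g v) ≡ ξ f + ξ g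
  lin-+ f g = r _ ∙ ev-+ C f g ∙ sym (cong₂ _+_ (r f) (r g))

  lin-* : ∀ a (f : Fn) → ξ (λ v → a * f v) ≡ a * ξ f
  lin-* a f = r _ ∙ ev-* C a f ∙ cong (a *_) (sym (r f))

  lin-neg : ∀ (f : Fn) → ξ (λ v → - f v) ≡ - ξ f
  lin-neg f = lin-cong (λ v → neg-as-* (f v)) ∙ lin-* (-1#) f ∙ sym (neg-as-* _)

  lin-sub : ∀ (f g : Fn) → ξ (λ v → f v - g v) ≡ ξ f - ξ g
  lin-sub f g = lin-+ f (λ v → - g v) ∙ cong (ξ f +_) (lin-neg g)

  lin-0 : ∀ {f : Fn} → (∀ v → f v ≡ 0#) → ξ f ≡ 0#
  lin-0 {f} p = lin-cong {f} {λ v → 0# * f v} (λ v → p v ∙ sym (zeroˡ _)) ∙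
    lin-* 0# f ∙ zeroˡ _

  lin-conv : ∀ n (F : ℕ → ℕ → Fn) → ξ (λ v → conv n (λ i j → F i j v)) ≡ conv n (λ i j → ξ (F i j))
  lin-conv zero F = refl
  lin-conv (suc n) F = lin-+ (F 0 (suc n)) _ ∙ cong (ξ (F 0 (suc n)) +_) (lin-conv n (λ i j → F (suc i) j))

  lin-ev : ∀ C' (G : Mono → Fn) → ξ (λ v → ev C' (λ u → G u v)) ≡ ev C' (λ u → ξ (G u))
  lin-ev [] G = lin-0 (λ _ → refl)
  lin-ev ((c , u) ∷ C') G = lin-+ (λ v → c * G u v) _ ∙ cong₂ _+_ (lin-* c (G u)) (lin-ev C' G)

lin-cong-* : ∀ {ξ} → Lin ξ → ∀ {f g : Fn} {a} → (∀ v → f v ≡ a * g v) → ξ f ≡ a * ξ g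
lin-cong-* l p = lin-cong l p ∙ lin-* l _ _

lin-cong-sub : ∀ {ξ} → Lin ξ → ∀ {f g h : Fn} → (∀ v → f v ≡ g v - h v) → ξ f ≡ ξ g - ξ h
lin-cong-sub l p = lin-cong l p ∙ lin-sub l _ _

Lin-at : ∀ v → Lin (λ f → f v)
Lin-at v = (1# , v) ∷ [] , λ f → solve 1 (λ x → x := con 1# :* x :+ con 0#) refl (f v)

Lin-0 : Lin (λ _ → 0#)
Lin-0 = [] , λ _ → refl

Lin-≗ : ∀ {ξ η : Fn → ℚ} → Lin η → (∀ f → ξ f ≡ η f) → Lin ξ
Lin-≗ (C , r) p = C , λ f → p f ∙ r f

Lin-+ : ∀ {ξ η} → Lin ξ → Lin η → Lin (λ f → ξ f + η f)
Lin-+ (C , r) (C' , r') = C ++ C' , λ f → cong₂ _+_ (r f) (r' f) ∙ sym (ev-++ C C' f)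

Lin-* : ∀ {ξ} a → Lin ξ → Lin (λ f → a * ξ f)
Lin-* a (C , r) = scaleComb a C , λ f → cong (a *_) (r f) ∙ sym (ev-scale a C f)

Lin-neg : ∀ {ξ} → Lin ξ → Lin (λ f → - ξ f)
Lin-neg {ξ} L = Lin-≗ (Lin-* (-1#) L) (λ f → neg-as-* (ξ f))

Lin-sub : ∀ {ξ η} → Lin ξ → Lin η → Lin (λ f → ξ f - η f)
Lin-sub L L' = Lin-+ L (Lin-neg L')

Lin-conv : ∀ n {F : ℕ → ℕ → Fn → ℚ} → (∀ i j → Lin (F i j)) → Lin (λ f → conv n (λ i j → F i j f))
Lin-conv zero L = L 0 0
Lin-conv (suc n) L = Lin-+ (L 0 (suc n)) (Lin-conv n (λ i j → L (suc i) j))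

Lin-ev : ∀ C {F : Mono → Fn → ℚ} → (∀ v → Lin (F v)) → Lin (λ f → ev C (λ v → F v f))
Lin-ev [] L = Lin-0
Lin-ev ((c , v) ∷ C) L = Lin-+ (Lin-* c (L v)) (Lin-ev C L)

Lin-∘ : ∀ {ξ O} → Lin ξ → LinOp O → Lin (λ f → ξ (O f))
Lin-∘ (C , r) M = Lin-≗ (Lin-ev C M) (λ f → r _)

LinOp-∘ : ∀ {O O'} → LinOp O → LinOp O' → LinOp (λ f → O (O' f))
LinOp-∘ M M' w = Lin-∘ (M w) M'

-- Multiplication operators on functionals and the bilinear form on words.

-- Words in the letters bos n and fer a index products of h_n and p̃_a; an Fn is
-- a functional on the span of words, and operators act on Fn by transposition.

cons : Letter → Fn → Fn
cons c f w = f (c ∷ w)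

-- Stands for h_{n-1}, with h of negative index equal to 0; it appears whenever one unit is split
-- off from the index of h_n.
dn : ℕ → Fn → Fn
dn zero f w = 0#
dn (suc n) f w = f (bos n ∷ w)

δ : ℕ → ℕ → ℚ
δ zero zero = 1#
δ zero (suc n) = 0#
δ (suc m) zero = 0#
δ (suc m) (suc n) = δ m n

δ-sym : ∀ m n → δ m n ≡ δ n m
δ-sym zero zero = refl
δ-sym zero (suc n) = refl
δ-sym (suc m) zero = refl
δ-sym (suc m) (suc n) = δ-sym m n

δ-refl : ∀ n → δ n n ≡ 1#
δ-refl zero = refl
δ-refl (suc n) = δ-refl n

δ-≢ : ∀ m n → m ≢ n → δ m n ≡ 0#
δ-≢ zero zero p = ⊥-elim (p refl)
δ-≢ zero (suc n) p = refl
δ-≢ (suc m) zero p = refl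
δ-≢ (suc m) (suc n) p = δ-≢ m n (λ q → p (cong suc q))

at0 : ℕ → ℚ → ℚ
at0 zero x = x
at0 (suc n) x = 0#

vac : Fn
vac [] = 1#
vac (bos n ∷ w) = at0 n (vac w)
vac (fer a ∷ w) = 0#

-- Transpose of skewing by h_n, so that the functional of g becomes that of h_n g. Skewing h_k w by
-- h_n gives the sum over i of h_{k-i} times w skewed by h_{n-i}; the recursion separates i = 0 and
-- lowers n and k together in the rest.
hmul : ℕ → Fn → Fn
hmul zero f w = f w
hmul (suc n) f [] = 0#
hmul (suc n) f (bos k ∷ w) = hmul (suc n) (cons (bos k) f) w + dn k (hmul n f) w
hmul (suc n) f (fer a ∷ w) = hmul (suc n) (cons (fer a) f) w

hm1 : ℕ → Fn → Fn
hm1 zero f w = 0#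
hm1 (suc n) f w = hmul n f w

-- Transpose of the antiderivation of words that annihilates every h_n and sends p̃_b to δ_{ab}.
pmul : ℕ → Fn → Fn
pmul a f [] = 0#
pmul a f (bos n ∷ w) = pmul a (cons (bos n) f) w
pmul a f (fer b ∷ w) = δ a b * f w - pmul a (cons (fer b) f) w

Lin-cons : ∀ c → LinOp (cons c)
Lin-cons c w = Lin-at (c ∷ w)

Lin-dn : ∀ n → LinOp (dn n)
Lin-dn zero w = Lin-0
Lin-dn (suc n) w = Lin-at (bos n ∷ w)

Lin-hmul : ∀ n → LinOp (hmul n)
Lin-hmul zero w = Lin-at w
Lin-hmul (suc n) [] = Lin-0
Lin-hmul (suc n) (bos zero ∷ w) = Lin-+ (Lin-∘ (Lin-hmul (suc n) w) (Lin-cons (bos zero))) Lin-0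
Lin-hmul (suc n) (bos (suc k) ∷ w) = Lin-+ (Lin-∘ (Lin-hmul (suc n) w) (Lin-cons (bos (suc k)))) (Lin-hmul n (bos k ∷ w))
Lin-hmul (suc n) (fer a ∷ w) = Lin-∘ (Lin-hmul (suc n) w) (Lin-cons (fer a))

Lin-hm1 : ∀ n → LinOp (hm1 n)
Lin-hm1 zero w = Lin-0
Lin-hm1 (suc n) w = Lin-hmul n w

Lin-pmul : ∀ a → LinOp (pmul a)
Lin-pmul a [] = Lin-0
Lin-pmul a (bos n ∷ w) = Lin-∘ (Lin-pmul a w) (Lin-cons (bos n))
Lin-pmul a (fer b ∷ w) = Lin-sub (Lin-* (δ a b) (Lin-at w)) (Lin-∘ (Lin-pmul a w) (Lin-cons (fer b)))

dn-cong : ∀ k {f g : Fn} w → (∀ v → f v ≡ g v) → dn k f w ≡ dn k g w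
dn-cong zero w p = refl
dn-cong (suc k) w p = p _

hmul-bos : ∀ n k f w → hmul n f (bos k ∷ w) ≡ hmul n (cons (bos k) f) w + dn k (hm1 n f) w
hmul-bos zero zero f w = sym (+-identityʳ _)
hmul-bos zero (suc k) f w = sym (+-identityʳ _)
hmul-bos (suc n) k f w = refl

hmul-fer : ∀ n a f w → hmul n f (fer a ∷ w) ≡ hmul n (cons (fer a) f) w
hmul-fer zero a f w = refl
hmul-fer (suc n) a f w = refl

hmul-comm : ∀ m n f w → hmul m (hmul n f) w ≡ hmul n (hmul m f) w
hmul-comm zero n f w = refl
hmul-comm (suc m) zero f w = refl
hmul-comm (suc m) (suc n) f [] = refl
hmul-comm (suc m) (suc n) f (bos zero ∷ w) = cong (_+ 0#) (trans
  (lin-cong (Lin-hmul (suc m) w) (λ v → +-identityʳ _)) (hmul-comm (suc m) (suc n) (cons (bos zero) f) w ∙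
  sym (lin-cong (Lin-hmul (suc n) w) (λ v → +-identityʳ _))))
hmul-comm (suc m) (suc n) f (bos (suc k) ∷ w) = begin
  _
    ≡⟨ cong (_+ hmul m (hmul N f) v) (expand M n) ⟩
  (hmul M (hmul N f') w + (hmul M (hmul n f) v - dn k (hmul m (hmul n f)) w)) + hmul m (hmul N f) v
    ≡⟨ cong₂ _+_ (cong₂ _+_ (hmul-comm (suc m) (suc n) f' w) (cong₂ _-_ (hmul-comm (suc m) n f v) (dn-cong k w (hmul-comm m n f)))) (hmul-comm m (suc n) f v) ⟩
  (hmul N (hmul M f') w + (hmul n (hmul M f) v - dn k (hmul n (hmul m f)) w)) + hmul N (hmul m f) v
    ≡⟨ solve 4 (λ a b c d → (a :+ (b :- c)) :+ d := (a :+ (d :- c)) :+ b) refl _ _ _ _ ⟩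
  (hmul N (hmul M f') w + (hmul N (hmul m f) v - dn k (hmul n (hmul m f)) w)) + hmul n (hmul M f) v
    ≡⟨ cong (_+ hmul n (hmul M f) v) (sym (expand N m)) ⟩
  _ ∎
  where
  M = suc m ; N = suc n ; v = bos k ∷ w ; f' = cons (bos (suc k)) f
  expand : ∀ M n' → hmul M (cons (bos (suc k)) (hmul (suc n') f)) w
         ≡ hmul M (hmul (suc n') f') w + (hmul M (hmul n' f) v - dn k (hm1 M (hmul n' f)) w)
  expand M n' = lin-+ (Lin-hmul M w) (hmul (suc n') f') (cons (bos k) (hmul n' f)) ∙
    cong (hmul M (hmul (suc n') f') w +_)
      (solve 2 (λ a b → a := (a :+ b) :- b) refl _ _ ∙
             cong (_- dn k (hm1 M (hmul n' f)) w) (sym (hmul-bos M k (hmul n' f) w)))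
hmul-comm (suc m) (suc n) f (fer a ∷ w) = hmul-comm (suc m) (suc n) (cons (fer a) f) w

pmul-anticomm : ∀ a b f w → pmul a (pmul b f) w ≡ - pmul b (pmul a f) w
pmul-anticomm a b f [] = solve 0 (con 0# := :- con 0#) refl
pmul-anticomm a b f (bos n ∷ w) = pmul-anticomm a b (cons (bos n) f) w
pmul-anticomm a b f (fer c ∷ w) = begin
  _
    ≡⟨ cong (λ x → δ a c * pmul b f w - x) (expand a b) ⟩
  δ a c * pmul b f w - (δ b c * pmul a f w - pmul a (pmul b f') w)
    ≡⟨ cong (λ x → δ a c * pmul b f w - (δ b c * pmul a f w - x)) (pmul-anticomm a b f' w) ⟩
  δ a c * pmul b f w - (δ b c * pmul a f w - - pmul b (pmul a f') w)
    ≡⟨ solve 3 (λ x y z → x :- (y :- :- z) := :- (y :- (x :- z))) refl _ _ _ ⟩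
  - (δ b c * pmul a f w - (δ a c * pmul b f w - pmul b (pmul a f') w))
    ≡⟨ cong (λ x → - (δ b c * pmul a f w - x)) (sym (expand b a)) ⟩
  _ ∎
  where
  f' = cons (fer c) f
  expand : ∀ a b → pmul a (λ v → δ b c * f v - pmul b f' v) w ≡ δ b c * pmul a f w - pmul a (pmul b f') w
  expand a b = lin-sub (Lin-pmul a w) (λ v → δ b c * f v) (pmul b f') ∙
    cong (_- pmul a (pmul b f') w) (lin-* (Lin-pmul a w) (δ b c) f)

hmul-pmul : ∀ n a f w → hmul n (pmul a f) w ≡ pmul a (hmul n f) w
hmul-pmul zero a f w = refl
hmul-pmul (suc n) a f [] = refl
hmul-pmul (suc n) a f (bos zero ∷ w) =
  +-identityʳ _ ∙ hmul-pmul (suc n) a (cons (bos zero) f) w ∙ sym (lin-cong (Lin-pmul a w) (λ v → +-identityʳ _))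
hmul-pmul (suc n) a f (bos (suc k) ∷ w) =
  cong₂ _+_ (hmul-pmul (suc n) a (cons (bos (suc k)) f) w) (hmul-pmul n a f (bos k ∷ w)) ∙
        sym (lin-+ (Lin-pmul a w) _ _)
hmul-pmul (suc n) a f (fer b ∷ w) =
  lin-sub (Lin-hmul (suc n) w) (λ v → δ a b * f v) _ ∙
        cong₂ _-_ (lin-* (Lin-hmul (suc n) w) (δ a b) f) (hmul-pmul (suc n) a (cons (fer b) f) w)

L : Letter → Fn → Fn
L (bos n) = hmul n
L (fer a) = pmul a

Lin-L : ∀ c → LinOp (L c)
Lin-L (bos n) = Lin-hmul n
Lin-L (fer a) = Lin-pmul a

σ : Letter → Letter → ℚ
σ (fer _) (fer _) = -1#
σ (fer _) (bos _) = 1#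
σ (bos _) _ = 1#

L-comm : ∀ c d f w → L c (L d f) w ≡ σ c d * L d (L c f) w
L-comm (bos m) (bos n) f w = hmul-comm m n f w ∙ sym (*-identityˡ _)
L-comm (bos m) (fer b) f w = hmul-pmul m b f w ∙ sym (*-identityˡ _)
L-comm (fer a) (bos n) f w = sym (hmul-pmul n a f w) ∙ sym (*-identityˡ _)
L-comm (fer a) (fer b) f w = pmul-anticomm a b f w ∙ neg-as-* _

form : Mono → Fn
form [] = vac
form (c ∷ w) = L c (form w)

consComb : Letter → Comb → Comb
consComb c = map (λ p → fst p , c ∷ snd p)

ev-consComb : ∀ c C f → ev (consComb c C) f ≡ ev C (cons c f)
ev-consComb c [] f = refl
ev-consComb c ((a , v) ∷ C) f = cong (a * f (c ∷ v) +_) (ev-consComb c C f)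

-- Multiplication by c on functionals is dual to an operator on words, and this
-- operator is exactly the action of cons c on forms.
Adjoint : Letter → Mono → Set
Adjoint c w = Σ Comb λ C → (∀ g → L c g w ≡ ev C g) × (∀ x → form w (c ∷ x) ≡ ev C (λ v → form v x))

adjoint-bos : ∀ n w → Adjoint (bos n) w
adjoint-bos zero [] = (1# , []) ∷ [] , (λ g → snd (Lin-at []) g) , λ x → snd (Lin-at []) (λ v → form v x)
adjoint-bos (suc n) [] = [] , (λ g → refl) , λ x → refl
adjoint-bos zero (bos k ∷ w) with adjoint-bos zero w
... | C , p , q = consComb (bos k) C , (λ g → p (cons (bos k) g) ∙ sym (ev-consComb _ C g)) ,
  λ x → hmul-bos k 0 (form w) x ∙ +-identityʳ _ ∙
    lin-cong (Lin-hmul k x) q ∙ lin-ev (Lin-hmul k x) C form ∙ sym (ev-consComb _ C (λ v → form v x))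
adjoint-bos (suc n) (bos zero ∷ w) with adjoint-bos (suc n) w
... | C , p , q = consComb (bos 0) C , (λ g → +-identityʳ _ ∙ p (cons (bos 0) g) ∙ sym (ev-consComb _ C g)) ,
  λ x → q x ∙ sym (ev-consComb _ C (λ v → form v x))
adjoint-bos (suc n) (bos (suc k) ∷ w) with adjoint-bos (suc n) w | adjoint-bos n (bos k ∷ w)
... | C , p , q | C' , p' , q' = consComb (bos (suc k)) C ++ C' ,
  (λ g → cong₂ _+_ (p (cons (bos (suc k)) g) ∙ sym (ev-consComb (bos (suc k)) C g)) (p' g) ∙ sym (ev-++ (consComb (bos (suc k)) C) C' g)) ,
  λ x → cong₂ _+_ (lin-cong (Lin-hmul (suc k) x) q ∙ lin-ev (Lin-hmul (suc k) x) C form ∙ sym (ev-consComb (bos (suc k)) C (λ v → form v x))) (q' x) ∙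
    sym (ev-++ (consComb (bos (suc k)) C) C' (λ v → form v x))
adjoint-bos n (fer a ∷ w) with adjoint-bos n w
... | C , p , q = consComb (fer a) C , (λ g → hmul-fer n a g w ∙ p (cons (fer a) g) ∙ sym (ev-consComb _ C g)) ,
  λ x → lin-cong (Lin-pmul a x) q ∙ lin-ev (Lin-pmul a x) C form ∙ sym (ev-consComb _ C (λ v → form v x))

adjoint-fer : ∀ a w → Adjoint (fer a) w
adjoint-fer a [] = [] , (λ g → refl) , λ x → refl
adjoint-fer a (bos k ∷ w) with adjoint-fer a w
... | C , p , q = consComb (bos k) C , (λ g → p (cons (bos k) g) ∙ sym (ev-consComb _ C g)) ,
  λ x → hmul-fer k a (form w) x ∙ lin-cong (Lin-hmul k x) q ∙
    lin-ev (Lin-hmul k x) C form ∙ sym (ev-consComb _ C (λ v → form v x))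
adjoint-fer a (fer b ∷ w) with adjoint-fer a w
... | C , p , q = (δ a b , w) ∷ scaleComb -1# (consComb (fer b) C) ,
  (λ g → cong (δ a b * g w +_) (cong -_ (p (cons (fer b) g) ∙ sym (ev-consComb _ C g)) ∙ scaled g)) ,
  λ x → cong₂ _+_ (cong (_* form w x) (δ-sym b a))
    (cong -_ (lin-cong (Lin-pmul b x) q ∙ lin-ev (Lin-pmul b x) C form ∙ sym (ev-consComb _ C (λ v → form v x))) ∙
      scaled (λ v → form v x))
  where
  scaled : ∀ g → - ev (consComb (fer b) C) g ≡ ev (scaleComb -1# (consComb (fer b) C)) g
  scaled g = neg-as-* _ ∙ sym (ev-scale -1# (consComb (fer b) C) g)

adjoint : ∀ c w → Adjoint c w
adjoint (bos n) = adjoint-bos n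
adjoint (fer a) = adjoint-fer a

form-[] : ∀ w → form w [] ≡ vac w
form-[] [] = refl
form-[] (bos zero ∷ w) = form-[] w
form-[] (bos (suc n) ∷ w) = refl
form-[] (fer a ∷ w) = refl

-- By `adjoint`, `L c` on the left argument is the transpose of prefixing c on the right, so the
-- letters of u cross over one at a time.
form-sym : ∀ u w → form u w ≡ form w u
form-sym [] w = sym (form-[] w)
form-sym (c ∷ u) w with adjoint c w
... | C , p , q = p (form u) ∙ ev-cong C (form-sym u) ∙ sym (q u)

-- Functionals respecting supercommutativity.

-- Symm f: f respects the relations h_0 = 1 and (super)commutativity of words.

record Front (f : Fn) : Set where
  field
    swap : ∀ c d w → f (c ∷ d ∷ w) ≡ σ c d * f (d ∷ c ∷ w)
    unit : ∀ w → f (bos 0 ∷ w) ≡ f w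

record Symm (f : Fn) : Set where
  constructor symm
  field at : ∀ u → Front (λ w → f (u ++ w))
open Symm public

module _ {f : Fn} (s : Symm f) where
  swap : ∀ c d w → f (c ∷ d ∷ w) ≡ σ c d * f (d ∷ c ∷ w)
  swap = Front.swap (at s [])

  swap-bos : ∀ m d w → f (bos m ∷ d ∷ w) ≡ f (d ∷ bos m ∷ w)
  swap-bos m d w = swap (bos m) d w ∙ *-identityˡ _

  swap-fer : ∀ a b w → f (fer a ∷ fer b ∷ w) ≡ - f (fer b ∷ fer a ∷ w)
  swap-fer a b w = swap (fer a) (fer b) w ∙ sym (neg-as-* _)

  drop0 : ∀ w → f (bos 0 ∷ w) ≡ f w
  drop0 = Front.unit (at s [])

  Symm-cons : ∀ c → Symm (cons c f)
  Symm-cons c .at u = at s (c ∷ u)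

Front-≗ : ∀ {f g} → (∀ w → f w ≡ g w) → Front g → Front f
Front-≗ p F .Front.swap c d w = p _ ∙ Front.swap F c d w ∙ cong (σ c d *_) (sym (p _))
Front-≗ p F .Front.unit w = p _ ∙ Front.unit F w ∙ sym (p _)

Front-0 : Front (λ _ → 0#)
Front-0 .Front.swap c d w = sym (zeroʳ _)
Front-0 .Front.unit w = refl

Front-+ : ∀ {f g} → Front f → Front g → Front (λ w → f w + g w)
Front-+ F G .Front.swap c d w = cong₂ _+_ (Front.swap F c d w) (Front.swap G c d w) ∙ sym (distribˡ _ _ _)
Front-+ F G .Front.unit w = cong₂ _+_ (Front.unit F w) (Front.unit G w)

Front-* : ∀ {f} a → Front f → Front (λ w → a * f w)
Front-* a F .Front.swap c d w = cong (a *_) (Front.swap F c d w) ∙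
  solve 3 (λ a s x → a :* (s :* x) := s :* (a :* x)) refl a (σ c d) _
Front-* a F .Front.unit w = cong (a *_) (Front.unit F w)

Front-neg : ∀ {f} → Front f → Front (λ w → - f w)
Front-neg F = Front-≗ (λ w → neg-as-* _) (Front-* -1# F)

Front-sub : ∀ {f g} → Front f → Front g → Front (λ w → f w - g w)
Front-sub F G = Front-+ F (Front-neg G)

Front-conv : ∀ n {F : ℕ → ℕ → Fn} → (∀ i j → Front (F i j)) → Front (λ w → conv n (λ i j → F i j w))
Front-conv zero p = p 0 0
Front-conv (suc n) p = Front-+ (p 0 (suc n)) (Front-conv n (λ i j → p (suc i) j))

Front-ev : ∀ C {F : Mono → Fn} → (∀ v → Front (F v)) → Front (λ w → ev C (λ v → F v w))
Front-ev [] p = Front-0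
Front-ev ((a , v) ∷ C) p = Front-+ (Front-* a (p v)) (Front-ev C p)

Symm-≗ : ∀ {f g} → (∀ w → f w ≡ g w) → Symm g → Symm f
Symm-≗ p s .at u = Front-≗ (λ w → p (u ++ w)) (at s u)

Symm-0 : Symm (λ _ → 0#)
Symm-0 .at u = Front-0

Symm-* : ∀ {f} a → Symm f → Symm (λ w → a * f w)
Symm-* a s .at u = Front-* a (at s u)

Symm-sub : ∀ {f g} → Symm f → Symm g → Symm (λ w → f w - g w)
Symm-sub s t .at u = Front-sub (at s u) (at t u)

Symm-conv : ∀ n {F : ℕ → ℕ → Fn} → (∀ i j → Symm (F i j)) → Symm (λ w → conv n (λ i j → F i j w))
Symm-conv n p .at u = Front-conv n (λ i j → at (p i j) u)

Symm-ev : ∀ C {F : Mono → Fn} → (∀ v → Symm (F v)) → Symm (λ w → ev C (λ v → F v w))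
Symm-ev C p .at u = Front-ev C (λ v → at (p v) u)

Symm-dn : ∀ n {f} → Symm f → Symm (dn n f)
Symm-dn zero s = Symm-0
Symm-dn (suc n) s = Symm-cons s (bos n)

foldL : Mono → Fn → Fn
foldL [] g = g
foldL (c ∷ u) g = L c (foldL u g)

foldL-cong : ∀ u {f g : Fn} → (∀ w → f w ≡ g w) → ∀ w → foldL u f w ≡ foldL u g w
foldL-cong [] p = p
foldL-cong (c ∷ u) p w = lin-cong (Lin-L c w) (foldL-cong u p)

foldL-* : ∀ u a (f : Fn) w → foldL u (λ v → a * f v) w ≡ a * foldL u f w
foldL-* [] a f w = refl
foldL-* (c ∷ u) a f w = lin-cong-* (Lin-L c w) (foldL-* u a f)

form-++ : ∀ u v w → form (u ++ v) w ≡ foldL u (form v) w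
form-++ [] v w = refl
form-++ (c ∷ u) v w = lin-cong (Lin-L c w) (form-++ u v)

-- Symmetry of `form` turns an exchange of letters in the argument into an exchange of the operators
-- `L`, which is `L-comm`.
Symm-form : ∀ x → Symm (form x)
Symm-form x .at u .Front.swap c d w = begin
  form x (u ++ c ∷ d ∷ w) ≡⟨ form-sym x _ ⟩
  form (u ++ c ∷ d ∷ w) x ≡⟨ form-++ u _ x ⟩
  foldL u (L c (L d (form w))) x ≡⟨ foldL-cong u (L-comm c d (form w)) x ⟩
  foldL u (λ v → σ c d * L d (L c (form w)) v) x ≡⟨ foldL-* u (σ c d) _ x ⟩
  σ c d * foldL u (L d (L c (form w))) x ≡⟨ cong (σ c d *_) (sym (form-++ u _ x)) ⟩
  σ c d * form (u ++ d ∷ c ∷ w) x ≡⟨ cong (σ c d *_) (form-sym _ x) ⟩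
  _ ∎
Symm-form x .at u .Front.unit w = begin
  form x (u ++ bos 0 ∷ w) ≡⟨ form-sym x _ ⟩
  form (u ++ bos 0 ∷ w) x ≡⟨ form-++ u _ x ⟩
  foldL u (form w) x ≡⟨ sym (form-++ u w x) ⟩
  form (u ++ w) x ≡⟨ form-sym _ x ⟩
  _ ∎

-- The operators D, Φ_k and A.

-- D is dual to the h-linear antiderivation with p̃_a ↦ h_a.
D : Fn → Fn
D f [] = 0#
D f (bos n ∷ w) = D (cons (bos n) f) w
D f (fer a ∷ w) = f (bos a ∷ w) - D (cons (fer a) f) w

-- At τ = 1 this is dual to f ↦ Σ_i θ_i x_i^k f(x∖x_i); at τ = 0, to multiplication by p̃_k.
Φ : ℚ → ℕ → Fn → Fn
Φ τ k f [] = f (fer k ∷ [])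
Φ τ k f (bos n ∷ w) = Φ τ k (cons (bos n) f) w - τ * Φ τ (suc k) (dn n f) w
Φ τ k f (fer a ∷ w) = - Φ τ k (cons (fer a) f) w

-- Multiplication by h̃_a = Σ p̃_i h_j, and the h-linear substitution p̃_a ↦ h̃_a.
h̃ : ℕ → Fn → Fn
h̃ a f w = conv a (λ i j → f (fer i ∷ bos j ∷ w))

A : Fn → Fn
A f [] = f []
A f (bos n ∷ w) = A (cons (bos n) f) w
A f (fer a ∷ w) = A (h̃ a f) w

Lin-D : LinOp D
Lin-D [] = Lin-0
Lin-D (bos n ∷ w) = Lin-∘ (Lin-D w) (Lin-cons (bos n))
Lin-D (fer a ∷ w) = Lin-sub (Lin-at _) (Lin-∘ (Lin-D w) (Lin-cons (fer a)))

Lin-Φ : ∀ τ k → LinOp (Φ τ k)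
Lin-Φ τ k [] = Lin-at _
Lin-Φ τ k (bos n ∷ w) = Lin-sub (Lin-∘ (Lin-Φ τ k w) (Lin-cons (bos n))) (Lin-* τ (Lin-∘ (Lin-Φ τ (suc k) w) (Lin-dn n)))
Lin-Φ τ k (fer a ∷ w) = Lin-neg (Lin-∘ (Lin-Φ τ k w) (Lin-cons (fer a)))

Lin-h̃ : ∀ a → LinOp (h̃ a)
Lin-h̃ a w = Lin-conv a (λ i j → Lin-at _)

Lin-A : LinOp A
Lin-A [] = Lin-at []
Lin-A (bos n ∷ w) = Lin-∘ (Lin-A w) (Lin-cons (bos n))
Lin-A (fer a ∷ w) = Lin-∘ (Lin-A w) (Lin-h̃ a)

1*-eq : ∀ {x y : ℚ} → x ≡ y → x ≡ 1# * y
1*-eq p = p ∙ sym (*-identityˡ _)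

Symm-D : ∀ {f} → Symm f → Symm (D f)
Symm-D s .at [] .Front.swap (bos m) (bos n) w = 1*-eq (lin-cong (Lin-D w) (λ v → swap-bos s m (bos n) v))
Symm-D {f} s .at [] .Front.swap (bos m) (fer b) w = 1*-eq
  (cong₂ _-_ (swap-bos s m (bos b) w) (lin-cong (Lin-D w) (λ v → swap-bos s m (fer b) v)))
Symm-D {f} s .at [] .Front.swap (fer a) (bos n) w = 1*-eq
  (cong₂ _-_ (swap-bos s a (bos n) w) (lin-cong (Lin-D w) (λ v → sym (swap-bos s n (fer a) v))))
Symm-D {f} s .at [] .Front.swap (fer a) (fer b) w =
  cong₂ _-_ (swap-bos s a (fer b) w) (cong₂ _-_ (sym (swap-bos s b (fer a) w))
    (lin-cong (Lin-D w) (λ v → swap-fer s a b v) ∙ lin-neg (Lin-D w) _)) ∙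
  solve 3 (λ x y z → x :- (y :- :- z) := :- (y :- (x :- z))) refl _ _ _ ∙ neg-as-* _
Symm-D s .at [] .Front.unit w = lin-cong (Lin-D w) (drop0 s)
Symm-D s .at (bos n ∷ u) = at (Symm-D (Symm-cons s (bos n))) u
Symm-D s .at (fer a ∷ u) = Front-sub (at s (bos a ∷ u)) (at (Symm-D (Symm-cons s (fer a))) u)

Symm-h̃ : ∀ a {f} → Symm f → Symm (h̃ a f)
Symm-h̃ a s = Symm-conv a (λ i j → Symm-cons (Symm-cons s (fer i)) (bos j))

dn-cons-bos : ∀ {f} → Symm f → ∀ m n w → dn n (cons (bos m) f) w ≡ dn n f (bos m ∷ w)
dn-cons-bos s m zero w = refl
dn-cons-bos s m (suc n) w = swap-bos s m (bos n) w

dn-cons-fer : ∀ {f} → Symm f → ∀ a n w → dn n (cons (fer a) f) w ≡ dn n f (fer a ∷ w)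
dn-cons-fer s a zero w = refl
dn-cons-fer s a (suc n) w = sym (swap-bos s n (fer a) w)

dn-dn : ∀ {f} → Symm f → ∀ m n w → dn n (dn m f) w ≡ dn m (dn n f) w
dn-dn s zero zero w = refl
dn-dn s zero (suc n) w = refl
dn-dn s (suc m) zero w = refl
dn-dn s (suc m) (suc n) w = swap-bos s m (bos n) w

Symm-Φ : ∀ τ k {f} → Symm f → Symm (Φ τ k f)
Symm-Φ τ k {f} s .at [] .Front.swap (bos m) (bos n) w = 1*-eq (trans
  (cong₂ _-_ (cong₂ _-_ (lin-cong (Lin-Φ τ k w) (λ v → swap-bos s m (bos n) v))
                        (cong (τ *_) (lin-cong (Lin-Φ τ (suc k) w) (dn-cons-bos s m n))))
             (cong (τ *_) (cong₂ _-_ (lin-cong (Lin-Φ τ (suc k) w) (λ v → sym (dn-cons-bos s n m v)))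
                                     (cong (τ *_) (lin-cong (Lin-Φ τ (suc (suc k)) w) (dn-dn s m n))))))
  (solve 5 (λ t a b c d → (a :- t :* b) :- t :* (c :- t :* d) := (a :- t :* c) :- t :* (b :- t :* d)) refl τ _ _ _ _))
Symm-Φ τ k {f} s .at [] .Front.swap (bos m) (fer b) w = 1*-eq (trans
  (cong₂ (λ x y → - x - τ * - y) (lin-cong (Lin-Φ τ k w) (λ v → swap-bos s m (fer b) v))
                                 (lin-cong (Lin-Φ τ (suc k) w) (λ v → sym (dn-cons-fer s b m v))))
  (solve 3 (λ t x y → :- x :- t :* :- y := :- (x :- t :* y)) refl τ _ _))
Symm-Φ τ k {f} s .at [] .Front.swap (fer a) (bos n) w = 1*-eq (trans
  (cong₂ (λ x y → - (x - τ * y)) (lin-cong (Lin-Φ τ k w) (λ v → sym (swap-bos s n (fer a) v)))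
                                 (lin-cong (Lin-Φ τ (suc k) w) (dn-cons-fer s a n)))
  (solve 3 (λ t x y → :- (x :- t :* y) := :- x :- t :* :- y) refl τ _ _))
Symm-Φ τ k {f} s .at [] .Front.swap (fer a) (fer b) w =
  cong (λ x → - - x) (lin-cong (Lin-Φ τ k w) (λ v → swap-fer s a b v) ∙ lin-neg (Lin-Φ τ k w) _) ∙
  solve 1 (λ x → :- :- :- x := :- (:- :- x)) refl _ ∙ neg-as-* _
Symm-Φ τ k {f} s .at [] .Front.unit w = cong₂ (λ x y → x - τ * y) (lin-cong (Lin-Φ τ k w) (drop0 s)) (lin-0 (Lin-Φ τ (suc k) w) (λ _ → refl)) ∙
  solve 2 (λ t x → x :- t :* con 0# := x) refl τ _
Symm-Φ τ k s .at (bos n ∷ u) = Front-sub (at (Symm-Φ τ k (Symm-cons s (bos n))) u) (Front-* τ (at (Symm-Φ τ (suc k) (Symm-dn n s)) u))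
Symm-Φ τ k s .at (fer a ∷ u) = Front-neg (at (Symm-Φ τ k (Symm-cons s (fer a))) u)

conv-swap : ∀ m n (F : ℕ → ℕ → ℕ → ℕ → ℚ) →
  conv m (λ i j → conv n (F i j)) ≡ conv n (λ k l → conv m (λ i j → F i j k l))
conv-swap zero n F = refl
conv-swap (suc m) n F = cong (conv n (F 0 (suc m)) +_) (conv-swap m n (λ i j → F (suc i) j)) ∙
  sym (conv-+ n (F 0 (suc m)) _)

pair-swap : ∀ {f} → Symm f → ∀ i j k l w →
  f (fer k ∷ bos l ∷ fer i ∷ bos j ∷ w) ≡ - f (fer i ∷ bos j ∷ fer k ∷ bos l ∷ w)
pair-swap {f} s i j k l w = begin
  f (fer k ∷ bos l ∷ fer i ∷ bos j ∷ w) ≡⟨ swap-bos (Symm-cons s (fer k)) l (fer i) _ ⟩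
  f (fer k ∷ fer i ∷ bos l ∷ bos j ∷ w) ≡⟨ swap-fer s k i _ ⟩
  - f (fer i ∷ fer k ∷ bos l ∷ bos j ∷ w) ≡⟨ cong -_ (swap-bos (Symm-cons (Symm-cons s (fer i)) (fer k)) l (bos j) w) ⟩
  - f (fer i ∷ fer k ∷ bos j ∷ bos l ∷ w) ≡⟨ cong -_ (sym (swap-bos (Symm-cons s (fer i)) j (fer k) _)) ⟩
  _ ∎

bos-past-pair : ∀ {f} → Symm f → ∀ n i j w → f (bos n ∷ fer i ∷ bos j ∷ w) ≡ f (fer i ∷ bos j ∷ bos n ∷ w)
bos-past-pair s n i j w = swap-bos s n (fer i) _ ∙ swap-bos (Symm-cons s (fer i)) n (bos j) w

Symm-A : ∀ {f} → Symm f → Symm (A f)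
Symm-A s .at [] .Front.swap (bos m) (bos n) w = 1*-eq (lin-cong (Lin-A w) (λ v → swap-bos s m (bos n) v))
Symm-A s .at [] .Front.swap (bos m) (fer b) w = 1*-eq (lin-cong (Lin-A w)
  (λ v → conv-cong b (λ i j _ → bos-past-pair s m i j v)))
Symm-A s .at [] .Front.swap (fer a) (bos n) w = 1*-eq (lin-cong (Lin-A w)
  (λ v → conv-cong a (λ i j _ → sym (bos-past-pair s n i j v))))
Symm-A {f} s .at [] .Front.swap (fer a) (fer b) w = lin-cong (Lin-A w) (λ v → begin
    _
      ≡⟨ conv-swap b a _ ⟩
    conv a (λ k l → conv b (λ i j → f (fer k ∷ bos l ∷ fer i ∷ bos j ∷ v)))
      ≡⟨ conv-cong a (λ k l _ → conv-cong b (λ i j _ → pair-swap s i j k l v) ∙ conv-neg b _) ⟩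
    conv a (λ k l → - conv b (λ i j → f (fer i ∷ bos j ∷ fer k ∷ bos l ∷ v)))
      ≡⟨ conv-neg a _ ⟩
    _ ∎) ∙
  lin-neg (Lin-A w) _ ∙ neg-as-* _
Symm-A s .at [] .Front.unit w = lin-cong (Lin-A w) (drop0 s)
Symm-A s .at (bos n ∷ u) = at (Symm-A (Symm-cons s (bos n))) u
Symm-A s .at (fer a ∷ u) = at (Symm-A (Symm-h̃ a s)) u

-- Relations between D and the Φ_k.

d2 : ℕ → Fn → Fn
d2 zero f w = 0#
d2 (suc n) f = dn n f

Symm-d2 : ∀ n {f} → Symm f → Symm (d2 n f)
Symm-d2 zero s = Symm-0
Symm-d2 (suc n) s = Symm-dn n s

φ : ℕ → Fn → Fn
φ = Φ 1#

Lin-φ : ∀ k → LinOp (φ k)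
Lin-φ = Lin-Φ 1#

Symm-φ : ∀ k {f} → Symm f → Symm (φ k f)
Symm-φ = Symm-Φ 1#

φ-bos : ∀ k n f w → φ k f (bos n ∷ w) ≡ φ k (cons (bos n) f) w - φ (suc k) (dn n f) w
φ-bos k n f w = cong (λ z → φ k (cons (bos n) f) w - z) (*-identityˡ _)

dn-φ : ∀ k n f w → dn n (φ k f) w ≡ φ k (dn n f) w - φ (suc k) (d2 n f) w
dn-φ k zero f w = sym (cong₂ _-_ (lin-0 (Lin-φ k w) (λ _ → refl)) (lin-0 (Lin-φ (suc k) w) (λ _ → refl)) ∙
  -‿inverseʳ 0#)
dn-φ k (suc n) f w = φ-bos k n f w

φφ-bos : ∀ a b n f w → φ a (φ b f) (bos n ∷ w) ≡
  (φ a (φ b (cons (bos n) f)) w - φ a (φ (suc b) (dn n f)) w) - (φ (suc a) (φ b (dn n f)) w - φ (suc a) (φ (suc b) (d2 n f)) w)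
φφ-bos a b n f w = φ-bos a n (φ b f) w ∙ cong₂ _-_
  (lin-cong-sub (Lin-φ a w) (φ-bos b n f))
  (lin-cong-sub (Lin-φ (suc a) w) (dn-φ b n f))

φφ-fer : ∀ a b c f w → φ a (φ b f) (fer c ∷ w) ≡ φ a (φ b (cons (fer c) f)) w
φφ-fer a b c f w = cong -_ (lin-neg (Lin-φ a w) (φ b (cons (fer c) f))) ∙ solve 1 (λ x → :- :- x := x) refl _

-- Two operators Φ split off two different variables and produce Σ_{i≠j} θ_i θ_j x_i^a x_j^b; the
-- θ's anticommute. On words, a letter h_n yields four terms, which a ↔ b permutes.
φ-anticomm : ∀ {f} → Symm f → ∀ a b w → φ a (φ b f) w ≡ - φ b (φ a f) w
φ-anticomm s a b [] = cong -_ (swap-fer s a b []) ∙ cong (λ x → - x) refl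
φ-anticomm {f} s a b (bos n ∷ w) = begin
  _
    ≡⟨ φφ-bos a b n f w ⟩
  _
    ≡⟨ cong₂ _-_ (cong₂ _-_ (φ-anticomm (Symm-cons s (bos n)) a b w) (φ-anticomm (Symm-dn n s) a (suc b) w))
                 (cong₂ _-_ (φ-anticomm (Symm-dn n s) (suc a) b w) (φ-anticomm (Symm-d2 n s) (suc a) (suc b) w)) ⟩
  _ ≡⟨ solve 4 (λ x y z t → (:- x :- :- y) :- (:- z :- :- t) := :- ((x :- z) :- (y :- t))) refl _ _ _ _ ⟩
  _
    ≡⟨ cong -_ (sym (φφ-bos b a n f w)) ⟩
  _ ∎
φ-anticomm {f} s a b (fer c ∷ w) = φφ-fer a b c f w ∙
  φ-anticomm (Symm-cons s (fer c)) a b w ∙ cong -_ (sym (φφ-fer b a c f w))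

φφ-0 : ∀ {f} → Symm f → ∀ a w → φ a (φ a f) w ≡ 0#
φφ-0 s a w = antisymmetric⇒0 (φ-anticomm s a a w)

DD-0 : ∀ f w → D (D f) w ≡ 0#
DD-0 f [] = refl
DD-0 f (bos n ∷ w) = DD-0 (cons (bos n) f) w
DD-0 f (fer a ∷ w) = cong (λ z → D (cons (bos a) f) w - z) (lin-sub (Lin-D w) _ _) ∙
  cong (λ x → D (cons (bos a) f) w - (D (cons (bos a) f) w - x)) (DD-0 (cons (fer a) f) w) ∙
    solve 1 (λ x → x :- (x :- con 0#) := con 0#) refl _

dn-D : ∀ n f w → dn n (D f) w ≡ D (dn n f) w
dn-D zero f w = sym (lin-0 (Lin-D w) (λ _ → refl))
dn-D (suc n) f w = refl

d2-D : ∀ n f w → d2 n (D f) w ≡ D (d2 n f) w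
d2-D zero f w = sym (lin-0 (Lin-D w) (λ _ → refl))
d2-D (suc n) f w = dn-D n f w

φφD-bos : ∀ a b n f w → φ a (φ b (D f)) (bos n ∷ w) ≡
  (φ a (φ b (D (cons (bos n) f))) w - φ a (φ (suc b) (D (dn n f))) w) - (φ (suc a) (φ b (D (dn n f))) w - φ (suc a) (φ (suc b) (D (d2 n f))) w)
φφD-bos a b n f w = φφ-bos a b n (D f) w ∙ cong₂ _-_
  (cong (λ x → φ a (φ b (D (cons (bos n) f))) w - x) (inner a (suc b) (dn-D n f)))
  (cong₂ _-_ (inner (suc a) b (dn-D n f)) (inner (suc a) (suc b) (d2-D n f)))
  where
  inner : ∀ a b {g g' : Fn} → (∀ v → g v ≡ g' v) → φ a (φ b g) w ≡ φ a (φ b g') w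
  inner a b p = lin-cong (Lin-φ a w) (λ v → lin-cong (Lin-φ b v) p)

φDφ-bos : ∀ a b n f w → φ a (D (φ b f)) (bos n ∷ w) ≡
  (φ a (D (φ b (cons (bos n) f))) w - φ a (D (φ (suc b) (dn n f))) w) - (φ (suc a) (D (φ b (dn n f))) w - φ (suc a) (D (φ (suc b) (d2 n f))) w)
φDφ-bos a b n f w = φ-bos a n (D (φ b f)) w ∙ cong₂ _-_
  (lin-cong-sub (Lin-φ a w) (λ v → lin-cong-sub (Lin-D v) (φ-bos b n f)))
  (lin-cong-sub (Lin-φ (suc a) w) (λ v → dn-D n (φ b f) v ∙ lin-cong-sub (Lin-D v) (dn-φ b n f)))

φφD-fer : ∀ a b c f w → φ a (φ b (D f)) (fer c ∷ w) ≡ φ a (φ b (cons (bos c) f)) w - φ a (φ b (D (cons (fer c) f))) w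
φφD-fer a b c f w = φφ-fer a b c (D f) w ∙
  lin-cong-sub (Lin-φ a w) (λ v → lin-sub (Lin-φ b v) _ _)

φDφ-fer : ∀ a b c f w → φ a (D (φ b f)) (fer c ∷ w) ≡
  (φ a (φ (suc b) (dn c f)) w - φ a (φ b (cons (bos c) f)) w) - φ a (D (φ b (cons (fer c) f))) w
φDφ-fer a b c f w = cong -_ (lin-sub (Lin-φ a w) (λ v → φ b f (bos c ∷ v)) _ ∙
    cong₂ _-_ (lin-cong-sub (Lin-φ a w) (φ-bos b c f))
               (lin-cong (Lin-φ a w) (λ v → lin-neg (Lin-D v) (φ b (cons (fer c) f))) ∙ lin-neg (Lin-φ a w) _)) ∙
  solve 3 (λ x y z → :- ((x :- y) :- :- z) := (y :- x) :- z) refl _ _ _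

-- The source of all straightening relations. With B_k = D Φ_k it reads B_{j+1} Φ_k - B_j Φ_{k+1} =
-- Φ_k B_{j+1} + Φ_j B_{k+1}. In the induction on the word, a letter p̃_c adds terms in which D has
-- turned it into h_c; these cancel by `φ-anticomm`.
φφD-exchange : ∀ {f} → Symm f → ∀ k j w →
  φ k (φ (suc j) (D f)) w - φ (suc k) (φ j (D f)) w ≡ φ (suc j) (D (φ k f)) w + φ (suc k) (D (φ j f)) w
φφD-exchange {f} s k j [] = begin
  _
    ≡⟨ cong₂ (λ x y → - (f (bos k ∷ fer (suc j) ∷ []) - (x - 0#)) - - (f (bos (suc k) ∷ fer j ∷ []) - (y - 0#)))
             (sym (swap-bos s (suc j) (fer k) [])) (sym (swap-bos s j (fer (suc k)) [])) ⟩
  _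
    ≡⟨ solve 4 (λ x y z t → :- (x :- (y :- con 0#)) :- :- (z :- (t :- con 0#)) := ((y :- con 1# :* t) :- con 0#) :+ ((z :- con 1# :* x) :- con 0#)) refl _ _ _ _ ⟩
  _ ∎
φφD-exchange {f} s k j (bos n ∷ w) = begin
  _
    ≡⟨ cong₂ _-_ (φφD-bos k (suc j) n f w) (φφD-bos (suc k) j n f w) ⟩
  ((E₁ - E₂) - (E₃ - E₄)) - ((E₁' - E₂') - (E₃' - E₄'))
    ≡⟨ solve 8 (λ a b c d a' b' c' d' → ((a :- b) :- (c :- d)) :- ((a' :- b') :- (c' :- d')) :=
                                   ((a :- a') :- (b :- b')) :- ((c :- c') :- (d :- d'))) refl E₁ E₂ E₃ E₄ E₁' E₂' E₃' E₄' ⟩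
  -- `E₂'` and `E₃` are the same term, so the middle part reduces to `E₂ - E₃'`. Inserting `E₃`
  -- splits it into the instances (k, j+1) and (k+1, j) of the relation.
  ((E₁ - E₁') - (E₂ - E₂')) - ((E₃ - E₃') - (E₄ - E₄'))
    ≡⟨ solve 5 (λ x y y' z t → (x :- (y :- y')) :- ((y' :- z) :- t) := (x :- (y :- z)) :+ t) refl (E₁ - E₁') E₂ E₃ E₃' (E₄ - E₄') ⟩
  ((E₁ - E₁') - (E₂ - E₃')) + (E₄ - E₄')
    ≡⟨ cong (λ x → ((E₁ - E₁') - x) + (E₄ - E₄')) (solve 3 (λ x y z → x :- z := (x :- y) :+ (y :- z)) refl E₂ E₃ E₃') ⟩
  ((E₁ - E₁') - ((E₂ - E₃) + (E₃ - E₃'))) + (E₄ - E₄')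
    ≡⟨ cong₂ (λ x y → x + y) (cong₂ _-_ (φφD-exchange (Symm-cons s (bos n)) k j w)
         (cong₂ _+_ (φφD-exchange (Symm-dn n s) k (suc j) w) (φφD-exchange (Symm-dn n s) (suc k) j w)))
         (φφD-exchange (Symm-d2 n s) (suc k) (suc j) w) ⟩
  ((F₁ + F₁') - ((F₃ + F₂') + (F₂ + F₃'))) + (F₄ + F₄')
    ≡⟨ solve 8 (λ a b c d a' b' c' d' → ((a :+ a') :- ((c :+ b') :+ (b :+ c'))) :+ (d :+ d') := ((a :- b) :- (c :- d)) :+ ((a' :- b') :- (c' :- d'))) refl F₁ F₂ F₃ F₄ F₁' F₂' F₃' F₄' ⟩
  ((F₁ - F₂) - (F₃ - F₄)) + ((F₁' - F₂') - (F₃' - F₄'))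
    ≡⟨ sym (cong₂ _+_ (φDφ-bos (suc j) k n f w) (φDφ-bos (suc k) j n f w)) ⟩
  _ ∎
  where
  E₁ = φ k (φ (suc j) (D (cons (bos n) f))) w
  E₂ = φ k (φ (suc (suc j)) (D (dn n f))) w
  E₃ = φ (suc k) (φ (suc j) (D (dn n f))) w
  E₄ = φ (suc k) (φ (suc (suc j)) (D (d2 n f))) w
  E₁' = φ (suc k) (φ j (D (cons (bos n) f))) w
  E₂' = φ (suc k) (φ (suc j) (D (dn n f))) w
  E₃' = φ (suc (suc k)) (φ j (D (dn n f))) w
  E₄' = φ (suc (suc k)) (φ (suc j) (D (d2 n f))) w
  F₁ = φ (suc j) (D (φ k (cons (bos n) f))) w
  F₂ = φ (suc j) (D (φ (suc k) (dn n f))) w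
  F₃ = φ (suc (suc j)) (D (φ k (dn n f))) w
  F₄ = φ (suc (suc j)) (D (φ (suc k) (d2 n f))) w
  F₁' = φ (suc k) (D (φ j (cons (bos n) f))) w
  F₂' = φ (suc k) (D (φ (suc j) (dn n f))) w
  F₃' = φ (suc (suc k)) (D (φ j (dn n f))) w
  F₄' = φ (suc (suc k)) (D (φ (suc j) (d2 n f))) w
φφD-exchange {f} s k j (fer c ∷ w) = begin
  _
    ≡⟨ cong₂ _-_ (φφD-fer k (suc j) c f w) (φφD-fer (suc k) j c f w) ⟩
  (φ k (φ (suc j) g) w - X) - (φ (suc k) (φ j g) w - X')
    ≡⟨ cong (λ x → (x - X) - (φ (suc k) (φ j g) w - X')) (φ-anticomm (Symm-cons s (bos c)) k (suc j) w) ⟩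
  (- φ (suc j) (φ k g) w - X) - (φ (suc k) (φ j g) w - X')
    ≡⟨ solve 4 (λ a b x x' → (:- a :- x) :- (b :- x') := (:- a :- b) :- (x :- x')) refl (φ (suc j) (φ k g) w) (φ (suc k) (φ j g) w) X X' ⟩
  (- φ (suc j) (φ k g) w - φ (suc k) (φ j g) w) - (X - X')
    ≡⟨ cong (λ z → (- φ (suc j) (φ k g) w - φ (suc k) (φ j g) w) - z) (φφD-exchange (Symm-cons s (fer c)) k j w) ⟩
  (- φ (suc j) (φ k g) w - φ (suc k) (φ j g) w) - (Y + Y')
    ≡⟨ solve 5 (λ a b y y' z → (:- a :- b) :- (y :+ y') := ((z :- a) :- y) :+ ((:- z :- b) :- y')) refl
         (φ (suc j) (φ k g) w) (φ (suc k) (φ j g) w) Y Y' (φ (suc j) (φ (suc k) (dn c f)) w) ⟩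
  _
    ≡⟨ cong (λ x → ((φ (suc j) (φ (suc k) (dn c f)) w - φ (suc j) (φ k g) w) - Y) + ((x - φ (suc k) (φ j g) w) - Y'))
         (sym (φ-anticomm (Symm-dn c s) (suc k) (suc j) w)) ⟩
  _
    ≡⟨ sym (cong₂ _+_ (φDφ-fer (suc j) k c f w) (φDφ-fer (suc k) j c f w)) ⟩
  _ ∎
  where
  g = cons (bos c) f
  X = φ k (φ (suc j) (D (cons (fer c) f))) w
  X' = φ (suc k) (φ j (D (cons (fer c) f))) w
  Y = φ (suc j) (D (φ k (cons (fer c) f))) w
  Y' = φ (suc k) (D (φ j (cons (fer c) f))) w

module _ {f : Fn} (s : Symm f) (w : Mono) where

  -- In terms of the creation operators Φ_k and B_k = D Φ_k this reads
  -- Σ_{i+j=n} Φ_{k+i} B_{k+1+j} = B_{k+1+n} Φ_k.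
  φDφ-collapse : ∀ n k → conv n (λ i j → φ (suc k ℕ.+ j) (D (φ (k ℕ.+ i) f)) w) ≡ φ k (φ (suc k ℕ.+ n) (D f)) w
  -- The sum is doubled so that each term meets its mirror image under i ↔ j, where the exchange
  -- relation applies.
  φDφ-collapse n k = double-injective (begin
    _
      ≡⟨ cong (conv n U +_) (conv-flip n U) ⟩
    conv n U + conv n (λ i j → U j i)
      ≡⟨ sym (conv-+ n U _) ⟩
    conv n (λ i j → U i j + U j i)
      ≡⟨ conv-cong n (λ i j _ → sym (φφD-exchange s (k ℕ.+ i) (k ℕ.+ j) w)) ⟩
    conv n (λ i j → V i j - φ (suc k ℕ.+ i) (φ (k ℕ.+ j) (D f)) w)
      ≡⟨ conv-cong n (λ i j _ → cong (λ x → V i j - x) (φ-anticomm (Symm-D s) (suc k ℕ.+ i) (k ℕ.+ j) w)) ⟩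
    conv n (λ i j → V i j - - V j i)
      ≡⟨ conv-cong n (λ i j _ → cong (V i j +_) (solve 1 (λ x → :- :- x := x) refl (V j i))) ⟩
    conv n (λ i j → V i j + V j i)
      ≡⟨ conv-+ n V _ ⟩
    conv n V + conv n (λ i j → V j i)
      ≡⟨ cong (conv n V +_) (sym (conv-flip n V)) ⟩
    conv n V + conv n V
      ≡⟨ cong₂ _+_ (diagonal n k) (diagonal n k) ⟩
    _ ∎)
    where
    U V : ℕ → ℕ → ℚ
    U i j = φ (suc k ℕ.+ j) (D (φ (k ℕ.+ i) f)) w
    V i j = φ (k ℕ.+ i) (φ (suc k ℕ.+ j) (D f)) w
    -- Once i ≥ 1 is written as i + 1, both indices start at k + 1 and the terms cancel by
    -- antisymmetry; only i = 0 survives.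
    diagonal : ∀ n k → conv n (λ i j → φ (k ℕ.+ i) (φ (suc k ℕ.+ j) (D f)) w) ≡ φ k (φ (suc k ℕ.+ n) (D f)) w
    diagonal zero k = cong (λ x → φ x (φ (suc k ℕ.+ 0) (D f)) w) (ℕP.+-identityʳ k)
    diagonal (suc n) k = cong₂ _+_ (cong (λ x → φ x (φ (suc k ℕ.+ suc n) (D f)) w) (ℕP.+-identityʳ k))
      (conv-antisymmetric n _ (λ i j → cong (λ x → φ x (φ (suc k ℕ.+ j) (D f)) w) (+-suc k i) ∙
        φ-anticomm (Symm-D s) (suc k ℕ.+ i) (suc k ℕ.+ j) w ∙
          cong (λ x → - φ x (φ (suc k ℕ.+ i) (D f)) w) (sym (+-suc k j)))) ∙
      +-identityʳ _

  -- At j = k both sides of the exchange relation are doubled, the left one by `φ-anticomm`.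
  φDφ-swap : ∀ k → φ (suc k) (D (φ k f)) w ≡ φ k (φ (suc k) (D f)) w
  φDφ-swap k = double-injective (sym (φφD-exchange s k k w) ∙
    cong (λ x → φ k (φ (suc k) (D f)) w - x) (φ-anticomm (Symm-D s) (suc k) k w) ∙
      solve 1 (λ x → x :- :- x := x :+ x) refl _)

sub-cong : ∀ {a b c d : ℚ} → a ≡ b → c ≡ d → a - c ≡ b - d
sub-cong = cong₂ _-_

-- Multiplication by e_n and by m_{(0;1^n)}.

-- hook i n is multiplication by Σ_j (-1)^j h_{i+j} e_{n-j}, and el n by e_n.

hook : ℕ → ℕ → Fn → Fn
hook i zero f w = f (bos i ∷ w)
hook i (suc n) f w = hook 1 n (cons (bos i) f) w - hook (suc i) n f w

el : ℕ → Fn → Fn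
el zero f = f
el (suc n) f = hook 1 n f

Lin-hook : ∀ i n → LinOp (hook i n)
Lin-hook i zero w = Lin-at _
Lin-hook i (suc n) w = Lin-sub (Lin-∘ (Lin-hook 1 n w) (Lin-cons (bos i))) (Lin-hook (suc i) n w)

Lin-el : ∀ n → LinOp (el n)
Lin-el zero w = Lin-at w
Lin-el (suc n) w = Lin-hook 1 n w

Symm-hook : ∀ i n {f} → Symm f → Symm (hook i n f)
Symm-hook i zero s = Symm-cons s (bos i)
Symm-hook i (suc n) s = Symm-sub (Symm-hook 1 n (Symm-cons s (bos i))) (Symm-hook (suc i) n s)

Symm-el : ∀ n {f} → Symm f → Symm (el n f)
Symm-el zero s = s
Symm-el (suc n) s = Symm-hook 1 n s

hook-cons : ∀ {f} → Symm f → ∀ c j n w → hook j n (cons c f) w ≡ hook j n f (c ∷ w)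
hook-cons s c j zero w = sym (swap-bos s j c w)
hook-cons s c j (suc n) w = sub-cong
  (lin-cong (Lin-hook 1 n w) (λ v → sym (swap-bos s j c v)) ∙ hook-cons (Symm-cons s (bos j)) c 1 n w)
  (hook-cons s c (suc j) n w)

el-cons : ∀ {f} → Symm f → ∀ c n w → el n (cons c f) w ≡ el n f (c ∷ w)
el-cons s c zero w = refl
el-cons s c (suc n) w = hook-cons s c 1 n w

-- This is Σ_j (-1)^j h_j e_{n+1-j} = 0, which is built into the definition of e through `hook 1`.
hook-0 : ∀ {f} → Symm f → ∀ n w → hook 0 (suc n) f w ≡ 0#
hook-0 {f} s n w = cong (_- hook 1 n f w) (lin-cong (Lin-hook 1 n w) (drop0 s)) ∙ -‿inverseʳ _

-- If O h_{i+1} = h_{i+1} O + O' h_i on functionals then O e_{n+1} = e_{n+1} O + e_n O'.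
module EAfter {O O' : Fn → Fn} (LO : LinOp O) (LO' : LinOp O')
  (rule : ∀ i f w → O (cons (bos (suc i)) f) w ≡ O f (bos (suc i) ∷ w) + O' (cons (bos i) f) w) where

  hook-rule : ∀ {f} → Symm f → ∀ i n w → O (hook (suc i) n f) w ≡ hook (suc i) n (O f) w + el n (O' (cons (bos i) f)) w
  hook-rule {f} s i zero w = rule i f w
  hook-rule {f} s i (suc n) w = begin
    _
      ≡⟨ lin-sub (LO w) _ _ ⟩
    O (hook 1 n (cons (bos (suc i)) f)) w - O (hook (suc (suc i)) n f) w
      ≡⟨ sub-cong (hook-rule (Symm-cons s (bos (suc i))) 0 n w) (hook-rule s (suc i) n w) ⟩
    _
      ≡⟨ cong₂ (λ x y → (x + y) - (hook (suc (suc i)) n (O f) w + el n (O' (cons (bos (suc i)) f)) w))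
           (lin-cong (Lin-hook 1 n w) (rule i f) ∙ lin-+ (Lin-hook 1 n w) _ _)
           (lin-cong (Lin-el n w) (λ v → lin-cong (LO' v) (drop0 (Symm-cons s (bos (suc i)))))) ⟩
    _ ≡⟨ solve 4 (λ a b x y → ((a :+ b) :+ x) :- (y :+ x) := (a :- y) :+ b) refl _ _ _ _ ⟩
    _ ∎

  el-rule : ∀ {f} → Symm f → ∀ n w → O (el (suc n) f) w ≡ el (suc n) (O f) w + el n (O' f) w
  el-rule s n w = hook-rule s 0 n w ∙
    cong₂ _+_ refl (lin-cong (Lin-el n w) (λ v → lin-cong (LO' v) (drop0 s)))

-- If h_{i+1} O = O h_{i+1} + h_i O' on functionals then e_{n+1} O = O e_{n+1} + O' e_n.
module EBefore {O O' : Fn → Fn} (LO : LinOp O) (SO : ∀ {f} → Symm f → Symm (O f)) (SO' : ∀ {f} → Symm f → Symm (O' f))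
  (rule : ∀ i f w → O f (bos (suc i) ∷ w) ≡ O (cons (bos (suc i)) f) w + O' f (bos i ∷ w)) where

  hook-rule : ∀ {f} → Symm f → ∀ i n w → hook (suc i) n (O f) w ≡ O (hook (suc i) n f) w + O' (el n f) (bos i ∷ w)
  hook-rule {f} s i zero w = rule i f w
  hook-rule {f} s i (suc n) w = begin
    _
      ≡⟨ sub-cong (hook-cons (SO s) (bos (suc i)) 1 n w ∙ hook-rule s 0 n (bos (suc i) ∷ w)) (hook-rule s (suc i) n w) ⟩
    _
      ≡⟨ cong₂ (λ x y → (x + y) - (O (hook (suc (suc i)) n f) w + O' (el n f) (bos (suc i) ∷ w)))
           (rule i (hook 1 n f) w ∙ cong (_+ O' (hook 1 n f) (bos i ∷ w)) (lin-cong (LO w) (λ v → sym (hook-cons s (bos (suc i)) 1 n v))))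
           (drop0 (SO' (Symm-el n s)) _) ⟩
    _ ≡⟨ solve 4 (λ a b x y → ((a :+ b) :+ x) :- (y :+ x) := (a :- y) :+ b) refl _ _ _ _ ⟩
    _
      ≡⟨ cong (_+ O' (hook 1 n f) (bos i ∷ w)) (sym (lin-sub (LO w) _ _)) ⟩
    _ ∎

  el-rule : ∀ {f} → Symm f → ∀ n w → el (suc n) (O f) w ≡ O (el (suc n) f) w + O' (el n f) w
  el-rule s n w = hook-rule s 0 n w ∙ cong₂ _+_ refl (drop0 (SO' (Symm-el n s)) w)

x≡x-y+y : ∀ {x y z : ℚ} → x ≡ y - z → y ≡ x + z
x≡x-y+y {y = y} {z} p = solve 2 (λ y z → y := (y :- z) :+ z) refl y z ∙ cong (_+ z) (sym p)

-- With the split-off variable x_i restored, e_{n+1} becomes e_{n+1} + x_i e_n in the other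
-- variables, and the factor x_i raises k. A row therefore grows by at most one cell.
φ-el : ∀ {f} → Symm f → ∀ k n w → φ k (el (suc n) f) w ≡ el (suc n) (φ k f) w + el n (φ (suc k) f) w
φ-el s k n w = EAfter.el-rule (Lin-φ k) (Lin-φ (suc k)) (λ i f w → x≡x-y+y (φ-bos k (suc i) f w)) s n w

-- Here h_ℓ becomes Σ_a x_i^a h_{ℓ-a} in the other variables, so a row may grow by any number of
-- cells.
φ-h : ∀ {f} → Symm f → ∀ ℓ k w → φ k (cons (bos ℓ) f) w ≡ conv ℓ (λ i j → φ (k ℕ.+ i) f (bos j ∷ w))
φ-h {f} s zero k w = lin-cong (Lin-φ k w) (drop0 s) ∙
  sym (drop0 (Symm-φ k s) w) ∙ cong (λ x → φ x f (bos 0 ∷ w)) (sym (ℕP.+-identityʳ k))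
φ-h {f} s (suc ℓ) k w = x≡x-y+y (φ-bos k (suc ℓ) f w) ∙
  cong₂ _+_ (cong (λ x → φ x f (bos (suc ℓ) ∷ w)) (sym (ℕP.+-identityʳ k)))
    (φ-h s ℓ (suc k) w ∙ conv-cong ℓ (λ i j _ → cong (λ x → φ x f (bos j ∷ w)) (sym (+-suc k i))))

D-hook : ∀ f i n w → D (hook i n f) w ≡ hook i n (D f) w
D-hook f i zero w = refl
D-hook f i (suc n) w = lin-sub (Lin-D w) _ _ ∙ sub-cong (D-hook (cons (bos i) f) 1 n w) (D-hook f (suc i) n w)

D-el : ∀ f n w → D (el n f) w ≡ el n (D f) w
D-el f zero w = refl
D-el f (suc n) w = D-hook f 1 n w

A-hook : ∀ f i n w → A (hook i n f) w ≡ hook i n (A f) w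
A-hook f i zero w = refl
A-hook f i (suc n) w = lin-sub (Lin-A w) _ _ ∙ sub-cong (A-hook (cons (bos i) f) 1 n w) (A-hook f (suc i) n w)

A-el : ∀ f n w → A (el n f) w ≡ el n (A f) w
A-el f zero w = refl
A-el f (suc n) w = A-hook f 1 n w

pow : ℚ → ℕ → ℚ
pow x zero = 1#
pow x (suc n) = x * pow x n

pow-1 : ∀ n → pow 1# n ≡ 1#
pow-1 zero = refl
pow-1 (suc n) = *-identityˡ _ ∙ pow-1 n

-- ẽ τ i n is multiplication by Σ_j (-1)^j τ^{n-j} p̃_{i+j} e_{n-j}; for τ = 1, i = 0 this is the
-- monomial function m_{(0;1^n)}, and for τ = 0, i = 0 it is (-1)^n p̃_n.
ẽ : ℚ → ℕ → ℕ → Fn → Fn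
ẽ τ i zero f w = f (fer i ∷ w)
ẽ τ i (suc n) f w = pow τ (suc n) * el (suc n) (cons (fer i) f) w - ẽ τ (suc i) n f w

Lin-ẽ : ∀ τ i n → LinOp (ẽ τ i n)
Lin-ẽ τ i zero w = Lin-at _
Lin-ẽ τ i (suc n) w = Lin-sub (Lin-* _ (Lin-∘ (Lin-el (suc n) w) (Lin-cons (fer i)))) (Lin-ẽ τ (suc i) n w)

Symm-ẽ : ∀ τ i n {f} → Symm f → Symm (ẽ τ i n f)
Symm-ẽ τ i zero s = Symm-cons s (fer i)
Symm-ẽ τ i (suc n) s = Symm-sub (Symm-* _ (Symm-el (suc n) (Symm-cons s (fer i)))) (Symm-ẽ τ (suc i) n s)

ẽ-suc : ∀ i n f w → ẽ 1# i (suc n) f w ≡ el (suc n) (cons (fer i) f) w - ẽ 1# (suc i) n f w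
ẽ-suc i n f w = cong (_- ẽ 1# (suc i) n f w) (cong₂ _*_ (pow-1 (suc n)) refl ∙ *-identityˡ _)

ẽ⁻ : ℕ → ℕ → Fn → Fn
ẽ⁻ i zero f w = 0#
ẽ⁻ i (suc n) f w = ẽ 1# i n f w

el-ẽ⁻ : ∀ i n f w → el n (cons (fer i) f) w ≡ ẽ 1# i n f w + ẽ⁻ (suc i) n f w
el-ẽ⁻ i zero f w = sym (+-identityʳ _)
el-ẽ⁻ i (suc n) f w = x≡x-y+y (ẽ-suc i n f w)

-- `ẽ 1# i n` multiplies by the sum over j of θ_j x_j^i times e_n of the variables other than x_j.
-- Splitting off a further variable acts on this e_n as in `φ-el`, the terms with a squared θ drop
-- out, and the signs come from moving one θ past another.
φ-ẽ : ∀ {f} → Symm f → ∀ k i n w → φ k (ẽ 1# i n f) w ≡ - ẽ 1# i n (φ k f) w - ẽ⁻ i n (φ (suc k) f) w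
φ-ẽ {f} s k i zero w = solve 1 (λ x → x := :- :- x :- con 0#) refl _
φ-ẽ {f} s k i (suc n) w = begin
  _
    ≡⟨ lin-cong-sub (Lin-φ k w) (ẽ-suc i n f) ⟩
  φ k (el (suc n) fᵢ) w - φ k (ẽ 1# (suc i) n f) w
    ≡⟨ sub-cong (φ-el (Symm-cons s (fer i)) k n w) (φ-ẽ s k (suc i) n w) ⟩
  _
    ≡⟨ cong (_- (- ẽ 1# (suc i) n (φ k f) w - ẽ⁻ (suc i) n (φ (suc k) f) w)) (cong₂ _+_ (past k (suc n)) (past (suc k) n)) ⟩
  _
    ≡⟨ cong (λ z → (- el (suc n) (cons (fer i) (φ k f)) w + - z) - (- ẽ 1# (suc i) n (φ k f) w - ẽ⁻ (suc i) n (φ (suc k) f) w)) (el-ẽ⁻ i n (φ (suc k) f) w) ⟩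
  _ ≡⟨ solve 4 (λ a b c d → (:- a :+ :- (b :+ c)) :- (:- d :- c) := :- (a :- d) :- b) refl _ _ _ _ ⟩
  - (el (suc n) (cons (fer i) (φ k f)) w - ẽ 1# (suc i) n (φ k f) w) - ẽ 1# i n (φ (suc k) f) w
    ≡⟨ cong (λ z → - z - ẽ 1# i n (φ (suc k) f) w) (sym (ẽ-suc i n (φ k f) w)) ⟩
  _ ∎
  where
  fᵢ = cons (fer i) f
  past : ∀ k m → el m (φ k fᵢ) w ≡ - el m (cons (fer i) (φ k f)) w
  past k m = lin-cong (Lin-el m w) (λ v → solve 1 (λ x → x := :- :- x) refl (φ k fᵢ v)) ∙ lin-neg (Lin-el m w) _

-- D is an antiderivation with p̃_a ↦ h_a, so it sends the function behind `ẽ 1# i n` to Σ_j (-1)^j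
-- h_{i+j} e_{n-j}. For i = 0 this vanishes except at n = 0, which accounts for the two separate
-- forms `ẽ0-D` and `ẽ-D-suc`.
ẽ-D : ∀ f i n w → ẽ 1# i n (D f) w ≡ hook i n f w - D (ẽ 1# i n f) w
ẽ-D f i zero w = refl
ẽ-D f i (suc n) w = begin
  _
    ≡⟨ ẽ-suc i n (D f) w ⟩
  el (suc n) (λ v → f (bos i ∷ v) - D (cons (fer i) f) v) w - ẽ 1# (suc i) n (D f) w
    ≡⟨ sub-cong (lin-sub (Lin-el (suc n) w) (cons (bos i) f) _ ∙ cong (λ z → el (suc n) (cons (bos i) f) w - z) (sym (D-el (cons (fer i) f) (suc n) w)))
                (ẽ-D f (suc i) n w) ⟩
  _
    ≡⟨ solve 4 (λ a b c d → (a :- b) :- (c :- d) := (a :- c) :- (b :- d)) refl _ _ _ _ ⟩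
  hook i (suc n) f w - (D (el (suc n) (cons (fer i) f)) w - D (ẽ 1# (suc i) n f) w)
    ≡⟨ cong (λ z → hook i (suc n) f w - z) (sym (lin-sub (Lin-D w) _ _) ∙ lin-cong (Lin-D w) (λ v → sym (ẽ-suc i n f v))) ⟩
  _ ∎

ẽ0-D : ∀ {f} → Symm f → ∀ w → ẽ 1# 0 0 (D f) w ≡ f w - D (ẽ 1# 0 0 f) w
ẽ0-D {f} s w = cong (_- D (cons (fer 0) f) w) (drop0 s w)

ẽ-D-suc : ∀ {f} → Symm f → ∀ n w → ẽ 1# 0 (suc n) (D f) w ≡ - D (ẽ 1# 0 (suc n) f) w
ẽ-D-suc {f} s n w = ẽ-D f 0 (suc n) w ∙ cong (_- D (ẽ 1# 0 (suc n) f) w) (hook-0 s n w) ∙ +-identityˡ _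

-- Φ_k e_n is the sum of θ_j x_j^k times e_n of the other variables, which is the function behind
-- `ẽ 1# k n`.
el-φ-vac : ∀ {f} → Symm f → ∀ k n → el n (φ k f) [] ≡ ẽ 1# k n f []
el-φ-vac s k zero = refl
el-φ-vac {f} s k (suc n) = begin
  _
    ≡⟨ solve 2 (λ a b → a := (a :+ b) :- b) refl _ (el n (φ (suc k) f) []) ⟩
  (el (suc n) (φ k f) [] + el n (φ (suc k) f) []) - el n (φ (suc k) f) []
    ≡⟨ sub-cong (sym (φ-el s k n [])) (el-φ-vac s (suc k) n) ⟩
  el (suc n) f (fer k ∷ []) - ẽ 1# (suc k) n f []
    ≡⟨ cong (_- ẽ 1# (suc k) n f []) (sym (el-cons s (fer k) (suc n) [])) ⟩
  el (suc n) (cons (fer k) f) [] - ẽ 1# (suc k) n f []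
    ≡⟨ sym (ẽ-suc k n f []) ⟩
  _ ∎

vac-B0 : ∀ {f} → Symm f → φ 0 (D f) [] ≡ f []
vac-B0 s = solve 1 (λ x → x :- con 0# := x) refl _ ∙ drop0 s []

-- Prepend an empty row, B_0 1 = 1, and carry e_{n+1} past it. Of the two terms, B_0 e_{n+1} is 0 by
-- `ẽ-D-suc`, and B_1 e_n remains.
el-vac : ∀ {f} → Symm f → ∀ n → el (suc n) f [] ≡ el n (φ 1 (D f)) []
el-vac {f} s n = begin
  el (suc n) f [] ≡⟨ sym (vac-B0 (Symm-el (suc n) s)) ⟩
  φ 0 (D (el (suc n) f)) [] ≡⟨ D-el f (suc n) (fer 0 ∷ []) ⟩
  φ 0 (el (suc n) (D f)) [] ≡⟨ φ-el (Symm-D s) 0 n [] ⟩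
  el (suc n) (φ 0 (D f)) [] + el n (φ 1 (D f)) []
    ≡⟨ cong (_+ el n (φ 1 (D f)) []) (el-φ-vac (Symm-D s) 0 (suc n) ∙ ẽ-D-suc s n [] ∙ solve 0 (:- con 0# := con 0#) refl) ⟩
  0# + el n (φ 1 (D f)) [] ≡⟨ +-identityˡ _ ⟩
  _ ∎

-- Same device as in `el-vac`; the unwanted term now contains Φ_0 twice.
ẽ-vac : ∀ {f} → Symm f → ∀ n → ẽ 1# 0 (suc n) f [] ≡ ẽ 1# 0 n (φ 1 (D f)) []
ẽ-vac {f} s n = begin
  ẽ 1# 0 (suc n) f [] ≡⟨ sym (vac-B0 (Symm-ẽ 1# 0 (suc n) s)) ⟩
  D (ẽ 1# 0 (suc n) f) (fer 0 ∷ []) ≡⟨ solve 1 (λ x → x := :- :- x) refl _ ⟩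
  - - D (ẽ 1# 0 (suc n) f) (fer 0 ∷ []) ≡⟨ cong -_ (sym (ẽ-D-suc s n (fer 0 ∷ []))) ⟩
  - φ 0 (ẽ 1# 0 (suc n) (D f)) [] ≡⟨ cong -_ (φ-ẽ (Symm-D s) 0 0 (suc n) []) ⟩
  - (- ẽ 1# 0 (suc n) (φ 0 (D f)) [] - ẽ 1# 0 n (φ 1 (D f)) [])
    ≡⟨ cong (λ z → - (- z - ẽ 1# 0 n (φ 1 (D f)) []))
         (sym (el-φ-vac (Symm-φ 0 (Symm-D s)) 0 (suc n)) ∙ lin-0 (Lin-el (suc n) []) (φφ-0 (Symm-D s) 0)) ⟩
  - (- 0# - ẽ 1# 0 n (φ 1 (D f)) []) ≡⟨ solve 1 (λ x → :- (:- con 0# :- x) := x) refl _ ⟩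
  _ ∎

-- A carries multiplication by m_{(0;1^n)} to multiplication by (-1)^n p̃_n.

ẽ-0 : ∀ i n f w → ẽ 0# i n f w ≡ pow -1# n * f (fer (n ℕ.+ i) ∷ w)
ẽ-0 i zero f w = sym (*-identityˡ _)
ẽ-0 i (suc n) f w = cong₂ _-_ (cong₂ _*_ (zeroˡ _) refl ∙ zeroˡ _) (ẽ-0 (suc i) n f w) ∙
  solve 2 (λ p x → con 0# :- p :* x := con -1# :* p :* x) refl (pow -1# n) _ ∙
    cong (λ z → pow -1# (suc n) * f (fer z ∷ w)) (+-suc n i)

h̃-hook : ℕ → ℕ → Fn → Fn
h̃-hook i zero f = h̃ i f
h̃-hook i (suc n) f w = el (suc n) (h̃ i f) w - h̃-hook (suc i) n f w

ẽ-A : ∀ f i n w → ẽ 1# i n (A f) w ≡ A (h̃-hook i n f) w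
ẽ-A f i zero w = refl
ẽ-A f i (suc n) w = ẽ-suc i n (A f) w ∙
  sub-cong (sym (A-el (h̃ i f) (suc n) w)) (ẽ-A f (suc i) n w) ∙ sym (lin-sub (Lin-A w) _ _)

-- h̃ is the convolution of p̃ with h, and the alternating convolution of h with e collapses. The
-- isolated p̃ is what the collapse leaves; the sum contains the hooks that have not collapsed, and
-- at i = 0 it vanishes by `hook-0`.
h̃-hook-suc : ∀ {f} → Symm f → ∀ i n w →
  h̃-hook i (suc n) f w ≡ conv i (λ b c → hook c (suc n) (cons (fer b) f) w) + pow -1# (suc n) * f (fer (suc n ℕ.+ i) ∷ w)
h̃-hook-suc {f} s i zero w = begin
  _
    ≡⟨ cong (λ z → el 1 (h̃ i f) w - z) (conv-last i (λ b c → f (fer b ∷ bos c ∷ w))) ⟩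
  _
    ≡⟨ cong (λ z → conv i (λ b c → f (fer b ∷ bos c ∷ bos 1 ∷ w)) - (conv i (λ b c → f (fer b ∷ bos (suc c) ∷ w)) + z)) (drop0 (Symm-cons s (fer (suc i))) w) ⟩
  _ ≡⟨ solve 3 (λ x y z → x :- (y :+ z) := (x :+ :- y) :+ (con -1# :* con 1#) :* z) refl _ _ _ ⟩
  _
    ≡⟨ cong (_+ pow -1# 1 * f (fer (suc i) ∷ w)) (cong₂ _+_ refl (sym (conv-neg i _)) ∙ sym (conv-+ i _ _)) ⟩
  _ ∎
h̃-hook-suc {f} s i (suc n) w = begin
  _
    ≡⟨ sub-cong (lin-conv (Lin-el (suc (suc n)) w) i _)
         (h̃-hook-suc s (suc i) n w ∙ cong (_+ pow -1# (suc n) * f (fer (suc n ℕ.+ suc i) ∷ w))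
           (conv-last i (λ b c → hook c (suc n) (cons (fer b) f) w) ∙ cong₂ _+_ refl (hook-0 (Symm-cons s (fer (suc i))) n w))) ⟩
  X - ((Y + 0#) + pow -1# (suc n) * f (fer (suc n ℕ.+ suc i) ∷ w))
    ≡⟨ cong (λ z → X - ((Y + 0#) + pow -1# (suc n) * f (fer z ∷ w))) (+-suc (suc n) i) ⟩
  X - ((Y + 0#) + pow -1# (suc n) * f (fer (suc (suc n) ℕ.+ i) ∷ w))
    ≡⟨ solve 4 (λ x y p z → x :- ((y :+ con 0#) :+ p :* z) := (x :+ :- y) :+ con -1# :* p :* z) refl X Y (pow -1# (suc n)) _ ⟩
  (X + - Y) + pow -1# (suc (suc n)) * f (fer (suc (suc n) ℕ.+ i) ∷ w)
    ≡⟨ cong (_+ pow -1# (suc (suc n)) * f (fer (suc (suc n) ℕ.+ i) ∷ w)) (cong (X +_) (sym (conv-neg i _)) ∙ sym (conv-+ i _ _)) ⟩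
  _ ∎
  where
  X = conv i (λ b c → el (suc (suc n)) (λ v → f (fer b ∷ bos c ∷ v)) w)
  Y = conv i (λ b c → hook (suc c) (suc n) (cons (fer b) f) w)

ẽ-A-0 : ∀ {f} → Symm f → ∀ n w → ẽ 1# 0 n (A f) w ≡ A (ẽ 0# 0 n f) w
ẽ-A-0 {f} s zero w = lin-cong (Lin-A w) (drop0 (Symm-cons s (fer 0)))
ẽ-A-0 {f} s (suc n) w = ẽ-A f 0 (suc n) w ∙ lin-cong (Lin-A w) (λ v →
  h̃-hook-suc s 0 n v ∙ cong (_+ pow -1# (suc n) * f (fer (suc n ℕ.+ 0) ∷ v)) (hook-0 (Symm-cons s (fer 0)) n v) ∙
    +-identityˡ _ ∙ sym (ẽ-0 0 (suc n) f v))

-- Rows, their order, and valid words.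

-- A superpartition is encoded by its rows: bos k (k ≥ 1) is a row of length k, fer k a row of
-- length k ending in a circle; in a valid word they are listed from the first row down.

infix 4 _<ᴸ_ _≺_ _≼_

-- The chain bos 0 < fer 0 < bos 1 < fer 1 < ...: longer rows are larger, and at equal length the
-- circled row is larger.
_<ᴸ_ : Letter → Letter → Set
bos j <ᴸ bos k = j < k
bos j <ᴸ fer k = j ≤ k
fer j <ᴸ bos k = j < k
fer j <ᴸ fer k = j < k

<ᴸ-trans : ∀ {c d d'} → c <ᴸ d → d <ᴸ d' → c <ᴸ d'
<ᴸ-trans {bos _} {bos _} {bos _} p q = <-trans p q
<ᴸ-trans {bos _} {bos _} {fer _} p q = <⇒≤ (<-≤-trans p q)
<ᴸ-trans {bos _} {fer _} {bos _} p q = ≤-<-trans p q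
<ᴸ-trans {bos _} {fer _} {fer _} p q = <⇒≤ (≤-<-trans p q)
<ᴸ-trans {fer _} {bos _} {bos _} p q = <-trans p q
<ᴸ-trans {fer _} {bos _} {fer _} p q = <-≤-trans p q
<ᴸ-trans {fer _} {fer _} {bos _} p q = <-trans p q
<ᴸ-trans {fer _} {fer _} {fer _} p q = <-trans p q

<ᴸ-irrefl : ∀ {c} → ¬ (c <ᴸ c)
<ᴸ-irrefl {bos _} p = <-irrefl refl p
<ᴸ-irrefl {fer _} p = <-irrefl refl p

<ᴸ-cmp : ∀ c d → c <ᴸ d ⊎ c ≡ d ⊎ d <ᴸ c
<ᴸ-cmp (j , b) (k , b') with <-cmp j k
<ᴸ-cmp (bos j) (bos k) | tri< p _ _ = inl p
<ᴸ-cmp (bos j) (fer k) | tri< p _ _ = inl (<⇒≤ p)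
<ᴸ-cmp (fer j) (bos k) | tri< p _ _ = inl p
<ᴸ-cmp (fer j) (fer k) | tri< p _ _ = inl p
<ᴸ-cmp (bos j) (bos k) | tri≈ _ refl _ = inr (inl refl)
<ᴸ-cmp (bos j) (fer k) | tri≈ _ refl _ = inl ≤-refl
<ᴸ-cmp (fer j) (bos k) | tri≈ _ refl _ = inr (inr ≤-refl)
<ᴸ-cmp (fer j) (fer k) | tri≈ _ refl _ = inr (inl refl)
<ᴸ-cmp (bos j) (bos k) | tri> _ _ p = inr (inr p)
<ᴸ-cmp (bos j) (fer k) | tri> _ _ p = inr (inr p)
<ᴸ-cmp (fer j) (bos k) | tri> _ _ p = inr (inr (<⇒≤ p))
<ᴸ-cmp (fer j) (fer k) | tri> _ _ p = inr (inr p)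

up : Letter → Letter
up (k , b) = suc k , b

up-mono : ∀ {c d} → c <ᴸ d → up c <ᴸ up d
up-mono {bos _} {bos _} p = s≤s p
up-mono {bos _} {fer _} p = s≤s p
up-mono {fer _} {bos _} p = s≤s p
up-mono {fer _} {fer _} p = s≤s p

<ᴸ-up : ∀ c → c <ᴸ up c
<ᴸ-up (bos k) = ≤-refl
<ᴸ-up (fer k) = ≤-refl

-- Lexicographic from the first row down. Unlike dominance it is total, and `<SP⇒≺` shows that it
-- refines the order on superpartitions.
data _≺_ : Mono → Mono → Set where
  []≺ : ∀ {c w} → [] ≺ c ∷ w
  here : ∀ {c d w v} → c <ᴸ d → c ∷ w ≺ d ∷ v
  there : ∀ {c w v} → w ≺ v → c ∷ w ≺ c ∷ v

_≼_ : Mono → Mono → Set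
w ≼ v = w ≡ v ⊎ w ≺ v

≺-trans : ∀ {u v w} → u ≺ v → v ≺ w → u ≺ w
≺-trans []≺ (here _) = []≺
≺-trans []≺ (there _) = []≺
≺-trans (here p) (here q) = here (<ᴸ-trans p q)
≺-trans (here p) (there q) = here p
≺-trans (there p) (here q) = here q
≺-trans (there p) (there q) = there (≺-trans p q)

≺-irrefl : ∀ {w} → ¬ (w ≺ w)
≺-irrefl (here p) = <ᴸ-irrefl p
≺-irrefl (there p) = ≺-irrefl p

≺-cmp : ∀ w v → w ≺ v ⊎ w ≡ v ⊎ v ≺ w
≺-cmp [] [] = inr (inl refl)
≺-cmp [] (d ∷ v) = inl []≺
≺-cmp (c ∷ w) [] = inr (inr []≺)
≺-cmp (c ∷ w) (d ∷ v) with <ᴸ-cmp c d | ≺-cmp w v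
... | inl p | _ = inl (here p)
... | inr (inr p) | _ = inr (inr (here p))
... | inr (inl refl) | inl q = inl (there q)
... | inr (inl refl) | inr (inl refl) = inr (inl refl)
... | inr (inl refl) | inr (inr q) = inr (inr (there q))

≼-≺-trans : ∀ {u v w} → u ≼ v → v ≺ w → u ≺ w
≼-≺-trans (inl refl) q = q
≼-≺-trans (inr p) q = ≺-trans p q

≺-≼-trans : ∀ {u v w} → u ≺ v → v ≼ w → u ≺ w
≺-≼-trans p (inl refl) = p
≺-≼-trans p (inr q) = ≺-trans p q

≼-cons : ∀ c {u v} → u ≼ v → c ∷ u ≼ c ∷ v
≼-cons c (inl refl) = inl refl
≼-cons c (inr p) = inr (there p)

data HeadLt (d : Letter) : Mono → Set where
  [] : HeadLt d []
  _∷_ : ∀ {c} → c <ᴸ d → ∀ w → HeadLt d (c ∷ w)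

HeadLt⇒≺ : ∀ {d w v} → HeadLt d w → w ≺ d ∷ v
HeadLt⇒≺ [] = []≺
HeadLt⇒≺ (p ∷ _) = here p

HeadLt-≺ : ∀ {d w v} → HeadLt d v → w ≺ v → HeadLt d w
HeadLt-≺ _ []≺ = []
HeadLt-≺ (p ∷ _) (here q) = <ᴸ-trans q p ∷ _
HeadLt-≺ (p ∷ _) (there q) = p ∷ _

HeadLt-≼ : ∀ {d w v} → HeadLt d v → w ≼ v → HeadLt d w
HeadLt-≼ h (inl refl) = h
HeadLt-≼ h (inr p) = HeadLt-≺ h p

HeadLt-weaken : ∀ {d d' w} → HeadLt d w → d <ᴸ d' → HeadLt d' w
HeadLt-weaken [] q = []
HeadLt-weaken (p ∷ w) q = <ᴸ-trans p q ∷ w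

Pos : Letter → Set
Pos (bos k) = 1 ≤ k
Pos (fer k) = ⊤

-- Both bos k and fer k may be followed exactly by the letters below fer k.
data Valid : Mono → Set where
  [] : Valid []
  row : ∀ {k b w} → Pos (k , b) → HeadLt (fer k) w → Valid w → Valid ((k , b) ∷ w)

Pos-up : ∀ c → Pos (up c)
Pos-up (bos k) = s≤s z≤n
Pos-up (fer k) = tt

-- The functions S_w and their product with e_n.

X : Letter → Fn → Fn
X (bos k) f = φ k (D f)
X (fer k) f = φ k f

Lin-X : ∀ c → LinOp (X c)
Lin-X (bos k) = LinOp-∘ (Lin-φ k) Lin-D
Lin-X (fer k) = Lin-φ k

Symm-X : ∀ c {f} → Symm f → Symm (X c f)
Symm-X (bos k) s = Symm-φ k (Symm-D s)
Symm-X (fer k) s = Symm-φ k s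

-- As a combination of words, S_{c ∷ w} is the row operator of c applied to S_w; transposition makes
-- `X c` act on f first.
S : Mono → Fn → ℚ
S [] f = f []
S (c ∷ w) f = S w (X c f)

Lin-S : ∀ w → Lin (S w)
Lin-S [] = Lin-at []
Lin-S (c ∷ w) = Lin-∘ (Lin-S w) (Lin-X c)

<ᴸ? : ∀ d k → (d <ᴸ fer k) ⊎ ¬ (d <ᴸ fer k)
<ᴸ? (bos j) k with j ℕ.≤? k
... | yes p = inl p
... | no ¬p = inr ¬p
<ᴸ? (fer j) k with j ℕ.<? k
... | yes p = inl p
... | no ¬p = inr ¬p

-- The row straightening of X_c S_u when the first row of u is at most one cell longer than c.
push : Letter → Mono → List Mono
push c [] = (c ∷ []) ∷ []
push c (d ∷ u) with <ᴸ? d (fst c)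
push c (d ∷ u) | inl _ = (c ∷ d ∷ u) ∷ []
push (fer k) (bos j ∷ u) | inr _ = map (bos j ∷_) (push (fer k) u)
push (fer k) (fer j ∷ u) | inr _ = []
push (bos k) (d ∷ u) | inr _ = []

sumL : List Mono → (Mono → ℚ) → ℚ
sumL [] g = 0#
sumL (v ∷ vs) g = g v + sumL vs g

sumL-map : ∀ (h : Mono → Mono) vs g → sumL (map h vs) g ≡ sumL vs (λ v → g (h v))
sumL-map h [] g = refl
sumL-map h (v ∷ vs) g = cong (g (h v) +_) (sumL-map h vs g)

sumL-++ : ∀ vs us g → sumL (vs ++ us) g ≡ sumL vs g + sumL us g
sumL-++ [] us g = sym (+-identityˡ _)
sumL-++ (v ∷ vs) us g = cong (g v +_) (sumL-++ vs us g) ∙ sym (+-assoc _ _ _)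

sumL-cong : ∀ vs {g h : Mono → ℚ} → (∀ v → v ∈ vs → g v ≡ h v) → sumL vs g ≡ sumL vs h
sumL-cong [] p = refl
sumL-cong (v ∷ vs) p = cong₂ _+_ (p v (Any.here refl)) (sumL-cong vs (λ u q → p u (Any.there q)))

sumL-concatMap : ∀ (h : Mono → List Mono) vs g → sumL (concatMap h vs) g ≡ sumL vs (λ v → sumL (h v) g)
sumL-concatMap h [] g = refl
sumL-concatMap h (v ∷ vs) g = sumL-++ (h v) _ g ∙ cong (sumL (h v) g +_) (sumL-concatMap h vs g)

private
  same-row : ∀ {j k} → ¬ (j ≤ k) → j ≤ suc k → j ≡ suc k
  same-row ¬p q = ≤-antisym q (≰⇒> ¬p)

  same-circle : ∀ {j k} → ¬ (j < k) → j < suc k → j ≡ k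
  same-circle ¬p q = ≤-antisym (≤-pred q) (≮⇒≥ ¬p)

-- Four relations suffice: B_k B_{k+1} = 0, from `φDφ-swap` and D² = 0; B_k Φ_k = 0; Φ_k Φ_k = 0;
-- and Φ_k B_{k+1} = B_{k+1} Φ_k, by which a circled row sinks below rows one cell longer.
push-S : ∀ c u → Valid u → HeadLt (fer (suc (fst c))) u → ∀ {f} → Symm f → S u (X c f) ≡ sumL (push c u) (λ v → S v f)
push-S c [] _ _ s = sym (+-identityʳ _)
push-S c (d ∷ u) val top s with <ᴸ? d (fst c)
push-S c (d ∷ u) val top s | inl _ = sym (+-identityʳ _)
push-S (bos k) (bos j ∷ u) val (q ∷ _) {f} s | inr ¬p with same-row ¬p q
... | refl = lin-0 (Lin-S u) (λ v → φDφ-swap (Symm-D s) v k ∙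
    lin-0 (Lin-φ k v) (λ w → lin-0 (Lin-φ (suc k) w) (DD-0 f)))
push-S (bos k) (fer j ∷ u) val (q ∷ _) s | inr ¬p with same-circle ¬p q
... | refl = lin-0 (Lin-S u) (φφ-0 (Symm-D s) k)
push-S (fer k) (fer j ∷ u) val (q ∷ _) s | inr ¬p with same-circle ¬p q
... | refl = lin-0 (Lin-S u) (φφ-0 s k)
push-S (fer k) (bos j ∷ u) (row _ hu val) (q ∷ _) {f} s | inr ¬p with same-row ¬p q
... | refl = lin-cong (Lin-S u) (λ v → φDφ-swap s v k) ∙
  push-S (fer k) u val hu (Symm-X (bos (suc k)) s) ∙ sym (sumL-map (bos (suc k) ∷_) (push (fer k) u) _)

All-map : ∀ {P Q : Mono → Set} (h : Mono → Mono) → (∀ v → P v → Q (h v)) → ∀ {vs} → All P vs → All Q (map h vs)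
All-map h p [] = []
All-map h p (x ∷ xs) = p _ x ∷ All-map h p xs

push-valid : ∀ c u → Pos c → Valid u → HeadLt (fer (suc (fst c))) u →
  All (λ v → Valid v × HeadLt (up c) v) (push c u)
push-valid c [] pos _ _ = (row pos [] [] , <ᴸ-up c ∷ []) ∷ []
push-valid c (d ∷ u) pos val top with <ᴸ? d (fst c)
push-valid c (d ∷ u) pos val top | inl p = (row pos (p ∷ u) val , <ᴸ-up c ∷ _) ∷ []
push-valid (bos k) (d ∷ u) pos val top | inr _ = []
push-valid (fer k) (fer j ∷ u) pos val top | inr _ = []
push-valid (fer k) (bos j ∷ u) pos (row posj hu val) (q ∷ _) | inr ¬p with same-row ¬p q
... | refl = All-map (bos (suc k) ∷_) (λ v r → row posj (snd r) (fst r) , ≤-refl ∷ v) (push-valid (fer k) u pos val hu)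

-- O false r is multiplication by e_r, O true r by m_{(0;1^r)}.
O : Bool → ℕ → Fn → Fn
O false r = el r
O true r = ẽ 1# 0 r

Symm-O : ∀ b r {f} → Symm f → Symm (O b r f)
Symm-O false r = Symm-el r
Symm-O true r = Symm-ẽ 1# 0 r

-- Koszul sign of moving the odd factor past the row operator of c; B_k is even, Φ_k odd.
η : Bool → Letter → ℚ
η true (fer _) = -1#
η true (bos _) = 1#
η false _ = 1#

-- Every row either stays or grows by one cell, with or without a circle: this is the shape of a
-- vertical strip. For an odd factor and an uncircled row, the sign contributed by D cancels that of
-- Φ_k.
X-O : ∀ {f} → Symm f → ∀ b r c w → X c (O b (suc r) f) w ≡ η b c * (O b (suc r) (X c f) w + O b r (X (up c) f) w)
X-O s false r (fer k) w = 1*-eq (φ-el s k r w)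
X-O s true r (fer k) w = φ-ẽ s k 0 (suc r) w ∙ solve 2 (λ a b → :- a :- b := con -1# :* (a :+ b)) refl _ _
X-O {f} s false r (bos k) w = 1*-eq (lin-cong (Lin-φ k w) (D-el f (suc r)) ∙ φ-el (Symm-D s) k r w)
X-O {f} s true r (bos k) w = 1*-eq (begin
  _
    ≡⟨ lin-cong (Lin-φ k w) (λ v → solve 1 (λ x → x := :- :- x) refl _ ∙ cong -_ (sym (ẽ-D-suc s r v))) ⟩
  φ k (λ v → - ẽ 1# 0 (suc r) (D f) v) w
    ≡⟨ lin-neg (Lin-φ k w) _ ∙ cong -_ (φ-ẽ (Symm-D s) k 0 (suc r) w) ⟩
  - (- ẽ 1# 0 (suc r) (φ k (D f)) w - ẽ 1# 0 r (φ (suc k) (D f)) w)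
    ≡⟨ solve 2 (λ a b → :- (:- a :- b) := a :+ b) refl _ _ ⟩
  _ ∎)

X-O0-fer : ∀ {f} → Symm f → ∀ k w → X (fer k) (O true 0 f) w ≡ - O true 0 (X (fer k) f) w
X-O0-fer s k w = φ-ẽ s k 0 0 w ∙ solve 1 (λ x → :- x :- con 0# := :- x) refl _

-- Since D p̃_0 = 1, multiplication by p̃_0 fails to anticommute with D; the defect puts a circle on
-- the row.
X-O0-bos : ∀ {f} → Symm f → ∀ k w → X (bos k) (O true 0 f) w ≡ X (fer k) f w + O true 0 (X (bos k) f) w
X-O0-bos {f} s k w = begin
  _
    ≡⟨ lin-cong (Lin-φ k w) (λ v → solve 2 (λ a b → b := a :- (a :- b)) refl (f v) _ ∙ cong (λ z → f v - z) (sym (ẽ0-D s v))) ⟩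
  φ k (λ v → f v - ẽ 1# 0 0 (D f) v) w
    ≡⟨ lin-sub (Lin-φ k w) f _ ⟩
  φ k f w - φ k (ẽ 1# 0 0 (D f)) w
    ≡⟨ cong (λ z → φ k f w - z) (X-O0-fer (Symm-D s) k w) ⟩
  φ k f w - - ẽ 1# 0 0 (φ k (D f)) w
    ≡⟨ solve 2 (λ a b → a :- :- b := a :+ b) refl _ _ ⟩
  _ ∎

O-vac : ∀ {f} → Symm f → ∀ b r → O b (suc r) f [] ≡ O b r (X (bos 1) f) []
O-vac s false r = el-vac s r
O-vac s true r = ẽ-vac s r

-- The words indexing the product of S_w by e_n.
V : Mono → ℕ → List Mono
V [] zero = [] ∷ []
V [] (suc n) = map (bos 1 ∷_) (V [] n)
V (c ∷ w) zero = concatMap (push c) (V w zero)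
V (c ∷ w) (suc n) = map (up c ∷_) (V w n) ++ concatMap (push c) (V w (suc n))

All-++ : ∀ {P : Mono → Set} {vs us} → All P vs → All P us → All P (vs ++ us)
All-++ [] qs = qs
All-++ (p ∷ ps) qs = p ∷ All-++ ps qs

All-concatMap : ∀ {P Q : Mono → Set} (h : Mono → List Mono) → (∀ v → P v → All Q (h v)) → ∀ {vs} → All P vs → All Q (concatMap h vs)
All-concatMap h p [] = []
All-concatMap h p (x ∷ xs) = All-++ (p _ x) (All-concatMap h p xs)

-- The second component provides the hypothesis of `push-S`: a row that could stand above w is
-- exceeded by the first row of v by at most one cell.
V-valid : ∀ {w} n → Valid w → All (λ v → Valid v × (∀ k → HeadLt (fer k) w → HeadLt (fer (suc k)) v)) (V w n)
V-valid {[]} zero val = (val , λ _ _ → []) ∷ []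
V-valid {(k , b) ∷ w} zero (row pos top val) =
  All-concatMap (push (k , b)) (λ u p → All.map (λ q → fst q , bound (snd q)) (push-valid (k , b) u pos (fst p) (snd p k top))) (V-valid zero val)
  where
  bound : ∀ {v} → HeadLt (up (k , b)) v → ∀ k' → HeadLt (fer k') ((k , b) ∷ w) → HeadLt (fer (suc k')) v
  bound h k' (q ∷ _) = HeadLt-weaken h (up-mono q)
V-valid {[]} (suc n) val = All-map (bos 1 ∷_)
  (λ v p → row ≤-refl (snd p 0 []) (fst p) , λ k h → s≤s z≤n ∷ v) (V-valid n val)
V-valid {(k , b) ∷ w} (suc n) (row pos top val) = All-++
  (All-map (up (k , b) ∷_) (λ v p → row (Pos-up (k , b)) (snd p k top) (fst p) , head v) (V-valid n val))
  (All-concatMap (push (k , b)) (λ u p → All.map (λ q → fst q , bound (snd q)) (push-valid (k , b) u pos (fst p) (snd p k top))) (V-valid (suc n) val))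
  where
  head : ∀ v k' → HeadLt (fer k') ((k , b) ∷ w) → HeadLt (fer (suc k')) (up (k , b) ∷ v)
  head v k' (q ∷ _) = up-mono q ∷ v
  bound : ∀ {v} → HeadLt (up (k , b)) v → ∀ k' → HeadLt (fer k') ((k , b) ∷ w) → HeadLt (fer (suc k')) v
  bound h k' (q ∷ _) = HeadLt-weaken h (up-mono q)

∈-All : ∀ {P : Mono → Set} {vs v} → All P vs → v ∈ vs → P v
∈-All (p ∷ ps) (Any.here refl) = p
∈-All (p ∷ ps) (Any.there q) = ∈-All ps q

-- By `X-O` the first row grows or stays. A grown row still dominates what lies below it; a row that
-- stays may be overtaken by one cell, and then `push` straightens it.
S-el : ∀ {w} n → Valid w → ∀ {f} → Symm f → S w (el n f) ≡ sumL (V w n) (λ v → S v f)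
S-el {[]} zero val s = sym (+-identityʳ _)
S-el {(k , b) ∷ w} zero (row pos top val) {f} s =
  S-el zero val (Symm-X (k , b) s) ∙ sumL-cong (V w zero) straighten ∙ sym (sumL-concatMap (push (k , b)) (V w zero) _)
  where
  straighten : ∀ v → v ∈ V w zero → S v (X (k , b) f) ≡ sumL (push (k , b) v) (λ u → S u f)
  straighten v q with ∈-All (V-valid zero val) q
  ... | val' , top' = push-S (k , b) v val' (top' k top) s
S-el {[]} (suc n) val {f} s = el-vac s n ∙
  S-el n val (Symm-X (bos 1) s) ∙ sym (sumL-map (bos 1 ∷_) (V [] n) _)
S-el {(k , b) ∷ w} (suc n) (row pos top val) {f} s = begin
  _
    ≡⟨ lin-cong (Lin-S w) (λ v → X-O s false n c v ∙ *-identityˡ _) ⟩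
  S w (λ v → el (suc n) (X c f) v + el n (X (up c) f) v)
    ≡⟨ lin-+ (Lin-S w) _ _ ∙ +-comm _ _ ⟩
  S w (el n (X (up c) f)) + S w (el (suc n) (X c f))
    ≡⟨ cong₂ _+_ (S-el n val (Symm-X (up c) s) ∙ sym (sumL-map (up c ∷_) (V w n) _))
         (S-el (suc n) val (Symm-X c s) ∙ sumL-cong (V w (suc n)) straighten ∙ sym (sumL-concatMap (push c) (V w (suc n)) _)) ⟩
  _
    ≡⟨ sym (sumL-++ (map (up c ∷_) (V w n)) _ _) ⟩
  _ ∎
  where
  c = k , b
  straighten : ∀ v → v ∈ V w (suc n) → S v (X c f) ≡ sumL (push c v) (λ u → S u f)
  straighten v q with ∈-All (V-valid (suc n) val) q
  ... | val' , top' = push-S c v val' (top' k top) s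

-- Leading terms of products with a column.

-- The equality is stated on `Symm` functionals only, because straightening relies on the
-- commutation relations.
Span : (Mono → Set) → (Fn → ℚ) → Set
Span P ξ = Σ Comb λ C → All (λ p → Valid (snd p) × P (snd p)) C × (∀ {f} → Symm f → ξ f ≡ ev C (λ v → S v f))

module _ {P : Mono → Set} where
  Span-0 : ∀ {ξ} → (∀ {f} → Symm f → ξ f ≡ 0#) → Span P ξ
  Span-0 p = [] , [] , p

  Span-S : ∀ v → Valid v → P v → Span P (S v)
  Span-S v val p = (1# , v) ∷ [] , (val , p) ∷ [] , λ s → solve 1 (λ x → x := con 1# :* x :+ con 0#) refl _

  Span-≗ : ∀ {ξ ζ} → Span P ζ → (∀ {f} → Symm f → ξ f ≡ ζ f) → Span P ξ
  Span-≗ (C , a , r) p = C , a , λ s → p s ∙ r s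

  Span-+ : ∀ {ξ ζ} → Span P ξ → Span P ζ → Span P (λ f → ξ f + ζ f)
  Span-+ (C , a , r) (C' , a' , r') = C ++ C' , AllP.++⁺ a a' , λ s → cong₂ _+_ (r s) (r' s) ∙ sym (ev-++ C C' _)

  Span-* : ∀ {ξ} c → Span P ξ → Span P (λ f → c * ξ f)
  Span-* c (C , a , r) = scaleComb c C , AllP.map⁺ a , λ s → cong (c *_) (r s) ∙ sym (ev-scale c C _)

  Span-sum : ∀ vs → All (λ v → Valid v × P v) vs → Span P (λ f → sumL vs (λ v → S v f))
  Span-sum [] [] = Span-0 (λ _ → refl)
  Span-sum (v ∷ vs) ((val , p) ∷ a) = Span-+ (Span-S v val p) (Span-sum vs a)

Span-mono : ∀ {P Q : Mono → Set} {ξ} → (∀ v → P v → Q v) → Span P ξ → Span Q ξ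
Span-mono h (C , a , r) = C , All.map (λ p → fst p , h _ (snd p)) a , r

Span-bind : ∀ {P Q : Mono → Set} {ξ} {T : Fn → Fn} → (∀ {f} → Symm f → Symm (T f)) →
  (∀ v → Valid v → P v → Span Q (λ f → S v (T f))) → Span P ξ → Span Q (λ f → ξ (T f))
Span-bind {P} {Q} {ξ} {T} ST h (C , a , r) = Span-≗ (go C a) (λ s → r (ST s))
  where
  go : ∀ C → All (λ p → Valid (snd p) × P (snd p)) C → Span Q (λ f → ev C (λ v → S v (T f)))
  go [] [] = Span-0 (λ _ → refl)
  go ((c , v) ∷ C) ((val , p) ∷ a) = Span-+ (Span-* c (h v val p)) (go C a)

circ : Mono → Mono
circ [] = fer 0 ∷ []
circ (bos k ∷ v) = fer k ∷ v
circ (fer k ∷ v) = fer k ∷ circ v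

-- The leading word of the product of S_v by O b r.
β : Bool → ℕ → Mono → Mono
β b zero v = if b then circ v else v
β b (suc r) [] = bos 1 ∷ β b r []
β b (suc r) (c ∷ v) = up c ∷ β b r v

circ-top : ∀ k v → HeadLt (fer k) v → HeadLt (fer (suc k)) (circ v)
circ-top k [] _ = s≤s z≤n ∷ []
circ-top k (bos j ∷ v) (p ∷ _) = s≤s p ∷ _
circ-top k (fer j ∷ v) (p ∷ _) = <-trans p ≤-refl ∷ _

β-top : ∀ b r k v → HeadLt (fer k) v → HeadLt (fer (suc k)) (β b r v)
β-top false zero k v h = HeadLt-weaken h ≤-refl
β-top true zero k v h = circ-top k v h
β-top b (suc r) k [] h = s≤s z≤n ∷ _
β-top b (suc r) k (c ∷ v) (p ∷ _) = up-mono p ∷ _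

-- If u does not exceed a word with head at most fer k, then X_{fer k} S_u needs no swap.
push-circ : ∀ k u z → u ≼ z → HeadLt (fer (suc k)) z → (∀ j v → z ≡ bos j ∷ v → j ≤ k) →
  All (_≼ fer k ∷ z) (push (fer k) u)
push-circ k [] z p h n = ≼-cons (fer k) p ∷ []
push-circ k (d ∷ u) z p h n with <ᴸ? d k
push-circ k (d ∷ u) z p h n | inl _ = ≼-cons (fer k) p ∷ []
push-circ k (fer j ∷ u) z p h n | inr _ = []
push-circ k (bos j ∷ u) .(bos j ∷ u) (inl refl) h n | inr ¬q = ⊥-elim (¬q (n j u refl))
push-circ k (bos j ∷ u) (bos i ∷ v) (inr (here p)) h n | inr ¬q = ⊥-elim (¬q (<⇒≤ (<-≤-trans p (n i v refl))))
push-circ k (bos j ∷ u) (fer i ∷ v) (inr (here p)) (h ∷ _) n | inr ¬q = ⊥-elim (¬q (≤-trans p (≤-pred h)))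
push-circ k (bos j ∷ u) .(bos j ∷ _) (inr (there p)) h n | inr ¬q = ⊥-elim (¬q (n j _ refl))

circ-bos : ∀ k v → HeadLt (fer k) v → ∀ j u → circ v ≡ bos j ∷ u → j ≤ k
circ-bos k [] h j u ()
circ-bos k (bos i ∷ v) h j u ()
circ-bos k (fer i ∷ v) h j u ()

zip-All : ∀ {P Q : Mono → Set} {vs} → All P vs → All Q vs → All (λ v → P v × Q v) vs
zip-All [] [] = []
zip-All (p ∷ ps) (q ∷ qs) = (p , q) ∷ zip-All ps qs

push-bos-head : ∀ k u → All (λ v → v ≡ bos k ∷ u) (push (bos k) u)
push-bos-head k [] = refl ∷ []
push-bos-head k (d ∷ u) with <ᴸ? d k
... | inl _ = refl ∷ []
... | inr _ = []

Span-X : ∀ {P Q : Mono → Set} {ξ} c → Pos c → (∀ v → Valid v → P v → HeadLt (fer (suc (fst c))) v) →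
  (∀ v → Valid v → P v → All Q (push c v)) → Span P ξ → Span Q (λ f → ξ (X c f))
Span-X c pos top h = Span-bind (Symm-X c) (λ v val p → Span-≗
  (Span-sum (push c v) (zip-All (All.map fst (push-valid c v pos val (top v val p))) (h v val p)))
  (λ s → push-S c v val (top v val p) s))

Span-X-lower : ∀ {P : Mono → Set} {ξ z} c → Pos c → (∀ v → Valid v → P v → HeadLt (fer (suc (fst c))) v) →
  Span P ξ → Span (_≺ up c ∷ z) (λ f → ξ (X c f))
Span-X-lower c pos top = Span-X c pos top
  (λ v val p → All.map (λ q → HeadLt⇒≺ (snd q)) (push-valid c v pos val (top v val p)))

push-under : ∀ k b u → HeadLt (fer k) u → push (k , b) u ≡ ((k , b) ∷ u) ∷ []
push-under k b [] h = refl
push-under k b (d ∷ u) (p ∷ _) with <ᴸ? d k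
... | inl _ = refl
... | inr ¬p = ⊥-elim (¬p p)

Span-X-cons : ∀ {P Q : Mono → Set} {ξ} c → Pos c → (∀ v → Valid v → P v → HeadLt (fer (fst c)) v) →
  (∀ v → P v → Q (c ∷ v)) → Span P ξ → Span Q (λ f → ξ (X c f))
Span-X-cons c pos top h = Span-bind (Symm-X c) (λ v val p → Span-S (c ∷ v) (row pos (top v val p) val) (h v p))

-- Letting the first r rows grow is lexicographically best. If a row c stays, straightening leaves a
-- head below `up c`, and this already decides the comparison.
O-span : ∀ b r {v} → Valid v → Span (_≼ β b r v) (λ f → S v (O b r f))
O-span false zero {v} val = Span-S v val (inl refl)
O-span true zero {[]} val = Span-S (fer 0 ∷ []) (row tt [] []) (inl refl)
O-span true zero {bos k ∷ v} (row pos top val) = Span-≗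
  (Span-+ (Span-S (fer k ∷ v) (row tt top val) (inl refl))
    (Span-X (bos k) pos (λ u _ p → HeadLt-≼ (circ-top k v top) p)
      (λ u _ p → All.map (λ { refl → inr (here ≤-refl) }) (push-bos-head k u)) (O-span true zero val)))
  (λ s → lin-cong (Lin-S v) (X-O0-bos s k) ∙ lin-+ (Lin-S v) _ _)
O-span true zero {fer k ∷ v} (row pos top val) = Span-≗
  (Span-* -1# (Span-X (fer k) tt (λ u _ p → HeadLt-≼ (circ-top k v top) p)
      (λ u _ p → push-circ k u (circ v) p (circ-top k v top) (circ-bos k v top)) (O-span true zero val)))
  (λ s → lin-cong (Lin-S v) (X-O0-fer s k) ∙ lin-neg (Lin-S v) _ ∙ neg-as-* _)
O-span b (suc r) {[]} val = Span-≗
  (Span-X-cons (bos 1) ≤-refl (λ u _ p → HeadLt-≼ (β-top b r 0 [] []) p) (λ u p → ≼-cons (bos 1) p) (O-span b r val))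
  (λ s → O-vac s b r)
O-span b (suc r) {(k , i) ∷ v} (row pos top val) = Span-≗
  (Span-* (η b c) (Span-+
    (Span-mono (λ _ → inr) (Span-X-lower c pos (λ u _ p → HeadLt-≼ (β-top b (suc r) k v top) p) (O-span b (suc r) val)))
    (Span-X-cons (up c) (Pos-up c) (λ u _ p → HeadLt-≼ (β-top b r k v top) p) (λ u p → ≼-cons (up c) p) (O-span b r val))))
  (λ s → lin-cong (Lin-S v) (X-O s b r c) ∙ lin-* (Lin-S v) (η b c) _ ∙ cong (η b c *_) (lin-+ (Lin-S v) _ _))
  where c = k , i

signF : Bool → Mono → ℚ
signF b [] = 1#
signF b (c ∷ v) = η b c * signF b v

Lead : ℚ → Mono → (Fn → ℚ) → Set
Lead a z ξ = Span (_≺ z) (λ f → ξ f - a * S z f)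

-- When r is at least the number of rows, the leading word requires every row to grow. It therefore
-- arises exactly once, and its coefficient is the product of the Koszul signs on the way.
O-lead : ∀ b r {v} → Valid v → length v ≤ r → Lead (signF b v) (β b r v) (λ f → S v (O b r f))
O-lead false zero {[]} val le = Span-0 (λ s → solve 1 (λ x → x :- con 1# :* x := con 0#) refl _)
O-lead true zero {[]} val le = Span-0 (λ s → solve 1 (λ x → x :- con 1# :* x := con 0#) refl _)
O-lead b (suc r) {[]} val le = Span-≗
  (Span-X-cons (bos 1) ≤-refl (λ u _ p → HeadLt-≺ (β-top b r 0 [] []) p) (λ u p → there p) (O-lead b r val z≤n))
  (λ s → sub-cong (O-vac s b r) refl)
O-lead b (suc r) {(k , i) ∷ v} (row pos top val) (s≤s le) = Span-≗
  (Span-* (η b c) (Span-+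
    (Span-X-lower c pos (λ u _ p → HeadLt-≼ (β-top b (suc r) k v top) p) (O-span b (suc r) val))
    (Span-X-cons (up c) (Pos-up c) (λ u _ p → HeadLt-≺ (β-top b r k v top) p) (λ u p → there p) (O-lead b r val le))))
  (λ s → sub-cong (lin-cong (Lin-S v) (X-O s b r c) ∙ lin-* (Lin-S v) (η b c) _ ∙ cong (η b c *_) (lin-+ (Lin-S v) _ _)) refl ∙
    solve 5 (λ h x y g z → h :* (x :+ y) :- h :* g :* z := h :* (x :+ (y :- g :* z))) refl (η b c) _ _ (signF b v) _)
  where c = k , i

-- Removing columns, and the column products E_w.

-- `rows`, `has0` and `strip` describe the first column of the diagram: its height, whether a circle
-- lies at its bottom (a circled row of length 0), and the diagram left after deleting it.
rows : Mono → ℕ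
rows [] = 0
rows ((zero , _) ∷ w) = rows w
rows ((suc _ , _) ∷ w) = suc (rows w)

has0 : Mono → Bool
has0 [] = false
has0 ((zero , _) ∷ w) = true
has0 ((suc _ , _) ∷ w) = has0 w

strip : Mono → Mono
strip [] = []
strip ((zero , _) ∷ w) = strip w
strip ((suc zero , false) ∷ w) = strip w
strip ((suc zero , true) ∷ w) = fer 0 ∷ strip w
strip ((suc (suc k) , b) ∷ w) = (suc k , b) ∷ strip w

Bounded : ℕ → Mono → Set
Bounded N = All (λ c → fst c < N)

strip-small : ∀ {w} → Valid w → HeadLt (fer 1) w → strip w ≡ []
strip-small [] _ = refl
strip-small (row {zero} {true} _ [] val) (p ∷ _) = refl
strip-small (row {zero} {true} _ (_∷_ {c = bos .0} z≤n _) (row () _ _)) (p ∷ _)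
strip-small (row {suc zero} {false} _ top val) (p ∷ _) = strip-small val top
strip-small (row {suc (suc k)} {false} _ top val) (s≤s () ∷ _)
strip-small (row {suc k} {true} _ top val) (s≤s () ∷ _)

strip-top : ∀ {k w} → Valid w → HeadLt (fer (suc k)) w → HeadLt (fer k) (strip w)
strip-top [] _ = []
strip-top (row {zero} {true} _ [] val) (p ∷ _) = []
strip-top (row {zero} {true} _ (_∷_ {c = bos .0} z≤n _) (row () _ _)) (p ∷ _)
strip-top {k} (row {suc zero} {false} _ top val) (p ∷ _) = subst (HeadLt (fer k)) (sym (strip-small val top)) []
strip-top (row {suc zero} {true} _ top val) (s≤s p ∷ _) = p ∷ _
strip-top (row {suc (suc j)} {false} _ top val) (s≤s p ∷ _) = p ∷ _
strip-top (row {suc (suc j)} {true} _ top val) (s≤s p ∷ _) = p ∷ _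

strip-valid : ∀ {w} → Valid w → Valid (strip w)
strip-valid [] = []
strip-valid (row {zero} _ top val) = strip-valid val
strip-valid (row {suc zero} {false} _ top val) = strip-valid val
strip-valid (row {suc zero} {true} _ top val) = row tt (strip-top val top) (strip-valid val)
strip-valid (row {suc (suc k)} {false} _ top val) = row (s≤s z≤n) (strip-top val top) (strip-valid val)
strip-valid (row {suc (suc k)} {true} _ top val) = row tt (strip-top val top) (strip-valid val)

strip-length : ∀ w → length (strip w) ≤ rows w
strip-length [] = z≤n
strip-length ((zero , _) ∷ w) = strip-length w
strip-length ((suc zero , false) ∷ w) = m≤n⇒m≤1+n (strip-length w)
strip-length ((suc zero , true) ∷ w) = s≤s (strip-length w)
strip-length ((suc (suc k) , b) ∷ w) = s≤s (strip-length w)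

strip-bounded : ∀ {N w} → Bounded (suc N) w → Bounded N (strip w)
strip-bounded {w = []} [] = []
strip-bounded {w = (zero , _) ∷ w} (p ∷ a) = strip-bounded a
strip-bounded {w = (suc zero , false) ∷ w} (p ∷ a) = strip-bounded a
strip-bounded {w = (suc zero , true) ∷ w} (s≤s p ∷ a) = p ∷ strip-bounded a
strip-bounded {w = (suc (suc k) , b) ∷ w} (s≤s p ∷ a) = p ∷ strip-bounded a

β-strip : ∀ {w} → Valid w → β (has0 w) (rows w) (strip w) ≡ w
β-strip [] = refl
β-strip (row {zero} {true} _ [] []) = refl
β-strip (row {zero} {true} _ (_∷_ {c = bos .0} z≤n _) (row () _ _))
β-strip {_ ∷ w} (row {suc zero} {false} _ top val) =
  cong (β (has0 w) (suc (rows w))) (strip-small val top) ∙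
    cong (bos 1 ∷_) (cong (β (has0 w) (rows w)) (sym (strip-small val top)) ∙ β-strip val)
β-strip (row {suc zero} {true} _ top val) = cong (fer 1 ∷_) (β-strip val)
β-strip (row {suc (suc k)} {b} _ top val) = cong ((suc (suc k) , b) ∷_) (β-strip val)

β-mono : ∀ b r {x y} → Valid x → Valid y → length y ≤ r → x ≺ y → β b r x ≺ β b r y
β-mono b zero {y = []} _ _ _ ()
β-mono b (suc r) {[]} {bos (suc k) ∷ y} _ _ _ []≺ = here (s≤s (s≤s z≤n))
β-mono b (suc r) {[]} {bos zero ∷ y} _ (row () _ _) _ []≺
β-mono b (suc r) {[]} {fer k ∷ y} _ _ _ []≺ = here (s≤s z≤n)
β-mono b (suc r) {c ∷ x} {d ∷ y} _ _ _ (here p) = here (up-mono p)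
β-mono b (suc r) {c ∷ x} {.c ∷ y} (row _ _ vx) (row _ _ vy) (s≤s le) (there p) = there (β-mono b r vx vy le p)

-- E τ N w is, up to sign, the product of the columns of w (all of whose rows are shorter than N),
-- a column of length r contributing e_r, or ẽ τ 0 r if it ends in a circle.
Oτ : ℚ → Bool → ℕ → Fn → Fn
Oτ τ false r = el r
Oτ τ true r = ẽ τ 0 r

E : ℚ → ℕ → Mono → Fn → ℚ
E τ zero w f = f []
E τ (suc N) w f = signF (has0 w) (strip w) * E τ N (strip w) (Oτ τ (has0 w) (rows w) f)

O≡Oτ : ∀ b r f w → Oτ 1# b r f w ≡ O b r f w
O≡Oτ false r f w = refl
O≡Oτ true r f w = refl

signF² : ∀ b v → signF b v * signF b v ≡ 1#
signF² b [] = *-identityˡ _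
signF² b (c ∷ v) = solve 2 (λ h g → h :* g :* (h :* g) := (h :* h) :* (g :* g)) refl (η b c) (signF b v) ∙
  cong₂ _*_ (η² b c) (signF² b v) ∙ *-identityˡ _
  where
  η² : ∀ b c → η b c * η b c ≡ 1#
  η² false c = *-identityˡ _
  η² true (bos _) = *-identityˡ _
  η² true (fer _) = solve 0 (con -1# :* con -1# := con 1#) refl

Lin-Oτ : ∀ τ b r → LinOp (Oτ τ b r)
Lin-Oτ τ false r = Lin-el r
Lin-Oτ τ true r = Lin-ẽ τ 0 r

Symm-Oτ : ∀ τ b r {f} → Symm f → Symm (Oτ τ b r f)
Symm-Oτ τ false r = Symm-el r
Symm-Oτ τ true r = Symm-ẽ τ 0 r

Lin-E : ∀ τ N w → Lin (E τ N w)
Lin-E τ zero w = Lin-at []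
Lin-E τ (suc N) w = Lin-* _ (Lin-∘ (Lin-E τ N (strip w)) (Lin-Oτ τ (has0 w) (rows w)))

Bounded-0 : ∀ {w} → Bounded 0 w → w ≡ []
Bounded-0 [] = refl
Bounded-0 (() ∷ _)

-- By `β-strip`, adding the first column back to `strip w` restores w, and `β-mono` keeps lower
-- terms lower. The sign put into `E` cancels that of `O-lead`.
E-lead : ∀ N {w} → Valid w → Bounded N w → Lead 1# w (E 1# N w)
E-lead zero {w} val bd with Bounded-0 bd
... | refl = Span-0 (λ s → solve 1 (λ x → x :- con 1# :* x := con 0#) refl _)
E-lead (suc N) {w} val bd = subst (λ z → Lead 1# z (E 1# (suc N) w)) (β-strip val) (Span-≗
  (Span-* g (Span-+ (O-lead b r sv (strip-length w))
    (Span-bind (Symm-O b r) (λ u uv p → Span-mono (λ _ q → ≼-≺-trans q (β-mono b r uv sv (strip-length w) p)) (O-span b r uv))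
      (E-lead N sv (strip-bounded bd)))))
  (λ {f} s → cong (λ z → g * z - 1# * S (β b r v) f) (lin-cong (Lin-E 1# N v) (O≡Oτ b r f)) ∙
    cong (λ z → g * E 1# N v (O b r f) - z * S (β b r v) f) (sym (signF² b v)) ∙
    solve 4 (λ g x y z → g :* x :- g :* g :* z := g :* ((y :- g :* z) :+ (x :- con 1# :* y))) refl g _ (S v (O b r f)) _))
  where
  b = has0 w
  r = rows w
  v = strip w
  g = signF b v
  sv = strip-valid val

Symm-hmul : ∀ n {f} → Symm f → Symm (hmul n f)
Symm-hmul zero s = s
Symm-hmul (suc n) {f} s .at [] .Front.swap (bos k) (bos l) w = 1*-eq (begin
  _
    ≡⟨ cong₂ (λ x y → (x + y) + dn k (hmul n f) (bos l ∷ w)) (lin-cong (Lin-hmul (suc n) w) (λ v → swap-bos s k (bos l) v)) (expand k l) ⟩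
  (M + (dn l (hmul n f) (bos k ∷ w) - dn l (dn k (hm1 n f)) w)) + dn k (hmul n f) (bos l ∷ w)
    ≡⟨ cong (λ z → (M + (dn l (hmul n f) (bos k ∷ w) - z)) + dn k (hmul n f) (bos l ∷ w)) (dn-dn (Symm-hm1 n) k l w) ⟩
  (M + (dn l (hmul n f) (bos k ∷ w) - dn k (dn l (hm1 n f)) w)) + dn k (hmul n f) (bos l ∷ w)
    ≡⟨ solve 4 (λ m x y z → (m :+ (x :- y)) :+ z := (m :+ (z :- y)) :+ x) refl _ _ _ _ ⟩
  (M + (dn k (hmul n f) (bos l ∷ w) - dn k (dn l (hm1 n f)) w)) + dn l (hmul n f) (bos k ∷ w)
    ≡⟨ cong (λ x → (M + x) + dn l (hmul n f) (bos k ∷ w)) (sym (expand l k)) ⟩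
  _ ∎)
  where
  M = hmul (suc n) (cons (bos k) (cons (bos l) f)) w
  Symm-hm1 : ∀ n → Symm (hm1 n f)
  Symm-hm1 zero = Symm-0
  Symm-hm1 (suc n) = Symm-hmul n s
  expand : ∀ k l → dn l (hmul n (cons (bos k) f)) w ≡ dn l (hmul n f) (bos k ∷ w) - dn l (dn k (hm1 n f)) w
  expand k zero = solve 0 (con 0# := con 0# :- con 0#) refl
  expand k (suc l) = solve 2 (λ a b → a := (a :+ b) :- b) refl _ (dn k (hm1 n f) (bos l ∷ w)) ∙
    sub-cong (sym (hmul-bos n k f (bos l ∷ w)) ∙ swap-bos (Symm-hmul n s) k (bos l) w) refl
Symm-hmul (suc n) {f} s .at [] .Front.swap (bos k) (fer b) w = 1*-eq
  (cong₂ _+_ (lin-cong (Lin-hmul (suc n) w) (λ v → swap-bos s k (fer b) v)) (moved k))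
  where
  moved : ∀ k → dn k (hmul n f) (fer b ∷ w) ≡ dn k (hmul n (cons (fer b) f)) w
  moved zero = refl
  moved (suc k) = swap-bos (Symm-hmul n s) k (fer b) w ∙ hmul-fer n b f (bos k ∷ w)
Symm-hmul (suc n) {f} s .at [] .Front.swap (fer a) (bos l) w = 1*-eq
  (cong₂ _+_ (lin-cong (Lin-hmul (suc n) w) (λ v → sym (swap-bos s l (fer a) v))) (moved l))
  where
  moved : ∀ k → dn k (hmul n (cons (fer a) f)) w ≡ dn k (hmul n f) (fer a ∷ w)
  moved zero = refl
  moved (suc k) = sym (swap-bos (Symm-hmul n s) k (fer a) w ∙ hmul-fer n a f (bos k ∷ w))
Symm-hmul (suc n) {f} s .at [] .Front.swap (fer a) (fer b) w =
  lin-cong (Lin-hmul (suc n) w) (λ v → swap-fer s a b v) ∙ lin-neg (Lin-hmul (suc n) w) _ ∙ neg-as-* _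
Symm-hmul (suc n) s .at [] .Front.unit w = +-identityʳ _ ∙ lin-cong (Lin-hmul (suc n) w) (drop0 s)
Symm-hmul (suc n) s .at (bos k ∷ u) = Front-+ (at (Symm-hmul (suc n) (Symm-cons s (bos k))) u) (at (Symm-dn k (Symm-hmul n s)) u)
Symm-hmul (suc n) s .at (fer a ∷ u) = at (Symm-hmul (suc n) (Symm-cons s (fer a))) u

Symm-hm1 : ∀ n {f} → Symm f → Symm (hm1 n f)
Symm-hm1 zero s = Symm-0
Symm-hm1 (suc n) s = Symm-hmul n s

Symm-pmul : ∀ a {f} → Symm f → Symm (pmul a f)
Symm-pmul a s .at [] .Front.swap (bos k) (bos l) w = 1*-eq (lin-cong (Lin-pmul a w) (λ v → swap-bos s k (bos l) v))
Symm-pmul a {f} s .at [] .Front.swap (bos k) (fer b) w = 1*-eq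
  (cong (λ z → δ a b * f (bos k ∷ w) - z) (lin-cong (Lin-pmul a w) (λ v → swap-bos s k (fer b) v)))
Symm-pmul a {f} s .at [] .Front.swap (fer b) (bos l) w = 1*-eq
  (cong (λ z → δ a b * f (bos l ∷ w) - z) (lin-cong (Lin-pmul a w) (λ v → sym (swap-bos s l (fer b) v))))
Symm-pmul a {f} s .at [] .Front.swap (fer b) (fer c) w =
  cong (λ z → δ a b * f (fer c ∷ w) - (δ a c * f (fer b ∷ w) - z))
      (lin-cong (Lin-pmul a w) (λ v → swap-fer s b c v) ∙ lin-neg (Lin-pmul a w) _) ∙
    solve 3 (λ x y z → x :- (y :- :- z) := :- (y :- (x :- z))) refl _ _ _ ∙ neg-as-* _
Symm-pmul a s .at [] .Front.unit w = lin-cong (Lin-pmul a w) (drop0 s)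
Symm-pmul a s .at (bos k ∷ u) = at (Symm-pmul a (Symm-cons s (bos k))) u
Symm-pmul a s .at (fer b ∷ u) = Front-sub (Front-* (δ a b) (at s u)) (at (Symm-pmul a (Symm-cons s (fer b))) u)

-- Monomial coefficients.

-- Multiplication by h̃_a on functionals; mform v pairs words with ∏ h̃ h, that is, mform v w is the
-- coefficient in w of the monomial with exponents v.

h̃mul : ℕ → Fn → Fn
h̃mul a g w = conv a (λ i j → pmul i (hmul j g) w)

h̃m1 : ℕ → Fn → Fn
h̃m1 zero g w = 0#
h̃m1 (suc a) g w = h̃mul a g w

Lin-h̃mul : ∀ a → LinOp (h̃mul a)
Lin-h̃mul a w = Lin-conv a (λ i j → Lin-∘ (Lin-pmul i w) (Lin-hmul j))

Lin-h̃m1 : ∀ a → LinOp (h̃m1 a)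
Lin-h̃m1 zero w = Lin-0
Lin-h̃m1 (suc a) w = Lin-h̃mul a w

Symm-h̃mul : ∀ a {f} → Symm f → Symm (h̃mul a f)
Symm-h̃mul a s = Symm-conv a (λ i j → Symm-pmul i (Symm-hmul j s))

Symm-h̃m1 : ∀ a {f} → Symm f → Symm (h̃m1 a f)
Symm-h̃m1 zero s = Symm-0
Symm-h̃m1 (suc a) s = Symm-h̃mul a s

h̃mul-bos : ∀ a i g w → h̃mul a g (bos i ∷ w) ≡ h̃mul a (cons (bos i) g) w + dn i (h̃m1 a g) w
h̃mul-bos a i g w = trans
  (conv-cong a (λ b c _ → lin-cong (Lin-pmul b w) (hmul-bos c i g) ∙ lin-+ (Lin-pmul b w) _ _))
  (conv-+ a _ _ ∙ cong (h̃mul a (cons (bos i) g) w +_) (lower a i))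
  where
  lower : ∀ a i → conv a (λ b c → pmul b (dn i (hm1 c g)) w) ≡ dn i (h̃m1 a g) w
  lower a zero = conv-0 a _ (λ b c _ → lin-0 (Lin-pmul b w) (λ _ → refl))
  lower zero (suc i) = lin-0 (Lin-pmul 0 w) (λ _ → refl)
  lower (suc a) (suc i) = conv-last a (λ b c → pmul b (dn (suc i) (hm1 c g)) w) ∙
    +0 (lin-0 (Lin-pmul (suc a) w) (λ _ → refl))

h̃mul-suc : ∀ a i g w → h̃mul a g (bos (suc i) ∷ w) ≡ h̃mul a (cons (bos (suc i)) g) w + h̃m1 a g (bos i ∷ w)
h̃mul-suc a i g w = h̃mul-bos a (suc i) g w

-- hshift a i is multiplication by h_{a-i}.
hshift : ℕ → ℕ → Fn → Fn
hshift a zero g = hmul a g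
hshift zero (suc i) g w = 0#
hshift (suc a) (suc i) g = hshift a i g

conv-δ : ∀ a i g w → conv a (λ b c → δ b i * hmul c g w) ≡ hshift a i g w
conv-δ zero zero g w = *-identityˡ _
conv-δ zero (suc i) g w = zeroˡ _
conv-δ (suc a) zero g w = cong₂ _+_ (*-identityˡ _) (conv-0 a _ (λ b c _ → zeroˡ _)) ∙ +-identityʳ _
conv-δ (suc a) (suc i) g w = cong₂ _+_ (zeroˡ _) (conv-δ a i g w) ∙ +-identityˡ _

h̃mul-fer : ∀ a i g w → h̃mul a g (fer i ∷ w) ≡ hshift a i g w - h̃mul a (cons (fer i) g) w
h̃mul-fer a i g w = conv-+ a _ _ ∙ cong₂ _+_ (conv-δ a i g w)
  (conv-neg a _ ∙ cong -_ (conv-cong a (λ b c _ → lin-cong (Lin-pmul b w) (hmul-fer c i g))))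

L̃ : Letter → Fn → Fn
L̃ (bos n) = hmul n
L̃ (fer a) = h̃mul a

Lin-L̃ : ∀ c → LinOp (L̃ c)
Lin-L̃ (bos n) = Lin-hmul n
Lin-L̃ (fer a) = Lin-h̃mul a

Symm-L̃ : ∀ c {f} → Symm f → Symm (L̃ c f)
Symm-L̃ (bos n) = Symm-hmul n
Symm-L̃ (fer a) = Symm-h̃mul a

hmul-h̃mul : ∀ n a f w → hmul n (h̃mul a f) w ≡ h̃mul a (hmul n f) w
hmul-h̃mul n a f w = lin-conv (Lin-hmul n w) a _ ∙
  conv-cong a (λ i j _ → hmul-pmul n i (hmul j f) w ∙ lin-cong (Lin-pmul i w) (hmul-comm n j f))

h̃mul-anticomm : ∀ a b f w → h̃mul a (h̃mul b f) w ≡ - h̃mul b (h̃mul a f) w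
h̃mul-anticomm a b f w = begin
  _
    ≡⟨ conv-cong a (λ i j _ → expand i j b) ⟩
  conv a (λ i j → conv b (λ k l → pmul i (pmul k (hmul l (hmul j f))) w))
    ≡⟨ conv-swap a b _ ⟩
  conv b (λ k l → conv a (λ i j → pmul i (pmul k (hmul l (hmul j f))) w))
    ≡⟨ conv-cong b (λ k l _ → conv-cong a (λ i j _ → exchange i j k l) ∙ conv-neg a _) ⟩
  conv b (λ k l → - conv a (λ i j → pmul k (pmul i (hmul j (hmul l f))) w))
    ≡⟨ conv-neg b _ ⟩
  - conv b (λ k l → conv a (λ i j → pmul k (pmul i (hmul j (hmul l f))) w))
    ≡⟨ cong -_ (conv-cong b (λ k l _ → sym (expand k l a))) ⟩
  _ ∎
  where
  expand : ∀ i j b → pmul i (hmul j (h̃mul b f)) w ≡ conv b (λ k l → pmul i (pmul k (hmul l (hmul j f))) w)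
  expand i j b = lin-cong (Lin-pmul i w) (hmul-h̃mul j b f) ∙ lin-conv (Lin-pmul i w) b _
  exchange : ∀ i j k l → pmul i (pmul k (hmul l (hmul j f))) w ≡ - pmul k (pmul i (hmul j (hmul l f))) w
  exchange i j k l = pmul-anticomm i k _ w ∙
    cong -_ (lin-cong (Lin-pmul k w) (λ v → lin-cong (Lin-pmul i v) (hmul-comm l j f)))

L̃-comm : ∀ c d f w → L̃ c (L̃ d f) w ≡ σ c d * L̃ d (L̃ c f) w
L̃-comm (bos m) (bos n) f w = 1*-eq (hmul-comm m n f w)
L̃-comm (bos m) (fer b) f w = 1*-eq (hmul-h̃mul m b f w)
L̃-comm (fer a) (bos n) f w = 1*-eq (sym (hmul-h̃mul n a f w))
L̃-comm (fer a) (fer b) f w = h̃mul-anticomm a b f w ∙ neg-as-* _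

mform : Mono → Fn
mform [] = vac
mform (c ∷ v) = L̃ c (mform v)

Symm-mform : ∀ v → Symm (mform v)
Symm-mform [] = Symm-form []
Symm-mform (c ∷ v) = Symm-L̃ c (Symm-mform v)

el-hmul : ∀ {f} → Symm f → ∀ k n w → el (suc n) (hmul k f) w ≡ hmul k (el (suc n) f) w + hm1 k (el n f) w
el-hmul s k n w = EBefore.el-rule (Lin-hmul k) (Symm-hmul k) (Symm-hm1 k) (λ i f w → hmul-bos k (suc i) f w) s n w

el-h̃mul : ∀ {f} → Symm f → ∀ a n w → el (suc n) (h̃mul a f) w ≡ h̃mul a (el (suc n) f) w + h̃m1 a (el n f) w
el-h̃mul s a n w = EBefore.el-rule (Lin-h̃mul a) (Symm-h̃mul a) (Symm-h̃m1 a) (h̃mul-suc a) s n w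

ẽ-hmul : ∀ {f} → Symm f → ∀ k i n w → ẽ 1# i n (hmul k f) w ≡ hmul k (ẽ 1# i n f) w + hm1 k (ẽ⁻ i n f) w
ẽ-hmul {f} s k i zero w = hmul-fer k i f w ∙ sym (+-identityʳ _) ∙ cong₂ _+_ refl (sym (lin-0 (Lin-hm1 k w) (λ _ → refl)))
ẽ-hmul {f} s k i (suc n) w = begin
  _
    ≡⟨ ẽ-suc i n (hmul k f) w ⟩
  el (suc n) (cons (fer i) (hmul k f)) w - ẽ 1# (suc i) n (hmul k f) w
    ≡⟨ sub-cong (lin-cong (Lin-el (suc n) w) (hmul-fer k i f) ∙ el-hmul (Symm-cons s (fer i)) k n w) (ẽ-hmul s k (suc i) n w) ⟩
  _
    ≡⟨ cong (λ z → (hmul k (el (suc n) fᵢ) w + z) - (hmul k (ẽ 1# (suc i) n f) w + hm1 k (ẽ⁻ (suc i) n f) w))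
         (lin-cong (Lin-hm1 k w) (el-ẽ⁻ i n f) ∙ lin-+ (Lin-hm1 k w) _ _) ⟩
  _ ≡⟨ solve 4 (λ a x y b → (a :+ (x :+ y)) :- (b :+ y) := (a :- b) :+ x) refl _ _ _ _ ⟩
  (hmul k (el (suc n) fᵢ) w - hmul k (ẽ 1# (suc i) n f) w) + hm1 k (ẽ 1# i n f) w
    ≡⟨ cong (_+ hm1 k (ẽ 1# i n f) w) (sym (lin-sub (Lin-hmul k w) _ _) ∙ lin-cong (Lin-hmul k w) (λ v → sym (ẽ-suc i n f v))) ⟩
  _ ∎
  where fᵢ = cons (fer i) f

el-0 : ∀ n w → el n (λ _ → 0#) w ≡ 0#
el-0 n w = lin-0 (Lin-el n w) (λ _ → refl)

el-hshift : ∀ {f} → Symm f → ∀ a i n w → el (suc n) (hshift a i f) w ≡ hshift a i (el (suc n) f) w + hshift a (suc i) (el n f) w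
el-hshift s zero zero n w = el-hmul s 0 n w ∙ refl
el-hshift s (suc a) zero n w = el-hmul s (suc a) n w
el-hshift s zero (suc i) n w = el-0 (suc n) w ∙ sym (+-identityˡ 0#)
el-hshift s (suc a) (suc i) n w = el-hshift s a i n w

ẽ-h̃mul : ∀ {f} → Symm f → ∀ a i n w →
  ẽ 1# i n (h̃mul a f) w ≡ (hshift a i (el n f) w - h̃mul a (ẽ 1# i n f) w) - h̃m1 a (ẽ⁻ i n f) w
ẽ-h̃mul {f} s a i zero w = h̃mul-fer a i f w ∙
  solve 1 (λ x → x := x :- con 0#) refl _ ∙ cong (λ z → (hshift a i f w - h̃mul a (cons (fer i) f) w) - z) (sym (lin-0 (Lin-h̃m1 a w) (λ _ → refl)))
ẽ-h̃mul {f} s a i (suc n) w = begin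
  _
    ≡⟨ ẽ-suc i n (h̃mul a f) w ⟩
  el (suc n) (cons (fer i) (h̃mul a f)) w - ẽ 1# (suc i) n (h̃mul a f) w
    ≡⟨ sub-cong (lin-cong (Lin-el (suc n) w) (h̃mul-fer a i f) ∙ lin-sub (Lin-el (suc n) w) _ _ ∙
         sub-cong (el-hshift s a i n w) (el-h̃mul (Symm-cons s (fer i)) a n w)) (ẽ-h̃mul s a (suc i) n w) ⟩
  _
    ≡⟨ cong (λ z → ((hshift a i (el (suc n) f) w + Z) - (h̃mul a (el (suc n) fᵢ) w + z)) - ((Z - h̃mul a (ẽ 1# (suc i) n f) w) - h̃m1 a (ẽ⁻ (suc i) n f) w))
         (lin-cong (Lin-h̃m1 a w) (el-ẽ⁻ i n f) ∙ lin-+ (Lin-h̃m1 a w) _ _) ⟩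
  _ ≡⟨ solve 6 (λ x z p q r t → ((x :+ z) :- (p :+ (q :+ r))) :- ((z :- t) :- r) := (x :- (p :- t)) :- q) refl _ Z _ _ _ _ ⟩
  _
    ≡⟨ cong (λ z → (hshift a i (el (suc n) f) w - z) - h̃m1 a (ẽ 1# i n f) w)
         (sym (lin-sub (Lin-h̃mul a w) _ _) ∙ lin-cong (Lin-h̃mul a w) (λ v → sym (ẽ-suc i n f v))) ⟩
  _ ∎
  where
  fᵢ = cons (fer i) f
  Z = hshift a (suc i) (el n f) w

L̃1 : Letter → Fn → Fn
L̃1 (bos n) = hm1 n
L̃1 (fer a) = h̃m1 a

-- Extra term produced when the fermionic factor of O true r replaces θ_i.
mark : Bool → Letter → ℕ → Fn → Fn
mark true (fer a) r f = hmul a (el r f)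
mark true (bos _) r f w = 0#
mark false _ r f w = 0#

O-L̃ : ∀ {f} → Symm f → ∀ b r c w → O b (suc r) (L̃ c f) w ≡
  η b c * (L̃ c (O b (suc r) f) w + L̃1 c (O b r f) w) + mark b c (suc r) f w
O-L̃ s false r (bos n) w = el-hmul s n r w ∙ solve 1 (λ x → x := con 1# :* x :+ con 0#) refl _
O-L̃ s false r (fer a) w = el-h̃mul s a r w ∙ solve 1 (λ x → x := con 1# :* x :+ con 0#) refl _
O-L̃ s true r (bos n) w = ẽ-hmul s n 0 (suc r) w ∙ solve 1 (λ x → x := con 1# :* x :+ con 0#) refl _
O-L̃ s true r (fer a) w = ẽ-h̃mul s a 0 (suc r) w ∙ solve 3 (λ x y z → (x :- y) :- z := con -1# :* (y :+ z) :+ x) refl _ _ _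

O0-L̃ : ∀ {f} → Symm f → ∀ b c w → O b 0 (L̃ c f) w ≡ η b c * L̃ c (O b 0 f) w + mark b c 0 f w
O0-L̃ s false c w = solve 1 (λ x → x := con 1# :* x :+ con 0#) refl _
O0-L̃ {f} s true (bos n) w = hmul-fer n 0 f w ∙ solve 1 (λ x → x := con 1# :* x :+ con 0#) refl _
O0-L̃ {f} s true (fer a) w = h̃mul-fer a 0 f w ∙ solve 2 (λ x y → x :- y := con -1# :* y :+ x) refl _ _

hook-vac : ∀ i n w → hook (suc i) n vac w ≡ 0#
hook-vac i zero w = refl
hook-vac i (suc n) w = 0-0 (lin-0 (Lin-hook 1 n w) (λ _ → refl)) (hook-vac (suc i) n w)

ẽ-vac-0 : ∀ i n w → ẽ 1# i n vac w ≡ 0#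
ẽ-vac-0 i zero w = refl
ẽ-vac-0 i (suc n) w = ẽ-suc i n vac w ∙ 0-0 (lin-0 (Lin-el (suc n) w) (λ _ → refl)) (ẽ-vac-0 (suc i) n w)

-- Dec b r v u: u arises from v by lowering r letters and, if b, replacing a further fer a by bos a.
data Dec : Bool → ℕ → Mono → Mono → Set where
  done : Dec false 0 [] []
  keep : ∀ {b r c v u} → Dec b r v u → Dec b r (c ∷ v) (c ∷ u)
  down : ∀ {b r c v u} → Dec b r v u → Dec b (suc r) (up c ∷ v) (c ∷ u)
  marked : ∀ {r a v u} → Dec false r v u → Dec true r (fer a ∷ v) (bos a ∷ u)

-- `O b r (mform v)` is a signed combination of the `mform u` with `Dec b r v u`. Only vanishing
-- will be needed, so the coefficients are never written down.
O-mform-0 : ∀ b r v {ξ} → Lin ξ → (∀ u → Dec b r v u → ξ (mform u) ≡ 0#) → ξ (O b r (mform v)) ≡ 0#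
mark-0 : ∀ b r c v {ξ} → Lin ξ → (∀ u → Dec b r (c ∷ v) u → ξ (mform u) ≡ 0#) → ξ (mark b c r (mform v)) ≡ 0#

O-mform-0 false zero [] l p = p [] done
O-mform-0 false (suc r) [] l p = lin-0 l (hook-vac 0 r)
O-mform-0 true r [] l p = lin-0 l (ẽ-vac-0 0 r)
O-mform-0 b zero (c ∷ v) {ξ} l p = lin-cong l (O0-L̃ (Symm-mform v) b c) ∙
  lin-+ l _ _ ∙ cong₂ _+_
    (lin-* l (η b c) _ ∙ *0 (O-mform-0 b 0 v (Lin-∘ l (Lin-L̃ c)) (λ u q → p (c ∷ u) (keep q))))
    (mark-0 b 0 c v l p) ∙ +-identityˡ 0#
O-mform-0 b (suc r) (c ∷ v) {ξ} l p = lin-cong l (O-L̃ (Symm-mform v) b r c) ∙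
  lin-+ l _ _ ∙ cong₂ _+_
    (lin-* l (η b c) _ ∙ *0 (lin-+ l _ _ ∙ cong₂ _+_
      (O-mform-0 b (suc r) v (Lin-∘ l (Lin-L̃ c)) (λ u q → p (c ∷ u) (keep q))) (lowered c p) ∙ +-identityˡ 0#))
    (mark-0 b (suc r) c v l p) ∙ +-identityˡ 0#
  where
  lowered : ∀ c → (∀ u → Dec b (suc r) (c ∷ v) u → ξ (mform u) ≡ 0#) → ξ (L̃1 c (O b r (mform v))) ≡ 0#
  lowered (bos zero) p = lin-0 l (λ _ → refl)
  lowered (fer zero) p = lin-0 l (λ _ → refl)
  lowered (bos (suc k)) p = O-mform-0 b r v (Lin-∘ l (Lin-L̃ (bos k))) (λ u q → p (bos k ∷ u) (down q))
  lowered (fer (suc k)) p = O-mform-0 b r v (Lin-∘ l (Lin-L̃ (fer k))) (λ u q → p (fer k ∷ u) (down q))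

mark-0 false r c v l p = lin-0 l (λ _ → refl)
mark-0 true r (bos n) v l p = lin-0 l (λ _ → refl)
mark-0 true r (fer a) v l p = O-mform-0 false r v (Lin-∘ l (Lin-L̃ (bos a))) (λ u q → p (bos a ∷ u) (marked q))

ins : Letter → Mono → Mono
ins c [] = c ∷ []
ins c (d ∷ v) with <ᴸ-cmp c d
... | inl _ = d ∷ ins c v
... | inr _ = c ∷ d ∷ v

insb : ℕ → Mono → Mono
insb zero v = v
insb (suc k) v = ins (bos (suc k)) v

insz : Letter → Mono → Mono
insz (bos k) v = insb k v
insz (fer k) v = ins (fer k) v

norm : Mono → Mono
norm [] = []
norm (c ∷ v) = insz c (norm v)

below-fer : ∀ {k b c} → c <ᴸ (k , b) → c <ᴸ fer k
below-fer {k} {true} p = p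
below-fer {k} {false} {bos j} p = <⇒≤ p
below-fer {k} {false} {fer j} p = p

ins-top : ∀ {d} c v → c <ᴸ d → HeadLt d v → HeadLt d (ins c v)
ins-top c [] p h = p ∷ []
ins-top c (e ∷ v) p (q ∷ _) with <ᴸ-cmp c e
... | inl _ = q ∷ _
... | inr _ = p ∷ _

Scaled : Fn → Fn → Set
Scaled f g = Σ ℚ λ a → ∀ w → f w ≡ a * g w

Scaled-L̃ : ∀ c {f g} → Scaled f g → Scaled (L̃ c f) (L̃ c g)
Scaled-L̃ c (a , p) = a , λ w → lin-cong-* (Lin-L̃ c w) p

ins-mform : ∀ c v → Scaled (L̃ c (mform v)) (mform (ins c v))
ins-mform c [] = 1# , λ w → sym (*-identityˡ _)
ins-mform c (d ∷ v) with <ᴸ-cmp c d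
... | inr _ = 1# , λ w → sym (*-identityˡ _)
... | inl _ with Scaled-L̃ d (ins-mform c v)
... | a , p = σ c d * a , λ w → L̃-comm c d (mform v) w ∙ cong (σ c d *_) (p w) ∙ sym (*-assoc _ _ _)

insz-mform : ∀ c v → Scaled (L̃ c (mform v)) (mform (insz c v))
insz-mform (bos zero) v = 1# , λ w → sym (*-identityˡ _)
insz-mform (bos (suc k)) v = ins-mform (bos (suc k)) v
insz-mform (fer k) v = ins-mform (fer k) v

norm-mform : ∀ v → Scaled (mform v) (mform (norm v))
norm-mform [] = 1# , λ w → sym (*-identityˡ _)
norm-mform (c ∷ v) with Scaled-L̃ c (norm-mform v) | insz-mform c (norm v)
... | a , p | a' , q = a * a' , λ w → p w ∙ cong (a *_) (q w) ∙ sym (*-assoc _ _ _)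

L̃-0 : ∀ c {f} → (∀ w → f w ≡ 0#) → ∀ w → L̃ c f w ≡ 0#
L̃-0 c p w = lin-0 (Lin-L̃ c w) p

ins-valid : ∀ c {v} → Pos c → Valid v → Valid (ins c v) ⊎ (∀ w → L̃ c (mform v) w ≡ 0#)
ins-valid c {[]} pos val = inl (row pos [] [])
ins-valid c {d ∷ v} pos (row posd top val) with <ᴸ-cmp c d
... | inr (inr p) = inl (row pos (below-fer p ∷ v) (row posd top val))
ins-valid (bos k) {.(bos k) ∷ v} pos (row posd top val) | inr (inl refl) = inl (row pos (≤-refl ∷ v) (row posd top val))
ins-valid (fer k) {.(fer k) ∷ v} pos (row posd top val) | inr (inl refl) = inr (λ w → antisymmetric⇒0 (h̃mul-anticomm k k (mform v) w))
ins-valid c {d ∷ v} pos (row posd top val) | inl p with ins-valid c pos val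
... | inl val' = inl (row posd (ins-top c v (below-fer p) top) val')
... | inr z = inr (λ w → L̃-comm c d (mform v) w ∙ *0 (L̃-0 d z w))

-- A word that cannot be sorted into a valid one repeats a circled letter, and h̃_k anticommutes
-- with itself.
norm-valid : ∀ v → Valid (norm v) ⊎ (∀ w → mform v w ≡ 0#)
norm-valid [] = inl []
norm-valid (c ∷ v) with norm-valid v
... | inr z = inr (L̃-0 c z)
norm-valid (bos zero ∷ v) | inl val = inl val
norm-valid (bos (suc k) ∷ v) | inl val = scaled (ins-valid (bos (suc k)) (s≤s z≤n) val)
  where
  scaled : ∀ {A : Set} → A ⊎ (∀ w → hmul (suc k) (mform (norm v)) w ≡ 0#) → A ⊎ (∀ w → mform (bos (suc k) ∷ v) w ≡ 0#)
  scaled (inl x) = inl x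
  scaled (inr z) = inr (λ w → snd (Scaled-L̃ (bos (suc k)) (norm-mform v)) w ∙ *0 (z w))
norm-valid (fer k ∷ v) | inl val = scaled (ins-valid (fer k) tt val)
  where
  scaled : ∀ {A : Set} → A ⊎ (∀ w → h̃mul k (mform (norm v)) w ≡ 0#) → A ⊎ (∀ w → mform (fer k ∷ v) w ≡ 0#)
  scaled (inl x) = inl x
  scaled (inr z) = inr (λ w → snd (Scaled-L̃ (fer k) (norm-mform v)) w ∙ *0 (z w))

AllLt : Letter → Mono → Set
AllLt d = All (_<ᴸ d)

≤fer-trans : ∀ {j c k b} → c <ᴸ fer j → (j , b) <ᴸ fer k → c <ᴸ fer k
≤fer-trans {j} {bos i} {k} {false} p q = ≤-trans p q
≤fer-trans {j} {fer i} {k} {false} p q = <-≤-trans p q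
≤fer-trans {j} {bos i} {k} {true} p q = <⇒≤ (≤-<-trans p q)
≤fer-trans {j} {fer i} {k} {true} p q = <-trans p q

Valid-AllLt : ∀ {k v} → Valid v → HeadLt (fer k) v → AllLt (fer k) v
Valid-AllLt [] _ = []
Valid-AllLt (row pos top val) (p ∷ _) = p ∷ Valid-AllLt val (weaken top)
  where
  weaken : ∀ {v} → HeadLt (fer _) v → HeadLt (fer _) v
  weaken [] = []
  weaken (q ∷ v) = ≤fer-trans q p ∷ v

Dec-AllLt : ∀ {b r v u k} → Dec b r v u → AllLt (fer k) v → AllLt (fer k) u
Dec-AllLt done [] = []
Dec-AllLt (keep q) (p ∷ a) = p ∷ Dec-AllLt q a
Dec-AllLt (down {c = c} q) (p ∷ a) = <ᴸ-trans (<ᴸ-up c) p ∷ Dec-AllLt q a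
Dec-AllLt (marked q) (p ∷ a) = <⇒≤ p ∷ Dec-AllLt q a

ins-All : ∀ {P : Letter → Set} c {v} → P c → All P v → All P (ins c v)
ins-All c {[]} p [] = p ∷ []
ins-All c {d ∷ v} p (q ∷ a) with <ᴸ-cmp c d
... | inl _ = q ∷ ins-All c p a
... | inr _ = p ∷ q ∷ a

norm-All : ∀ {P : Letter → Set} {v} → All P v → All P (norm v)
norm-All [] = []
norm-All {v = bos zero ∷ v} (p ∷ a) = norm-All a
norm-All {v = bos (suc k) ∷ v} (p ∷ a) = ins-All (bos (suc k)) p (norm-All a)
norm-All {v = fer k ∷ v} (p ∷ a) = ins-All (fer k) p (norm-All a)

norm-Pos : ∀ v → All Pos (norm v)
norm-Pos [] = []
norm-Pos (bos zero ∷ v) = norm-Pos v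
norm-Pos (bos (suc k) ∷ v) = ins-All (bos (suc k)) (s≤s z≤n) (norm-Pos v)
norm-Pos (fer k ∷ v) = ins-All (fer k) tt (norm-Pos v)

All-head : ∀ {d v} → AllLt d v → HeadLt d v
All-head [] = []
All-head (p ∷ a) = p ∷ _

ins-above : ∀ k b v → HeadLt (fer k) v → ins (k , b) v ≡ (k , b) ∷ v
ins-above k b [] h = refl
ins-above k b (d ∷ v) (p ∷ _) with <ᴸ-cmp (k , b) d
... | inr _ = refl
ins-above k true (d ∷ v) (p ∷ _) | inl q = ⊥-elim (<ᴸ-irrefl {d} (<ᴸ-trans {d} {fer k} {d} p q))
ins-above k false (bos j ∷ v) (p ∷ _) | inl q = ⊥-elim (<⇒≱ q p)
ins-above k false (fer j ∷ v) (p ∷ _) | inl q = ⊥-elim (<⇒≱ p q)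

bos1-up : ∀ d → Pos d → bos 1 <ᴸ up d
bos1-up (bos k) p = s≤s p
bos1-up (fer k) p = s≤s z≤n

-- Lowering r letters is undone at best by raising the r largest rows of the outcome, and a lost
-- circle is restored at best on the first free row; hence `β` bounds v from above.
Dec-β : ∀ {b r v u} → Valid v → Dec b r v u → v ≼ β b r (norm u)
Dec-β [] done = inl refl
Dec-β {b} {r} {(k , i) ∷ v} {_ ∷ u} (row pos top val) (keep q) = subst (λ z → (k , i) ∷ v ≼ β b r z) (sym (insz-ins (k , i) pos ∙ ins-above k i (norm u) hu)) (go b r (Dec-β val q))
  where
  hu = All-head (norm-All (Dec-AllLt q (Valid-AllLt val top)))
  insz-ins : ∀ c → Pos c → insz c (norm u) ≡ ins c (norm u)
  insz-ins (bos (suc _)) _ = refl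
  insz-ins (fer _) _ = refl
  go : ∀ b r → v ≼ β b r (norm u) → (k , i) ∷ v ≼ β b r ((k , i) ∷ norm u)
  go false zero p = ≼-cons (k , i) p
  go true zero p = circled i p
    where
    circled : ∀ i → v ≼ circ (norm u) → (k , i) ∷ v ≼ circ ((k , i) ∷ norm u)
    circled true p = ≼-cons (fer k) p
    circled false p = inr (here ≤-refl)
  go b (suc r) p = inr (here (<ᴸ-up (k , i)))
Dec-β {b} {suc r} {_ ∷ v} {(zero , false) ∷ u} (row pos top val) (down q) = go (norm u) (norm-Pos u) (Dec-β val q)
  where
  go : ∀ N → All Pos N → v ≼ β b r N → bos 1 ∷ v ≼ β b (suc r) N
  go [] _ p = ≼-cons (bos 1) p
  go (d ∷ N) (pd ∷ _) p = inr (here (bos1-up d pd))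
Dec-β {b} {suc r} {_ ∷ v} {(zero , true) ∷ u} (row pos top val) (down q) = go (norm u) (Dec-β val q)
  where
  go : ∀ N → v ≼ β b r N → fer 1 ∷ v ≼ β b (suc r) (ins (fer 0) N)
  go [] p = ≼-cons (fer 1) p
  go (d ∷ N) p with <ᴸ-cmp (fer 0) d
  ... | inl lt = inr (here (up-mono lt))
  ... | inr _ = ≼-cons (fer 1) p
Dec-β {b} {suc r} {_ ∷ v} {(suc k , i) ∷ u} (row pos top val) (down q) = go i (norm u) (Dec-β val q)
  where
  go : ∀ i N → v ≼ β b r N → (suc (suc k) , i) ∷ v ≼ β b (suc r) (insz (suc k , i) N)
  go false [] p = ≼-cons _ p
  go true [] p = ≼-cons _ p
  go false (d ∷ N) p with <ᴸ-cmp (bos (suc k)) d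
  ... | inl lt = inr (here (up-mono lt))
  ... | inr _ = ≼-cons _ p
  go true (d ∷ N) p with <ᴸ-cmp (fer (suc k)) d
  ... | inl lt = inr (here (up-mono lt))
  ... | inr _ = ≼-cons _ p
Dec-β {true} {r} {fer zero ∷ v} {_ ∷ u} (row pos top val) (marked q) =
  go r (norm u) (norm-Pos u) (All-head (norm-All (Dec-AllLt q (Valid-AllLt val top)))) (Dec-β val q)
  where
  go : ∀ r N → All Pos N → HeadLt (fer 0) N → v ≼ β false r N → fer 0 ∷ v ≼ β true r N
  go zero [] _ _ p = ≼-cons (fer 0) p
  go (suc r) [] _ _ p = inr (here (s≤s z≤n))
  go r (bos .0 ∷ N) (() ∷ _) (z≤n ∷ _) p
Dec-β {true} {r} {fer (suc k) ∷ v} {_ ∷ u} (row pos top val) (marked q) =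
  subst (λ z → fer (suc k) ∷ v ≼ β true r z) (sym (ins-above (suc k) false (norm u) hu)) (go r (Dec-β val q))
  where
  hu = All-head (norm-All (Dec-AllLt q (Valid-AllLt val top)))
  go : ∀ r → v ≼ β false r (norm u) → fer (suc k) ∷ v ≼ β true r (bos (suc k) ∷ norm u)
  go zero p = ≼-cons _ p
  go (suc r) p = inr (here ≤-refl)

L̃-[] : ∀ c v → Pos c → L̃ c (mform v) [] ≡ 0#
L̃-[] (bos (suc k)) v p = refl
L̃-[] (fer a) v p = conv-0 a _ (λ i j _ → refl)

-- No monomial of E_w exceeds w. Removing the first column from v leaves words u with v ≼ β (norm
-- u); if norm u did not exceed `strip w`, monotonicity of `β` and `β-strip` would give v ≼ w.
E-mform-0 : ∀ N {w v} → Valid w → Bounded N w → Valid v → w ≺ v → E 1# N w (mform v) ≡ 0#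
E-mform-0 zero {w} {v} _ bd (row pos _ _) lt with Bounded-0 bd
E-mform-0 zero {.[]} {c ∷ v} _ bd (row pos _ _) lt | refl = L̃-[] c v pos
E-mform-0 zero {w} {v} _ bd [] ()
E-mform-0 (suc N) {w} {v} vw bd vv lt = *0 (lin-cong (Lin-E 1# N (strip w)) (O≡Oτ b r (mform v)) ∙ O-mform-0 b r v (Lin-E 1# N (strip w)) below)
  where
  b = has0 w
  r = rows w
  below : ∀ u → Dec b r v u → E 1# N (strip w) (mform u) ≡ 0#
  below u q with norm-valid u
  ... | inr z = lin-0 (Lin-E 1# N (strip w)) z
  ... | inl vu with norm-mform u
  ... | a , p = lin-cong (Lin-E 1# N (strip w)) p ∙ lin-* (Lin-E 1# N (strip w)) a _ ∙
    *0 (E-mform-0 N (strip-valid vw) (strip-bounded bd) vu above)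
    where
    above : strip w ≺ norm u
    above with ≺-cmp (strip w) (norm u)
    ... | inl x = x
    ... | inr (inl x) = ⊥-elim (≺-irrefl (≺-≼-trans lt (subst (v ≼_) (cong (β b r) (sym x) ∙ β-strip vw) (Dec-β vv q))))
    ... | inr (inr x) = ⊥-elim (≺-irrefl (≺-trans lt (≼-≺-trans (Dec-β vv q)
            (subst (β b r (norm u) ≺_) (β-strip vw) (β-mono b r vu (strip-valid vw) (strip-length w) x)))))

-- Each cell of the column lowers a different positive exponent.
O-mform-rows : ∀ b r v → rows v < r → ∀ w → O b r (mform v) w ≡ 0#
O-mform-rows false (suc r) [] lt w = hook-vac 0 r w
O-mform-rows true (suc r) [] lt w = ẽ-vac-0 0 (suc r) w
O-mform-rows b (suc r) (c ∷ v) lt w = O-L̃ (Symm-mform v) b r c w ∙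
  cong₂ (λ x y → η b c * x + y) (0+0 (L̃-0 c (O-mform-rows b (suc r) v (weaken c lt)) w) (lowered c lt)) (marks b c lt) ∙
    cong (_+ 0#) (zeroʳ _) ∙ +-identityˡ 0#
  where
  weaken : ∀ c → rows (c ∷ v) < suc r → rows v < suc r
  weaken (zero , _) p = p
  weaken (suc _ , _) p = <-trans (n<1+n _) p
  lowered : ∀ c → rows (c ∷ v) < suc r → L̃1 c (O b r (mform v)) w ≡ 0#
  lowered (bos zero) p = refl
  lowered (fer zero) p = refl
  lowered (bos (suc k)) (s≤s p) = L̃-0 (bos k) (O-mform-rows b r v p) w
  lowered (fer (suc k)) (s≤s p) = L̃-0 (fer k) (O-mform-rows b r v p) w
  marks : ∀ b c → rows (c ∷ v) < suc r → mark b c (suc r) (mform v) w ≡ 0#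
  marks false c p = refl
  marks true (bos _) p = refl
  marks true (fer a) p = L̃-0 (bos a) (O-mform-rows false (suc r) v (weaken (fer a) p)) w

-- With exactly as many positive exponents as the column has cells, all of them must be lowered, and
-- a circle at the bottom can then only use the row `fer 0`. A single term survives.
O-mform-strip : ∀ {v} → Valid v → ∀ w → O (has0 v) (rows v) (mform v) w ≡ signF (has0 v) (strip v) * mform (strip v) w
O-mform-strip [] w = sym (*-identityˡ _)
O-mform-strip (row {zero} {true} _ [] []) w = cong (λ z → 1# * vac w - z) (lin-0 (Lin-pmul 0 w) (λ _ → refl)) ∙
  solve 1 (λ x → con 1# :* x :- con 0# := con 1# :* x) refl (vac w)
O-mform-strip (row {zero} {true} _ (_∷_ {c = bos .0} z≤n _) (row () _ _)) w
O-mform-strip {_ ∷ v} (row {suc k} {i} _ top val) w = O-L̃ (Symm-mform v) hv r (suc k , i) w ∙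
  cong₂ (λ x y → η hv (suc k , i) * (x + y) + mark hv (suc k , i) (suc r) (mform v) w) (L̃-0 (suc k , i) (O-mform-rows hv (suc r) v ≤-refl) w) (lowered i) ∙
    cong₂ _+_ refl (marks hv i) ∙ collect k i
  where
  hv = has0 v
  r = rows v
  lowered : ∀ i → L̃1 (suc k , i) (O hv r (mform v)) w ≡ signF hv (strip v) * L̃ (k , i) (mform (strip v)) w
  lowered false = lin-cong-* (Lin-hmul k w) (O-mform-strip val)
  lowered true = lin-cong-* (Lin-h̃mul k w) (O-mform-strip val)
  marks : ∀ b i → mark b (suc k , i) (suc r) (mform v) w ≡ 0#
  marks false i = refl
  marks true false = refl
  marks true true = L̃-0 (bos (suc k)) (O-mform-rows false (suc r) v ≤-refl) w
  tidy : ∀ a b x → a * (0# + b * x) + 0# ≡ a * b * x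
  tidy = solve 3 (λ a b x → a :* (con 0# :+ b :* x) :+ con 0# := a :* b :* x) refl
  η-suc : ∀ b j j' i → η b (j , i) ≡ η b (j' , i)
  η-suc false j j' i = refl
  η-suc true j j' false = refl
  η-suc true j j' true = refl
  η-bos : ∀ b → η b (bos 1) * signF b (strip v) ≡ signF b (strip v)
  η-bos false = *-identityˡ _
  η-bos true = *-identityˡ _
  collect : ∀ k i → η hv (suc k , i) * (0# + signF hv (strip v) * L̃ (k , i) (mform (strip v)) w) + 0#
    ≡ signF hv (strip ((suc k , i) ∷ v)) * mform (strip ((suc k , i) ∷ v)) w
  collect zero false = tidy (η hv (bos 1)) _ _ ∙ cong (_* mform (strip v) w) (η-bos hv)
  collect zero true = tidy (η hv (fer 1)) _ _ ∙ cong (λ z → z * signF hv (strip v) * h̃mul 0 (mform (strip v)) w) (η-suc hv 1 0 true)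
  collect (suc k) i = tidy (η hv (suc (suc k) , i)) _ _ ∙ cong (λ z → z * signF hv (strip v) * L̃ (suc k , i) (mform (strip v)) w) (η-suc hv (suc (suc k)) (suc k) i)

E-mform-1 : ∀ N {w} → Valid w → Bounded N w → E 1# N w (mform w) ≡ 1#
E-mform-1 zero {w} vw bd with Bounded-0 bd
... | refl = refl
E-mform-1 (suc N) {w} vw bd = cong (g *_) (lin-cong-* l (λ v → O≡Oτ (has0 w) (rows w) (mform w) v ∙ O-mform-strip vw v)) ∙
  cong (λ z → g * (g * z)) (E-mform-1 N (strip-valid vw) (strip-bounded bd)) ∙
    sym (*-assoc g g 1#) ∙ *-identityʳ _ ∙ signF² (has0 w) (strip w)
  where
  l = Lin-E 1# N (strip w)
  g = signF (has0 w) (strip w)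

-- Well-foundedness and triangularity of S_w.

-- On arbitrary words the lexicographic order descends forever, for instance by prefixing more and
-- more small letters. Valid words have decreasing rows, which excludes this.
_⊏_ : Mono → Mono → Set
u ⊏ w = Valid u × u ≺ w

acc-[] : Acc _⊏_ []
acc-[] = acc (λ ())

private
  acc-cons : ∀ {c w} → (∀ x → Valid x → HeadLt c x → Acc _⊏_ x) → Acc _⊏_ w → Acc _⊏_ (c ∷ w)
  acc-cons {c} lower (acc rs) = acc (λ { {[]} (_ , []≺) → acc-[] ; {d ∷ x} (val , here p) → lower (d ∷ x) val (p ∷ x)
    ; {d ∷ x} (row _ _ val , there q) → acc-cons lower (rs (val , q)) })

  split-fer : ∀ {k c} → c <ᴸ fer k → c <ᴸ bos k ⊎ c ≡ bos k
  split-fer {k} {bos j} p with m≤n⇒m<n∨m≡n p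
  ... | inl q = inl q
  ... | inr refl = inr refl
  split-fer {k} {fer j} p = inl p

  split-bos : ∀ {k c} → c <ᴸ bos (suc k) → c <ᴸ fer k ⊎ c ≡ fer k
  split-bos {k} {bos j} p = inl (≤-pred p)
  split-bos {k} {fer j} p with m≤n⇒m<n∨m≡n (≤-pred p)
  ... | inl q = inl q
  ... | inr refl = inr refl

  -- Mutual induction along the chain bos 0, fer 0, bos 1, .... The tail of a valid word is again
  -- bounded by some fer k and is handled by structural recursion on its validity.
  acc-bos : ∀ k {w} → Valid w → HeadLt (bos k) w → Acc _⊏_ w
  acc-fer : ∀ k {w} → Valid w → HeadLt (fer k) w → Acc _⊏_ w
  acc-bos k [] _ = acc-[]
  acc-bos zero {bos j ∷ w} _ (() ∷ _)
  acc-bos zero {fer j ∷ w} _ (() ∷ _)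
  acc-bos (suc k) (row pos top val) (p ∷ w) with split-bos p
  ... | inl q = acc-fer k (row pos top val) (q ∷ w)
  ... | inr refl = acc-cons (λ x vx hx → acc-fer k vx hx) (acc-fer k val top)
  acc-fer k [] _ = acc-[]
  acc-fer k (row pos top val) (p ∷ w) with split-fer p
  ... | inl q = acc-bos k (row pos top val) (q ∷ w)
  ... | inr refl = acc-cons (λ x vx hx → acc-bos k vx hx) (acc-fer k val top)

⊏-wf : ∀ {w} → Valid w → Acc _⊏_ w
⊏-wf [] = acc-[]
⊏-wf {(k , b) ∷ w} val = acc-fer (suc k) val (<ᴸ-fer b ∷ w)
  where
  <ᴸ-fer : ∀ b → (k , b) <ᴸ fer (suc k)
  <ᴸ-fer true = ≤-refl
  <ᴸ-fer false = n≤1+n k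

bound : Mono → ℕ
bound [] = 0
bound ((k , _) ∷ w) = suc k ℕ.+ bound w

bounded : ∀ w → Bounded (bound w) w
bounded [] = []
bounded ((k , b) ∷ w) = m≤m+n (suc k) (bound w) ∷ All.map (λ p → ≤-trans p (m≤n+m (bound w) (suc k))) (bounded w)

ev-0 : ∀ C (f : Fn) → All (λ p → f (snd p) ≡ 0#) C → ev C f ≡ 0#
ev-0 [] f [] = refl
ev-0 ((c , v) ∷ C) f (p ∷ a) = cong₂ (λ x y → c * x + y) p (ev-0 C f a) ∙ cong (_+ 0#) (zeroʳ c) ∙ +-identityˡ 0#

-- Induction along ⊏ from the E_w, given by S_w plus lower terms.
S-from-E : ∀ {w} → Valid w → ∀ {f} → Symm f →
  Σ Comb λ C → All (λ p → Valid (snd p) × snd p ≺ w) C × E 1# (bound w) w f ≡ S w f + ev C (λ v → S v f)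
S-from-E {w} val {f} s with E-lead (bound w) val (bounded w)
... | C , a , r = C , a , solve 2 (λ e s → e := s :+ (e :- con 1# :* s)) refl _ (S w f) ∙ cong (S w f +_) (r s)

-- S_w differs from E_w by smaller S_u, to which the induction applies, and E_w has no monomial
-- above w.
S-mform-0 : ∀ {w v} → Acc _⊏_ w → Valid w → Valid v → w ≺ v → S w (mform v) ≡ 0#
S-mform-0 {w} {v} (acc rs) vw vv lt = let C , a , r = S-from-E vw (Symm-mform v) in begin
  S w (mform v) ≡⟨ sym (+-identityʳ _) ⟩
  S w (mform v) + 0# ≡⟨ cong (S w (mform v) +_) (sym (ev-0 C (λ u → S u (mform v)) (All.map (λ (vu , q) → S-mform-0 (rs (vu , q)) vu vv (≺-trans q lt)) a))) ⟩
  S w (mform v) + ev C (λ u → S u (mform v)) ≡⟨ sym r ⟩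
  E 1# (bound w) w (mform v) ≡⟨ E-mform-0 (bound w) vw (bounded w) vv lt ⟩
  0# ∎

S-mform-1 : ∀ {w} → Valid w → S w (mform w) ≡ 1#
S-mform-1 {w} vw = let C , a , r = S-from-E vw (Symm-mform w) in begin
  S w (mform w) ≡⟨ sym (+-identityʳ _) ⟩
  S w (mform w) + 0# ≡⟨ cong (S w (mform w) +_) (sym (ev-0 C (λ u → S u (mform w)) (All.map (λ (vu , q) → S-mform-0 (⊏-wf vu) vu vw q) a))) ⟩
  S w (mform w) + ev C (λ u → S u (mform w)) ≡⟨ sym r ⟩
  E 1# (bound w) w (mform w) ≡⟨ E-mform-1 (bound w) vw (bounded w) ⟩
  1# ∎

-- Expansion of S_w in products of p̃'s and h's: f w plus words whose rearrangement is larger.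

wsize nf : Mono → ℕ
wsize [] = 0
wsize ((k , _) ∷ w) = k ℕ.+ wsize w
nf [] = 0
nf (bos _ ∷ w) = nf w
nf (fer _ ∷ w) = suc (nf w)

Deg : Mono → ℕ × ℕ
Deg w = wsize w , nf w

Deg-cons : ∀ c v w → Deg v ≡ Deg w → Deg (c ∷ v) ≡ Deg (c ∷ w)
Deg-cons (bos k) _ _ p = cong (λ d → k ℕ.+ fst d , snd d) p
Deg-cons (fer k) _ _ p = cong (λ d → k ℕ.+ fst d , suc (snd d)) p

Deg-swap : ∀ c d w → Deg (c ∷ d ∷ w) ≡ Deg (d ∷ c ∷ w)
Deg-swap (k , b) (l , b') w = cong₂ _,_ (sym (ℕP.+-assoc k l _) ∙ cong (ℕ._+ wsize w) (ℕP.+-comm k l) ∙ ℕP.+-assoc l k _) (nf-swap b b')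
  where
  nf-swap : ∀ b b' → nf ((k , b) ∷ (l , b') ∷ w) ≡ nf ((l , b') ∷ (k , b) ∷ w)
  nf-swap false false = refl
  nf-swap false true = refl
  nf-swap true false = refl
  nf-swap true true = refl

HSpan : (Mono → Set) → (Fn → ℚ) → Set
HSpan P ξ = Σ Comb λ C → All (λ p → P (snd p)) C × (∀ {f} → Symm f → ξ f ≡ ev C f)

HSpan-0 : ∀ {P ξ} → (∀ {f} → Symm f → ξ f ≡ 0#) → HSpan P ξ
HSpan-0 p = [] , [] , p

HSpan-at : ∀ {P : Mono → Set} v → P v → HSpan P (λ f → f v)
HSpan-at v p = (1# , v) ∷ [] , p ∷ [] , λ s → solve 1 (λ x → x := con 1# :* x :+ con 0#) refl _

HSpan-≗ : ∀ {P ξ ζ} → HSpan P ζ → (∀ {f} → Symm f → ξ f ≡ ζ f) → HSpan P ξ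
HSpan-≗ (C , a , r) p = C , a , λ s → p s ∙ r s

HSpan-+ : ∀ {P ξ ζ} → HSpan P ξ → HSpan P ζ → HSpan P (λ f → ξ f + ζ f)
HSpan-+ (C , a , r) (C' , a' , r') = C ++ C' , AllP.++⁺ a a' , λ s → cong₂ _+_ (r s) (r' s) ∙ sym (ev-++ C C' _)

HSpan-* : ∀ {P ξ} c → HSpan P ξ → HSpan P (λ f → c * ξ f)
HSpan-* c (C , a , r) = scaleComb c C , AllP.map⁺ a , λ s → cong (c *_) (r s) ∙ sym (ev-scale c C _)

HSpan-mono : ∀ {P Q : Mono → Set} {ξ} → (∀ v → P v → Q v) → HSpan P ξ → HSpan Q ξ
HSpan-mono h (C , a , r) = C , All.map (h _) a , r

HSpan-bind : ∀ {P Q : Mono → Set} {ξ} {T : Fn → Fn} → (∀ {f} → Symm f → Symm (T f)) →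
  (∀ v → P v → HSpan Q (λ f → T f v)) → HSpan P ξ → HSpan Q (λ f → ξ (T f))
HSpan-bind {P} {Q} {ξ} {T} ST h (C , a , r) = HSpan-≗ (go C a) (λ s → r (ST s))
  where
  go : ∀ C → All (λ p → P (snd p)) C → HSpan Q (λ f → ev C (T f))
  go [] [] = HSpan-0 (λ _ → refl)
  go ((c , v) ∷ C) (p ∷ a) = HSpan-+ (HSpan-* c (h v p)) (go C a)

HSpan-cons : ∀ {P Q : Mono → Set} {ξ} c → (∀ v → P v → Q (c ∷ v)) → HSpan P ξ → HSpan Q (λ f → ξ (cons c f))
HSpan-cons c h = HSpan-bind (λ s → Symm-cons s c) (λ v p → HSpan-at (c ∷ v) (h v p))

AnyGt : Letter → Mono → Set
AnyGt c = Any.Any (c <ᴸ_)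

-- Moving Φ_k past h_n costs Φ_{k+1} with h_{n-1}: the circled letter grows, so every correction
-- contains a letter larger than fer k.
φ-expand : ∀ k u → HSpan (λ v → AnyGt (fer k) v × Deg v ≡ Deg (fer k ∷ u)) (λ f → φ k f u - f (fer k ∷ u))
φ-expand k [] = HSpan-0 (λ _ → -‿inverseʳ _)
φ-expand k (bos n ∷ u) = HSpan-≗
  (HSpan-+ (HSpan-cons (bos n) (λ v p → Any.there (fst p) , Deg-cons (bos n) v (fer k ∷ u) (snd p) ∙ Deg-swap (bos n) (fer k) u) (φ-expand k u))
    (lower n))
  (λ {f} s → cong₂ _-_ (φ-bos k n f u) (sym (swap-bos s n (fer k) u)) ∙
    solve 3 (λ x y z → (x :- y) :- z := (x :- z) :+ :- y) refl _ _ _)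
  where
  lower : ∀ n → HSpan (λ v → AnyGt (fer k) v × Deg v ≡ Deg (fer k ∷ bos n ∷ u)) (λ f → - φ (suc k) (dn n f) u)
  lower zero = HSpan-0 (λ _ → cong -_ (lin-0 (Lin-φ (suc k) u) (λ _ → refl)) ∙ solve 0 (:- con 0# := con 0#) refl)
  lower (suc n) = HSpan-≗ (HSpan-* -1# (HSpan-+
      (HSpan-cons (bos n) (λ v p → Any.there (Any.map (λ q → <ᴸ-trans (<ᴸ-up (fer k)) q) (fst p)) , Deg-cons (bos n) v (fer (suc k) ∷ u) (snd p) ∙ degs) (φ-expand (suc k) u))
      (HSpan-at (bos n ∷ fer (suc k) ∷ u) (Any.there (Any.here ≤-refl) , degs))))
    (λ s → solve 2 (λ x y → :- x := con -1# :* ((x :- y) :+ y)) refl _ _)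
    where
    degs : Deg (bos n ∷ fer (suc k) ∷ u) ≡ Deg (fer k ∷ bos (suc n) ∷ u)
    degs = cong (_, suc (nf u)) (+-suc n _ ∙ cong suc (sym (ℕP.+-assoc n k _) ∙ cong (ℕ._+ wsize u) (ℕP.+-comm n k) ∙ ℕP.+-assoc k n _) ∙ sym (+-suc k _))
φ-expand k (fer a ∷ u) = HSpan-≗
  (HSpan-* -1# (HSpan-cons (fer a) (λ v p → Any.there (fst p) , Deg-cons (fer a) v (fer k ∷ u) (snd p) ∙ Deg-swap (fer a) (fer k) u) (φ-expand k u)))
  (λ {f} s → cong (λ z → - φ k (cons (fer a) f) u - z) (swap-fer s k a u) ∙ solve 2 (λ x y → :- x :- :- y := con -1# :* (x :- y)) refl _ _)

ins-lt : ∀ {c d} v → c <ᴸ d → ins c (d ∷ v) ≡ d ∷ ins c v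
ins-lt {c} {d} v p with <ᴸ-cmp c d
... | inl _ = refl
... | inr (inl refl) = ⊥-elim (<ᴸ-irrefl p)
... | inr (inr q) = ⊥-elim (<ᴸ-irrefl (<ᴸ-trans p q))

ins-ge : ∀ {c d} v → ¬ (c <ᴸ d) → ins c (d ∷ v) ≡ c ∷ d ∷ v
ins-ge {c} {d} v p with <ᴸ-cmp c d
... | inl q = ⊥-elim (p q)
... | inr _ = refl

ins-cases : ∀ c d v → ins c (d ∷ v) ≡ d ∷ ins c v ⊎ ins c (d ∷ v) ≡ c ∷ d ∷ v
ins-cases c d v with <ᴸ-cmp c d
... | inl _ = inl refl
... | inr _ = inr refl

private
  ins-comm-lt : ∀ {c d} v → c <ᴸ d → ins c (ins d v) ≡ ins d (ins c v)
  ins-comm-lt {c} {d} [] p = ins-lt [] p ∙ sym (ins-ge [] (λ q → <ᴸ-irrefl (<ᴸ-trans p q)))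
  ins-comm-lt {c} {d} (e ∷ v) p with <ᴸ-cmp d e
  ... | inl q = ins-lt _ (<ᴸ-trans p q) ∙ cong (e ∷_) (ins-comm-lt v p) ∙
          sym (cong (ins d) (ins-lt v (<ᴸ-trans p q)) ∙ ins-lt _ q)
  ... | inr q = ins-lt (e ∷ v) p ∙ sym top
    where
    not-lt : d ≡ e ⊎ e <ᴸ d → ¬ (d <ᴸ e)
    not-lt (inl refl) r = <ᴸ-irrefl r
    not-lt (inr q') r = <ᴸ-irrefl (<ᴸ-trans r q')
    ¬d<e = not-lt q
    top : ins d (ins c (e ∷ v)) ≡ d ∷ ins c (e ∷ v)
    top with ins c (e ∷ v) | ins-cases c e v
    ... | _ | inl refl = ins-ge _ ¬d<e
    ... | _ | inr refl = ins-ge _ (λ r → <ᴸ-irrefl (<ᴸ-trans p r))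

ins-comm : ∀ c d v → ins c (ins d v) ≡ ins d (ins c v)
ins-comm c d v with <ᴸ-cmp c d
... | inl p = ins-comm-lt v p
... | inr (inl refl) = refl
... | inr (inr p) = sym (ins-comm-lt v p)

insb-comm : ∀ n d v → insb n (ins d v) ≡ ins d (insb n v)
insb-comm zero d v = refl
insb-comm (suc n) d v = ins-comm (bos (suc n)) d v

-- Keeps the letter that has just lost its circle in front when a further letter is added, so that
-- `Unmark` can point to it.
second : Letter → Mono → Mono
second c [] = c ∷ []
second c (d ∷ v) = d ∷ c ∷ v

-- v is u with one fer a replaced by bos a, moved to the front.
data Unmark (u : Mono) : Mono → Set where
  unmark : ∀ a r → norm u ≡ ins (fer a) (norm r) → Deg u ≡ Deg (fer a ∷ r) → Unmark u (bos a ∷ r)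

Unmark-second : ∀ {u v} c → (∀ a x → insz c (ins (fer a) x) ≡ ins (fer a) (insz c x)) → Unmark u v → Unmark (c ∷ u) (second c v)
Unmark-second {u} c h (unmark a r p q) = unmark a (c ∷ r) (cong (insz c) p ∙ h a (norm r))
  (Deg-cons c u (fer a ∷ r) q ∙ Deg-swap c (fer a) r)

ev-second : ∀ {u f} c C → Symm f → All (λ p → Unmark u (snd p)) C → ev C (cons c f) ≡ ev (map (λ p → fst p , second c (snd p)) C) f
ev-second c [] s [] = refl
ev-second c ((x , _) ∷ C) s (unmark a r _ _ ∷ all) = cong₂ _+_ (cong (x *_) (sym (swap-bos s a c r))) (ev-second c C s all)

HSpan-second : ∀ {u ξ} c → (∀ a x → insz c (ins (fer a) x) ≡ ins (fer a) (insz c x)) →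
  HSpan (Unmark u) ξ → HSpan (Unmark (c ∷ u)) (λ f → ξ (cons c f))
HSpan-second c h (C , all , r) = map (λ p → fst p , second c (snd p)) C , AllP.map⁺ (All.map (Unmark-second c h) all) ,
  λ s → r (Symm-cons s c) ∙ ev-second c C s all

D-expand : ∀ u → HSpan (Unmark u) (λ f → D f u)
D-expand [] = HSpan-0 (λ _ → refl)
D-expand (bos n ∷ u) = HSpan-second (bos n) (λ a x → insb-comm n (fer a) x) (D-expand u)
D-expand (fer b ∷ u) = HSpan-≗ (HSpan-+ (HSpan-at (bos b ∷ u) (unmark b u refl refl))
  (HSpan-* -1# (HSpan-second (fer b) (λ a x → ins-comm (fer b) (fer a) x) (D-expand u))))
  (λ s → cong₂ _+_ refl (neg-as-* _))

cons≺ins : ∀ c {w x} → w ≺ x → c ∷ w ≺ ins c x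
cons≺ins c {w} {e ∷ x} p with <ᴸ-cmp c e
... | inl q = here q
... | inr _ = there p

data HeadGt (c : Letter) : Mono → Set where
  gt : ∀ {d v} → c <ᴸ d → HeadGt c (d ∷ v)

ins-HeadGt : ∀ c d {v} → HeadGt c v → HeadGt c (ins d v)
ins-HeadGt c d {e ∷ v} (gt p) with <ᴸ-cmp d e
... | inl _ = gt p
... | inr (inl refl) = gt p
... | inr (inr q) = gt (<ᴸ-trans p q)

ins-HeadGt' : ∀ c d v → c <ᴸ d → HeadGt c (ins d v)
ins-HeadGt' c d [] p = gt p
ins-HeadGt' c d (e ∷ v) p with <ᴸ-cmp d e
... | inl q = gt (<ᴸ-trans p q)
... | inr _ = gt p

norm-HeadGt : ∀ {c v} → AnyGt c v → HeadGt c (norm v)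
norm-HeadGt {c} {fer k ∷ v} (Any.here p) = ins-HeadGt' c (fer k) (norm v) p
norm-HeadGt {bos j} {bos zero ∷ v} (Any.here ())
norm-HeadGt {fer j} {bos zero ∷ v} (Any.here ())
norm-HeadGt {c} {bos (suc k) ∷ v} (Any.here p) = ins-HeadGt' c (bos (suc k)) (norm v) p
norm-HeadGt {c} {fer k ∷ v} (Any.there a) = ins-HeadGt c (fer k) (norm-HeadGt a)
norm-HeadGt {c} {bos zero ∷ v} (Any.there a) = norm-HeadGt a
norm-HeadGt {c} {bos (suc k) ∷ v} (Any.there a) = ins-HeadGt c (bos (suc k)) (norm-HeadGt a)

HeadGt⇒≺ : ∀ {c w v} → HeadGt c v → c ∷ w ≺ v
HeadGt⇒≺ (gt p) = here p

-- If the letter losing its circle is not the head, the head is at least fer k and so exceeds bos k.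
-- If it is the head, either a > k or the tails decide.
unmark-≺ : ∀ {k a w} x → 1 ≤ k → fer k ∷ w ≺ ins (fer a) x → bos k ∷ w ≺ insb a x
unmark-≺ {k} {zero} [] _ (here ())
unmark-≺ {k} {suc a} [] _ (here p) = here p
unmark-≺ {k} {a} (e ∷ x) 1≤k p with <ᴸ-cmp (fer a) e
unmark-≺ {k} {a} {w} (e ∷ x) 1≤k p | inl q = HeadGt⇒≺ (head a q)
  where
  k<e : bos k <ᴸ e
  k<e = go p
    where
    go : ∀ {y} → fer k ∷ w ≺ e ∷ y → bos k <ᴸ e
    go (here r) = <ᴸ-trans {bos k} {fer k} {e} ≤-refl r
    go (there _) = ≤-refl
  head : ∀ a → fer a <ᴸ e → HeadGt (bos k) (insb a (e ∷ x))
  head zero q = gt k<e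
  head (suc a) q = ins-HeadGt (bos k) (bos (suc a)) (gt k<e)
unmark-≺ {k} {suc a} (e ∷ x) 1≤k (here p) | inr _ = HeadGt⇒≺ (ins-HeadGt' (bos k) (bos (suc a)) (e ∷ x) p)
unmark-≺ {suc k} (e ∷ x) 1≤k (there p) | inr _ = cons≺ins (bos (suc k)) p

AboveW : Mono → Mono → Set
AboveW w v = w ≺ norm v × Deg v ≡ Deg w

φ-above : ∀ k w (ξ : Fn → ℚ) → HSpan (AboveW w) (λ f → ξ f - f w) → HSpan (AboveW (fer k ∷ w)) (λ f → ξ (φ k f) - f (fer k ∷ w))
φ-above k w ξ sp = HSpan-≗ (HSpan-+
  (HSpan-bind (Symm-φ k) (λ v (p , q) → HSpan-≗
      (HSpan-+ (HSpan-at (fer k ∷ v) (cons≺ins (fer k) p , Deg-cons (fer k) v w q))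
               (HSpan-mono (λ u (a , d) → HeadGt⇒≺ (norm-HeadGt a) , d ∙ Deg-cons (fer k) v w q) (φ-expand k v)))
      (λ s → solve 2 (λ x y → x := y :+ (x :- y)) refl _ _)) sp)
  (HSpan-mono (λ u (a , d) → HeadGt⇒≺ (norm-HeadGt a) , d) (φ-expand k w)))
  (λ s → solve 3 (λ x y z → x :- z := (x :- y) :+ (y :- z)) refl _ _ _)

-- For B_k = D Φ_k, first Φ_k and then D is expanded, and D removes one circle. Removing the new one
-- from the leading term gives w; removing an older one leaves fer k in the word, which is larger
-- than bos k.
S-above : ∀ {w} → Valid w → HSpan (AboveW w) (λ f → S w f - f w)
S-above [] = HSpan-0 (λ _ → -‿inverseʳ _)
S-above (row {k} {true} {w} pos top val) = φ-above k w (S w) (S-above val)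
S-above (row {k} {false} {w} pos top val) = HSpan-≗ (HSpan-+
  (HSpan-bind Symm-D (λ v (p , q) → HSpan-mono (λ u x → unmarked p q x) (D-expand v)) (φ-above k w (S w) (S-above val)))
  (HSpan-* -1# (HSpan-cons (fer k) (λ v → marked-below) (D-expand w))))
  (λ s → solve 4 (λ x y z t → x :- z := (x :- (z :- t)) :+ con -1# :* t) refl _ 0# _ _)
  where
  unmarked : ∀ {v u} → fer k ∷ w ≺ norm v → Deg v ≡ Deg (fer k ∷ w) → Unmark v u → AboveW (bos k ∷ w) u
  unmarked p q (unmark a r n d) = unmark-≺ (norm r) pos (subst (fer k ∷ w ≺_) n p) ,
    cong (λ e → fst e , ℕ.pred (snd e)) (sym d ∙ q)
  marked-below : ∀ {v} → Unmark w v → AboveW (bos k ∷ w) (fer k ∷ v)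
  marked-below (unmark a r n d) = HeadGt⇒≺ (norm-HeadGt {bos k} {fer k ∷ bos a ∷ r} (Any.here ≤-refl)) ,
    cong (λ e → k ℕ.+ fst e , snd e) (sym d)

-- The product of S_w with h_ℓ.

conv-assoc : ∀ n (F : ℕ → ℕ → ℕ → ℚ) →
  conv n (λ i j → conv j (λ a m → F i a m)) ≡ conv n (λ j m → conv j (λ i a → F i a m))
conv-assoc zero F = refl
conv-assoc (suc n) F = begin
  _
    ≡⟨ cong ((F 0 0 (suc n) + conv n (λ a m → F 0 (suc a) m)) +_) (conv-assoc n (λ i → F (suc i))) ⟩
  _
    ≡⟨ +-assoc _ _ _ ∙ cong (F 0 0 (suc n) +_) (sym (conv-+ n _ _)) ⟩
  _ ∎

convL : ℕ → (ℕ → ℕ → List Mono) → List Mono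
convL zero F = F 0 0
convL (suc n) F = F 0 (suc n) ++ convL n (λ i j → F (suc i) j)

sumL-convL : ∀ n F g → sumL (convL n F) g ≡ conv n (λ i j → sumL (F i j) g)
sumL-convL zero F g = refl
sumL-convL (suc n) F g = sumL-++ (F 0 (suc n)) _ g ∙ cong (sumL (F 0 (suc n)) g +_) (sumL-convL n _ g)

under? : ∀ k u → HeadLt (fer k) u ⊎ ¬ HeadLt (fer k) u
under? k [] = inl []
under? k (d ∷ u) with <ᴸ? d k
... | inl p = inl (p ∷ u)
... | inr p = inr λ { (q ∷ _) → p q }

good : ℕ → List Mono → List Mono
good k [] = []
good k (u ∷ us) with under? k u
... | inl _ = u ∷ good k us
... | inr _ = good k us

bad : ℕ → (Mono → ℚ) → Mono → ℚ
bad k g u with under? k u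
... | inl _ = 0#
... | inr _ = g u

bad-under : ∀ k g u → HeadLt (fer k) u → bad k g u ≡ 0#
bad-under k g u h with under? k u
... | inl _ = refl
... | inr n = ⊥-elim (n h)

bad-over : ∀ k g u → ¬ HeadLt (fer k) u → bad k g u ≡ g u
bad-over k g u n with under? k u
... | inl h = ⊥-elim (n h)
... | inr _ = refl

sumL-good : ∀ k us g → sumL us g ≡ sumL (good k us) g + sumL us (bad k g)
sumL-good k [] g = sym (+-identityˡ 0#)
sumL-good k (u ∷ us) g with under? k u
... | inl _ = cong (g u +_) (sumL-good k us g) ∙ solve 3 (λ a b c → a :+ (b :+ c) := (a :+ b) :+ (con 0# :+ c)) refl _ _ _
... | inr _ = cong (g u +_) (sumL-good k us g) ∙ solve 3 (λ a b c → a :+ (b :+ c) := b :+ (a :+ c)) refl _ _ _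

-- A word with first row bos p, p > k, receives the circle of a row of length k just below it.
tuck : ℕ → Mono → List Mono
tuck k [] = []
tuck k (fer p ∷ u) = []
tuck k (bos p ∷ u) with p ℕ.≤? k
... | yes _ = []
... | no _ = (bos p ∷ fer k ∷ u) ∷ []

-- The words indexing the product of S_w by h_ℓ.
P : Mono → ℕ → List Mono
P [] zero = [] ∷ []
P [] (suc ℓ) = (bos (suc ℓ) ∷ []) ∷ []
P (bos k ∷ w) ℓ = convL ℓ (λ i j → map (bos (k ℕ.+ i) ∷_) (good k (P w j)))
P (fer k ∷ w) ℓ = convL ℓ (λ i j → map (fer (k ℕ.+ i) ∷_) (good k (P w j))) ++ concatMap (tuck k) (P w ℓ)

-- The words of P w whose first row is too long to fit under a row of length k: the excess of
-- this first row is free, and the rest of the word depends only on what remains.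
Tail : ℕ → Mono → Set
Tail k w = Σ (ℕ → List Mono) λ F → Σ (ℕ → List Mono) λ B → ∀ n g →
  sumL (P w n) (bad k g) ≡ conv n (λ a m → sumL (F m) (λ u → g (fer (k ℕ.+ a) ∷ u)))
                         + conv n (λ a m → sumL (B m) (λ u → g (bos (suc k ℕ.+ a) ∷ u)))

delay : (ℕ → List Mono) → ℕ → List Mono
delay F zero = []
delay F (suc n) = F n

conv-delay : ∀ n (F : ℕ → List Mono) (g : ℕ → Mono → ℚ) → (∀ u → g 0 u ≡ 0#) →
  conv n (λ a m → sumL (F m) (g a)) ≡ conv n (λ a m → sumL (delay F m) (g (suc a)))
conv-delay zero F g p = sumL-0 (F 0)
  where
  sumL-0 : ∀ vs → sumL vs (g 0) ≡ 0#
  sumL-0 [] = refl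
  sumL-0 (v ∷ vs) = 0+0 (p v) (sumL-0 vs)
conv-delay (suc n) F g p = cong₂ _+_ (sumL-0 (F (suc n))) refl ∙ +-identityˡ _ ∙
  sym (conv-last n (λ a m → sumL (delay F m) (g (suc a))) ∙ +-identityʳ _)
  where
  sumL-0 : ∀ vs → sumL vs (g 0) ≡ 0#
  sumL-0 [] = refl
  sumL-0 (v ∷ vs) = 0+0 (p v) (sumL-0 vs)

sumL-≗ : ∀ vs {g h : Mono → ℚ} → (∀ v → g v ≡ h v) → sumL vs g ≡ sumL vs h
sumL-≗ vs p = sumL-cong vs (λ v _ → p v)

bad-bad : ∀ k g u → bad (suc k) g u ≡ bad k (bad (suc k) g) u
bad-bad k g u with under? k u
... | inr _ = refl
... | inl h = bad-under (suc k) g u (HeadLt-weaken h ≤-refl)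

-- With k raised by one, the words that exceeded k minimally now fit; the others keep a free excess,
-- whose index is shifted by `delay`.
Tail-suc : ∀ {k w} → Tail k w → Tail (suc k) w
Tail-suc {k} {w} (F , B , p) = delay F , delay B , λ n g → begin
  _
    ≡⟨ sumL-≗ (P w n) (bad-bad k g) ⟩
  sumL (P w n) (bad k (bad (suc k) g))
    ≡⟨ p n (bad (suc k) g) ⟩
  _
    ≡⟨ cong₂ _+_ (conv-delay n F (λ a u → bad (suc k) g (fer (k ℕ.+ a) ∷ u)) (λ u → bad-under (suc k) g (fer (k ℕ.+ 0) ∷ u) (s≤s (≤-reflexive (ℕP.+-identityʳ k)) ∷ u)))
                 (conv-delay n B (λ a u → bad (suc k) g (bos (suc k ℕ.+ a) ∷ u)) (λ u → bad-under (suc k) g (bos (suc k ℕ.+ 0) ∷ u) (s≤s (≤-reflexive (ℕP.+-identityʳ k)) ∷ u))) ⟩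
  _
    ≡⟨ cong₂ _+_ (conv-cong n (λ a m _ → sumL-≗ (delay F m) (λ u → cong (λ x → bad (suc k) g (fer x ∷ u)) (+-suc k a) ∙
                    bad-over (suc k) g (fer (suc k ℕ.+ a) ∷ u) (λ { (q ∷ _) → <⇒≱ q (m≤m+n (suc k) a) }))))
                 (conv-cong n (λ a m _ → sumL-≗ (delay B m) (λ u → cong (λ x → bad (suc k) g (bos x ∷ u)) (+-suc (suc k) a) ∙
                    bad-over (suc k) g (bos (suc (suc k) ℕ.+ a) ∷ u) (λ { (q ∷ _) → <⇒≱ (s≤s (m≤m+n (suc k) a)) q })))) ⟩
  _ ∎

Tail-≤ : ∀ {w j k} → j ℕ.≤′ k → Tail j w → Tail k w
Tail-≤ ℕ.≤′-refl t = t
Tail-≤ {w} (ℕ.≤′-step p) t = Tail-suc {w = w} (Tail-≤ {w} p t)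

0-conv : ∀ n → conv n (λ _ _ → 0#) ≡ 0#
0-conv n = conv-0 n _ (λ _ _ _ → refl)

single : ℕ → List Mono
single zero = [] ∷ []
single (suc n) = []

conv-single : ∀ n (g : ℕ → Mono → ℚ) → conv n (λ a m → sumL (single m) (g a)) ≡ g n []
conv-single zero g = +-identityʳ _
conv-single (suc n) g = +-identityˡ _ ∙ conv-single n (λ a → g (suc a))

Tail-[] : Tail 0 []
Tail-[] = (λ _ → []) , delay single , eq
  where
  eq : ∀ n g → sumL (P [] n) (bad 0 g) ≡ conv n (λ _ _ → 0#) + conv n (λ a m → sumL (delay single m) (λ u → g (bos (suc a) ∷ u)))
  eq zero g = cong (_+ 0#) (bad-under 0 g [] []) ∙ refl
  eq (suc n) g = +-identityʳ _ ∙ bad-over 0 g (bos (suc n) ∷ []) (λ { (() ∷ _) }) ∙ sym (cong₂ _+_ (0-conv (suc n))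
    (conv-last n (λ a m → sumL (delay single m) (λ u → g (bos (suc a) ∷ u))) ∙ +-identityʳ _ ∙ conv-single n (λ a u → g (bos (suc a) ∷ u))) ∙ +-identityˡ _)

Tail-bos : ∀ k w → Tail k (bos k ∷ w)
Tail-bos k w = (λ _ → []) , delay B , λ n g → begin
  _
    ≡⟨ sumL-convL n _ (bad k g) ⟩
  conv n (λ i j → sumL (map (bos (k ℕ.+ i) ∷_) (B j)) (bad k g))
    ≡⟨ conv-cong n (λ i j _ → sumL-map (bos (k ℕ.+ i) ∷_) (B j) (bad k g)) ⟩
  conv n (λ i j → sumL (B j) (λ u → bad k g (bos (k ℕ.+ i) ∷ u)))
    ≡⟨ conv-delay n B (λ i u → bad k g (bos (k ℕ.+ i) ∷ u)) (λ u → bad-under k g (bos (k ℕ.+ 0) ∷ u) (≤-reflexive (ℕP.+-identityʳ k) ∷ u)) ⟩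
  conv n (λ i j → sumL (delay B j) (λ u → bad k g (bos (k ℕ.+ suc i) ∷ u)))
    ≡⟨ conv-cong n (λ i j _ → sumL-≗ (delay B j) (λ u → cong (λ x → bad k g (bos x ∷ u)) (+-suc k i) ∙
         bad-over k g (bos (suc k ℕ.+ i) ∷ u) (λ { (q ∷ _) → <⇒≱ (s≤s (m≤m+n k i)) q }))) ⟩
  conv n (λ i j → sumL (delay B j) (λ u → g (bos (suc k ℕ.+ i) ∷ u)))
    ≡⟨ sym (+-identityˡ _) ∙ cong₂ _+_ (sym (0-conv n)) refl ⟩
  _ ∎
  where
  B : ℕ → List Mono
  B j = good k (P w j)

tucked : ℕ → (Mono → ℚ) → Mono → ℚ
tucked k g [] = 0#
tucked k g (fer p ∷ u) = 0#
tucked k g (bos p ∷ u) = g (bos p ∷ fer k ∷ u)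

sumL-tuck : ∀ k us g → sumL (concatMap (tuck k) us) g ≡ sumL us (bad k (tucked k g))
sumL-tuck k us g = sumL-concatMap (tuck k) us g ∙ sumL-≗ us one
  where
  one : ∀ u → sumL (tuck k u) g ≡ bad k (tucked k g) u
  one [] = sym (bad-under k (tucked k g) [] [])
  one (fer p ∷ u) with under? k (fer p ∷ u)
  ... | inl _ = refl
  ... | inr _ = refl
  one (bos p ∷ u) with p ℕ.≤? k
  ... | yes _ = refl
  ... | no _ = +-identityʳ _

tuck-over : ∀ k u → All (λ v → ¬ HeadLt (fer k) v) (tuck k u)
tuck-over k [] = []
tuck-over k (fer p ∷ u) = []
tuck-over k (bos p ∷ u) with p ℕ.≤? k
... | yes _ = []
... | no ¬q = (λ { (q ∷ _) → ¬q q }) ∷ []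

sumL-tucked : ∀ {k w} ((F , B , _) : Tail k w) n g →
  sumL (concatMap (tuck k) (P w n)) g ≡ conv n (λ a m → sumL (B m) (λ u → g (bos (suc k ℕ.+ a) ∷ fer k ∷ u)))
sumL-tucked {k} {w} (F , B , p) n g = sumL-tuck k (P w n) g ∙ p n (tucked k g) ∙
  cong (_+ conv n (λ a m → sumL (B m) (λ u → g (bos (suc k ℕ.+ a) ∷ fer k ∷ u)))) (conv-0 n _ (λ a m _ → zeros (F m))) ∙ +-identityˡ _
  where
  zeros : ∀ vs → sumL vs (λ _ → 0#) ≡ 0#
  zeros [] = refl
  zeros (v ∷ vs) = +-identityˡ _ ∙ zeros vs

-- Words that keep the circle in the first row have a free excess by construction; those where the
-- circle was tucked inherit theirs from w.
Tail-fer : ∀ k w → Tail k w → Tail k (fer k ∷ w)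
Tail-fer k w t@(_ , B , _) = F , (λ n → map (fer k ∷_) (B n)) , λ n g → begin
  _
    ≡⟨ sumL-++ (convL n (λ i j → map (fer (k ℕ.+ i) ∷_) (F j))) _ (bad k g) ⟩
  _
    ≡⟨ cong₂ _+_
        (sumL-convL n _ (bad k g) ∙ conv-cong n (λ i j _ → sumL-map (fer (k ℕ.+ i) ∷_) (F j) (bad k g) ∙
          sumL-≗ (F j) (λ u → bad-over k g (fer (k ℕ.+ i) ∷ u) (λ { (q ∷ _) → <⇒≱ q (m≤m+n k i) }))))
        (sumL-cong (concatMap (tuck k) (P w n)) (λ v q → bad-over k g v (∈-All (All-concatMap {λ _ → ⊤} (tuck k) (λ u _ → tuck-over k u) (All.universal (λ _ → tt) (P w n))) q)) ∙
          sumL-tucked {k} {w} t n g ∙ conv-cong n (λ a m _ → sym (sumL-map (fer k ∷_) (B m) (λ u → g (bos (suc k ℕ.+ a) ∷ u))))) ⟩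
  _ ∎
  where
  F : ℕ → List Mono
  F j = good k (P w j)

tail : ∀ {k w} → Valid w → HeadLt (fer k) w → Tail k w
tail {k} [] _ = Tail-≤ {[]} (≤⇒≤′ z≤n) Tail-[]
tail {k} (row {j} {false} {w} pos top val) (p ∷ _) = Tail-≤ {bos j ∷ w} (≤⇒≤′ p) (Tail-bos j w)
tail {k} (row {j} {true} {w} pos top val) (p ∷ _) = Tail-≤ {fer j ∷ w} (≤⇒≤′ (<⇒≤ p)) (Tail-fer j w (tail val top))

good-All : ∀ {Q : Mono → Set} k {us} → All Q us → All (λ u → Q u × HeadLt (fer k) u) (good k us)
good-All k [] = []
good-All k {u ∷ us} (p ∷ a) with under? k u
... | inl h = (p , h) ∷ good-All k a
... | inr _ = good-All k a

All-convL : ∀ {Q : Mono → Set} n {F : ℕ → ℕ → List Mono} → (∀ i j → All Q (F i j)) → All Q (convL n F)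
All-convL zero p = p 0 0
All-convL (suc n) p = All-++ (p 0 (suc n)) (All-convL n (λ i j → p (suc i) j))

Second : ℕ → Mono → Set
Second k [] = ⊤
Second k (_ ∷ v) = HeadLt (fer k) v

P-valid : ∀ {w} → Valid w → ∀ ℓ → All Valid (P w ℓ) × (∀ k → HeadLt (fer k) w → All (Second k) (P w ℓ))
P-valid [] zero = [] ∷ [] , λ _ _ → tt ∷ []
P-valid [] (suc ℓ) = row (s≤s z≤n) [] [] ∷ [] , λ _ _ → [] ∷ []
P-valid (row {k} {false} pos top val) ℓ =
  All-convL ℓ (λ i j → All-map (bos (k ℕ.+ i) ∷_) (λ u (v , hu) → row (≤-trans pos (m≤m+n k i)) (longer i hu) v) (good-All k (fst (P-valid val j)))) ,
  λ { k' (p ∷ _) → All-convL ℓ (λ i j → All-map (bos (k ℕ.+ i) ∷_) (λ u (_ , hu) → shorter p hu) (good-All k (fst (P-valid val j)))) }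
  where
  longer : ∀ i {u} → HeadLt (fer k) u → HeadLt (fer (k ℕ.+ i)) u
  longer zero hu = subst (λ x → HeadLt (fer x) _) (sym (ℕP.+-identityʳ k)) hu
  longer (suc i) hu = HeadLt-weaken hu (m<m+n k (s≤s z≤n))
  shorter : ∀ {k' u} → k ≤ k' → HeadLt (fer k) u → HeadLt (fer k') u
  shorter q [] = []
  shorter q (r ∷ u) = ≤fer-trans {k} {_} {_} {false} r q ∷ u
P-valid (row {k} {true} {w} pos top val) ℓ =
  All-++ (All-convL ℓ (λ i j → All-map (fer (k ℕ.+ i) ∷_) (λ u (v , hu) → row tt (longer i hu) v) (good-All k (fst (P-valid val j)))))
    (All-concatMap (tuck k) tuck-valid (zip-All (fst (P-valid val ℓ)) (snd (P-valid val ℓ) k top))) ,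
  λ { k' (p ∷ _) → All-++ (All-convL ℓ (λ i j → All-map (fer (k ℕ.+ i) ∷_) (λ u (_ , hu) → HeadLt-weaken hu p) (good-All k (fst (P-valid val j)))))
        (All-concatMap {λ _ → ⊤} (tuck k) (λ u _ → tuck-second p u) (All.universal (λ _ → tt) (P w ℓ))) }
  where
  longer : ∀ i {u} → HeadLt (fer k) u → HeadLt (fer (k ℕ.+ i)) u
  longer zero hu = subst (λ x → HeadLt (fer x) _) (sym (ℕP.+-identityʳ k)) hu
  longer (suc i) hu = HeadLt-weaken hu (m<m+n k (s≤s z≤n))
  tuck-valid : ∀ u → Valid u × Second k u → All Valid (tuck k u)
  tuck-valid [] _ = []
  tuck-valid (fer p ∷ u) _ = []
  tuck-valid (bos p ∷ u) (row pp tp vu , sec) with p ℕ.≤? k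
  ... | yes _ = []
  ... | no ¬q = row pp (≰⇒> ¬q ∷ u) (row tt sec vu) ∷ []
  tuck-second : ∀ {k'} → k < k' → ∀ u → All (Second k') (tuck k u)
  tuck-second q [] = []
  tuck-second q (fer p ∷ u) = []
  tuck-second q (bos p ∷ u) with p ℕ.≤? k
  ... | yes _ = []
  ... | no _ = (q ∷ u) ∷ []

X-h : ∀ {f} → Symm f → ∀ ℓ k b w → X (k , b) (cons (bos ℓ) f) w ≡ conv ℓ (λ i j → X (k ℕ.+ i , b) f (bos j ∷ w))
X-h s ℓ k true w = φ-h s ℓ k w
X-h s ℓ k false w = φ-h (Symm-D s) ℓ k w

-- Put i cells into the first row and the others below. Words that do not fit under the original
-- length k form families with a free excess (`tail`). If their first row is circled, the products
-- of two Φ's cancel by antisymmetry. If it is not, the sum collapses by `φDφ-collapse` to a product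
-- B Φ_k: the tucked word when the row of length k is circled, and zero by D² = 0 otherwise.
S-h : ∀ {w} → Valid w → ∀ ℓ {f} → Symm f → S w (cons (bos ℓ) f) ≡ sumL (P w ℓ) (λ v → S v f)
S-h [] zero s = drop0 s [] ∙ sym (+-identityʳ _)
S-h [] (suc ℓ) s = solve 1 (λ x → x := (x :- con 0#) :+ con 0#) refl _
S-h (row {k} {b} {w} pos top val) ℓ {f} s = begin
  _
    ≡⟨ lin-cong (Lin-S w) (X-h s ℓ k b) ∙ lin-conv (Lin-S w) ℓ _ ⟩
  conv ℓ (λ i j → S w (cons (bos j) (Xᵢ i)))
    ≡⟨ conv-cong ℓ (λ i j _ → S-h val j (Symm-X (k ℕ.+ i , b) s) ∙ sumL-good k (P w j) _) ⟩
  _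
    ≡⟨ conv-+ ℓ _ _ ⟩
  _
    ≡⟨ cong₂ _+_ (conv-cong ℓ (λ i j _ → sym (sumL-map ((k ℕ.+ i , b) ∷_) (good k (P w j)) (λ v → S v f))) ∙ sym (sumL-convL ℓ _ (λ v → S v f))) (overflow b) ⟩
  sumL (convL ℓ (λ i j → map ((k ℕ.+ i , b) ∷_) (good k (P w j)))) (λ v → S v f) + rest b
    ≡⟨ assemble b ⟩
  _ ∎
  where
  Xᵢ : ℕ → Fn
  Xᵢ i = X (k ℕ.+ i , b) f
  t = tail {k} val top
  F = fst t
  B = fst (snd t)
  rest : Bool → ℚ
  rest false = 0#
  rest true = sumL (concatMap (tuck k) (P w ℓ)) (λ v → S v f)
  assemble : ∀ b → sumL (convL ℓ (λ i j → map ((k ℕ.+ i , b) ∷_) (good k (P w j)))) (λ v → S v f) + rest b ≡ sumL (P ((k , b) ∷ w) ℓ) (λ v → S v f)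
  assemble false = +-identityʳ _
  assemble true = sym (sumL-++ (convL ℓ (λ i j → map (fer (k ℕ.+ i) ∷_) (good k (P w j)))) _ _)

  sumL-conv : ∀ n vs (G : ℕ → ℕ → Mono → ℚ) → conv n (λ i j → sumL vs (G i j)) ≡ sumL vs (λ u → conv n (λ i j → G i j u))
  sumL-conv n [] G = 0-conv n
  sumL-conv n (v ∷ vs) G = conv-+ n _ _ ∙ cong (conv n (λ i j → G i j v) +_) (sumL-conv n vs G)

  regroup : ∀ (R : ℕ → List Mono) (G : ℕ → ℕ → Mono → ℚ) →
    conv ℓ (λ i j → conv j (λ a m → sumL (R m) (G i a))) ≡ conv ℓ (λ j m → sumL (R m) (λ u → conv j (λ i a → G i a u)))
  regroup R G = conv-assoc ℓ _ ∙ conv-cong ℓ (λ j m _ → sumL-conv j (R m) G)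

  zeros : ∀ (R : ℕ → List Mono) (G : ℕ → Mono → ℚ) → (∀ j u → G j u ≡ 0#) → conv ℓ (λ j m → sumL (R m) (G j)) ≡ 0#
  zeros R G p = conv-0 ℓ _ (λ j m _ → sumL-≗ (R m) (p j) ∙ go (R m))
    where
    go : ∀ vs → sumL vs (λ _ → 0#) ≡ 0#
    go [] = refl
    go (v ∷ vs) = +-identityˡ _ ∙ go vs

  S-conv : ∀ n u (G : ℕ → ℕ → Fn) → conv n (λ i a → S u (G i a)) ≡ S u (λ v → conv n (λ i a → G i a v))
  S-conv n u G = sym (lin-conv (Lin-S u) n G)

  split : ∀ b → conv ℓ (λ i j → sumL (P w j) (bad k (λ u → S u (X (k ℕ.+ i , b) f))))
    ≡ conv ℓ (λ j m → sumL (F m) (λ u → conv j (λ i a → S u (φ (k ℕ.+ a) (X (k ℕ.+ i , b) f)))))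
    + conv ℓ (λ j m → sumL (B m) (λ u → conv j (λ i a → S u (φ (suc k ℕ.+ a) (D (X (k ℕ.+ i , b) f))))))
  split b = conv-cong ℓ (λ i j _ → snd (snd t) j (λ u → S u (X (k ℕ.+ i , b) f))) ∙
    conv-+ ℓ _ _ ∙ cong₂ _+_ (regroup F (λ i a u → S u (φ (k ℕ.+ a) (X (k ℕ.+ i , b) f))))
      (regroup B (λ i a u → S u (φ (suc k ℕ.+ a) (D (X (k ℕ.+ i , b) f)))))

  antisym : ∀ {g} → Symm g → ∀ j u → conv j (λ i a → S u (φ (k ℕ.+ a) (φ (k ℕ.+ i) g))) ≡ 0#
  antisym {g} sg j u = S-conv j u _ ∙ lin-0 (Lin-S u) (λ v → conv-antisymmetric j _ (λ i a → φ-anticomm sg (k ℕ.+ a) (k ℕ.+ i) v))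

  collapse : ∀ {g} → Symm g → ∀ j u → conv j (λ i a → S u (φ (suc k ℕ.+ a) (D (φ (k ℕ.+ i) g)))) ≡ S u (φ k (φ (suc k ℕ.+ j) (D g)))
  collapse sg j u = S-conv j u _ ∙ lin-cong (Lin-S u) (λ v → φDφ-collapse sg v j k)

  overflow : ∀ b → conv ℓ (λ i j → sumL (P w j) (bad k (λ u → S u (X (k ℕ.+ i , b) f)))) ≡ rest b
  overflow false = split false ∙ cong₂ _+_
    (zeros F _ (λ j u → antisym (Symm-D s) j u))
    (zeros B _ (λ j u → collapse (Symm-D s) j u ∙ lin-0 (Lin-S u) (λ v → lin-0 (Lin-φ k v) (λ v' → lin-0 (Lin-φ (suc k ℕ.+ j) v') (DD-0 f))))) ∙
    +-identityˡ 0#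
  overflow true = split true ∙ cong₂ _+_
    (zeros F _ (λ j u → antisym s j u))
    (conv-cong ℓ (λ j m _ → sumL-≗ (B m) (λ u → collapse s j u))) ∙
    +-identityˡ _ ∙ sym (sumL-tucked {k} {w} t ℓ (λ v → S v f))

-- Words and superpartitions.

ferL bosL : Mono → List ℕ
ferL [] = []
ferL (bos _ ∷ w) = ferL w
ferL (fer k ∷ w) = k ∷ ferL w
bosL [] = []
bosL (bos k ∷ w) = k ∷ bosL w
bosL (fer _ ∷ w) = bosL w

fromW : Mono → SP
fromW w = ferL w , bosL w

toW : SP → Mono
toW Λ = norm (canon Λ)

ferL<⇒ : ∀ {k w} → Valid w → HeadLt (fer k) w → All (_< k) (ferL w)
ferL<⇒ {k} {w} val top = go (Valid-AllLt val top)
  where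
  go : ∀ {w} → AllLt (fer k) w → All (_< k) (ferL w)
  go [] = []
  go {bos _ ∷ w} (p ∷ a) = go a
  go {fer _ ∷ w} (p ∷ a) = p ∷ go a

bosL≤⇒ : ∀ {k w} → Valid w → HeadLt (fer k) w → All (_≤ k) (bosL w)
bosL≤⇒ {k} {w} val top = go (Valid-AllLt val top)
  where
  go : ∀ {w} → AllLt (fer k) w → All (_≤ k) (bosL w)
  go [] = []
  go {bos _ ∷ w} (p ∷ a) = p ∷ go a
  go {fer _ ∷ w} (p ∷ a) = go a

T-∧ : ∀ {x y} → T x → T y → T (x ∧ y)
T-∧ {true} {true} _ _ = tt

T-∧₁ : ∀ x {y} → T (x ∧ y) → T x
T-∧₁ true _ = tt

T-∧₂ : ∀ x {y} → T (x ∧ y) → T y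
T-∧₂ true p = p

strictDec-cons : ∀ x xs → All (_< x) xs → T (strictDec xs) → T (strictDec (x ∷ xs))
strictDec-cons x [] _ _ = tt
strictDec-cons x (y ∷ ys) (p ∷ _) t = T-∧ (<⇒<ᵇ p) t

weakDec-cons : ∀ x xs → 1 ≤ x → All (_≤ x) xs → T (weakDecPos xs) → T (weakDecPos (x ∷ xs))
weakDec-cons x [] p _ _ = ≤⇒≤ᵇ p
weakDec-cons x (y ∷ ys) p (q ∷ _) t = T-∧ (≤⇒≤ᵇ q) (T-∧ (≤⇒≤ᵇ p) t)

fromW-SP : ∀ {w} → Valid w → IsSP (fromW w)
fromW-SP val = T-∧ (strict val) (weak val)
  where
  strict : ∀ {w} → Valid w → T (strictDec (ferL w))
  strict [] = tt
  strict (row {b = false} pos top val) = strict val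
  strict (row {b = true} pos top val) = strictDec-cons _ _ (ferL<⇒ val top) (strict val)
  weak : ∀ {w} → Valid w → T (weakDecPos (bosL w))
  weak [] = tt
  weak (row {b = false} pos top val) = weakDec-cons _ _ pos (bosL≤⇒ val top) (weak val)
  weak (row {b = true} pos top val) = weak val

norm-bos-past : ∀ k a v → norm (map (λ e → fer e) a ++ bos k ∷ v) ≡ insb k (norm (map (λ e → fer e) a ++ v))
norm-bos-past k [] v = refl
norm-bos-past k (x ∷ a) v = cong (ins (fer x)) (norm-bos-past k a v) ∙ sym (insb-comm k (fer x) _)

toW-fromW : ∀ {w} → Valid w → toW (fromW w) ≡ w
toW-fromW [] = refl
toW-fromW (row {k} {true} {w} pos top val) = cong (ins (fer k)) (toW-fromW val) ∙ ins-above k true w top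
toW-fromW (row {suc k} {false} {w} pos top val) = norm-bos-past (suc k) (ferL w) _ ∙
  cong (ins (bos (suc k))) (toW-fromW val) ∙ ins-above (suc k) false w top

ins-fer : ∀ x {w} → Valid w → All (_< x) (ferL w) → Valid (ins (fer x) w) × fromW (ins (fer x) w) ≡ (x ∷ ferL w , bosL w)
ins-fer x [] _ = row tt [] [] , refl
ins-fer x {d ∷ w} (row pos top val) a with <ᴸ-cmp (fer x) d
ins-fer x {bos j ∷ w} (row pos top val) a | inr (inr p) = row tt (p ∷ w) (row pos top val) , refl
ins-fer x {bos j ∷ w} (row pos top val) a | inl p with ins-fer x val a
... | v , eq = row pos (ins-top (fer x) w p top) v , cong (λ Λ → fst Λ , j ∷ snd Λ) eq
ins-fer x {fer j ∷ w} (row pos top val) (q ∷ a) | inr _ = row tt (q ∷ w) (row pos top val) , refl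
ins-fer x {fer j ∷ w} (row pos top val) (q ∷ a) | inl p = ⊥-elim (<-asym p q)

strictDec⇒All : ∀ x xs → T (strictDec (x ∷ xs)) → All (_< x) xs × T (strictDec xs)
strictDec⇒All x [] _ = [] , tt
strictDec⇒All x (y ∷ ys) t = p ∷ All.map (λ q → <-trans q p) (fst (strictDec⇒All y ys t')) , t'
  where
  p = <ᵇ⇒< y x (T-∧₁ (y <ᵇ x) t)
  t' = T-∧₂ (y <ᵇ x) t

weakDec⇒All : ∀ x xs → T (weakDecPos (x ∷ xs)) → 1 ≤ x × All (_≤ x) xs × T (weakDecPos xs)
weakDec⇒All x [] t = ≤ᵇ⇒≤ 1 x t , [] , tt
weakDec⇒All x (y ∷ ys) t = ≤ᵇ⇒≤ 1 x (T-∧₁ (1 ≤ᵇ x) (T-∧₂ (y ≤ᵇ x) t)) ,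
  p ∷ All.map (λ q → ≤-trans q p) (fst (snd (weakDec⇒All y ys t'))) , t'
  where
  p = ≤ᵇ⇒≤ y x (T-∧₁ (y ≤ᵇ x) t)
  t' = T-∧₂ (1 ≤ᵇ x) (T-∧₂ (y ≤ᵇ x) t)

toW-SP : ∀ Λ → IsSP Λ → Valid (toW Λ) × fromW (toW Λ) ≡ Λ
toW-SP (a , s) isp = go a (T-∧₁ (strictDec a) isp)
  where
  bosons : ∀ s → T (weakDecPos s) → Valid (norm (map (λ e → bos e) s)) × fromW (norm (map (λ e → bos e) s)) ≡ ([] , s)
  bosons [] _ = [] , refl
  bosons (x ∷ s) t with weakDec⇒All x s t
  bosons (suc x ∷ s) t | p , q , t' with bosons s t'
  ... | v , eq = subst Valid (sym above) (row p top v) ,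
      cong fromW above ∙ cong (λ Λ → fst Λ , suc x ∷ snd Λ) eq
    where
    allBos : ∀ {s} → All (_≤ suc x) s → AllLt (fer (suc x)) (map (λ e → bos e) s)
    allBos [] = []
    allBos (r ∷ a) = r ∷ allBos a
    top : HeadLt (fer (suc x)) (norm (map (λ e → bos e) s))
    top = All-head (norm-All (allBos q))
    above : ins (bos (suc x)) (norm (map (λ e → bos e) s)) ≡ bos (suc x) ∷ norm (map (λ e → bos e) s)
    above = ins-above (suc x) false _ top
  go : ∀ a → T (strictDec a) → Valid (toW (a , s)) × fromW (toW (a , s)) ≡ (a , s)
  go [] _ = bosons s (T-∧₂ (strictDec a) isp)
  go (x ∷ a) t with strictDec⇒All x a t
  ... | q , t' with go a t'
  ... | v , eq with ins-fer x v (subst (All (_< x)) (sym (cong fst eq)) q)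
  ... | v' , eq' = v' , eq' ∙ cong (λ Λ → x ∷ fst Λ , snd Λ) eq

mform-bos-past : ∀ k a v x → mform (map (λ e → fer e) a ++ bos k ∷ v) x ≡ hmul k (mform (map (λ e → fer e) a ++ v)) x
mform-bos-past k [] v x = refl
mform-bos-past k (y ∷ a) v x = lin-cong (Lin-h̃mul y x) (mform-bos-past k a v) ∙ sym (hmul-h̃mul k y _ x)

mform-canon : ∀ w x → mform (canon (fromW w)) x ≡ mform w x
mform-canon [] x = refl
mform-canon (fer k ∷ w) x = lin-cong (Lin-h̃mul k x) (mform-canon w)
mform-canon (bos k ∷ w) x = mform-bos-past k (ferL w) _ x ∙ lin-cong (Lin-hmul k x) (mform-canon w)

mform-toW : ∀ Λ → IsSP Λ → ∀ x → mform (canon Λ) x ≡ mform (toW Λ) x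
mform-toW Λ isp x = cong (λ Ω → mform (canon Ω) x) (sym (snd (toW-SP Λ isp))) ∙ mform-canon (toW Λ) x

insertDesc-ins : ∀ x l → map (λ e → bos e) (insertDesc x l) ≡ ins (bos x) (map (λ e → bos e) l)
insertDesc-ins x [] = refl
insertDesc-ins x (y ∷ l) with y ≤ᵇ x in eq
... | true = sym (ins-ge _ (λ p → <⇒≱ p (≤ᵇ⇒≤ y x (subst T (sym eq) tt))))
... | false = cong (bos y ∷_) (insertDesc-ins x l) ∙ sym (ins-lt _ (≰⇒> (λ p → subst T eq (≤⇒≤ᵇ p))))

map-bos-injective : ∀ {l m} → map (λ e → bos e) l ≡ map (λ e → bos e) m → l ≡ m
map-bos-injective = LP.map-injective {A = ℕ} (cong fst)

insertDesc-comm : ∀ x y l → insertDesc x (insertDesc y l) ≡ insertDesc y (insertDesc x l)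
insertDesc-comm x y l = map-bos-injective (begin
  _ ≡⟨ insertDesc-ins x (insertDesc y l) ⟩
  _ ≡⟨ cong (ins (bos x)) (insertDesc-ins y l) ⟩
  _ ≡⟨ ins-comm (bos x) (bos y) (map (λ e → bos e) l) ⟩
  _ ≡⟨ cong (ins (bos y)) (sym (insertDesc-ins x l)) ⟩
  _ ≡⟨ sym (insertDesc-ins y (insertDesc x l)) ⟩
  _ ∎)

sortDesc-past : ∀ a k s → sortDesc (a ++ k ∷ s) ≡ insertDesc k (sortDesc (a ++ s))
sortDesc-past [] k s = refl
sortDesc-past (x ∷ a) k s = cong (insertDesc x) (sortDesc-past a k s) ∙ insertDesc-comm x k (sortDesc (a ++ s))

insertDesc-top : ∀ x l → All (_≤ x) l → insertDesc x l ≡ x ∷ l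
insertDesc-top x [] _ = refl
insertDesc-top x (y ∷ l) (p ∷ _) with y ≤ᵇ x | ≤⇒≤ᵇ p
... | true | _ = refl

rowLens ends : Mono → List ℕ
rowLens = map fst
ends [] = []
ends (bos k ∷ w) = k ∷ ends w
ends (fer k ∷ w) = suc k ∷ ends w

star-fromW : ∀ {w} → Valid w → star (fromW w) ≡ rowLens w
star-fromW [] = refl
star-fromW (row {k} {true} {w} pos top val) = cong (insertDesc k) (star-fromW val) ∙ insertDesc-top k _ (lens (Valid-AllLt val top))
  where
  lens : ∀ {w} → AllLt (fer k) w → All (_≤ k) (rowLens w)
  lens [] = []
  lens {bos _ ∷ _} (p ∷ a) = p ∷ lens a
  lens {fer _ ∷ _} (p ∷ a) = <⇒≤ p ∷ lens a
star-fromW (row {k} {false} {w} pos top val) = sortDesc-past (ferL w) k (bosL w) ∙ cong (insertDesc k) (star-fromW val) ∙ insertDesc-top k _ (lens (Valid-AllLt val top))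
  where
  lens : ∀ {w} → AllLt (fer k) w → All (_≤ k) (rowLens w)
  lens [] = []
  lens {bos _ ∷ _} (p ∷ a) = p ∷ lens a
  lens {fer _ ∷ _} (p ∷ a) = <⇒≤ p ∷ lens a

ends≤ : ∀ {k w} → AllLt (fer k) w → All (_≤ k) (ends w)
ends≤ [] = []
ends≤ {w = bos _ ∷ _} (p ∷ a) = p ∷ ends≤ a
ends≤ {w = fer _ ∷ _} (p ∷ a) = p ∷ ends≤ a

circledast-fromW : ∀ {w} → Valid w → circledast (fromW w) ≡ ends w
circledast-fromW [] = refl
circledast-fromW (row {k} {true} {w} pos top val) = cong (insertDesc (suc k)) (circledast-fromW val) ∙
  insertDesc-top (suc k) _ (All.map m≤n⇒m≤1+n (ends≤ (Valid-AllLt val top)))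
circledast-fromW (row {k} {false} {w} pos top val) = sortDesc-past (map suc (ferL w)) k (bosL w) ∙
  cong (insertDesc k) (circledast-fromW val) ∙ insertDesc-top k _ (ends≤ (Valid-AllLt val top))

Dom-tail : ∀ {k μ ν} → Dom (k ∷ μ) (k ∷ ν) → Dom μ ν
Dom-tail {k} d j = +-cancelˡ-≤ k _ _ (d (suc j))

Dom-head : ∀ {j k μ ν} → Dom (j ∷ μ) (k ∷ ν) → j ≤ k
Dom-head d = subst₂ _≤_ (ℕP.+-identityʳ _) (ℕP.+-identityʳ _) (d 1)

-- At the first row where the words differ, the larger word is longer there in Λ^* or, at equal
-- length, in Λ^⊛, against one of the two dominance inequalities.
dominance⇒¬≺ : ∀ {x y} → Valid x → Dom (rowLens x) (rowLens y) → Dom (ends x) (ends y) → ¬ (y ≺ x)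
dominance⇒¬≺ (row {suc k} {false} pos _ _) d d' []≺ = n≮0 (d 1)
dominance⇒¬≺ (row {k} {true} _ _ _) d d' []≺ = n≮0 (d' 1)
dominance⇒¬≺ {bos j ∷ x} {bos k ∷ y} _ d d' (here p) = <⇒≱ p (Dom-head {μ = rowLens x} {rowLens y} d)
dominance⇒¬≺ {fer j ∷ x} {bos k ∷ y} _ d d' (here p) = <⇒≱ (s≤s p) (Dom-head {μ = ends x} {ends y} d')
dominance⇒¬≺ {bos j ∷ x} {fer k ∷ y} _ d d' (here p) = <⇒≱ p (Dom-head {μ = rowLens x} {rowLens y} d)
dominance⇒¬≺ {fer j ∷ x} {fer k ∷ y} _ d d' (here p) = <⇒≱ p (Dom-head {μ = rowLens x} {rowLens y} d)
dominance⇒¬≺ {bos j ∷ x} {_ ∷ y} (row _ _ val) d d' (there p) = dominance⇒¬≺ val (Dom-tail {μ = rowLens x} {rowLens y} d) (Dom-tail {μ = ends x} {ends y} d') p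
dominance⇒¬≺ {fer j ∷ x} {_ ∷ y} (row _ _ val) d d' (there p) = dominance⇒¬≺ val (Dom-tail {μ = rowLens x} {rowLens y} d) (Dom-tail {μ = ends x} {ends y} d') p

<SP⇒≺ : ∀ {Ω Λ} → Ω <SP Λ → toW Ω ≺ toW Λ
<SP⇒≺ {Ω} {Λ} ((Ωsp , Λsp , _ , _ , d , d') , ≢) with ≺-cmp (toW Ω) (toW Λ)
... | inl p = p
... | inr (inl p) = ⊥-elim (≢ (sym (snd (toW-SP Ω Ωsp)) ∙ cong fromW p ∙ snd (toW-SP Λ Λsp)))
... | inr (inr p) = ⊥-elim (dominance⇒¬≺ (fst (toW-SP Ω Ωsp)) (subst₂ Dom (lens Ω Ωsp) (lens Λ Λsp) d) (subst₂ Dom (lens' Ω Ωsp) (lens' Λ Λsp) d') p)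
  where
  lens : ∀ Λ → IsSP Λ → star Λ ≡ rowLens (toW Λ)
  lens Λ isp = cong star (sym (snd (toW-SP Λ isp))) ∙ star-fromW (fst (toW-SP Λ isp))
  lens' : ∀ Λ → IsSP Λ → circledast Λ ≡ ends (toW Λ)
  lens' Λ isp = cong circledast (sym (snd (toW-SP Λ isp))) ∙ circledast-fromW (fst (toW-SP Λ isp))

sum-rowLens : ∀ w → sum (rowLens w) ≡ wsize w
sum-rowLens [] = refl
sum-rowLens (c ∷ w) = cong (fst c ℕ.+_) (sum-rowLens w)

length-ferL : ∀ w → length (ferL w) ≡ nf w
length-ferL [] = refl
length-ferL (bos _ ∷ w) = length-ferL w
length-ferL (fer _ ∷ w) = cong suc (length-ferL w)

<SP-Deg : ∀ {Ω Λ} → Ω ≤SP Λ → Deg (toW Ω) ≡ Deg (toW Λ)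
<SP-Deg {Ω} {Λ} (Ωsp , Λsp , f , s , _) = cong₂ _,_ (sym (sz Ω Ωsp) ∙ s ∙ sz Λ Λsp) (sym (fd Ω Ωsp) ∙ f ∙ fd Λ Λsp)
  where
  sz : ∀ Λ → IsSP Λ → sum (star Λ) ≡ wsize (toW Λ)
  sz Λ isp = cong (λ Λ → sum (star Λ)) (sym (snd (toW-SP Λ isp))) ∙ cong sum (star-fromW (fst (toW-SP Λ isp))) ∙ sum-rowLens (toW Λ)
  fd : ∀ Λ → IsSP Λ → fdeg Λ ≡ nf (toW Λ)
  fd Λ isp = cong fdeg (sym (snd (toW-SP Λ isp))) ∙ length-ferL (toW Λ)

-- The vertical-strip rule.

one : ℕ → ℕ → ℕ
one c k = if c ≤ᵇ k then 1 else 0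

one-yes : ∀ {c k} → c ≤ k → one c k ≡ 1
one-yes {c} {k} p with c ≤ᵇ k | ≤⇒≤ᵇ p
... | true | _ = refl

one-no : ∀ {c k} → k < c → one c k ≡ 0
one-no {c} {k} p with c ≤ᵇ k in eq
... | true = ⊥-elim (<⇒≱ p (≤ᵇ⇒≤ c k (subst T (sym eq) tt)))
... | false = refl

one≤1 : ∀ c k → one c k ≤ 1
one≤1 c k with c ≤ᵇ k
... | true = ≤-refl
... | false = z≤n

-- The length of column c. It also locates circles: the one belonging to the part x lies in row 1 +
-- cnt (x + 1).
cnt : ℕ → Mono → ℕ
cnt c [] = 0
cnt c ((k , _) ∷ w) = one c k ℕ.+ cnt c w

cnt-yes : ∀ {c k} w → c ≤ k → one c k ℕ.+ cnt c w ≡ suc (cnt c w)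
cnt-yes {c} w p = cong (ℕ._+ cnt c w) (one-yes p)

cnt-no : ∀ {c k} w → k < c → one c k ℕ.+ cnt c w ≡ cnt c w
cnt-no {c} w p = cong (ℕ._+ cnt c w) (one-no p)

rows≤ : ∀ {k w} → Valid w → HeadLt (fer k) w → All (λ c → fst c ≤ k) w
rows≤ val top = All.map weaken (Valid-AllLt val top)
  where
  weaken : ∀ {k c} → c <ᴸ fer k → fst c ≤ k
  weaken {k} {bos j} p = p
  weaken {k} {fer j} p = <⇒≤ p

cnt-0 : ∀ {c w} → All (λ d → fst d < c) w → cnt c w ≡ 0
cnt-0 [] = refl
cnt-0 {c} {_ ∷ w} (p ∷ a) = cnt-no {c} w p ∙ cnt-0 a

cnt-top : ∀ {k w} → Valid w → HeadLt (fer k) w → cnt (suc k) w ≡ 0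
cnt-top val top = cnt-0 (All.map s≤s (rows≤ val top))

length-filter : ∀ c a k s → length (filter (c ℕ.≤?_) (a ++ k ∷ s)) ≡ one c k ℕ.+ length (filter (c ℕ.≤?_) (a ++ s))
length-filter c [] k s with c ≤ᵇ k
... | true = refl
... | false = refl
length-filter c (x ∷ a) k s with c ≤ᵇ x
... | true = cong suc (length-filter c a k s) ∙ sym (+-suc (one c k) _)
... | false = length-filter c a k s

cnt-parts : ∀ c w → length (filter (c ℕ.≤?_) (ferL w ++ bosL w)) ≡ cnt c w
cnt-parts c [] = refl
cnt-parts c (bos k ∷ w) = length-filter c (ferL w) k (bosL w) ∙ cong (one c k ℕ.+_) (cnt-parts c w)
cnt-parts c (fer k ∷ w) = length-filter c [] k (ferL w ++ bosL w) ∙ cong (one c k ℕ.+_) (cnt-parts c w)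

cnt-rowLens : ∀ c w → length (filter (c ℕ.≤?_) (rowLens w)) ≡ cnt c w
cnt-rowLens c [] = refl
cnt-rowLens c ((k , _) ∷ w) = length-filter c [] k (rowLens w) ∙ cong (one c k ℕ.+_) (cnt-rowLens c w)

nth-All : ∀ {Q : ℕ → Set} {xs} → All Q xs → ∀ i → i < length xs → Q (nth xs i)
nth-All (p ∷ a) zero q = p
nth-All (p ∷ a) (suc i) (s≤s q) = nth-All a i q

VS : List ℕ → List ℕ → Set
VS μ ν = ∀ i → nth μ i ≤ nth ν i × nth ν i ≤ suc (nth μ i)

VS-cons : ∀ {k k' μ ν} → k ≤ k' → k' ≤ suc k → VS μ ν → VS (k ∷ μ) (k' ∷ ν)
VS-cons p q s zero = p , q
VS-cons p q s (suc i) = s i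

VS-tail : ∀ {k k' μ ν} → VS (k ∷ μ) (k' ∷ ν) → VS μ ν
VS-tail s i = s (suc i)

VS-0 : ∀ {ν} → VS [] ν → VS (0 ∷ []) ν
VS-0 s zero = s zero
VS-0 s (suc i) = s (suc i)

VS-0' : ∀ {ν} → VS (0 ∷ []) ν → VS [] ν
VS-0' s zero = s zero
VS-0' s (suc i) = s (suc i)

VS-[]cons : ∀ {k ν} → k ≤ 1 → VS [] ν → VS [] (k ∷ ν)
VS-[]cons p s zero = z≤n , p
VS-[]cons p s (suc i) = s i

VS-[]tail : ∀ {k ν} → VS [] (k ∷ ν) → VS [] ν
VS-[]tail s i = s (suc i)

-- Condition (2') with the column lengths abstracted to N and N', so that deleting the first rows of
-- both diagrams only shifts them by one. The circle of a part x lies in row 1 + N (x + 1) and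
-- column x + 1, hence c ≥ 2 reads 1 ≤ x.
record CondV (N N' : ℕ → ℕ) (xs ys : List ℕ) : Set where
  constructor condV
  field
    at-row : ∀ i → i < length xs →
      (N (suc (nth xs i)) ≡ N' (suc (nth ys i)) ⊎ nth xs i ≡ nth ys i) ×
      (nth xs i ≡ nth ys i → 1 ≤ nth xs i → suc (N' (suc (nth ys i))) ≤ N (nth xs i))
open CondV public

condV-shift : ∀ {N N₁ N' N₁' : ℕ → ℕ} {xs ys} → length ys ≡ length xs →
  All (λ x → N₁ (suc x) ≡ suc (N (suc x)) × N₁ x ≡ suc (N x)) xs → All (λ y → N₁' (suc y) ≡ suc (N' (suc y))) ys →
  CondV N N' xs ys → CondV N₁ N₁' xs ys
condV-shift {N} {N₁} {N'} {N₁'} {xs} {ys} le a a' c .at-row i p =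
  row-or-col (fst (at-row c i p)) ,
  (λ q r → subst₂ (λ m n → suc m ≤ n) (sym py) (sym (snd px)) (s≤s (snd (at-row c i p) q r)))
  where
  px = nth-All a i p
  py = nth-All a' i (subst (i <_) (sym le) p)
  row-or-col : N (suc (nth xs i)) ≡ N' (suc (nth ys i)) ⊎ nth xs i ≡ nth ys i → N₁ (suc (nth xs i)) ≡ N₁' (suc (nth ys i)) ⊎ nth xs i ≡ nth ys i
  row-or-col (inl q) = inl (fst px ∙ cong suc q ∙ sym py)
  row-or-col (inr q) = inr q

condV-unshift : ∀ {N N₁ N' N₁' : ℕ → ℕ} {xs ys} → length ys ≡ length xs →
  All (λ x → N₁ (suc x) ≡ suc (N (suc x)) × N₁ x ≡ suc (N x)) xs → All (λ y → N₁' (suc y) ≡ suc (N' (suc y))) ys →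
  CondV N₁ N₁' xs ys → CondV N N' xs ys
condV-unshift {N} {N₁} {N'} {N₁'} {xs} {ys} le a a' c .at-row i p =
  row-or-col (fst (at-row c i p)) ,
  (λ q r → ≤-pred (subst₂ (λ m n → suc m ≤ n) py (snd px) (snd (at-row c i p) q r)))
  where
  px = nth-All a i p
  py = nth-All a' i (subst (i <_) (sym le) p)
  row-or-col : N₁ (suc (nth xs i)) ≡ N₁' (suc (nth ys i)) ⊎ nth xs i ≡ nth ys i → N (suc (nth xs i)) ≡ N' (suc (nth ys i)) ⊎ nth xs i ≡ nth ys i
  row-or-col (inl q) = inl (suc-injective (sym (fst px) ∙ q ∙ py))
  row-or-col (inr q) = inr q

condV-cons : ∀ {N N' x y xs ys} → ((N (suc x) ≡ N' (suc y) ⊎ x ≡ y) × (x ≡ y → 1 ≤ x → suc (N' (suc y)) ≤ N x)) →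
  CondV N N' xs ys → CondV N N' (x ∷ xs) (y ∷ ys)
condV-cons p c .at-row zero _ = p
condV-cons p c .at-row (suc i) (s≤s q) = at-row c i q

condV-tail : ∀ {N N' x y xs ys} → CondV N N' (x ∷ xs) (y ∷ ys) → CondV N N' xs ys
condV-tail c .at-row i q = at-row c (suc i) (s≤s q)

record PV (w : Mono) (n : ℕ) (v : Mono) : Set where
  constructor pv
  field
    fermions : nf v ≡ nf w
    strip-V : VS (rowLens w) (rowLens v)
    boxes : wsize v ≡ wsize w ℕ.+ n
    circles : CondV (λ c → cnt c w) (λ c → cnt c v) (ferL w) (ferL v)

-- u with a row fer k inserted below its rows of length k + 1.
data Tuck (k : ℕ) : Mono → Mono → Set where
  here : ∀ {u} → HeadLt (fer k) u → Tuck k u (fer k ∷ u)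
  there : ∀ {u v} → Tuck k u v → Tuck k (bos (suc k) ∷ u) (bos (suc k) ∷ v)

push-form : ∀ k b u → HeadLt (fer (suc k)) u → Valid u →
  All (λ v → (v ≡ (k , b) ∷ u × HeadLt (fer k) u) ⊎ (b ≡ true × Tuck k u v)) (push (k , b) u)
push-form k b [] top val = inl (refl , []) ∷ []
push-form k b (d ∷ u) top val with <ᴸ? d k
push-form k b (d ∷ u) top val | inl p = inl (refl , p ∷ u) ∷ []
push-form k false (d ∷ u) top val | inr _ = []
push-form k true (fer j ∷ u) top val | inr _ = []
push-form k true (bos j ∷ u) (q ∷ _) (row _ top val) | inr ¬p with ≤-antisym q (≰⇒> ¬p)
... | refl = All-map (bos (suc k) ∷_) tucked-below (push-form k true u top val)
  where
  tucked-below : ∀ v → (v ≡ fer k ∷ u × HeadLt (fer k) u) ⊎ (true ≡ true × Tuck k u v) →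
    (bos (suc k) ∷ v ≡ fer k ∷ bos (suc k) ∷ u × HeadLt (fer k) (bos (suc k) ∷ u)) ⊎ (true ≡ true × Tuck k (bos (suc k) ∷ u) (bos (suc k) ∷ v))
  tucked-below v (inl (refl , h)) = inr (refl , there (here h))
  tucked-below v (inr (_ , t)) = inr (refl , there t)

Tuck-push : ∀ {k u v} → Tuck k u v → v ∈ push (fer k) u
Tuck-push {k} {u} (here top) = subst (fer k ∷ u ∈_) (sym (push-under k true u top)) (Any.here refl)
Tuck-push {k} (there {u} t) with suc k ℕ.≤? k
... | yes p = ⊥-elim (1+n≰n p)
... | no _ = ∈-map⁺ (bos (suc k) ∷_) (Tuck-push t)

Tuck-cnt : ∀ {k u v} c → Tuck k u v → cnt c v ≡ one c k ℕ.+ cnt c u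
Tuck-cnt c (here _) = refl
Tuck-cnt {k} c (there {u} t) = cong (one c (suc k) ℕ.+_) (Tuck-cnt c t) ∙
  sym (ℕP.+-assoc (one c (suc k)) (one c k) _) ∙ cong (ℕ._+ cnt c u) (ℕP.+-comm (one c (suc k)) (one c k)) ∙ ℕP.+-assoc (one c k) _ _

Tuck-ferL : ∀ {k u v} → Tuck k u v → ferL v ≡ k ∷ ferL u
Tuck-ferL (here _) = refl
Tuck-ferL (there t) = Tuck-ferL t

Tuck-size : ∀ {k u v} → Tuck k u v → wsize v ≡ k ℕ.+ wsize u
Tuck-size (here _) = refl
Tuck-size {k} (there {u} t) = cong (suc k ℕ.+_) (Tuck-size t) ∙
  sym (ℕP.+-assoc (suc k) k _) ∙ cong (ℕ._+ wsize u) (ℕP.+-comm (suc k) k) ∙ ℕP.+-assoc k (suc k) _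

Tuck-nf : ∀ {k u v} → Tuck k u v → nf v ≡ suc (nf u)
Tuck-nf (here _) = refl
Tuck-nf (there t) = Tuck-nf t

Tuck-ferL< : ∀ {k u v} → Valid u → Tuck k u v → All (_< k) (ferL u)
Tuck-ferL< val (here top) = ferL<⇒ val top
Tuck-ferL< (row _ _ val) (there t) = Tuck-ferL< val t

-- Rows grow by at most one cell, so a row that reaches column c + 1 in u already reached column c
-- in w.
cnt-VS : ∀ {c} → 1 ≤ c → ∀ w u → VS (rowLens w) (rowLens u) → cnt (suc c) u ≤ cnt c w
cnt-VS p w [] s = z≤n
cnt-VS {c} p [] ((j , b) ∷ u) s = subst (_≤ 0) (sym (cnt-no {suc c} {j} u (s≤s (≤-trans (snd (s 0)) p)))) (cnt-VS p [] u (VS-[]tail s))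
cnt-VS {c} p ((k , b) ∷ w) ((j , b') ∷ u) s with c ℕ.≤? k
... | yes q = subst (cnt (suc c) ((j , b') ∷ u) ≤_) (sym (cnt-yes w q)) (+-mono-≤ (one≤1 (suc c) j) (cnt-VS p w u (VS-tail s)))
... | no ¬q = subst₂ _≤_ (sym (cnt-no {suc c} {j} u (s≤s (≤-trans (snd (s 0)) (≰⇒> ¬q))))) (sym (cnt-no w (≰⇒> ¬q)))
  (cnt-VS p w u (VS-tail s))

-- Rows of length k + 1 in u stand against rows of w of length k (or new rows if k = 0). When
-- `fer k` goes below them they slide up against the added top row k, and no growth exceeds one.
VS-tuck : ∀ {k w u v} → Valid w → HeadLt (fer k) w → VS (rowLens w) (rowLens u) → Tuck k u v → VS (k ∷ rowLens w) (rowLens v)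
VS-tuck val top s (here _) = VS-cons ≤-refl (n≤1+n _) s
VS-tuck {k} {[]} val top s (there {v = v} t) with ≤-antisym (≤-pred (snd (s 0))) z≤n
... | refl = VS-cons z≤n ≤-refl (VS-0' {rowLens v} (VS-tuck [] [] (VS-[]tail s) t))
VS-tuck {k} {(j , b) ∷ w} (row {b = b} pos top' val) (p ∷ _) s (there t) with ≤-antisym (All.head (rows≤ {k} (row {b = b} pos top' val) (p ∷ w))) (≤-pred (snd (s 0)))
... | refl = VS-cons (n≤1+n _) ≤-refl (VS-tuck val top' (VS-tail s) t)

shift-low : ∀ {k xs} w → All (_< k) xs → All (λ x → one (suc x) k ℕ.+ cnt (suc x) w ≡ suc (cnt (suc x) w) × one x k ℕ.+ cnt x w ≡ suc (cnt x w)) xs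
shift-low w = All.map (λ p → cnt-yes w p , cnt-yes w (<⇒≤ p))

shift-high : ∀ {k ys} w → All (_< k) ys → All (λ y → one (suc y) k ℕ.+ cnt (suc y) w ≡ suc (cnt (suc y) w)) ys
shift-high w = All.map (λ p → cnt-yes w p)

lengths : ∀ v w → nf v ≡ nf w → length (ferL v) ≡ length (ferL w)
lengths v w p = length-ferL v ∙ p ∙ sym (length-ferL w)

PV-up : ∀ {c w n v} → Valid (c ∷ w) → Valid v → HeadLt (fer (suc (fst c))) v → PV w n v → PV (c ∷ w) (suc n) (up c ∷ v)
PV-up {bos k} {w} {n} {v} (row _ top val) vv top' (pv f s b c) = pv f (VS-cons (n≤1+n k) ≤-refl s)
  (cong (suc k ℕ.+_) b ∙ sym (ℕP.+-assoc (suc k) _ n) ∙ sym (+-suc (k ℕ.+ wsize w) n))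
  (condV-shift (lengths v w f) (shift-low w (ferL<⇒ val top)) (shift-high v (ferL<⇒ vv top')) c)
PV-up {fer k} {w} {n} {v} (row _ top val) vv top' (pv f s b c) = pv (cong suc f) (VS-cons (n≤1+n k) ≤-refl s)
  (cong (suc k ℕ.+_) b ∙ sym (ℕP.+-assoc (suc k) _ n) ∙ sym (+-suc (k ℕ.+ wsize w) n))
  (condV-cons (inl (cnt-no w ≤-refl ∙ cnt-top val top ∙
      sym (cnt-no v ≤-refl ∙ cnt-top vv top')) , λ p → ⊥-elim (1+n≢n (sym p)))
    (condV-shift (lengths v w f) (shift-low w (ferL<⇒ val top)) (shift-high v (ferL<⇒ vv top')) c))

PV-bos : ∀ {k w n u} → Valid (bos k ∷ w) → Valid u → HeadLt (fer k) u → PV w n u → PV (bos k ∷ w) n (bos k ∷ u)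
PV-bos {k} {w} {n} {u} (row _ top val) vu top' (pv f s b c) = pv f (VS-cons ≤-refl (n≤1+n k) s)
  (cong (k ℕ.+_) b ∙ sym (ℕP.+-assoc k _ n))
  (condV-shift (lengths u w f) (shift-low w (ferL<⇒ val top)) (shift-high u (ferL<⇒ vu top')) c)

PV-tuck : ∀ {k w n u v} → Valid (fer k ∷ w) → Valid u → Tuck k u v → PV w n u → PV (fer k ∷ w) n v
PV-tuck {k} {w} {n} {u} {v} (row _ top val) vu t (pv f s b c) = pv (Tuck-nf t ∙ cong suc f) (VS-tuck val top s t)
  (Tuck-size t ∙ cong (k ℕ.+_) b ∙ sym (ℕP.+-assoc k _ n))
  (subst (CondV _ _ (k ∷ ferL w)) (sym (Tuck-ferL t))
    (condV-cons (inr refl , λ _ 1≤k → subst₂ (λ x y → suc x ≤ y) (sym (Tuck-cnt (suc k) t ∙ cong (ℕ._+ cnt (suc k) u) (one-no {suc k} {k} ≤-refl)))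
        (sym (cnt-yes w ≤-refl)) (s≤s (cnt-VS 1≤k w u s)))
      (condV-shift (lengths u w f) (shift-low w (ferL<⇒ val top))
        (All.map (λ {y} p → Tuck-cnt (suc y) t ∙ cong (ℕ._+ cnt (suc y) u) (one-yes p)) (Tuck-ferL< vu t)) c)))

push-PV : ∀ {c w n u} → Valid (c ∷ w) → Valid u × HeadLt (fer (suc (fst c))) u × PV w n u → All (PV (c ∷ w) n) (push c u)
push-PV {bos k} {w} {n} {u} vw (vu , top , p) = All.map
  (λ { (inl (refl , h)) → PV-bos vw vu h p ; (inr (() , _)) }) (push-form k false u top vu)
push-PV {fer k} {w} {n} {u} vw (vu , top , p) = All.map
  (λ { (inl (refl , h)) → PV-tuck vw vu (here h) p ; (inr (_ , t)) → PV-tuck vw vu t p }) (push-form k true u top vu)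

V-sound : ∀ {w} → Valid w → ∀ n → All (PV w n) (V w n)
V-sound [] zero = pv refl (λ i → z≤n , z≤n) refl (condV (λ _ ())) ∷ []
V-sound [] (suc n) = All-map (bos 1 ∷_)
  (λ u (pv f s b c) → pv f (VS-[]cons ≤-refl s) (cong suc b) (condV (λ _ ()))) (V-sound [] n)
V-sound {c ∷ w} vw@(row pos top val) n = go n
  where
  pushed : ∀ n → All (PV (c ∷ w) n) (concatMap (push c) (V w n))
  pushed n = All-concatMap (push c) (λ u (q , p) → push-PV vw (fst q , snd q (fst c) top , p)) (zip-All (V-valid n val) (V-sound val n))
  go : ∀ n → All (PV (c ∷ w) n) (V (c ∷ w) n)
  go zero = pushed zero
  go (suc n) = All-++ (All-map (up c ∷_) (λ u (q , p) → PV-up vw (fst q) (snd q (fst c) top) p) (zip-All (V-valid n val) (V-sound val n))) (pushed (suc n))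

untuck : ∀ {k v ys} → Valid v → HeadLt (fer (suc k)) v → ferL v ≡ k ∷ ys → Σ Mono λ u → Tuck k u v × Valid u
untuck {k} (row {j} {true} pos top val) _ refl = _ , here top , val
untuck {k} (row {j} {false} {v} pos top val) (p ∷ _) eq with ≤-antisym p (All.head (subst (All (_< j)) eq (ferL<⇒ val top)))
... | refl with untuck val (tops top) eq
  where
  tops : ∀ {v} → HeadLt (fer (suc k)) v → HeadLt (fer (suc k)) v
  tops x = x
... | u , t , vu = bos (suc k) ∷ u , there t , row pos (below t top) vu
  where
  below : ∀ {u v} → Tuck k u v → HeadLt (fer (suc k)) v → HeadLt (fer (suc k)) u
  below (here h) _ = HeadLt-weaken h ≤-refl
  below (there t) (q ∷ _) = q ∷ _

-- Undoing the slide requires a row of w of length k for each row of length k + 1, unless k = 0,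
-- where new rows are allowed. The last hypothesis, which is the bound in condition (2'), supplies
-- these rows.
VS-untuck : ∀ {k w u v} → Valid w → HeadLt (fer k) w → Tuck k u v → VS (k ∷ rowLens w) (rowLens v) →
  (1 ≤ k → cnt (suc k) u ≤ cnt k w) → VS (rowLens w) (rowLens u)
VS-untuck val top (here _) s c = VS-tail s
VS-untuck {zero} {[]} val top (there {v = v} t) s c = VS-[]cons ≤-refl (VS-untuck [] [] t (VS-0 {rowLens v} (VS-tail s)) (λ ()))
VS-untuck {suc k} {[]} val top (there {u} t) s c = ⊥-elim (n≮0 (subst (_≤ 0) (cnt-yes {suc (suc k)} {suc (suc k)} u ≤-refl) (c (s≤s z≤n))))
VS-untuck {zero} {bos .0 ∷ w} (row () _ _) (z≤n ∷ _) (there t) s c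
VS-untuck {zero} {fer j ∷ w} val (() ∷ _) (there t) s c
VS-untuck {suc k} {(j , b) ∷ w} vw@(row {b = b} pos top' val) top@(p ∷ _) (there {u} t) s c with m≤n⇒m<n∨m≡n (All.head (rows≤ vw top))
... | inl j<k = ⊥-elim (n≮0 (≤-trans (subst (1 ≤_) (sym (cnt-yes {suc (suc k)} {suc (suc k)} u ≤-refl)) (s≤s z≤n))
    (subst (cnt (suc (suc k)) (bos (suc (suc k)) ∷ u) ≤_) (cnt-no w j<k ∙ cnt-0 (All.map (λ q → ≤-<-trans q j<k) (rows≤ val top'))) (c (s≤s z≤n)))))
... | inr refl = VS-cons (n≤1+n _) ≤-refl (VS-untuck val top' t (VS-tail s)
    (λ q → ≤-pred (subst₂ _≤_ (cnt-yes {suc (suc k)} {suc (suc k)} u ≤-refl) (cnt-yes {suc k} {suc k} w ≤-refl) (c q))))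

VS-size : ∀ w v → VS (rowLens w) (rowLens v) → wsize w ≤ wsize v
VS-size [] v s = z≤n
VS-size ((k , b) ∷ w) [] s = +-mono-≤ (fst (s 0)) (VS-size w [] (λ i → fst (s (suc i)) , z≤n))
VS-size ((k , b) ∷ w) (d ∷ v) s = +-mono-≤ (fst (s 0)) (VS-size w v (VS-tail s))

first-pos : ∀ {n} {xs : List ℕ} → suc n ≡ length xs → 0 < length xs
first-pos {xs = x ∷ xs} _ = s≤s z≤n

∈-push : ∀ {c w u v} n → u ∈ V w n → v ∈ push c u → v ∈ V (c ∷ w) n
∈-push {c} {w} n p q = go n (∈-concatMap⁺ (push c) (Any.map (λ { refl → q }) p))
  where
  go : ∀ n → _ ∈ concatMap (push c) (V w n) → _ ∈ V (c ∷ w) n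
  go zero r = r
  go (suc n) r = ∈-++⁺ʳ (map (up c ∷_) (V w n)) r

-- The first circle of Λ lies below an uncircled row of length k; neither its row nor its column can
-- be that of a circle ending the first row.
no-new-circle : ∀ {k w k' v n} → Valid (bos k ∷ w) → Valid (fer k' ∷ v) → ¬ PV (bos k ∷ w) n (fer k' ∷ v)
no-new-circle {k} {w} {k'} {v} (row pos top val) (row _ top' val') (pv f s b c) = impossible (fst (at-row c 0 q))
  where
  q = first-pos {xs = ferL w} (lengths (fer k' ∷ v) w f)
  x<k = nth-All (ferL<⇒ val top) 0 q
  impossible : cnt (suc (nth (ferL w) 0)) (bos k ∷ w) ≡ cnt (suc k') (fer k' ∷ v) ⊎ nth (ferL w) 0 ≡ k' → ⊥
  impossible (inl r) = 1+n≢0 (sym (cnt-yes w x<k) ∙ r ∙ cnt-no v ≤-refl ∙ cnt-top val' top')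
  impossible (inr r) = <⇒≱ x<k (subst (k ≤_) (sym r) (fst (s 0)))

-- The first rows decide the branch of `V`: grown, kept, or abandoned by its circle. In the last
-- case the circle stays in its column, below rows of length k + 1, and `untuck` takes it out.
V-complete : ∀ {w v} n → Valid w → Valid v → PV w n v → v ∈ V w n
V-complete {[]} {[]} zero _ _ _ = Any.here refl
V-complete {[]} {[]} (suc n) _ _ (pv _ _ () _)
V-complete {[]} {fer _ ∷ v} n _ _ (pv () _ _ _)
V-complete {[]} {bos zero ∷ v} n _ (row () _ _) _
V-complete {[]} {bos (suc k) ∷ v} zero _ _ (pv _ _ () _)
V-complete {[]} {bos (suc k) ∷ v} (suc n) _ (row _ _ val) (pv f s b c) with ≤-antisym (≤-pred (snd (s 0))) z≤n
... | refl = ∈-map⁺ (bos 1 ∷_) (V-complete n [] val (pv f (VS-[]tail s) (suc-injective b) (condV (λ _ ()))))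
V-complete {bos k ∷ w} {[]} n (row pos _ _) _ (pv _ s _ _) = ⊥-elim (<⇒≱ pos (fst (s 0)))
V-complete {fer k ∷ w} {[]} n _ _ (pv () _ _ _)
V-complete {c@(k , i) ∷ w} {(k' , i') ∷ v} n vw@(row pos top val) vv@(row pos' top' val') p@(pv f s b cc) with m≤n⇒m<n∨m≡n (snd (s 0))
V-complete {bos k ∷ w} {fer k' ∷ v} n vw vv p | _ = ⊥-elim (no-new-circle vw vv p)
V-complete {bos k ∷ w} {bos k' ∷ v} n (row pos top val) (row pos' top' val') (pv f s b cc) | inl k'≤k with ≤-antisym (≤-pred k'≤k) (fst (s 0))
... | refl = ∈-push n (V-complete n val val' (pv f (VS-tail s) (+-cancelˡ-≡ k _ _ (b ∙ ℕP.+-assoc k _ n))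
      (condV-unshift (lengths v w f) (shift-low w (ferL<⇒ val top)) (shift-high v (ferL<⇒ val' top')) cc)))
    (subst (bos k ∷ v ∈_) (sym (push-under k false v top')) (Any.here refl))
V-complete {bos k ∷ w} {bos .(suc k) ∷ v} zero (row pos top val) (row pos' top' val') (pv f s b cc) | inr refl =
  ⊥-elim (1+n≰n (≤-trans (s≤s (+-monoʳ-≤ k (VS-size w v (VS-tail s)))) (≤-reflexive (b ∙ ℕP.+-identityʳ _))))
V-complete {bos k ∷ w} {bos .(suc k) ∷ v} (suc n) (row pos top val) (row pos' top' val') (pv f s b cc) | inr refl =
  ∈-++⁺ˡ (∈-map⁺ (up (bos k) ∷_) (V-complete n val val' (pv f (VS-tail s)
    (+-cancelˡ-≡ (suc k) _ _ (b ∙ +-suc _ n ∙ ℕP.+-assoc (suc k) _ n))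
    (condV-unshift (lengths v w f) (shift-low w (ferL<⇒ val top)) (shift-high v (ferL<⇒ val' top')) cc))))
V-complete {fer k ∷ w} {fer k' ∷ v} n (row pos top val) (row pos' top' val') (pv f s b cc) | inl k'≤k with ≤-antisym (≤-pred k'≤k) (fst (s 0))
... | refl = ∈-push n (V-complete n val val' (pv (suc-injective f) (VS-tail s) (+-cancelˡ-≡ k _ _ (b ∙ ℕP.+-assoc k _ n))
      (condV-unshift (lengths v w (suc-injective f)) (shift-low w (ferL<⇒ val top)) (shift-high v (ferL<⇒ val' top')) (condV-tail cc))))
    (Tuck-push (here top'))
V-complete {fer k ∷ w} {fer .(suc k) ∷ v} zero (row pos top val) (row pos' top' val') (pv f s b cc) | inr refl =
  ⊥-elim (1+n≰n (≤-trans (s≤s (+-monoʳ-≤ k (VS-size w v (VS-tail s)))) (≤-reflexive (b ∙ ℕP.+-identityʳ _))))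
V-complete {fer k ∷ w} {fer .(suc k) ∷ v} (suc n) (row pos top val) (row pos' top' val') (pv f s b cc) | inr refl =
  ∈-++⁺ˡ (∈-map⁺ (up (fer k) ∷_) (V-complete n val val' (pv (suc-injective f) (VS-tail s)
    (+-cancelˡ-≡ (suc k) _ _ (b ∙ +-suc _ n ∙ ℕP.+-assoc (suc k) _ n))
    (condV-unshift (lengths v w (suc-injective f)) (shift-low w (ferL<⇒ val top)) (shift-high v (ferL<⇒ val' top')) (condV-tail cc)))))
V-complete {fer k ∷ w} {bos k' ∷ v} n (row pos top val) vv@(row pos' top' val') (pv f s b cc) | le = tucked-case (ferL v) refl
  where
  tucked-case : ∀ ys → ferL v ≡ ys → bos k' ∷ v ∈ V (fer k ∷ w) n
  tucked-case [] eq = ⊥-elim (1+n≢0 (sym f ∙ sym (length-ferL v) ∙ cong length eq))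
  tucked-case (y ∷ ys) eq = go (fst (at-row cc 0 (s≤s z≤n)))
    where
    y<k' : y < k'
    y<k' = All.head (subst (All (_< k')) eq (ferL<⇒ val' top'))
    nth-eq : nth (ferL v) 0 ≡ y
    nth-eq = cong (λ l → nth l 0) eq
    go : cnt (suc k) (fer k ∷ w) ≡ cnt (suc (nth (ferL v) 0)) (bos k' ∷ v) ⊎ k ≡ nth (ferL v) 0 → bos k' ∷ v ∈ V (fer k ∷ w) n
    go (inl r) = ⊥-elim (1+n≢0 (sym (cnt-yes v y<k') ∙ cong (λ z → cnt (suc z) (bos k' ∷ v)) (sym nth-eq) ∙
      sym r ∙ cnt-no w ≤-refl ∙ cnt-top val top))
    go (inr r) with r ∙ nth-eq
    ... | refl with untuck {k} vv (snd (s 0) ∷ v) eq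
    ... | u , t , vu = ∈-push n (V-complete n val vu (pv (suc-injective (sym (Tuck-nf t) ∙ f))
        (VS-untuck val top t s bound-t) (+-cancelˡ-≡ k _ _ (sym (Tuck-size t) ∙ b ∙ ℕP.+-assoc k _ n))
        (condV-unshift (lengths u w (suc-injective (sym (Tuck-nf t) ∙ f))) (shift-low w (ferL<⇒ val top))
          (All.map (λ {y} p → Tuck-cnt (suc y) t ∙ cong (ℕ._+ cnt (suc y) u) (one-yes p)) (Tuck-ferL< vu t))
          (condV-tail (subst (CondV _ _ (k ∷ ferL w)) (Tuck-ferL t) cc))))) (Tuck-push t)
      where
      bound-t : 1 ≤ k → cnt (suc k) u ≤ cnt k w
      bound-t 1≤k = ≤-pred (subst₂ _≤_
        (cong suc (cong (λ z → cnt (suc z) (bos k' ∷ v)) nth-eq ∙ Tuck-cnt (suc k) t ∙ cong (ℕ._+ cnt (suc k) u) (one-no {suc k} {k} ≤-refl)))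
        (cnt-yes w ≤-refl) (snd (at-row cc 0 (s≤s z≤n)) r 1≤k))

-- The horizontal-strip rule.

HS : List ℕ → List ℕ → Set
HS μ ν = ∀ i → nth μ i ≤ nth ν i × nth ν (suc i) ≤ nth μ i

HS-cons : ∀ {k k' μ ν} → k ≤ k' → nth ν 0 ≤ k → HS μ ν → HS (k ∷ μ) (k' ∷ ν)
HS-cons p q s zero = p , q
HS-cons p q s (suc i) = s i

HS-tail : ∀ {k k' μ ν} → HS (k ∷ μ) (k' ∷ ν) → HS μ ν
HS-tail s i = s (suc i)

HS-head : ∀ {p p' μ ν} → nth μ 0 ≤ p' → HS μ (p ∷ ν) → HS μ (p' ∷ ν)
HS-head q s zero = q , snd (s 0)
HS-head q s (suc i) = s (suc i)

-- As in `CondV`, with the row lengths μ for the bound in condition (2). The circle of x lies in row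
-- 1 + N (x + 1), so r ≥ 2 reads 1 ≤ N (x + 1), and the row above it has index N (x + 1) ∸ 1 counted
-- from 0.
record CondH (N N' : ℕ → ℕ) (xs ys μ : List ℕ) : Set where
  constructor condH
  field
    at-col : ∀ i → i < length xs →
      (N (suc (nth xs i)) ≡ N' (suc (nth ys i)) ⊎ nth xs i ≡ nth ys i) ×
      (N (suc (nth xs i)) ≡ N' (suc (nth ys i)) → 1 ≤ N (suc (nth xs i)) → suc (nth ys i) ≤ nth μ (N (suc (nth xs i)) ∸ 1))
open CondH public

condH-shift : ∀ {N N₁ N' N₁' : ℕ → ℕ} {xs ys k μ} → length ys ≡ length xs →
  All (λ x → N₁ (suc x) ≡ suc (N (suc x))) xs → All (λ y → y < k × N₁' (suc y) ≡ suc (N' (suc y))) ys →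
  CondH N N' xs ys μ → CondH N₁ N₁' xs ys (k ∷ μ)
condH-shift {N} {N₁} {N'} {N₁'} {xs} {ys} {k} {μ} le a a' c .at-col i p = row-or-col (fst (at-col c i p)) ,
  λ q _ → subst (λ r → suc (nth ys i) ≤ nth (k ∷ μ) (r ∸ 1)) (sym px)
    (limit (N (suc (nth xs i))) (snd (at-col c i p) (suc-injective (sym px ∙ q ∙ snd py))))
  where
  px = nth-All a i p
  py = nth-All a' i (subst (i <_) (sym le) p)
  row-or-col : N (suc (nth xs i)) ≡ N' (suc (nth ys i)) ⊎ nth xs i ≡ nth ys i → N₁ (suc (nth xs i)) ≡ N₁' (suc (nth ys i)) ⊎ nth xs i ≡ nth ys i
  row-or-col (inl q) = inl (px ∙ cong suc q ∙ sym (snd py))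
  row-or-col (inr q) = inr q
  limit : ∀ m → (1 ≤ m → suc (nth ys i) ≤ nth μ (m ∸ 1)) → suc (nth ys i) ≤ nth (k ∷ μ) m
  limit zero f = fst py
  limit (suc m) f = f (s≤s z≤n)

condH-unshift : ∀ {N N₁ N' N₁' : ℕ → ℕ} {xs ys k μ} → length ys ≡ length xs →
  All (λ x → N₁ (suc x) ≡ suc (N (suc x))) xs → All (λ y → N₁' (suc y) ≡ suc (N' (suc y))) ys →
  CondH N₁ N₁' xs ys (k ∷ μ) → CondH N N' xs ys μ
condH-unshift {N} {N₁} {N'} {N₁'} {xs} {ys} {k} {μ} le a a' c .at-col i p = row-or-col (fst (at-col c i p)) ,
  λ q → limit (N (suc (nth xs i)))
    (subst (λ r → suc (nth ys i) ≤ nth (k ∷ μ) (r ∸ 1)) px (snd (at-col c i p) (px ∙ cong suc q ∙ sym py) (subst (1 ≤_) (sym px) (s≤s z≤n))))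
  where
  px = nth-All a i p
  py = nth-All a' i (subst (i <_) (sym le) p)
  row-or-col : N₁ (suc (nth xs i)) ≡ N₁' (suc (nth ys i)) ⊎ nth xs i ≡ nth ys i → N (suc (nth xs i)) ≡ N' (suc (nth ys i)) ⊎ nth xs i ≡ nth ys i
  row-or-col (inl q) = inl (suc-injective (sym px ∙ q ∙ py))
  row-or-col (inr q) = inr q
  limit : ∀ m → suc (nth ys i) ≤ nth (k ∷ μ) m → 1 ≤ m → suc (nth ys i) ≤ nth μ (m ∸ 1)
  limit (suc m) f _ = f

condH-cons : ∀ {N N' x y xs ys μ} → N (suc x) ≡ 0 → (N (suc x) ≡ N' (suc y) ⊎ x ≡ y) →
  CondH N N' xs ys μ → CondH N N' (x ∷ xs) (y ∷ ys) μ
condH-cons r p c .at-col zero _ = p , λ _ q → ⊥-elim (n≮0 (subst (1 ≤_) r q))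
condH-cons r p c .at-col (suc i) (s≤s q) = at-col c i q

condH-tail : ∀ {N N' x y xs ys μ} → CondH N N' (x ∷ xs) (y ∷ ys) μ → CondH N N' xs ys μ
condH-tail c .at-col i q = at-col c (suc i) (s≤s q)

record PH (w : Mono) (n : ℕ) (v : Mono) : Set where
  constructor ph
  field
    fermions : nf v ≡ nf w
    strip-H : HS (rowLens w) (rowLens v)
    boxes : wsize v ≡ wsize w ℕ.+ n
    circles : CondH (λ c → cnt c w) (λ c → cnt c v) (ferL w) (ferL v) (rowLens w)

All-conv : ∀ {Q : Mono → Set} n {F : ℕ → ℕ → List Mono} → (∀ i j → i ℕ.+ j ≡ n → All Q (F i j)) → All Q (convL n F)
All-conv zero p = p 0 0 refl
All-conv (suc n) p = All-++ (p 0 (suc n) refl) (All-conv n (λ i j q → p (suc i) j (cong suc q)))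

∈-convL : ∀ n {F : ℕ → ℕ → List Mono} {v} i j → i ℕ.+ j ≡ n → v ∈ F i j → v ∈ convL n F
∈-convL zero zero zero refl q = q
∈-convL (suc n) zero .(suc n) refl q = ∈-++⁺ˡ q
∈-convL (suc n) {F} (suc i) j r q = ∈-++⁺ʳ (F 0 (suc n)) (∈-convL n i j (suc-injective r) q)

∈-good : ∀ k {us u} → u ∈ us → HeadLt (fer k) u → u ∈ good k us
∈-good k {x ∷ us} p h with under? k x
∈-good k {x ∷ us} (Any.here refl) h | inl _ = Any.here refl
∈-good k {x ∷ us} (Any.there p) h | inl _ = Any.there (∈-good k p h)
∈-good k {x ∷ us} (Any.here refl) h | inr n = ⊥-elim (n h)
∈-good k {x ∷ us} (Any.there p) h | inr _ = ∈-good k p h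

head≤ : ∀ {k u} → HeadLt (fer k) u → nth (rowLens u) 0 ≤ k
head≤ [] = z≤n
head≤ (_∷_ {c = bos j} p _) = p
head≤ (_∷_ {c = fer j} p _) = <⇒≤ p

shift-x : ∀ {k xs} w → All (_< k) xs → All (λ x → one (suc x) k ℕ.+ cnt (suc x) w ≡ suc (cnt (suc x) w)) xs
shift-x w = All.map (λ p → cnt-yes w p)

shift-y : ∀ {k k' ys} u → k ≤ k' → All (_< k) ys → All (λ y → y < k × one (suc y) k' ℕ.+ cnt (suc y) u ≡ suc (cnt (suc y) u)) ys
shift-y u q = All.map (λ p → p , cnt-yes u (≤-trans p q))

boxes-cons : ∀ k w u i j n → i ℕ.+ j ≡ n → wsize u ≡ wsize w ℕ.+ j → (k ℕ.+ i) ℕ.+ wsize u ≡ (k ℕ.+ wsize w) ℕ.+ n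
boxes-cons k w u i j .(i ℕ.+ j) refl b = cong ((k ℕ.+ i) ℕ.+_) b ∙
  ℕ-solve 4 (λ k i w j → (k ⊕ i) ⊕ (w ⊕ j) ⊜ (k ⊕ w) ⊕ (i ⊕ j)) refl k i (wsize w) j

PH-row : ∀ {k b w i j n u} → Valid ((k , b) ∷ w) → Valid u → HeadLt (fer k) u → i ℕ.+ j ≡ n → PH w j u → PH ((k , b) ∷ w) n ((k ℕ.+ i , b) ∷ u)
PH-row {k} {false} {w} {i} {j} {n} {u} (row _ top val) vu hu e (ph f s bx c) = ph f (HS-cons (m≤m+n k i) (head≤ hu) s)
  (boxes-cons k w u i j n e bx)
  (condH-shift (lengths u w f) (shift-x w (ferL<⇒ val top)) (shift-y u (m≤m+n k i) (ferL<⇒ vu hu)) c)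
PH-row {k} {true} {w} {i} {j} {n} {u} (row _ top val) vu hu e (ph f s bx c) = ph (cong suc f) (HS-cons (m≤m+n k i) (head≤ hu) s)
  (boxes-cons k w u i j n e bx)
  (condH-cons none (inl (none ∙ sym (cnt-0 {suc (k ℕ.+ i)} {fer (k ℕ.+ i) ∷ u} (≤-refl ∷ All.map (λ p → s≤s (≤-trans p (m≤m+n k i))) (rows≤ vu hu)))))
    (condH-shift (lengths u w f) (shift-x w (ferL<⇒ val top)) (shift-y u (m≤m+n k i) (ferL<⇒ vu hu)) c))
  where
  none = cnt-no {suc k} {k} w ≤-refl ∙ cnt-top val top

HS-tuck : ∀ {k p μ ν} → nth μ 0 ≤ k → k ≤ p → HS μ (p ∷ ν) → HS (k ∷ μ) (p ∷ k ∷ ν)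
HS-tuck {μ = μ} q r s = HS-cons r ≤-refl (HS-head {μ = μ} (≤-trans q ≤-refl) s)

cnt-second : ∀ p k u {y} → y < k → one (suc y) p ℕ.+ (one (suc y) k ℕ.+ cnt (suc y) u) ≡ suc (one (suc y) p ℕ.+ cnt (suc y) u)
cnt-second p k u {y} q = cong (one (suc y) p ℕ.+_) (cnt-yes u q) ∙ +-suc _ _

PH-tuck : ∀ {k w n p u} → Valid (fer k ∷ w) → Valid (bos p ∷ u) → HeadLt (fer k) u → k < p → PH w n (bos p ∷ u) → PH (fer k ∷ w) n (bos p ∷ fer k ∷ u)
PH-tuck {k} {w} {n} {p} {u} (row _ top val) (row _ _ vu) hu k<p (ph f s bx c) = ph (cong suc f) (HS-tuck (head≤ top) (<⇒≤ k<p) s)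
  (ℕ-solve 3 (λ p k u → p ⊕ (k ⊕ u) ⊜ k ⊕ (p ⊕ u)) refl p k (wsize u) ∙ cong (k ℕ.+_) bx ∙ sym (ℕP.+-assoc k _ n))
  (condH-cons (cnt-no {suc k} {k} w ≤-refl ∙ cnt-top val top) (inr refl)
    (condH-shift (lengths u w f) (shift-x w (ferL<⇒ val top)) (All.map (λ q → q , cnt-second p k u q) (ferL<⇒ vu hu)) c))

P-sound : ∀ {w} → Valid w → ∀ n → All (PH w n) (P w n)
P-sound [] zero = ph refl (λ i → z≤n , z≤n) refl (condH (λ _ ())) ∷ []
P-sound [] (suc n) = ph refl (λ i → z≤n , z≤n) (ℕP.+-identityʳ _) (condH (λ _ ())) ∷ []
P-sound {(k , b) ∷ w} vw@(row pos top val) n = go b refl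
  where
  rowed : All (PH ((k , b) ∷ w) n) (convL n (λ i j → map ((k ℕ.+ i , b) ∷_) (good k (P w j))))
  rowed = All-conv n (λ i j e → All-map ((k ℕ.+ i , b) ∷_) (λ u ((v , p) , hu) → PH-row vw v hu e p) (good-All k (zip-All (fst (P-valid val j)) (P-sound val j))))
  tucks : b ≡ true → ∀ u → (Valid u × Second k u) × PH w n u → All (PH ((k , b) ∷ w) n) (tuck k u)
  tucks _ [] _ = []
  tucks _ (fer p ∷ u) _ = []
  tucks refl (bos p ∷ u) ((v , hu) , q) with p ℕ.≤? k
  ... | yes _ = []
  ... | no ¬r = PH-tuck vw v hu (≰⇒> ¬r) q ∷ []
  go : ∀ b' → b ≡ b' → All (PH ((k , b) ∷ w) n) (P ((k , b) ∷ w) n)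
  go false refl = rowed
  go true refl = All-++ rowed (All-concatMap (tuck k) (tucks refl) (zip-All (zip-All (fst (P-valid val n)) (snd (P-valid val n) k top)) (P-sound val n)))

-- The first row below the top row d of the product fits under the top row of length k.
under-top : ∀ {k w k' v} → All (_< k) (ferL w) → length (ferL v) ≡ length (ferL w) → HeadLt (fer k') v → Valid v → nth (rowLens v) 0 ≤ k →
  CondH (λ c → one c k ℕ.+ cnt c w) (λ c → one c k' ℕ.+ cnt c v) (ferL w) (ferL v) (k ∷ rowLens w) → HeadLt (fer k) v
under-top {v = []} _ _ _ _ _ _ = []
under-top {v = bos j ∷ v} _ _ _ _ q _ = q ∷ v
under-top {k} {w} {k'} {fer j ∷ v} a le (j<k' ∷ _) (row _ top val) q c = go (fst (at-col c 0 r)) ∷ v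
  where
  r = first-pos {xs = ferL w} le
  x = nth (ferL w) 0
  N'≡1 : one (suc j) k' ℕ.+ (one (suc j) j ℕ.+ cnt (suc j) v) ≡ 1
  N'≡1 = cnt-yes (fer j ∷ v) j<k' ∙ cong suc (cnt-no {suc j} {j} v ≤-refl ∙ cnt-top val top)
  go : one (suc x) k ℕ.+ cnt (suc x) w ≡ one (suc j) k' ℕ.+ (one (suc j) j ℕ.+ cnt (suc j) v) ⊎ x ≡ j → j < k
  go (inr e) = subst (_< k) e (nth-All a 0 r)
  go (inl e) = subst (λ z → suc j ≤ nth (k ∷ rowLens w) (z ∸ 1)) (e ∙ N'≡1) (snd (at-col c 0 r) e (subst (1 ≤_) (sym (e ∙ N'≡1)) ≤-refl))

HS-size : ∀ w v → HS (rowLens w) (rowLens v) → wsize w ≤ wsize v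
HS-size [] v s = z≤n
HS-size ((k , b) ∷ w) [] s = +-mono-≤ (fst (s 0)) (HS-size w [] (λ i → fst (s (suc i)) , z≤n))
HS-size ((k , b) ∷ w) (d ∷ v) s = +-mono-≤ (fst (s 0)) (HS-size w v (HS-tail s))

split-boxes : ∀ k i w v n → wsize w ≤ wsize v → (k ℕ.+ i) ℕ.+ wsize v ≡ (k ℕ.+ wsize w) ℕ.+ n → Σ ℕ λ j → i ℕ.+ j ≡ n × wsize v ≡ wsize w ℕ.+ j
split-boxes k i w v n le e with ℕP.m≤n⇒∃[o]m+o≡n le
... | j , q = j , +-cancelˡ-≡ (k ℕ.+ wsize w) _ _ (ℕ-solve 4 (λ k w i j → (k ⊕ w) ⊕ (i ⊕ j) ⊜ (k ⊕ i) ⊕ (w ⊕ j)) refl k (wsize w) i j ∙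
  cong ((k ℕ.+ i) ℕ.+_) q ∙ e) , sym q

-- If the first circle has left the first row, it is still in its column. Interlacing bounds the
-- second row of Ω by k, so this row is `fer k`, and removing it undoes `tuck`.
P-complete : ∀ {w v} n → Valid w → Valid v → PH w n v → v ∈ P w n
P-complete {[]} {[]} zero _ _ _ = Any.here refl
P-complete {[]} {[]} (suc n) _ _ (ph _ _ () _)
P-complete {[]} {fer _ ∷ v} n _ _ (ph () _ _ _)
P-complete {[]} {bos zero ∷ v} n _ (row () _ _) _
P-complete {[]} {bos (suc k) ∷ []} (suc n) _ _ (ph _ _ b _) = subst (λ z → bos z ∷ [] ∈ P [] (suc n)) (sym (sym (ℕP.+-identityʳ _) ∙ b)) (Any.here refl)
P-complete {[]} {bos (suc k) ∷ fer _ ∷ v} n _ _ (ph () _ _ _)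
P-complete {[]} {bos (suc k) ∷ bos zero ∷ v} n _ (row _ _ (row () _ _)) _
P-complete {[]} {bos (suc k) ∷ bos (suc j) ∷ v} n _ _ (ph _ s _ _) = ⊥-elim (n≮0 (snd (s 0)))
P-complete {[]} {bos (suc k) ∷ []} zero _ _ (ph _ _ () _)
P-complete {bos k ∷ w} {[]} n (row pos _ _) _ (ph _ s _ _) = ⊥-elim (<⇒≱ pos (fst (s 0)))
P-complete {fer k ∷ w} {[]} n _ _ (ph () _ _ _)
P-complete {bos k ∷ w} {fer k' ∷ v} n (row pos top val) (row _ top' val') (ph f s b c) = ⊥-elim (impossible (fst (at-col c 0 q)))
  where
  q = first-pos {xs = ferL w} (lengths (fer k' ∷ v) w f)
  x<k = nth-All (ferL<⇒ val top) 0 q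
  impossible : cnt (suc (nth (ferL w) 0)) (bos k ∷ w) ≡ cnt (suc k') (fer k' ∷ v) ⊎ nth (ferL w) 0 ≡ k' → ⊥
  impossible (inl r) = 1+n≢0 (sym (cnt-yes w x<k) ∙ r ∙ cnt-no {suc k'} {k'} v ≤-refl ∙ cnt-top val' top')
  impossible (inr r) = <⇒≱ x<k (subst (k ≤_) (sym r) (fst (s 0)))
P-complete {bos k ∷ w} {bos k' ∷ v} n (row pos top val) (row pos' top' val') (ph f s b c) with ℕP.m≤n⇒∃[o]m+o≡n (fst (s 0))
... | i , refl with split-boxes k i w v n (HS-size w v (HS-tail s)) b
... | j , e , b' = ∈-convL n i j e (∈-map⁺ (bos (k ℕ.+ i) ∷_) (∈-good k (P-complete j val val' (ph f (HS-tail s) b'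
          (condH-unshift (lengths v w f) (shift-x w (ferL<⇒ val top)) (shift-x v (ferL<⇒ val' top')) c)))
          (under-top {k} {w} (ferL<⇒ val top) (lengths v w f) top' val' (snd (s 0)) c)))
P-complete {fer k ∷ w} {fer k' ∷ v} n (row pos top val) (row pos' top' val') (ph f s b c) with ℕP.m≤n⇒∃[o]m+o≡n (fst (s 0))
... | i , refl with split-boxes k i w v n (HS-size w v (HS-tail s)) b
... | j , e , b' = ∈-++⁺ˡ (∈-convL n i j e (∈-map⁺ (fer (k ℕ.+ i) ∷_) (∈-good k (P-complete j val val' (ph f' (HS-tail s) b'
          (condH-unshift (lengths v w f') (shift-x w (ferL<⇒ val top)) (shift-x v (ferL<⇒ val' top')) (condH-tail c))))
          (under-top {k} {w} (ferL<⇒ val top) (lengths v w f') top' val' (snd (s 0)) (condH-tail c)))))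
  where f' = suc-injective f
P-complete {fer k ∷ w} {bos k' ∷ v} n (row pos top val) (row pos' top' val') (ph f s b c) with fst (at-col c 0 (s≤s z≤n))
P-complete {fer k ∷ w} {bos k' ∷ v} n (row pos top val) (row pos' top' val') (ph f s b c) | inl r =
  ⊥-elim (1+n≢0 (sym (cnt-yes v (nth-All (ferL<⇒ val' top') 0 (subst (0 <_) (sym (lengths v (fer k ∷ w) f)) (s≤s z≤n)))) ∙ sym r ∙ cnt-no {suc k} {k} w ≤-refl ∙ cnt-top val top))
P-complete {fer k ∷ w} {bos k' ∷ []} n _ _ (ph () s b c) | inr r
P-complete {fer k ∷ w} {bos k' ∷ bos j ∷ v} n _ (row _ _ (row _ top' val')) (ph f s b c) | inr r =
  ⊥-elim (<⇒≱ (subst (_< j) (sym r) (nth-All (ferL<⇒ val' top') 0 (subst (0 <_) (sym (lengths v (fer k ∷ w) f)) (s≤s z≤n)))) (snd (s 0)))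
P-complete {fer k ∷ w} {bos k' ∷ fer .k ∷ u} n (row pos top val) (row pos' (k<k' ∷ _) (row _ hu vu)) (ph f s b c) | inr refl =
  ∈-++⁺ʳ (convL n _) (∈-concatMap⁺ (tuck k) (Any.map (λ { refl → tucked-here }) (P-complete n val (row pos' (HeadLt-weaken hu k<k') vu) (ph f' (HS-head {μ = rowLens w} head-bound (HS-tail s))
    (+-cancelˡ-≡ k _ _ (ℕ-solve 3 (λ p k u → k ⊕ (p ⊕ u) ⊜ p ⊕ (k ⊕ u)) refl k' k (wsize u) ∙ b ∙ ℕP.+-assoc k _ n))
    (condH-unshift (lengths u w f') (shift-x w (ferL<⇒ val top)) (All.map (λ q → cnt-second k' k u q) (ferL<⇒ vu hu)) (condH-tail c))))))
  where
  f' = suc-injective f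
  head-bound : nth (rowLens w) 0 ≤ k'
  head-bound = ≤-trans (head≤ top) (<⇒≤ k<k')
  tucked-here : bos k' ∷ fer k ∷ u ∈ tuck k (bos k' ∷ u)
  tucked-here with k' ℕ.≤? k
  ... | yes q = ⊥-elim (<⇒≱ k<k' q)
  ... | no _ = Any.here refl

left-inverse-Unique : ∀ {A B : Set} {h : A → List B} (g : B → A) (us : List A) →
  All (λ u → All (λ v → g v ≡ u) (h u) × Unique (h u)) us → Unique us → Unique (concatMap h us)
left-inverse-Unique g [] [] [] = []
left-inverse-Unique {h = h} g (u ∷ us) ((p , q) ∷ a) (n ∷ un) =
  UniqueP.++⁺ q (left-inverse-Unique g us a un) (λ { (i , j) → apart us n a (All.lookup p i) j })
  where
  apart : ∀ us {v} → All (u ≢_) us → All (λ u → All (λ v → g v ≡ u) (h u) × Unique (h u)) us → g v ≡ u → v ∈ concatMap h us → ⊥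
  apart (u' ∷ us) (n ∷ ns) ((p , _) ∷ a) e j with ∈-++⁻ (h u') j
  ... | inl k = n (sym e ∙ All.lookup p k)
  ... | inr k = apart us ns a e k

left-inverse-map : ∀ {A B : Set} {h : A → B} (g : B → A) (us : List A) → All (λ u → g (h u) ≡ u) us → Unique us → Unique (map h us)
left-inverse-map g [] [] [] = []
left-inverse-map {h = h} g (u ∷ us) (p ∷ a) (n ∷ un) = fresh us n a ∷ left-inverse-map g us a un
  where
  fresh : ∀ us → All (u ≢_) us → All (λ u → g (h u) ≡ u) us → All (h u ≢_) (map h us)
  fresh [] [] [] = []
  fresh (x ∷ us) (n ∷ ns) (q ∷ a) = (λ e → n (sym p ∙ cong g e ∙ q)) ∷ fresh us ns a

cons-Unique : ∀ (c : Letter) {us} → Unique us → Unique (map (c ∷_) us)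
cons-Unique c {us} = left-inverse-map rest us (All.universal (λ _ → refl) us)
  where
  rest : Mono → Mono
  rest [] = []
  rest (_ ∷ v) = v

apart-Unique : ∀ {A : Set} {Q R : A → Set} {xs ys : List A} → (∀ {x} → Q x → R x → ⊥) → All Q xs → All R ys →
  Unique xs → Unique ys → Unique (xs ++ ys)
apart-Unique d q r u u' = UniqueP.++⁺ u u' (λ { (i , j) → d (All.lookup q i) (All.lookup r j) })

push-Unique : ∀ c u → Unique (push c u)
push-Unique c [] = [] ∷ []
push-Unique (k , b) (d ∷ u) with <ᴸ? d k
push-Unique c (d ∷ u) | inl _ = [] ∷ []
push-Unique (fer k) (bos j ∷ u) | inr _ = cons-Unique (bos j) (push-Unique (fer k) u)
push-Unique (fer k) (fer j ∷ u) | inr _ = []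
push-Unique (bos k) (d ∷ u) | inr _ = []

-- Left inverse of `push`: the first row of length k is the inserted one, tucked or not.
pull : ℕ → Mono → Mono
pull k [] = []
pull k (d ∷ v) = if fst d ≡ᵇ k then v else d ∷ pull k v

≡ᵇ-refl : ∀ k → (k ≡ᵇ k) ≡ true
≡ᵇ-refl zero = refl
≡ᵇ-refl (suc k) = ≡ᵇ-refl k

suc≢ᵇ : ∀ k → (suc k ≡ᵇ k) ≡ false
suc≢ᵇ zero = refl
suc≢ᵇ (suc k) = suc≢ᵇ k

pull-cons : ∀ k b u → pull k ((k , b) ∷ u) ≡ u
pull-cons k b u rewrite ≡ᵇ-refl k = refl

pull-Tuck : ∀ {k u v} → Tuck k u v → pull k v ≡ u
pull-Tuck {k} {u} (here _) = pull-cons k true u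
pull-Tuck {k} (there t) rewrite suc≢ᵇ k = cong (bos (suc k) ∷_) (pull-Tuck t)

V-Unique : ∀ {w} → Valid w → ∀ n → Unique (V w n)
V-Unique [] zero = [] ∷ []
V-Unique [] (suc n) = cons-Unique (bos 1) (V-Unique [] n)
V-Unique {(k , b) ∷ w} (row pos top val) n = go n
  where
  pushed : ∀ n → Unique (concatMap (push (k , b)) (V w n))
  pushed n = left-inverse-Unique (pull k) (V w n)
    (All.map (λ {u} (vu , tu) → All.map inverse (push-form k b u (tu k top) vu) , push-Unique (k , b) u) (V-valid n val)) (V-Unique val n)
    where
    inverse : ∀ {u v} → (v ≡ (k , b) ∷ u × HeadLt (fer k) u) ⊎ (b ≡ true × Tuck k u v) → pull k v ≡ u
    inverse {u} (inl (refl , _)) = pull-cons k b u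
    inverse (inr (_ , t)) = pull-Tuck t
  Raised : Mono → Set
  Raised [] = ⊥
  Raised (c ∷ _) = c ≡ up (k , b)
  not-raised : ∀ {b'} {u v} → b' ≡ b → (v ≡ (k , b') ∷ u × HeadLt (fer k) u) ⊎ (b' ≡ true × Tuck k u v) → ¬ Raised v
  not-raised refl (inl (refl , _)) ()
  not-raised refl (inr (refl , here _)) ()
  not-raised refl (inr (refl , there _)) ()
  go : ∀ n → Unique (V ((k , b) ∷ w) n)
  go zero = pushed 0
  go (suc n) = apart-Unique {Q = Raised} {R = λ v → ¬ Raised v} (λ r ¬r → ¬r r)
    (All-map {P = λ _ → ⊤} (up (k , b) ∷_) (λ v _ → refl) (All.universal (λ _ → tt) (V w n)))
    (All-concatMap (push (k , b)) (λ u (vu , tu) → All.map (not-raised refl) (push-form k b u (tu k top) vu)) (V-valid (suc n) val))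
    (cons-Unique (up (k , b)) (V-Unique val n)) (pushed (suc n))

good-Unique : ∀ k {us} → Unique us → Unique (good k us)
good-Unique k {[]} _ = []
good-Unique k {u ∷ us} (n ∷ un) with under? k u
... | inl _ = fresh us n ∷ good-Unique k un
  where
  fresh : ∀ us → All (u ≢_) us → All (u ≢_) (good k us)
  fresh [] [] = []
  fresh (x ∷ us) (n ∷ ns) with under? k x
  ... | inl _ = n ∷ fresh us ns
  ... | inr _ = fresh us ns
... | inr _ = good-Unique k un

convL-Unique : ∀ {T : ℕ → Mono → Set} → (∀ {i j v} → T i v → T j v → i ≡ j) → ∀ n o {F : ℕ → ℕ → List Mono} →
  (∀ i j → All (T (i ℕ.+ o)) (F i j)) → (∀ i j → Unique (F i j)) → Unique (convL n F)
convL-Unique d zero o t u = u 0 0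
convL-Unique {T} d (suc n) o {F} t u = apart-Unique {Q = T o} {R = λ v → Σ ℕ λ i → T (suc i ℕ.+ o) v}
  (λ p (i , q) → m≢1+n+m o (d p q))
  (t 0 (suc n)) (All-convL n (λ i j → All.map (i ,_) (t (suc i) j)))
  (u 0 (suc n)) (convL-Unique {T} d n (suc o) (λ i j → subst (λ x → All (T x) (F (suc i) j)) (sym (+-suc i o)) (t (suc i) j)) (λ i j → u (suc i) j))

P-Unique : ∀ w n → Unique (P w n)
P-Unique [] zero = [] ∷ []
P-Unique [] (suc n) = [] ∷ []
P-Unique ((k , b) ∷ w) n = go b
  where
  T' : ℕ → Mono → Set
  T' i [] = ⊥
  T' i (c ∷ _) = fst c ≡ k ℕ.+ i
  functional : ∀ {i j v} → T' i v → T' j v → i ≡ j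
  functional {i} {j} {c ∷ v} p q = +-cancelˡ-≡ k i j (sym p ∙ q)
  rowed : ∀ b → Unique (convL n (λ i j → map ((k ℕ.+ i , b) ∷_) (good k (P w j))))
  rowed b = convL-Unique {T'} (λ {i} {j} {v} → functional {i} {j} {v}) n 0
    (λ i j → All-map {P = λ _ → ⊤} ((k ℕ.+ i , b) ∷_) (λ _ _ → cong (λ z → k ℕ.+ z) (sym (ℕP.+-identityʳ i))) (All.universal (λ _ → tt) _))
    (λ i j → cons-Unique (k ℕ.+ i , b) (good-Unique k (P-Unique w j)))
  unhook : Mono → Mono
  unhook (c ∷ d ∷ u) = c ∷ u
  unhook u = u
  Circled : Mono → Set
  Circled [] = ⊥
  Circled ((_ , b) ∷ _) = b ≡ true
  tucks : ∀ u → All (λ v → unhook v ≡ u) (tuck k u) × Unique (tuck k u) × All (λ v → ¬ Circled v) (tuck k u)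
  tucks [] = [] , [] , []
  tucks (fer p ∷ u) = [] , [] , []
  tucks (bos p ∷ u) with p ℕ.≤? k
  ... | yes _ = [] , [] , []
  ... | no _ = refl ∷ [] , [] ∷ [] , (λ ()) ∷ []
  go : ∀ b → Unique (P ((k , b) ∷ w) n)
  go false = rowed false
  go true = apart-Unique {Q = Circled} {R = λ v → ¬ Circled v} (λ r ¬r → ¬r r)
    (All-convL n (λ i j → All-map {P = λ _ → ⊤} (fer (k ℕ.+ i) ∷_) (λ _ _ → refl) (All.universal (λ _ → tt) _)))
    (All-concatMap {P = λ _ → ⊤} (tuck k) (λ u _ → snd (snd (tucks u))) (All.universal (λ _ → tt) (P w n)))
    (rowed true) (left-inverse-Unique unhook (P w n) (All.universal (λ u → fst (tucks u) , fst (snd (tucks u))) (P w n)) (P-Unique w n))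

-- The Pieri conditions on superpartitions and on words.

module _ {w v} (vw : Valid w) (vv : Valid v) where
  private
    N N' : ℕ → ℕ
    N c = cnt c w
    N' c = cnt c v

  circleRow-cnt : ∀ {u} x → circleRow (fromW u) x ≡ suc (cnt (suc x) u)
  circleRow-cnt {u} x = cong suc (cnt-parts (suc x) u)

  fdeg⇒nf : fdeg (fromW v) ≡ fdeg (fromW w) → nf v ≡ nf w
  fdeg⇒nf p = sym (length-ferL v) ∙ p ∙ length-ferL w

  nf⇒fdeg : nf v ≡ nf w → fdeg (fromW v) ≡ fdeg (fromW w)
  nf⇒fdeg p = length-ferL v ∙ p ∙ sym (length-ferL w)

  sum⇒wsize : ∀ {n} → sum (rowLens v) ≡ sum (rowLens w) ℕ.+ n → wsize v ≡ wsize w ℕ.+ n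
  sum⇒wsize {n} p = sym (sum-rowLens v) ∙ p ∙ cong (ℕ._+ n) (sum-rowLens w)

  wsize⇒sum : ∀ {n} → wsize v ≡ wsize w ℕ.+ n → sum (rowLens v) ≡ sum (rowLens w) ℕ.+ n
  wsize⇒sum {n} p = sum-rowLens v ∙ p ∙ cong (ℕ._+ n) (sym (sum-rowLens w))

  PieriV⇒PV : ∀ n → PieriV (fromW w) n (fromW v) → PV w n v
  PieriV⇒PV n (_ , f , strp , c) rewrite star-fromW vw | star-fromW vv = pv (fdeg⇒nf f) vs (sum⇒wsize (fst (snd strp))) (condV rc)
    where
    vs : VS (rowLens w) (rowLens v)
    vs i = fst strp i , thin
      where
      thin : nth (rowLens v) i ≤ suc (nth (rowLens w) i)
      thin with nth (rowLens v) i ℕ.≤? suc (nth (rowLens w) i)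
      ... | yes p = p
      -- Otherwise the two columns just beyond the old end of the row would both contain skew cells.
      ... | no ¬p = ⊥-elim (m≢1+n+m _ {0} (snd (snd strp) (suc i) _ _
              (s≤s z≤n , s≤s z≤n , ≤-trans (n≤1+n _) (≰⇒> ¬p) , ≤-refl)
              (s≤s z≤n , s≤s z≤n , ≰⇒> ¬p , n≤1+n _)))
    rc : ∀ i → i < length (ferL w) → _
    rc i p = roc (fst (c i p)) , λ q r → subst₂ _≤_ (circleRow-cnt {v} _) (cnt-rowLens (nth (ferL w) i) w) (snd (c i p) (cong suc q) (s≤s r))
      where
      roc : circleRow (fromW w) (nth (ferL w) i) ≡ circleRow (fromW v) (nth (ferL v) i) ⊎ suc (nth (ferL w) i) ≡ suc (nth (ferL v) i) → _
      roc (inl q) = inl (suc-injective (sym (circleRow-cnt {w} _) ∙ q ∙ circleRow-cnt {v} _))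
      roc (inr q) = inr (suc-injective q)

  PV⇒PieriV : ∀ n → PV w n v → PieriV (fromW w) n (fromW v)
  PV⇒PieriV n (pv f s b c) rewrite star-fromW vw | star-fromW vv =
    fromW-SP vv , nf⇒fdeg f , ((λ i → fst (s i)) , wsize⇒sum b , thin) , rc
    where
    thin : ∀ r c c' → InSkew (rowLens w) (rowLens v) r c → InSkew (rowLens w) (rowLens v) r c' → c ≡ c'
    thin r c c' (_ , _ , p , q) (_ , _ , p' , q') = at-end p q ∙ sym (at-end p' q')
      where
      at-end : ∀ {c} → c ≤ nth (rowLens v) (r ∸ 1) → nth (rowLens w) (r ∸ 1) < c → c ≡ suc (nth (rowLens w) (r ∸ 1))
      at-end p q = ≤-antisym (≤-trans p (snd (s (r ∸ 1)))) q
    rc : ∀ i → i < length (ferL w) → _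
    rc i p = roc (fst (at-row c i p)) , λ q r → subst₂ _≤_ (sym (circleRow-cnt {v} _)) (sym (cnt-rowLens (nth (ferL w) i) w)) (snd (at-row c i p) (suc-injective q) (≤-pred r))
      where
      roc : _ → circleRow (fromW w) (nth (ferL w) i) ≡ circleRow (fromW v) (nth (ferL v) i) ⊎ suc (nth (ferL w) i) ≡ suc (nth (ferL v) i)
      roc (inl q) = inl (circleRow-cnt {w} _ ∙ cong suc q ∙ sym (circleRow-cnt {v} _))
      roc (inr q) = inr (cong suc q)

  PieriH⇒PH : ∀ n → PieriH (fromW w) n (fromW v) → PH w n v
  PieriH⇒PH n (_ , f , strp , c) rewrite star-fromW vw | star-fromW vv = ph (fdeg⇒nf f) hs (sum⇒wsize (fst (snd strp))) (condH rc)
    where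
    hs : HS (rowLens w) (rowLens v)
    hs i = fst strp i , flat
      where
      flat : nth (rowLens v) (suc i) ≤ nth (rowLens w) i
      flat with nth (rowLens v) (suc i) ℕ.≤? nth (rowLens w) i
      ... | yes p = p
      -- Otherwise the last cell of the lower row would have a skew cell directly above it.
      ... | no ¬p = ⊥-elim (m≢1+n+m _ {0} (snd (snd strp) (suc i) (suc (suc i)) (nth (rowLens v) (suc i))
              (s≤s z≤n , ≤-trans (s≤s z≤n) (≰⇒> ¬p) , rows-desc vv i , ≰⇒> ¬p)
              (s≤s z≤n , ≤-trans (s≤s z≤n) (≰⇒> ¬p) , ≤-refl , ≤-trans (s≤s (rows-desc vw i)) (≰⇒> ¬p))))
        where
        rows-desc : ∀ {u} → Valid u → ∀ i → nth (rowLens u) (suc i) ≤ nth (rowLens u) i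
        rows-desc [] i = z≤n
        rows-desc (row {w = []} _ _ _) zero = z≤n
        rows-desc (row {w = _ ∷ _} _ top val) zero with rows≤ val top
        ... | p ∷ _ = p
        rows-desc (row _ _ val) (suc i) = rows-desc val i
    rc : ∀ i → i < length (ferL w) → _
    rc i p = roc (fst (c i p)) , λ q r → subst (λ z → suc (nth (ferL v) i) ≤ nth (rowLens w) (z ∸ 1)) (cnt-parts (suc (nth (ferL w) i)) w)
        (snd (c i p) (circleRow-cnt {w} _ ∙ cong suc q ∙ sym (circleRow-cnt {v} _)) (subst (2 ≤_) (sym (circleRow-cnt {w} _)) (s≤s r)))
      where
      roc : circleRow (fromW w) (nth (ferL w) i) ≡ circleRow (fromW v) (nth (ferL v) i) ⊎ suc (nth (ferL w) i) ≡ suc (nth (ferL v) i) → _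
      roc (inl q) = inl (suc-injective (sym (circleRow-cnt {w} _) ∙ q ∙ circleRow-cnt {v} _))
      roc (inr q) = inr (suc-injective q)

  PH⇒PieriH : ∀ n → PH w n v → PieriH (fromW w) n (fromW v)
  PH⇒PieriH n (ph f s b c) rewrite star-fromW vw | star-fromW vv =
    fromW-SP vv , nf⇒fdeg f , ((λ i → fst (s i)) , wsize⇒sum b , flat) , rc
    where
    below : ∀ i j → i < j → nth (rowLens v) j ≤ nth (rowLens w) i
    below i (suc j) (s≤s p) with m≤n⇒m<n∨m≡n p
    ... | inr refl = snd (s i)
    ... | inl q = ≤-trans (snd (s j)) (≤-trans (fst (s j)) (below i j q))
    clash : ∀ r r' c → InSkew (rowLens w) (rowLens v) r c → InSkew (rowLens w) (rowLens v) r' c → r < r' → ⊥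
    clash (suc r) (suc r') c (_ , _ , _ , q) (_ , _ , p , _) (s≤s lt) = <⇒≱ q (≤-trans p (below r r' lt))
    flat : ∀ r r' c → InSkew (rowLens w) (rowLens v) r c → InSkew (rowLens w) (rowLens v) r' c → r ≡ r'
    flat r r' c i j with <-cmp r r'
    ... | tri< lt _ _ = ⊥-elim (clash r r' c i j lt)
    ... | tri≈ _ eq _ = eq
    ... | tri> _ _ more = ⊥-elim (clash r' r c j i more)
    rc : ∀ i → i < length (ferL w) → _
    rc i p = roc (fst (at-col c i p)) , λ q r → subst (λ z → suc (nth (ferL v) i) ≤ nth (rowLens w) (z ∸ 1)) (sym (cnt-parts (suc (nth (ferL w) i)) w))
        (snd (at-col c i p) (suc-injective (sym (circleRow-cnt {w} _) ∙ q ∙ circleRow-cnt {v} _)) (≤-pred (subst (2 ≤_) (circleRow-cnt {w} _) r)))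
      where
      roc : _ → circleRow (fromW w) (nth (ferL w) i) ≡ circleRow (fromW v) (nth (ferL v) i) ⊎ suc (nth (ferL w) i) ≡ suc (nth (ferL v) i)
      roc (inl q) = inl (circleRow-cnt {w} _ ∙ cong suc q ∙ sym (circleRow-cnt {v} _))
      roc (inr q) = inr (cong suc q)

-- Sums over lists with the same members.

sumA : ∀ {A : Set} → List A → (A → ℚ) → ℚ
sumA [] g = 0#
sumA (x ∷ xs) g = g x + sumA xs g

sumℚ-sumA : ∀ {A : Set} (xs : List A) g → sumℚ (map g xs) ≡ sumA xs g
sumℚ-sumA [] g = refl
sumℚ-sumA (x ∷ xs) g = cong (λ z → g x ℚ.+ z) (sumℚ-sumA xs g) ∙ sym (+-raw _ _)

sumA-same-members : ∀ {A : Set} (g : A → ℚ) (xs ys : List A) → Unique xs → Unique ys →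
  (∀ {x} → x ∈ xs → x ∈ ys) → (∀ {x} → x ∈ ys → x ∈ xs) → sumA xs g ≡ sumA ys g
sumA-same-members g [] [] _ _ _ _ = refl
sumA-same-members g [] (y ∷ ys) _ _ _ q with q (Any.here refl)
... | ()
sumA-same-members g (x ∷ xs) ys (n ∷ u) u' p q with ∈-∃++ (p (Any.here refl))
... | as , bs , refl = cong (g x +_) (sumA-same-members g xs (as ++ bs) u (skip as u') into from) ∙ moved as
  where
  moved : ∀ as → g x + sumA (as ++ bs) g ≡ sumA (as ++ x ∷ bs) g
  moved [] = refl
  moved (a ∷ as) = solve 3 (λ x a s → x :+ (a :+ s) := a :+ (x :+ s)) refl (g x) (g a) _ ∙ cong (g a +_) (moved as)
  insert : ∀ {y} as → y ∈ as ++ bs → y ∈ as ++ x ∷ bs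
  insert [] i = Any.there i
  insert (a ∷ as) (Any.here r) = Any.here r
  insert (a ∷ as) (Any.there i) = Any.there (insert as i)
  delete : ∀ {y} as → y ≢ x → y ∈ as ++ x ∷ bs → y ∈ as ++ bs
  delete [] m (Any.here r) = ⊥-elim (m r)
  delete [] m (Any.there i) = i
  delete (a ∷ as) m (Any.here r) = Any.here r
  delete (a ∷ as) m (Any.there i) = Any.there (delete as m i)
  All-skip : ∀ {Q : _ → Set} as → All Q (as ++ x ∷ bs) → All Q (as ++ bs)
  All-skip [] (_ ∷ a) = a
  All-skip (_ ∷ as) (q ∷ a) = q ∷ All-skip as a
  skip : ∀ as → Unique (as ++ x ∷ bs) → Unique (as ++ bs)
  skip [] (_ ∷ u) = u
  skip (a ∷ as) (n ∷ u) = All-skip as n ∷ skip as u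
  member : ∀ as → x ∈ as ++ x ∷ bs
  member [] = Any.here refl
  member (_ ∷ as) = Any.there (member as)
  absent : ∀ as → Unique (as ++ x ∷ bs) → ∀ {y} → y ∈ as ++ bs → y ≢ x
  absent [] (n ∷ _) i refl = All.lookup n i refl
  absent (a ∷ as) (n ∷ _) (Any.here refl) e = All.lookup n (member as) e
  absent (a ∷ as) (_ ∷ u) (Any.there i) e = absent as u i e
  into : ∀ {y} → y ∈ xs → y ∈ as ++ bs
  into i = delete as (λ { refl → All.lookup n i refl }) (p (Any.there i))
  from : ∀ {y} → y ∈ as ++ bs → y ∈ xs
  from i with q (insert as i)
  ... | Any.here e = ⊥-elim (absent as u' i e)
  ... | Any.there j = j

sumA-fromW : ∀ vs (g : SP → ℚ) → sumA (map fromW vs) g ≡ sumL vs (λ v → g (fromW v))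
sumA-fromW [] g = refl
sumA-fromW (v ∷ vs) g = cong (g (fromW v) +_) (sumA-fromW vs g)

sum-words : ∀ (Q : SP → Set) {L : List SP} {vs : List Mono} → Unique L → (∀ Ω → (Ω ∈ L) ⇔ Q Ω) → Unique vs → All Valid vs →
  (∀ v → v ∈ vs → Q (fromW v)) → (∀ Ω → Q Ω → IsSP Ω × toW Ω ∈ vs) → ∀ g → sumℚ (map g L) ≡ sumL vs (λ v → g (fromW v))
sum-words Q {L} {vs} uL mem uvs val to from g = sumℚ-sumA L g ∙ trans
  (sumA-same-members g L (map fromW vs) uL (left-inverse-map toW vs (All.map toW-fromW val) uvs)
    (λ {Ω} i → let isp , j = from Ω (Equivalence.to (mem Ω) i) in subst (_∈ map fromW vs) (snd (toW-SP Ω isp)) (∈-map⁺ fromW j))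
    (λ i → back (∈-map⁻ fromW i)))
  (sumA-fromW vs g)
  where
  back : ∀ {Ω} → ∃ (λ v → v ∈ vs × Ω ≡ fromW v) → Ω ∈ L
  back (v , i , refl) = Equivalence.from (mem _) (to v i)

PieriV-sum : ∀ Λ ℓ → IsSP Λ → ∀ {L} → Unique L → (∀ Ω → (Ω ∈ L) ⇔ PieriV Λ ℓ Ω) →
  ∀ g → sumℚ (map g L) ≡ sumL (V (toW Λ) ℓ) (λ v → g (fromW v))
PieriV-sum Λ ℓ isp uL mem = sum-words (PieriV Λ ℓ) uL mem (V-Unique vΛ ℓ) valid
  (λ v i → subst (λ z → PieriV z ℓ (fromW v)) (snd (toW-SP Λ isp)) (PV⇒PieriV vΛ (All.lookup valid i) ℓ (All.lookup (V-sound vΛ ℓ) i)))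
  (λ Ω q → fst q , V-complete ℓ vΛ (fst (toW-SP Ω (fst q))) (PieriV⇒PV vΛ (fst (toW-SP Ω (fst q))) ℓ
    (subst₂ (λ x y → PieriV x ℓ y) (sym (snd (toW-SP Λ isp))) (sym (snd (toW-SP Ω (fst q)))) q)))
  where
  vΛ = fst (toW-SP Λ isp)
  valid = All.map fst (V-valid ℓ vΛ)

PieriH-sum : ∀ Λ ℓ → IsSP Λ → ∀ {L} → Unique L → (∀ Ω → (Ω ∈ L) ⇔ PieriH Λ ℓ Ω) →
  ∀ g → sumℚ (map g L) ≡ sumL (P (toW Λ) ℓ) (λ v → g (fromW v))
PieriH-sum Λ ℓ isp uL mem = sum-words (PieriH Λ ℓ) uL mem (P-Unique (toW Λ) ℓ) valid
  (λ v i → subst (λ z → PieriH z ℓ (fromW v)) (snd (toW-SP Λ isp)) (PH⇒PieriH vΛ (All.lookup valid i) ℓ (All.lookup (P-sound vΛ ℓ) i)))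
  (λ Ω q → fst q , P-complete ℓ vΛ (fst (toW-SP Ω (fst q))) (PieriH⇒PH vΛ (fst (toW-SP Ω (fst q))) ℓ
    (subst₂ (λ x y → PieriH x ℓ y) (sym (snd (toW-SP Λ isp))) (sym (snd (toW-SP Ω (fst q)))) q)))
  where
  vΛ = fst (toW-SP Λ isp)
  valid = fst (P-valid vΛ ℓ)

-- Coefficients and products of functionals.

-- ξ stands for a combination of words; evaluating it at `mform` reads off the coefficient of m_Γ.
co : (Fn → ℚ) → SymF
co ξ Γ = ξ (mform (canon Γ))

fers : List ℕ → Mono
fers = map (λ e → fer e)

bosons : List ℕ → Mono
bosons = map (λ e → bos e)

data Desc : List ℕ → Set where
  [] : Desc []
  _∷_ : ∀ {x xs} → All (_≤ x) xs → Desc xs → Desc (x ∷ xs)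

insertDesc-All : ∀ {Q : ℕ → Set} x l → Q x → All Q l → All Q (insertDesc x l)
insertDesc-All x [] p [] = p ∷ []
insertDesc-All x (y ∷ l) p (q ∷ a) with y ≤ᵇ x
... | true = p ∷ q ∷ a
... | false = q ∷ insertDesc-All x l p a

insertDesc-Desc : ∀ x {l} → Desc l → Desc (insertDesc x l)
insertDesc-Desc x [] = [] ∷ []
insertDesc-Desc x {y ∷ l} (a ∷ d) with y ≤ᵇ x in eq
... | true = (y≤x ∷ All.map (λ q → ≤-trans q y≤x) a) ∷ a ∷ d
  where y≤x = ≤ᵇ⇒≤ y x (subst T (sym eq) tt)
... | false = insertDesc-All x l (<⇒≤ (≰⇒> (λ p → subst T eq (≤⇒≤ᵇ p)))) a ∷ insertDesc-Desc x d

sortDesc-Desc : ∀ l → Desc (sortDesc l)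
sortDesc-Desc [] = []
sortDesc-Desc (x ∷ l) = insertDesc-Desc x (sortDesc-Desc l)

greater : ℕ → List ℕ → ℕ
greater e = countᵇ (e <ᵇ_)

greater-insertDesc : ∀ e x l → greater e (insertDesc x l) ≡ (if e <ᵇ x then 1 else 0) ℕ.+ greater e l
greater-insertDesc e x [] = refl
greater-insertDesc e x (y ∷ l) with y ≤ᵇ x
... | true = refl
... | false = cong ((if e <ᵇ y then 1 else 0) ℕ.+_) (greater-insertDesc e x l) ∙
  ℕ-solve 3 (λ a b c → a ⊕ (b ⊕ c) ⊜ b ⊕ (a ⊕ c)) refl (if e <ᵇ y then 1 else 0) (if e <ᵇ x then 1 else 0) (greater e l)

greater-0 : ∀ {e l} → All (_≤ e) l → greater e l ≡ 0
greater-0 [] = refl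
greater-0 {e} {y ∷ l} (p ∷ a) with e <ᵇ y in eq
... | true = ⊥-elim (<⇒≱ (<ᵇ⇒< e y (subst T (sym eq) tt)) p)
... | false = greater-0 a

sgn-suc : ∀ n → sgn (suc n) ≡ - sgn n
sgn-suc n = sym (neg-raw (sgn n))

h̃mul-insertDesc : ∀ e {l} → Desc l → ∀ t w → h̃mul e (mform (fers l ++ t)) w ≡ sgn (greater e l) * mform (fers (insertDesc e l) ++ t) w
h̃mul-insertDesc e [] t w = 1*-eq refl
h̃mul-insertDesc e {y ∷ l} (a ∷ d) t w with y ≤ᵇ e in eq
... | true = 1*-eq refl ∙ cong (λ n → sgn n * h̃mul e (mform (fers (y ∷ l) ++ t)) w)
    (sym (greater-0 (y≤e ∷ All.map (λ q → ≤-trans q y≤e) a)))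
  where y≤e = ≤ᵇ⇒≤ y e (subst T (sym eq) tt)
... | false with e <ᵇ y | <⇒<ᵇ (≰⇒> (λ p → subst T eq (≤⇒≤ᵇ {y} {e} p)))
... | true | _ = begin
  _
    ≡⟨ h̃mul-anticomm e y _ w ⟩
  - h̃mul y (h̃mul e (mform (fers l ++ t))) w
    ≡⟨ cong -_ (lin-cong-* (Lin-h̃mul y w) (h̃mul-insertDesc e d t)) ⟩
  - (sgn (greater e l) * h̃mul y (mform (fers (insertDesc e l) ++ t)) w)
    ≡⟨ solve 2 (λ a b → :- (a :* b) := (:- a) :* b) refl _ _ ⟩
  (- sgn (greater e l)) * h̃mul y (mform (fers (insertDesc e l) ++ t)) w
    ≡⟨ cong (_* h̃mul y (mform (fers (insertDesc e l) ++ t)) w) (sym (sgn-suc (greater e l))) ⟩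
  _ ∎

hmul-insertDesc : ∀ k l w → hmul k (mform (bosons l)) w ≡ mform (bosons (insertDesc k l)) w
hmul-insertDesc k [] w = refl
hmul-insertDesc k (y ∷ l) w with y ≤ᵇ k
... | true = refl
... | false = hmul-comm k y _ w ∙ lin-cong (Lin-hmul y w) (hmul-insertDesc k l)

greater-key : ∀ e M → countᵇ (λ y → snd y ∧ (e <ᵇ fst y)) M ≡ greater e (fst (keyOf M))
greater-key e [] = refl
greater-key e (bos k ∷ M) = greater-key e M
greater-key e (fer k ∷ M) = cong ((if e <ᵇ k then 1 else 0) ℕ.+_) (greater-key e M) ∙ sym (greater-insertDesc e k (fst (keyOf M)))

sgn-+ : ∀ m n → sgn (m ℕ.+ n) ≡ sgn m * sgn n
sgn-+ zero n = sym (*-identityˡ _)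
sgn-+ (suc m) n = sgn-suc (m ℕ.+ n) ∙ cong -_ (sgn-+ m n) ∙
  solve 2 (λ a b → :- (a :* b) := (:- a) :* b) refl _ _ ∙ cong (_* sgn n) (sym (sgn-suc m))

-- `invs` counts the exchanges that sort the θ-exponents, and each costs a sign; the other exponents
-- commute.
mform-key : ∀ M w → mform M w ≡ sgn (invs M) * mform (canon (keyOf M)) w
mform-key [] w = 1*-eq refl
mform-key (bos zero ∷ M) w = mform-key M w
mform-key (bos (suc k) ∷ M) w = begin
  _
    ≡⟨ lin-cong-* (Lin-hmul (suc k) w) (mform-key M) ⟩
  sgn (invs M) * hmul (suc k) (mform (fers a ++ bosons s)) w
    ≡⟨ cong (sgn (invs M) *_) (past a w) ⟩
  _ ∎
  where
  a = fst (keyOf M)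
  s = snd (keyOf M)
  past : ∀ a w → hmul (suc k) (mform (fers a ++ bosons s)) w ≡ mform (fers a ++ bosons (insertDesc (suc k) s)) w
  past [] w = hmul-insertDesc (suc k) s w
  past (x ∷ a) w = hmul-h̃mul (suc k) x _ w ∙ lin-cong (Lin-h̃mul x w) (past a)
mform-key (fer k ∷ M) w = begin
  _
    ≡⟨ lin-cong-* (Lin-h̃mul k w) (mform-key M) ⟩
  sgn (invs M) * h̃mul k (mform (fers a ++ bosons s)) w
    ≡⟨ cong (sgn (invs M) *_) (h̃mul-insertDesc k (sortDesc-Desc (map fst (Data.List.filterᵇ snd M))) (bosons s) w) ⟩
  sgn (invs M) * (sgn (greater k a) * mform (fers (insertDesc k a) ++ bosons s) w)
    ≡⟨ solve 3 (λ x y z → x :* (y :* z) := (y :* x) :* z) refl _ _ _ ⟩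
  (sgn (greater k a) * sgn (invs M)) * mform (fers (insertDesc k a) ++ bosons s) w
    ≡⟨ cong (_* mform (fers (insertDesc k a) ++ bosons s) w) (sym (sgn-+ (greater k a) (invs M)) ∙ cong (λ n → sgn (n ℕ.+ invs M)) (sym (greater-key k M))) ⟩
  _ ∎
  where
  a = fst (keyOf M)
  s = snd (keyOf M)

repeated : ∀ {l} → Desc l → strictDec l ≡ true ⊎ (∀ t w → mform (fers l ++ t) w ≡ 0#)
repeated [] = inl refl
repeated {x ∷ []} _ = inl refl
repeated {x ∷ y ∷ l} ((y≤x ∷ _) ∷ d) with y <ᵇ x in eq | repeated d
... | true | inl p = inl p
... | true | inr p = inr (λ t w → lin-0 (Lin-h̃mul x w) (p t))
... | false | _ = inr zeros
  where
  x≡y : x ≡ y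
  x≡y = ≤-antisym (≮⇒≥ (λ p → subst T eq (<⇒<ᵇ p))) y≤x
  zeros : ∀ t w → mform (fers (x ∷ y ∷ l) ++ t) w ≡ 0#
  zeros t w = cong (λ z → h̃mul z (mform (fers (y ∷ l) ++ t)) w) x≡y ∙ antisymmetric⇒0 (h̃mul-anticomm y y _ w)

weakDec-key : ∀ M → weakDecPos (snd (keyOf M)) ≡ true
weakDec-key M = T⇒≡ (go M)
  where
  T⇒≡ : ∀ {b} → T b → b ≡ true
  T⇒≡ {true} _ = refl
  Desc⇒ : ∀ {l} → Desc l → All (1 ≤_) l → T (weakDecPos l)
  Desc⇒ [] [] = tt
  Desc⇒ {x ∷ l} (a ∷ d) (p ∷ q) = weakDec-cons x l p a (Desc⇒ d q)
  positive : ∀ M → All (1 ≤_) (snd (keyOf M))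
  positive [] = []
  positive (fer k ∷ M) = positive M
  positive (bos zero ∷ M) = positive M
  positive (bos (suc k) ∷ M) = insertDesc-All (suc k) (snd (keyOf M)) (s≤s z≤n) (positive M)
  go : ∀ M → T (weakDecPos (snd (keyOf M)))
  go M = Desc⇒ {snd (keyOf M)} (sortDesc-Desc (Data.List.filterᵇ (λ e → 1 ≤ᵇ e) (map fst (Data.List.filterᵇ (λ y → not (snd y)) M)))) (positive M)

-- A key that is no superpartition has a repeated θ-exponent, and then the coefficient vanishes by
-- anticommutation as well.
coefMono-co : ∀ {ξ} → Lin ξ → ∀ M → coefMono (co ξ) M ≡ ξ (mform M)
coefMono-co {ξ} l M with repeated (sortDesc-Desc (map fst (Data.List.filterᵇ snd M)))
... | inl p rewrite p | weakDec-key M = sym (*-raw _ _) ∙ sym (lin-cong-* l (mform-key M))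
... | inr p = vanish ∙ sym (lin-0 l (λ w → mform-key M w ∙ *0 (p _ w)))
  where
  vanish : coefMono (co ξ) M ≡ 0#
  vanish with isSP (keyOf M)
  ... | true = sym (*-raw (sgn (invs M)) _) ∙ *0 (lin-0 l (p (bosons (snd (keyOf M)))))
  ... | false = refl

coefMono-cong : ∀ {f g : SymF} → (∀ Γ → IsSP Γ → f Γ ≡ g Γ) → ∀ M → coefMono f M ≡ coefMono g M
coefMono-cong p M with isSP (keyOf M) in eq
... | true = cong (sgn (invs M) ℚ.*_) (p (keyOf M) (subst T (sym eq) tt))
... | false = refl

sumA-++ : ∀ {A : Set} (xs ys : List A) g → sumA (xs ++ ys) g ≡ sumA xs g + sumA ys g
sumA-++ [] ys g = sym (+-identityˡ _)
sumA-++ (x ∷ xs) ys g = cong (g x +_) (sumA-++ xs ys g) ∙ sym (+-assoc _ _ _)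

sumA-concatMap : ∀ {A B : Set} (f : A → List B) xs g → sumA (concatMap f xs) g ≡ sumA xs (λ x → sumA (f x) g)
sumA-concatMap f [] g = refl
sumA-concatMap f (x ∷ xs) g = sumA-++ (f x) _ g ∙ cong (sumA (f x) g +_) (sumA-concatMap f xs g)

sumA-≗ : ∀ {A : Set} (xs : List A) {f g : A → ℚ} → (∀ x → f x ≡ g x) → sumA xs f ≡ sumA xs g
sumA-≗ [] p = refl
sumA-≗ (x ∷ xs) p = cong₂ _+_ (p x) (sumA-≗ xs p)

sumA-0 : ∀ {A : Set} (xs : List A) {f : A → ℚ} → (∀ x → f x ≡ 0#) → sumA xs f ≡ 0#
sumA-0 [] p = refl
sumA-0 (x ∷ xs) p = 0+0 (p x) (sumA-0 xs p)

sumA-+ : ∀ {A : Set} (xs : List A) (f g : A → ℚ) → sumA xs (λ x → f x + g x) ≡ sumA xs f + sumA xs g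
sumA-+ [] f g = sym (+-identityˡ 0#)
sumA-+ (x ∷ xs) f g = cong (f x + g x +_) (sumA-+ xs f g) ∙
  solve 4 (λ a b c d → (a :+ b) :+ (c :+ d) := (a :+ c) :+ (b :+ d)) refl _ _ _ _

sumA-* : ∀ {A : Set} (xs : List A) a (f : A → ℚ) → sumA xs (λ x → a * f x) ≡ a * sumA xs f
sumA-* [] a f = sym (zeroʳ a)
sumA-* (x ∷ xs) a f = cong (a * f x +_) (sumA-* xs a f) ∙ sym (distribˡ a _ _)

sumA-conv : ∀ {A : Set} (xs : List A) n (F : A → ℕ → ℕ → ℚ) → sumA xs (λ x → conv n (F x)) ≡ conv n (λ i j → sumA xs (λ x → F x i j))
sumA-conv xs zero F = refl
sumA-conv xs (suc n) F = sumA-+ xs _ _ ∙ cong (sumA xs (λ x → F x 0 (suc n)) +_) (sumA-conv xs n (λ x i j → F x (suc i) j))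

sumA-upTo : ∀ n (F : ℕ → ℕ → ℚ) → sumA (upTo (suc n)) (λ x → F x (n ∸ x)) ≡ conv n F
sumA-upTo zero F = +-identityʳ _
sumA-upTo (suc n) F = cong (F 0 (suc n) +_) (shift (λ x → x) (suc n) ∙ sumA-upTo n (λ i j → F (suc i) j))
  where
  shift : ∀ (f : ℕ → ℕ) m {g : ℕ → ℚ} → sumA (applyUpTo (λ x → suc (f x)) m) g ≡ sumA (applyUpTo f m) (λ x → g (suc x))
  shift f zero = refl
  shift f (suc m) {g} = cong (g (suc (f 0)) +_) (shift (λ x → f (suc x)) m)

sum-splits-bos : ∀ k xs (G : Mono × Mono → ℚ) → sumA (splits (bos k ∷ xs)) G ≡
  conv k (λ x y → sumA (splits xs) (λ p → G (bos x ∷ fst p , bos y ∷ snd p)))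
sum-splits-bos k xs G = sumA-concatMap _ (splits xs) G ∙ trans
  (sumA-≗ (splits xs) (λ p → sumA-concatMap (λ x → (bos x ∷ fst p , bos (k ∸ x) ∷ snd p) ∷ []) (upTo (suc k)) G ∙
    sumA-upTo k (λ x y → G (bos x ∷ fst p , bos y ∷ snd p) + 0#) ∙ conv-cong k (λ i j _ → +-identityʳ _)))
  (sumA-conv (splits xs) k _)

sum-splits-fer : ∀ k xs (G : Mono × Mono → ℚ) → sumA (splits (fer k ∷ xs)) G ≡
  conv k (λ x y → sumA (splits xs) (λ p → G (fer x ∷ fst p , bos y ∷ snd p)))
  + conv k (λ x y → sumA (splits xs) (λ p → G (bos x ∷ fst p , fer y ∷ snd p)))
sum-splits-fer k xs G = sumA-concatMap _ (splits xs) G ∙ trans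
  (sumA-≗ (splits xs) (λ p → sumA-concatMap (λ x → (fer x ∷ fst p , bos (k ∸ x) ∷ snd p) ∷ (bos x ∷ fst p , fer (k ∸ x) ∷ snd p) ∷ []) (upTo (suc k)) G ∙
    sumA-upTo k (λ x y → G (fer x ∷ fst p , bos y ∷ snd p) + (G (bos x ∷ fst p , fer y ∷ snd p) + 0#)) ∙
      conv-cong k (λ i j _ → cong₂ _+_ refl (+-identityʳ _)) ∙ conv-+ k _ _))
  (sumA-+ (splits xs) _ _ ∙ cong₂ _+_ (sumA-conv (splits xs) k _) (sumA-conv (splits xs) k _))

⋆-sum : ∀ (f g : SymF) Γ → IsSP Γ → (f ⋆ g) Γ ≡
  sumA (splits (canon Γ)) (λ p → sgn (shuf (fst p) (snd p)) * coefMono f (fst p) * coefMono g (snd p))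
⋆-sum f g Γ isp with isSP Γ
... | true = sumℚ-sumA (splits (canon Γ)) _ ∙ sumA-≗ (splits (canon Γ)) (λ p → sym (*-raw _ _) ∙ cong (_* coefMono g (snd p)) (sym (*-raw _ _)))

shuf-0ʳ : ∀ fs gs → countᵇ snd gs ≡ 0 → shuf fs gs ≡ 0
shuf-0ʳ [] gs p = refl
shuf-0ʳ (c ∷ fs) [] p = refl
shuf-0ʳ (c ∷ fs) (bos k ∷ gs) p = shuf-0ʳ fs gs p

shuf-0ˡ : ∀ fs gs → countᵇ snd fs ≡ 0 → shuf fs gs ≡ 0
shuf-0ˡ [] gs p = refl
shuf-0ˡ (bos _ ∷ fs) [] p = refl
shuf-0ˡ (bos _ ∷ fs) (bos k ∷ gs) p = shuf-0ˡ fs gs p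
shuf-0ˡ (bos _ ∷ fs) (fer k ∷ gs) p = cong (ℕ._+ shuf fs gs) p ∙ shuf-0ˡ fs gs p

-- Multiplication by a bosonic function Σ_M θ i M x^M whose coefficients are computed letter by letter,
-- the state moving from i to κ i y at an exponent y.
module Small {I : Set} (base : I → ℚ) (κ : I → ℕ → Maybe I) (Θ : I → Fn → Fn) (LΘ : ∀ i → LinOp (Θ i)) where

  MΘ : Maybe I → Fn → Fn
  MΘ (just i) f = Θ i f
  MΘ nothing f w = 0#

  θ : I → Mono → ℚ
  Mθ : Maybe I → Mono → ℚ
  θ i [] = base i
  θ i (bos y ∷ g) = Mθ (κ i y) g
  θ i (fer y ∷ g) = 0#
  Mθ (just i) g = θ i g
  Mθ nothing g = 0#

  θ-fer : ∀ i g → θ i g ≡ 0# ⊎ countᵇ snd g ≡ 0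
  θ-fer i [] = inr refl
  θ-fer i (fer y ∷ g) = inl refl
  θ-fer i (bos y ∷ g) with κ i y
  ... | just j = θ-fer j g
  ... | nothing = inl refl

  module _ (Θ-vac : ∀ i w → Θ i vac w ≡ base i * vac w)
           (Θ-L̃ : ∀ i k b {f} → Symm f → ∀ w → Θ i (L̃ (k , b) f) w ≡ conv k (λ x y → L̃ (x , b) (MΘ (κ i y) f) w)) where

    private
      step : ∀ i k b xs {ξ} → Lin ξ → (F : ℕ → ℕ → ℚ) →
        (∀ x y → F x y ≡ ξ (λ w → L̃ (x , b) (MΘ (κ i y) (mform xs)) w)) → conv k F ≡ ξ (Θ i (mform ((k , b) ∷ xs)))
      step i k b xs {ξ} l F p = conv-cong k (λ x y _ → p x y) ∙
        sym (lin-conv l k _) ∙ lin-cong l (λ w → sym (Θ-L̃ i k b (Symm-mform xs) w))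

    sum-right : ∀ xs i {ξ} → Lin ξ → sumA (splits xs) (λ p → ξ (mform (fst p)) * θ i (snd p)) ≡ ξ (Θ i (mform xs))
    Msum-right : ∀ xs m {ξ} → Lin ξ → sumA (splits xs) (λ p → ξ (mform (fst p)) * Mθ m (snd p)) ≡ ξ (MΘ m (mform xs))
    Msum-right xs (just i) l = sum-right xs i l
    Msum-right xs nothing l = sumA-0 (splits xs) (λ p → zeroʳ _) ∙ sym (lin-0 l (λ _ → refl))
    sum-right [] i {ξ} l = +-identityʳ _ ∙ *-comm _ _ ∙ sym (lin-cong-* l (Θ-vac i))
    sum-right (bos k ∷ xs) i l = sum-splits-bos k xs _ ∙
      step i k false xs l _ (λ x y → Msum-right xs (κ i y) (Lin-∘ l (Lin-hmul x)))
    sum-right (fer k ∷ xs) i l = sum-splits-fer k xs _ ∙ cong₂ _+_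
      (step i k true xs l _ (λ x y → Msum-right xs (κ i y) (Lin-∘ l (Lin-h̃mul x))))
      (conv-0 k _ (λ x y _ → sumA-0 (splits xs) (λ p → zeroʳ _))) ∙ +-identityʳ _

    sum-left : ∀ xs i {ξ} → Lin ξ → sumA (splits xs) (λ p → θ i (fst p) * ξ (mform (snd p))) ≡ ξ (Θ i (mform xs))
    Msum-left : ∀ xs m {ξ} → Lin ξ → sumA (splits xs) (λ p → Mθ m (fst p) * ξ (mform (snd p))) ≡ ξ (MΘ m (mform xs))
    Msum-left xs (just i) l = sum-left xs i l
    Msum-left xs nothing l = sumA-0 (splits xs) (λ p → zeroˡ _) ∙ sym (lin-0 l (λ _ → refl))
    sum-left [] i {ξ} l = +-identityʳ _ ∙ sym (lin-cong-* l (Θ-vac i))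
    sum-left (bos k ∷ xs) i l = sum-splits-bos k xs _ ∙ conv-flip k _ ∙
      step i k false xs l _ (λ x y → Msum-left xs (κ i y) (Lin-∘ l (Lin-hmul x)))
    sum-left (fer k ∷ xs) i l = sum-splits-fer k xs _ ∙ cong₂ _+_
      (conv-0 k _ (λ x y _ → sumA-0 (splits xs) (λ p → zeroˡ _)))
      (conv-flip k _ ∙ step i k true xs l _ (λ x y → Msum-left xs (κ i y) (Lin-∘ l (Lin-h̃mul x)))) ∙ +-identityˡ _

    ⋆-right : ∀ {ξ} → Lin ξ → ∀ i {g} → (∀ M → coefMono g M ≡ θ i M) → ∀ Γ → IsSP Γ → (co ξ ⋆ g) Γ ≡ ξ (Θ i (mform (canon Γ)))
    ⋆-right {ξ} l i {g} p Γ isp = ⋆-sum (co ξ) g Γ isp ∙ sumA-≗ (splits (canon Γ)) (λ q →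
      cong₂ (λ x y → sgn (shuf (fst q) (snd q)) * x * y) (coefMono-co l (fst q)) (p (snd q)) ∙ unsigned (fst q) (snd q)) ∙
      sum-right (canon Γ) i l
      where
      -- The factor g contains no θ, so the shuffle sign is 1 wherever its coefficient is nonzero.
      unsigned : ∀ fs gs → sgn (shuf fs gs) * ξ (mform fs) * θ i gs ≡ ξ (mform fs) * θ i gs
      unsigned fs gs with θ-fer i gs
      ... | inl z = cong (sgn (shuf fs gs) * ξ (mform fs) *_) z ∙ zeroʳ _ ∙ sym (*0 z)
      ... | inr z = cong (_* θ i gs) (cong (λ n → sgn n * ξ (mform fs)) (shuf-0ʳ fs gs z) ∙ *-identityˡ _)

    ⋆-left : ∀ {ξ} → Lin ξ → ∀ i {g} → (∀ M → coefMono g M ≡ θ i M) → ∀ Γ → IsSP Γ → (g ⋆ co ξ) Γ ≡ ξ (Θ i (mform (canon Γ)))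
    ⋆-left {ξ} l i {g} p Γ isp = ⋆-sum g (co ξ) Γ isp ∙ sumA-≗ (splits (canon Γ)) (λ q →
      cong₂ (λ x y → sgn (shuf (fst q) (snd q)) * x * y) (p (fst q)) (coefMono-co l (snd q)) ∙ unsigned (fst q) (snd q)) ∙
      sum-left (canon Γ) i l
      where
      unsigned : ∀ fs gs → sgn (shuf fs gs) * θ i fs * ξ (mform gs) ≡ θ i fs * ξ (mform gs)
      unsigned fs gs with θ-fer i fs
      ... | inl z = cong (_* ξ (mform gs)) (cong (sgn (shuf fs gs) *_) z ∙ zeroʳ _ ∙ sym z)
      ... | inr z = cong (_* ξ (mform gs)) (cong (λ n → sgn n * θ i fs) (shuf-0ˡ fs gs z) ∙ *-identityˡ _)

-- Newton's identities and the primitivity of p_n.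

sg : ℕ → ℚ
sg = pow -1#

nat : ℕ → ℚ
nat zero = 0#
nat (suc n) = 1# + nat n

-- Multiplication by p_n = Σ (-1)^j i h_i e_j.
Tp : ℕ → Fn → Fn
Tp n f w = conv n (λ i j → (nat i * sg j) * el j f (bos i ∷ w))

Lin-Tp : ∀ n → LinOp (Tp n)
Lin-Tp n w = Lin-conv n (λ i j → Lin-* _ (Lin-el j (bos i ∷ w)))

Symm-Tp : ∀ n {f} → Symm f → Symm (Tp n f)
Symm-Tp n s = Symm-conv n (λ i j → Symm-* _ (Symm-cons (Symm-el j s) (bos i)))

alternating-hook : ∀ m i f w → conv m (λ b j → sg b * el b (cons (bos (i ℕ.+ j)) f) w) ≡ sg m * hook i m f w
alternating-hook zero i f w = cong (λ k → 1# * f (bos k ∷ w)) (ℕP.+-identityʳ i)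
alternating-hook (suc m) i f w = begin
  _
    ≡⟨ conv-last m (λ b j → sg b * el b (cons (bos (i ℕ.+ j)) f) w) ⟩
  _
    ≡⟨ cong₂ _+_ (conv-cong m (λ b j _ → cong (λ k → sg b * el b (cons (bos k) f) w) (+-suc i j)) ∙ alternating-hook m (suc i) f w)
         (cong (λ k → sg (suc m) * el (suc m) (cons (bos k) f) w) (ℕP.+-identityʳ i)) ⟩
  sg m * hook (suc i) m f w + (-1# * sg m) * hook 1 m (cons (bos i) f) w
    ≡⟨ solve 3 (λ s x y → s :* x :+ (con -1# :* s) :* y := (con -1# :* s) :* (y :- x)) refl _ _ _ ⟩
  _ ∎

alternating-he : ∀ {f} → Symm f → ∀ m w → conv m (λ b j → sg b * el b (cons (bos j) f) w) ≡ at0 m (f w)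
alternating-he {f} s zero w = *-identityˡ _ ∙ drop0 s w
alternating-he {f} s (suc m) w = alternating-hook (suc m) 0 f w ∙ *0 (hook-0 s m w)

conv-at0 : ∀ n (G : ℕ → ℚ) → conv n (λ i j → at0 j (G i)) ≡ G n
conv-at0 zero G = refl
conv-at0 (suc n) G = +-identityˡ _ ∙ conv-at0 n (λ i → G (suc i))

at0-* : ∀ n a x → a * at0 n x ≡ at0 n (a * x)
at0-* zero a x = refl
at0-* (suc n) a x = zeroʳ a

-- After inserting the definition of p_i, the alternating convolution of the e's with the h's
-- collapses to its constant term.
newton : ∀ {f} → Symm f → ∀ n w → conv n (λ i j → Tp i (cons (bos j) f) w) ≡ nat n * f (bos n ∷ w)
newton {f} s n w = begin
  _
    ≡⟨ sym (conv-assoc n (λ a b j → (nat a * sg b) * el b (cons (bos j) f) (bos a ∷ w))) ⟩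
  conv n (λ a m → conv m (λ b j → (nat a * sg b) * el b (cons (bos j) f) (bos a ∷ w)))
    ≡⟨ conv-cong n (λ a m _ → conv-cong m (λ b j _ → *-assoc _ _ _) ∙ conv-* m (nat a) _ ∙
         cong (nat a *_) (alternating-he s m (bos a ∷ w)) ∙ at0-* m _ _) ⟩
  conv n (λ a m → at0 m (nat a * f (bos a ∷ w)))
    ≡⟨ conv-at0 n _ ⟩
  _ ∎

Tp-0 : ∀ f w → Tp 0 f w ≡ 0#
Tp-0 f w = solve 1 (λ x → (con 0# :* con 1#) :* x := con 0#) refl _

-- Since h_0 = 1, convolution with the h_j is a triangular recursion for U_n. Identities about p_n
-- can thus be checked after convolution, where `newton` replaces p by h.
newton-unique : (U : ℕ → Fn → ℚ) → (∀ i {f} → Symm f → U i (cons (bos 0) f) ≡ U i f) →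
  (∀ n {f} → Symm f → conv n (λ i j → U i (cons (bos j) f)) ≡ 0#) → ∀ n {f} → Symm f → U n f ≡ 0#
newton-unique U u0 u n = go n n ≤-refl
  where
  go : ∀ n i → i ≤ n → ∀ {f} → Symm f → U i f ≡ 0#
  go zero .0 z≤n s = sym (u0 0 s) ∙ u 0 s
  go (suc n) i p {f} s with m≤n⇒m<n∨m≡n p
  ... | inl (s≤s q) = go n i q s
  ... | inr refl = begin
    U (suc n) f ≡⟨ sym (u0 (suc n) s) ⟩
    U (suc n) (cons (bos 0) f)
      ≡⟨ sym (+-identityˡ _) ∙ cong (_+ U (suc n) (cons (bos 0) f))
           (sym (conv-0 n _ (λ i j e → go n i (subst (i ≤_) e (m≤m+n i j)) (Symm-cons s (bos (suc j)))))) ⟩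
    conv n (λ i j → U i (cons (bos (suc j)) f)) + U (suc n) (cons (bos 0) f) ≡⟨ sym (conv-last n (λ i j → U i (cons (bos j) f))) ⟩
    conv (suc n) (λ i j → U i (cons (bos j) f)) ≡⟨ u (suc n) s ⟩
    0# ∎

newton-dn : ∀ {g} → Symm g → ∀ n w → conv (suc n) (λ i j → Tp i (dn j g) w) ≡ nat n * g (bos n ∷ w)
newton-dn {g} s n w = conv-last n (λ i j → Tp i (dn j g) w) ∙ cong₂ _+_ (newton s n w) (lin-0 (Lin-Tp (suc n) w) (λ _ → refl)) ∙ +-identityʳ _

-- p_n is primitive: it acts as a derivation on products of operators with the coproduct of h.
module Derivation (Os : ℕ → Fn → Fn) (LO : ∀ m → LinOp (Os m)) (SO : ∀ m {f} → Symm f → Symm (Os m f))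
  (rule : ∀ m j f w → Os m f (bos (suc j) ∷ w) ≡ Os m (cons (bos (suc j)) f) w + Os (suc m) f (bos j ∷ w)) where

  lower : ℕ → ℕ → Fn → Mono → ℚ
  lower m zero f w = 0#
  lower m (suc n) f w = Os (suc n ℕ.+ m) f w

  private
    Os0 : ∀ m {f} → Symm f → ∀ w → Os m (cons (bos 0) f) w ≡ Os m f w
    Os0 m s w = lin-cong (LO m w) (drop0 s)

    rule-dn : ∀ m {f} → Symm f → ∀ j w → Os m (cons (bos j) f) w ≡ Os m f (bos j ∷ w) - dn j (Os (suc m) f) w
    rule-dn m {f} s zero w = Os0 m s w ∙ sym (drop0 (SO m s) w) ∙ solve 1 (λ x → x := x :- con 0#) refl _
    rule-dn m {f} s (suc j) w = solve 2 (λ a b → a := (a :+ b) :- b) refl _ (Os (suc m) f (bos j ∷ w)) ∙ sub-cong (sym (rule m j f w)) refl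

    expand : ∀ m {f} → Symm f → ∀ j w → Os m f (bos j ∷ w) ≡ conv j (λ i a → Os (i ℕ.+ m) (cons (bos a) f) w)
    expand m s zero w = drop0 (SO m s) w ∙ sym (Os0 m s w)
    expand m {f} s (suc j) w = rule m j f w ∙ cong₂ _+_ refl (expand (suc m) s j w ∙
      conv-cong j (λ i a _ → cong (λ k → Os k (cons (bos a) f) w) (+-suc i m)))

  derivation : ∀ m n {f} → Symm f → ∀ w → Tp n (Os m f) w ≡ Os m (Tp n f) w + lower m n f w
  derivation m n {f} s w = solve 3 (λ a b c → a := ((a :- b) :- c) :+ (b :+ c)) refl (Tp n (Os m f) w) (Os m (Tp n f) w) (lower m n f w) ∙
    cong (_+ (Os m (Tp n f) w + lower m n f w)) (newton-unique U U0 U-conv n s) ∙ +-identityˡ _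
    where
    -- The defect of the claim. After convolution with the h_j, `newton` evaluates both products
    -- with p, so the sum defining p_n is never expanded.
    U : ℕ → Fn → ℚ
    U i f = (Tp i (Os m f) w - Os m (Tp i f) w) - lower m i f w
    U0 : ∀ i {f} → Symm f → U i (cons (bos 0) f) ≡ U i f
    U0 i {f} s = sub-cong (sub-cong (lin-cong (Lin-Tp i w) (λ v → Os0 m s v)) (lin-cong (LO m w) (λ v → lin-cong (Lin-Tp i v) (drop0 s)))) (low i)
      where
      low : ∀ i → lower m i (cons (bos 0) f) w ≡ lower m i f w
      low zero = refl
      low (suc i) = Os0 (suc i ℕ.+ m) s w
    U-conv : ∀ n {f} → Symm f → conv n (λ i j → U i (cons (bos j) f)) ≡ 0#
    U-conv n {f} s = begin
      _
        ≡⟨ conv-+ n _ _ ∙ cong₂ _+_ (conv-+ n _ _ ∙ cong₂ _+_ refl (conv-neg n _)) (conv-neg n _) ⟩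
      _
        ≡⟨ sub-cong (sub-cong
             (conv-cong n (λ i j _ → lin-cong-sub (Lin-Tp i w) (rule-dn m s j)) ∙
               conv-+ n _ _ ∙ cong₂ _+_ (newton (SO m s) n w) (conv-neg n _))
             (sym (lin-conv (LO m w) n _) ∙ lin-cong-* (LO m w) (newton s n))) refl ⟩
      _
        ≡⟨ finish n ⟩
      0# ∎
      where
      finish : ∀ n → ((nat n * Os m f (bos n ∷ w) - conv n (λ i j → Tp i (dn j (Os (suc m) f)) w)) - nat n * Os m (cons (bos n) f) w) - conv n (λ i j → lower m i (cons (bos j) f) w) ≡ 0#
      finish zero = cong (λ z → ((0# * Os m f (bos 0 ∷ w) - z) - 0# * Os m (cons (bos 0) f) w) - 0#) (Tp-0 (dn 0 (Os (suc m) f)) w) ∙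
        solve 2 (λ a b → ((con 0# :* a :- con 0#) :- con 0# :* b) :- con 0# := con 0#) refl _ _
      finish (suc n) = cong₂ (λ y z → ((nat (suc n) * Os m f (bos (suc n) ∷ w) - y) - nat (suc n) * Os m (cons (bos (suc n)) f) w) - z)
          (newton-dn (SO (suc m) s) n w)
          (+-identityˡ _ ∙ conv-cong n (λ i j _ → cong (λ k → Os k (cons (bos j) f) w) (sym (+-suc i m))) ∙ sym (expand (suc m) s n w)) ∙
        cong (λ z → (((1# + nat n) * z - nat n * G) - (1# + nat n) * Os m (cons (bos (suc n)) f) w) - G) (rule m n f w) ∙
          solve 3 (λ k x g → (((con 1# :+ k) :* (x :+ g) :- k :* g) :- (con 1# :+ k) :* x) :- g := con 0#) refl (nat n) (Os m (cons (bos (suc n)) f) w) G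
        where G = Os (suc m) f (bos n ∷ w)

sel : ℕ → ℕ → (ℕ → ℚ) → ℚ
sel zero k G = G k
sel (suc r) zero G = 0#
sel (suc r) (suc k) G = sel r k G

L̃s : Letter → ℕ → Fn → Fn
L̃s (k , b) m f w = sel m k (λ x → L̃ (x , b) f w)

Lin-sel : ∀ m k {G : ℕ → Fn → ℚ} → (∀ x → Lin (G x)) → Lin (λ f → sel m k (λ x → G x f))
Lin-sel zero k l = l k
Lin-sel (suc m) zero l = Lin-0
Lin-sel (suc m) (suc k) l = Lin-sel m k l

Symm-sel : ∀ m k {G : ℕ → Fn} → (∀ x → Symm (G x)) → Symm (λ w → sel m k (λ x → G x w))
Symm-sel zero k s = s k
Symm-sel (suc m) zero s = Symm-0
Symm-sel (suc m) (suc k) s = Symm-sel m k s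

L̃-bos : ∀ k b i g w → L̃ (k , b) g (bos i ∷ w) ≡ L̃ (k , b) (cons (bos i) g) w + dn i (L̃1 (k , b) g) w
L̃-bos k false i g w = hmul-bos k i g w
L̃-bos k true i g w = h̃mul-bos k i g w

L̃1-0 : ∀ b g w → L̃1 (zero , b) g w ≡ 0#
L̃1-0 false g w = refl
L̃1-0 true g w = refl

L̃1-suc : ∀ k b g w → L̃1 (suc k , b) g w ≡ L̃ (k , b) g w
L̃1-suc k false g w = refl
L̃1-suc k true g w = refl

L̃s-rule : ∀ c m j f w → L̃s c m f (bos (suc j) ∷ w) ≡ L̃s c m (cons (bos (suc j)) f) w + L̃s c (suc m) f (bos j ∷ w)
L̃s-rule (zero , b) zero j f w = L̃-bos 0 b (suc j) f w ∙ cong₂ _+_ refl (L̃1-0 b f (bos j ∷ w))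
L̃s-rule (suc k , b) zero j f w = L̃-bos (suc k) b (suc j) f w ∙ cong₂ _+_ refl (L̃1-suc k b f (bos j ∷ w))
L̃s-rule (zero , b) (suc m) j f w = sym (+-identityʳ 0#)
L̃s-rule (suc k , b) (suc m) j f w = L̃s-rule (k , b) m j f w

module DerivationL̃ (c : Letter) = Derivation (L̃s c) (λ m w → Lin-sel m (fst c) (λ x → Lin-L̃ (x , snd c) w))
  (λ m s → Symm-sel m (fst c) (λ x → Symm-L̃ (x , snd c) s)) (L̃s-rule c)

Tp-L̃ : ∀ n c {f} → Symm f → ∀ w → Tp (suc n) (L̃ c f) w ≡ L̃ c (Tp (suc n) f) w + L̃s c (suc n) f w
Tp-L̃ n c {f} s w = DerivationL̃.derivation c 0 (suc n) s w ∙ cong (λ k → L̃ c (Tp (suc n) f) w + L̃s c (suc k) f w) (ℕP.+-identityʳ n)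

pmuls : ℕ → ℕ → Fn → Fn
pmuls a zero f = pmul a f
pmuls a (suc m) f w = 0#

Tp-pmul : ∀ n a {f} → Symm f → ∀ w → Tp n (pmul a f) w ≡ pmul a (Tp n f) w
Tp-pmul n a s w = Derivation.derivation (pmuls a) lin symmetric rule 0 n s w ∙ +0 (none n)
  where
  lin : ∀ m → LinOp (pmuls a m)
  lin zero = Lin-pmul a
  lin (suc m) w = Lin-0
  symmetric : ∀ m {f} → Symm f → Symm (pmuls a m f)
  symmetric zero = Symm-pmul a
  symmetric (suc m) _ = Symm-0
  rule : ∀ m j f w → pmuls a m f (bos (suc j) ∷ w) ≡ pmuls a m (cons (bos (suc j)) f) w + pmuls a (suc m) f (bos j ∷ w)
  rule zero j f w = sym (+-identityʳ _)
  rule (suc m) j f w = sym (+-identityʳ _)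
  none : ∀ n → Derivation.lower (pmuls a) lin symmetric rule 0 n _ w ≡ 0#
  none zero = refl
  none (suc n) = refl

conv-one : ∀ k (F : ℕ → ℕ → ℚ) r → (∀ x y → y ≢ r → F x y ≡ 0#) → conv k F ≡ sel r k (λ x → F x r)
conv-one zero F zero p = refl
conv-one zero F (suc r) p = p 0 0 (λ ())
conv-one (suc k) F zero p = conv-last k F ∙ 0+ (conv-0 k _ (λ x y _ → p x (suc y) (λ ())))
conv-one (suc k) F (suc r) p = conv-last k F ∙ cong₂ _+_ (conv-one k _ r (λ x y n → p x (suc y) (λ e → n (suc-injective e)))) (p (suc k) 0 (λ ())) ∙ +-identityʳ _

conv-two : ∀ k (F : ℕ → ℕ → ℚ) r → (∀ x y → y ≢ 0 → y ≢ suc r → F x y ≡ 0#) → conv k F ≡ F k 0 + sel (suc r) k (λ x → F x (suc r))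
conv-two zero F r p = sym (+-identityʳ _)
conv-two (suc k) F r p = conv-last k F ∙ +-comm _ _ ∙
  cong (F (suc k) 0 +_) (conv-one k _ r (λ x y n → p x (suc y) (λ ()) (λ e → n (suc-injective e))))

-- Coefficients of e_ℓ and h_ℓ, and products with them.

indicator : ∀ Λ {Γ} → Λ ≡ Γ → mono Λ Γ ≡ 1#
indicator Λ {Γ} p with Λ ≟SP Γ
... | yes _ = refl
... | no ¬p = ⊥-elim (¬p p)

indicator-0 : ∀ Λ {Γ} → Λ ≢ Γ → mono Λ Γ ≡ 0#
indicator-0 Λ {Γ} p with Λ ≟SP Γ
... | yes q = ⊥-elim (p q)
... | no _ = refl

insertDesc-nonempty : ∀ x l → insertDesc x l ≢ []
insertDesc-nonempty x (y ∷ l) p with y ≤ᵇ x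
insertDesc-nonempty x (y ∷ l) () | true
insertDesc-nonempty x (y ∷ l) () | false

insertDesc-sum : ∀ x l → sum (insertDesc x l) ≡ x ℕ.+ sum l
insertDesc-sum x [] = refl
insertDesc-sum x (y ∷ l) with y ≤ᵇ x
... | true = refl
... | false = cong (y ℕ.+_) (insertDesc-sum x l) ∙ ℕ-solve 3 (λ y x l → y ⊕ (x ⊕ l) ⊜ x ⊕ (y ⊕ l)) refl y x (sum l)

bosonic-key : ∀ M → fst (keyOf M) ≡ [] → invs M ≡ 0 × isSP (keyOf M) ≡ true
bosonic-key M p rewrite weakDec-key M | p = none M p , refl
  where
  none : ∀ M → fst (keyOf M) ≡ [] → invs M ≡ 0
  none [] p = refl
  none (bos k ∷ M) p = none M p
  none (fer k ∷ M) p = ⊥-elim (insertDesc-nonempty k (fst (keyOf M)) p)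

coefMono-mono : ∀ Λ {x} → IsSP Λ → ∀ M → (x ≡ 1# × Λ ≡ keyOf M × invs M ≡ 0) ⊎ (x ≡ 0# × Λ ≢ keyOf M) → coefMono (mono Λ) M ≡ x
coefMono-mono Λ isp M (inl (p , q , i)) with isSP (keyOf M) in eq
... | true = cong₂ ℚ._*_ (cong sgn i) (indicator Λ q) ∙ sym p
... | false = ⊥-elim (subst T (cong isSP q ∙ eq) isp)
coefMono-mono Λ isp M (inr (p , q)) with isSP (keyOf M)
... | true = cong (sgn (invs M) ℚ.*_) (indicator-0 Λ q) ∙ sym (*-raw (sgn (invs M)) 0#) ∙ zeroʳ (sgn (invs M)) ∙ sym p
... | false = sym p

-- The state is the number of exponents 1 still to be met; for `κh` it is the degree still to be
-- distributed. `nothing` means coefficient 0.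
κe : ℕ → ℕ → Maybe ℕ
κe ℓ zero = just ℓ
κe zero (suc y) = nothing
κe (suc ℓ) (suc zero) = just ℓ
κe (suc ℓ) (suc (suc y)) = nothing

κh : ℕ → ℕ → Maybe ℕ
κh ℓ zero = just ℓ
κh zero (suc y) = nothing
κh (suc ℓ) (suc y) = κh ℓ y

Ones : ℕ → Mono → Set
Ones ℓ M = ([] , replicate ℓ 1) ≡ keyOf M

replicate-insertDesc : ∀ ℓ → insertDesc 1 (replicate ℓ 1) ≡ replicate (suc ℓ) 1
replicate-insertDesc zero = refl
replicate-insertDesc (suc ℓ) = refl

insertDesc-ones : ∀ x l ℓ → replicate ℓ 1 ≡ insertDesc x l → x ≡ 1 × Σ ℕ λ k → ℓ ≡ suc k × replicate k 1 ≡ l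
insertDesc-ones x [] (suc zero) refl = refl , 0 , refl , refl
insertDesc-ones x [] (suc (suc ℓ)) ()
insertDesc-ones x (y ∷ l) ℓ p with y ≤ᵇ x in eq
insertDesc-ones x (y ∷ l) (suc ℓ) p | true with LP.∷-injective p
... | refl , q = refl , ℓ , refl , q
insertDesc-ones x (y ∷ l) (suc ℓ) p | false with LP.∷-injective p
... | refl , q with insertDesc-ones x l ℓ q
... | refl , k , e , r = refl , suc k , cong suc e , cong (1 ∷_) r

module SmallE = Small (λ ℓ → at0 ℓ 1#) κe el Lin-el

θe-key : ∀ ℓ M → (SmallE.θ ℓ M ≡ 1# × Ones ℓ M × invs M ≡ 0) ⊎ (SmallE.θ ℓ M ≡ 0# × ¬ Ones ℓ M)
θe-key zero [] = inl (refl , refl , refl)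
θe-key (suc ℓ) [] = inr (refl , λ ())
θe-key ℓ (fer k ∷ M) = inr (refl , λ p → insertDesc-nonempty k (fst (keyOf M)) (sym (cong fst p)))
θe-key ℓ (bos zero ∷ M) = θe-key ℓ M
θe-key zero (bos (suc y) ∷ M) = inr (refl , λ p → insertDesc-nonempty (suc y) (snd (keyOf M)) (sym (cong snd p)))
θe-key (suc ℓ) (bos (suc zero) ∷ M) with θe-key ℓ M
... | inl (p , q , i) = inl (p , cong₂ _,_ (cong fst q) (sym (replicate-insertDesc ℓ) ∙ cong (insertDesc 1) (cong snd q)) , i)
... | inr (p , q) = inr (p , λ r → let _ , k , e , r' = insertDesc-ones 1 (snd (keyOf M)) (suc ℓ) (cong snd r) in
  q (cong₂ _,_ (cong fst r) (cong (λ n → replicate n 1) (suc-injective e) ∙ r')))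
θe-key (suc ℓ) (bos (suc (suc y)) ∷ M) = inr (refl , λ r → two≢1 (fst (insertDesc-ones (suc (suc y)) (snd (keyOf M)) (suc ℓ) (cong snd r))))
  where
  two≢1 : suc (suc y) ≢ 1
  two≢1 ()

ones-SP : ∀ ℓ → IsSP ([] , replicate ℓ 1)
ones-SP zero = tt
ones-SP (suc zero) = tt
ones-SP (suc (suc ℓ)) = ones-SP (suc ℓ)

coefMono-e : ∀ ℓ M → coefMono (e ℓ) M ≡ SmallE.θ ℓ M
coefMono-e ℓ M = coefMono-mono ([] , replicate ℓ 1) {SmallE.θ ℓ M} (ones-SP ℓ) M (θe-key ℓ M)

⋆-e : ∀ {ξ} → Lin ξ → ∀ ℓ Γ → IsSP Γ → (co ξ ⋆ e ℓ) Γ ≡ ξ (el ℓ (mform (canon Γ)))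
⋆-e l ℓ = SmallE.⋆-right el-vac' el-L̃ l ℓ {e ℓ} (coefMono-e ℓ)
  where
  el-vac' : ∀ ℓ w → el ℓ vac w ≡ at0 ℓ 1# * vac w
  el-vac' zero w = sym (*-identityˡ _)
  el-vac' (suc n) w = hook-vac 0 n w ∙ sym (zeroˡ _)
  el-L̃' : ∀ n k b {f} → Symm f → ∀ w → el (suc n) (L̃ (k , b) f) w ≡ L̃ (k , b) (el (suc n) f) w + L̃1 (k , b) (el n f) w
  el-L̃' n k false s w = el-hmul s k n w
  el-L̃' n k true s w = el-h̃mul s k n w
  el-L̃ : ∀ i k b {f} → Symm f → ∀ w → el i (L̃ (k , b) f) w ≡ conv k (λ x y → L̃ (x , b) (SmallE.MΘ (κe i y) f) w)
  el-L̃ zero k b s w = sym (conv-one k _ 0 (λ { x zero n → ⊥-elim (n refl) ; x (suc y) _ → lin-0 (Lin-L̃ (x , b) w) (λ _ → refl) }))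
  el-L̃ (suc n) k b {f} s w = el-L̃' n k b s w ∙ cong₂ _+_ refl (one-less k) ∙
    sym (conv-two k _ 0 (λ { x zero n _ → ⊥-elim (n refl) ; x (suc zero) _ n → ⊥-elim (n refl) ; x (suc (suc y)) _ _ → lin-0 (Lin-L̃ (x , b) w) (λ _ → refl) }))
    where
    one-less : ∀ k → L̃1 (k , b) (el n f) w ≡ sel 1 k (λ x → L̃ (x , b) (el n f) w)
    one-less zero = L̃1-0 b (el n f) w
    one-less (suc k) = L̃1-suc k b (el n f) w

module SmallH = Small (λ ℓ → at0 ℓ 1#) κh (λ ℓ → cons (bos ℓ)) (λ ℓ → Lin-cons (bos ℓ))

size-test : List ℕ → ℕ → ℚ
size-test s ℓ = if sum s ≡ᵇ ℓ then 1# else 0#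

θh-key : ∀ ℓ M → (fst (keyOf M) ≡ [] × SmallH.θ ℓ M ≡ size-test (snd (keyOf M)) ℓ) ⊎ (fst (keyOf M) ≢ [] × SmallH.θ ℓ M ≡ 0#)
θh-key zero [] = inl (refl , refl)
θh-key (suc ℓ) [] = inl (refl , refl)
θh-key ℓ (fer k ∷ M) = inr (insertDesc-nonempty k (fst (keyOf M)) , refl)
θh-key ℓ (bos zero ∷ M) = θh-key ℓ M
θh-key ℓ (bos (suc y) ∷ M) = go (κ-sub ℓ y)
  where
  κ-sub : ∀ ℓ y → (Σ ℕ λ k → ℓ ≡ suc y ℕ.+ k × κh ℓ (suc y) ≡ just k) ⊎ (ℓ < suc y × κh ℓ (suc y) ≡ nothing)
  κ-sub zero y = inr (s≤s z≤n , refl)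
  κ-sub (suc ℓ) zero = inl (ℓ , refl , refl)
  κ-sub (suc ℓ) (suc y) with κ-sub ℓ y
  ... | inl (k , p , q) = inl (k , cong suc p , q)
  ... | inr (p , q) = inr (s≤s p , q)
  same : ∀ y a k → (y ℕ.+ a ≡ᵇ y ℕ.+ k) ≡ (a ≡ᵇ k)
  same zero a k = refl
  same (suc y) a k = same y a k
  apart : ∀ y a ℓ → ℓ < y → (y ℕ.+ a ≡ᵇ ℓ) ≡ false
  apart (suc y) a zero p = refl
  apart (suc y) a (suc ℓ) (s≤s p) = apart y a ℓ p
  a = snd (keyOf M)
  Target : Maybe ℕ → Set
  Target m = (fst (keyOf M) ≡ [] × SmallH.Mθ m M ≡ size-test (insertDesc (suc y) a) ℓ) ⊎ (fst (keyOf M) ≢ [] × SmallH.Mθ m M ≡ 0#)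
  Source : ℕ → Set
  Source k = (fst (keyOf M) ≡ [] × SmallH.θ k M ≡ size-test a k) ⊎ (fst (keyOf M) ≢ [] × SmallH.θ k M ≡ 0#)
  fits : ∀ k → ℓ ≡ suc y ℕ.+ k → Source k → Target (just k)
  fits k p (inr r) = inr r
  fits k p (inl (r , t)) = inl (r , t ∙ cong (λ b → if b then 1# else 0#)
    (sym (cong₂ _≡ᵇ_ (insertDesc-sum (suc y) a) p ∙ same (suc y) (sum a) k)))
  exceeds : ℓ < suc y → Source ℓ → Target nothing
  exceeds p (inr (r , _)) = inr (r , refl)
  exceeds p (inl (r , _)) = inl (r , cong (λ b → if b then 1# else 0#) (sym (cong (_≡ᵇ ℓ) (insertDesc-sum (suc y) a) ∙ apart (suc y) (sum a) ℓ p)))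
  go : (Σ ℕ λ k → ℓ ≡ suc y ℕ.+ k × κh ℓ (suc y) ≡ just k) ⊎ (ℓ < suc y × κh ℓ (suc y) ≡ nothing) → Target (κh ℓ (suc y))
  go (inl (k , p , q)) = subst Target (sym q) (fits k p (θh-key k M))
  go (inr (p , q)) = subst Target (sym q) (exceeds p (θh-key ℓ M))

h-value : ∀ ℓ a s n → weakDecPos s ≡ true → (a ≡ [] → n ≡ 0) →
  let x = if isSP (a , s) then sgn n ℚ.* h ℓ (a , s) else 0# in (a ≡ [] → x ≡ size-test s ℓ) × (a ≢ [] → x ≡ 0#)
h-value ℓ [] s n p q rewrite p | q refl = (λ _ → sym (*-raw 1# _) ∙ *-identityˡ _) , λ r → ⊥-elim (r refl)
h-value ℓ (x ∷ a) s n p q rewrite p with strictDec (x ∷ a)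
... | true = (λ ()) , λ _ → sym (*-raw (sgn n) 0#) ∙ zeroʳ (sgn n)
... | false = (λ ()) , λ _ → refl

coefMono-h : ∀ ℓ M → coefMono (h ℓ) M ≡ SmallH.θ ℓ M
coefMono-h ℓ M = go (θh-key ℓ M)
  where
  values = h-value ℓ (fst (keyOf M)) (snd (keyOf M)) (invs M) (weakDec-key M) (λ p → fst (bosonic-key M p))
  go : (fst (keyOf M) ≡ [] × SmallH.θ ℓ M ≡ size-test (snd (keyOf M)) ℓ) ⊎ (fst (keyOf M) ≢ [] × SmallH.θ ℓ M ≡ 0#) →
    coefMono (h ℓ) M ≡ SmallH.θ ℓ M
  go (inl (p , q)) = fst values p ∙ sym q
  go (inr (p , q)) = snd values p ∙ sym q

⋆-h : ∀ {ξ} → Lin ξ → ∀ ℓ Γ → IsSP Γ → (co ξ ⋆ h ℓ) Γ ≡ ξ (cons (bos ℓ) (mform (canon Γ)))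
⋆-h l ℓ = SmallH.⋆-right vac-h h-L̃ l ℓ {h ℓ} (coefMono-h ℓ)
  where
  vac-h : ∀ ℓ w → at0 ℓ (vac w) ≡ at0 ℓ 1# * vac w
  vac-h zero w = sym (*-identityˡ _)
  vac-h (suc n) w = sym (zeroˡ _)
  h-L̃ : ∀ i k b {f} → Symm f → ∀ w → L̃ (k , b) f (bos i ∷ w) ≡ conv k (λ x y → L̃ (x , b) (SmallH.MΘ (κh i y) f) w)
  h-L̃ zero k b {f} s w = L̃-bos k b 0 f w ∙ +-identityʳ _ ∙
    sym (conv-one k _ 0 (λ { x zero n → ⊥-elim (n refl) ; x (suc y) _ → lin-0 (Lin-L̃ (x , b) w) (λ _ → refl) }))
  h-L̃ (suc i) zero b {f} s w = L̃-bos 0 b (suc i) f w ∙ +0 (L̃1-0 b f (bos i ∷ w))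
  h-L̃ (suc i) (suc k) b {f} s w = L̃-bos (suc k) b (suc i) f w ∙ trans
    (cong₂ _+_ refl (L̃1-suc k b f (bos i ∷ w) ∙ h-L̃ i k b s w))
    (+-comm _ _ ∙ sym (conv-last k (λ x y → L̃ (x , b) (SmallH.MΘ (κh (suc i) y) f) w)))

-- Power sums.

Symm-vac : Symm vac
Symm-vac = Symm-form []

Tp-vac : ∀ n w → Tp n vac w ≡ 0#
Tp-vac n w = conv-0 n _ terms
  where
  terms : ∀ i j → i ℕ.+ j ≡ n → (nat i * sg j) * el j vac (bos i ∷ w) ≡ 0#
  terms zero j _ = 0* (zeroˡ (sg j))
  terms (suc i) j _ = *0 (sym (el-cons Symm-vac (bos (suc i)) j w) ∙ lin-0 (Lin-el j w) (λ _ → refl))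

step : ℕ → ℕ → Maybe Bool
step r y with y ℕ.≟ r
... | yes _ = just false
... | no _ = nothing

step-yes : ∀ r → step r r ≡ just false
step-yes r with r ℕ.≟ r
... | yes _ = refl
... | no ¬p = ⊥-elim (¬p refl)

step-no : ∀ r y → y ≢ r → step r y ≡ nothing
step-no r y n with y ℕ.≟ r
... | yes p = ⊥-elim (n p)
... | no _ = refl

-- In state `true` the exponent r + 1 is still awaited; in state `false` only zeros may follow.
κp : ℕ → Bool → ℕ → Maybe Bool
κp r b zero = just b
κp r false (suc y) = nothing
κp r true (suc y) = step r y

Θp : ℕ → Bool → Fn → Fn
Θp r false f = f
Θp r true = Tp (suc r)

Lin-Θp : ∀ r b → LinOp (Θp r b)
Lin-Θp r false = Lin-at
Lin-Θp r true = Lin-Tp (suc r)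

module SmallP (r : ℕ) = Small (λ b → if b then 0# else 1#) (κp r) (Θp r) (Lin-Θp r)

insertDesc-single : ∀ x y l → y ∷ [] ≡ insertDesc x l → y ≡ x × [] ≡ l
insertDesc-single x y [] refl = refl , refl
insertDesc-single x y (v ∷ l) p with v ≤ᵇ x
insertDesc-single x y (v ∷ l) () | true
insertDesc-single x y (v ∷ l) p | false = ⊥-elim (insertDesc-nonempty x l (sym (snd (LP.∷-injective p))))

target : ℕ → Bool → List ℕ
target r false = []
target r true = suc r ∷ []

θp-key : ∀ r b M → (SmallP.θ r b M ≡ 1# × ([] , target r b) ≡ keyOf M × invs M ≡ 0) ⊎ (SmallP.θ r b M ≡ 0# × ([] , target r b) ≢ keyOf M)
θp-key r false [] = inl (refl , refl , refl)
θp-key r true [] = inr (refl , λ ())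
θp-key r b (fer k ∷ M) = inr (refl , λ p → insertDesc-nonempty k (fst (keyOf M)) (sym (cong fst p)))
θp-key r b (bos zero ∷ M) = θp-key r b M
θp-key r false (bos (suc y) ∷ M) = inr (refl , λ p → insertDesc-nonempty (suc y) (snd (keyOf M)) (sym (cong snd p)))
θp-key r true (bos (suc y) ∷ M) = go (y ℕ.≟ r)
  where
  Goal : Maybe Bool → Set
  Goal m = (SmallP.Mθ r m M ≡ 1# × ([] , suc r ∷ []) ≡ keyOf (bos (suc y) ∷ M) × invs M ≡ 0) ⊎ (SmallP.Mθ r m M ≡ 0# × ([] , suc r ∷ []) ≢ keyOf (bos (suc y) ∷ M))
  found : y ≡ r → (SmallP.θ r false M ≡ 1# × ([] , []) ≡ keyOf M × invs M ≡ 0) ⊎ (SmallP.θ r false M ≡ 0# × ([] , []) ≢ keyOf M) → Goal (just false)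
  found refl (inl (p , q , i)) = inl (p , cong₂ _,_ (cong fst q) (cong (insertDesc (suc r)) (cong snd q)) , i)
  found refl (inr (p , q)) = inr (p , λ e → q (cong₂ _,_ (cong fst e) (snd (insertDesc-single (suc r) (suc r) (snd (keyOf M)) (cong snd e)))))
  go : Relation.Nullary.Decidable.Dec (y ≡ r) → Goal (step r y)
  go (yes refl) = subst Goal (sym (step-yes r)) (found refl (θp-key r false M))
  go (no ¬p) = subst Goal (sym (step-no r y ¬p)) (inr (refl , λ e → ¬p (suc-injective (sym (fst (insertDesc-single (suc y) (suc r) (snd (keyOf M)) (cong snd e)))))))

sel-cong : ∀ r k {F G : ℕ → ℚ} → (∀ x → F x ≡ G x) → sel r k F ≡ sel r k G
sel-cong zero k p = p k
sel-cong (suc r) zero p = refl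
sel-cong (suc r) (suc k) p = sel-cong r k p

⋆-p : ∀ {ξ} → Lin ξ → ∀ r Γ → IsSP Γ → (mono ([] , suc r ∷ []) ⋆ co ξ) Γ ≡ ξ (Tp (suc r) (mform (canon Γ)))
⋆-p l r = SmallP.⋆-left r p-vac p-L̃ l true {mono ([] , suc r ∷ [])} (λ M → coefMono-mono ([] , suc r ∷ []) {SmallP.θ r true M} tt M (θp-key r true M))
  where
  p-vac : ∀ b w → Θp r b vac w ≡ (if b then 0# else 1#) * vac w
  p-vac false w = sym (*-identityˡ _)
  p-vac true w = Tp-vac (suc r) w ∙ sym (zeroˡ _)
  p-L̃ : ∀ i k b {f} → Symm f → ∀ w → Θp r i (L̃ (k , b) f) w ≡ conv k (λ x y → L̃ (x , b) (SmallP.MΘ r (κp r i y) f) w)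
  p-L̃ false k b s w = sym (conv-one k _ 0 (λ { x zero n → ⊥-elim (n refl) ; x (suc y) _ → lin-0 (Lin-L̃ (x , b) w) (λ _ → refl) }))
  p-L̃ true k b {f} s w = Tp-L̃ r (k , b) s w ∙ sym (trans
    (conv-two k _ r (λ { x zero n _ → ⊥-elim (n refl) ; x (suc y) _ n → cong (λ m → L̃ (x , b) (SmallP.MΘ r m f) w) (step-no r y (λ e → n (cong suc e))) ∙ lin-0 (Lin-L̃ (x , b) w) (λ _ → refl) }))
    (cong₂ _+_ refl (sel-cong (suc r) k (λ x → cong (λ m → L̃ (x , b) (SmallP.MΘ r m f) w) (step-yes r)))))

-- Coefficients of p̃_k (state true) and of 1 (state false).
θt : ℕ → Bool → Mono → ℚ
θt k b [] = if b then 0# else 1#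
θt k b (fer x ∷ g) = if b then δ x k * θt k false g else 0#
θt k b (bos zero ∷ g) = θt k b g
θt k b (bos (suc y) ∷ g) = 0#

targetᵃ : ℕ → Bool → List ℕ
targetᵃ k false = []
targetᵃ k true = k ∷ []

θt-key : ∀ k b M → (θt k b M ≡ 1# × (targetᵃ k b , []) ≡ keyOf M × invs M ≡ 0) ⊎ (θt k b M ≡ 0# × (targetᵃ k b , []) ≢ keyOf M)
θt-key k false [] = inl (refl , refl , refl)
θt-key k true [] = inr (refl , λ ())
θt-key k b (bos zero ∷ M) = θt-key k b M
θt-key k b (bos (suc y) ∷ M) = inr (refl , λ p → insertDesc-nonempty (suc y) (snd (keyOf M)) (sym (cong snd p)))
θt-key k false (fer x ∷ M) = inr (refl , λ p → insertDesc-nonempty x (fst (keyOf M)) (sym (cong fst p)))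
θt-key k true (fer x ∷ M) with x ℕ.≟ k
... | no ¬p = inr (0* (δ-≢ x k ¬p) ,
  λ e → ¬p (sym (fst (insertDesc-single x k (fst (keyOf M)) (cong fst e)))))
... | yes refl = found (θt-key k false M)
  where
  one* : δ k k * θt k false M ≡ θt k false M
  one* = cong (_* θt k false M) (δ-refl k) ∙ *-identityˡ _
  found : (θt k false M ≡ 1# × ([] , []) ≡ keyOf M × invs M ≡ 0) ⊎ (θt k false M ≡ 0# × ([] , []) ≢ keyOf M) → (δ k k * θt k false M ≡ 1# × (k ∷ [] , []) ≡ keyOf (fer k ∷ M) × invs (fer k ∷ M) ≡ 0) ⊎ (δ k k * θt k false M ≡ 0# × (k ∷ [] , []) ≢ keyOf (fer k ∷ M))
  found (inl (p , q , i)) = inl (trans one* p , cong₂ _,_ (cong (insertDesc k) (cong fst q)) (cong snd q) ,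
    cong₂ ℕ._+_ (greater-key k M ∙ cong (greater k) (sym (cong fst q))) i)
  found (inr (p , q)) = inr (trans one* p , λ e → q (cong₂ _,_ (snd (insertDesc-single k k (fst (keyOf M)) (cong fst e))) (cong snd e)))

θt-count : ∀ k b M → θt k b M ≡ 0# ⊎ countᵇ snd M ≡ (if b then 1 else 0)
θt-count k false [] = inr refl
θt-count k true [] = inl refl
θt-count k b (bos zero ∷ M) = θt-count k b M
θt-count k b (bos (suc y) ∷ M) = inl refl
θt-count k false (fer x ∷ M) = inl refl
θt-count k true (fer x ∷ M) with θt-count k false M
... | inl p = inl (*0 p)
... | inr p = inr (cong suc p)

Θt : ℕ → Bool → Fn → Fn
Θt k false f = f
Θt k true = cons (fer k)

conv-first : ∀ k (F : ℕ → ℕ → ℚ) → (∀ x y → F (suc x) y ≡ 0#) → conv k F ≡ F 0 k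
conv-first zero F p = refl
conv-first (suc k) F p = cong (F 0 (suc k) +_) (conv-0 k _ (λ x y _ → p x y)) ∙ +-identityʳ _

-- p̃_k is odd, so the shuffle signs stay. When the θ of p̃_k is not taken from the current
-- fermionic letter, it comes from a later one and must cross that letter, which costs a sign.
sum-p̃ : ∀ k b xs {ξ} → Lin ξ →
  sumA (splits xs) (λ p → sgn (shuf (fst p) (snd p)) * θt k b (fst p) * ξ (mform (snd p))) ≡ ξ (Θt k b (mform xs))
sum-p̃ k false [] {ξ} l = solve 1 (λ x → (con 1# :* con 1#) :* x :+ con 0# := x) refl (ξ vac)
sum-p̃ k true [] {ξ} l = solve 1 (λ x → (con 1# :* con 0#) :* x :+ con 0# := con 0#) refl (ξ vac) ∙ sym (lin-0 l (λ _ → refl))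
sum-p̃ k b (bos m ∷ xs) {ξ} l = sum-splits-bos m xs _ ∙ trans
  (conv-first m _ (λ x y → sumA-0 (splits xs) (λ p → 0* (zeroʳ _))))
  (sum-p̃ k b xs (Lin-∘ l (Lin-hmul m)) ∙ moved b)
  where
  moved : ∀ b → ξ (hmul m (Θt k b (mform xs))) ≡ ξ (Θt k b (hmul m (mform xs)))
  moved false = refl
  moved true = lin-cong l (λ w → sym (hmul-fer m k (mform xs) w))
sum-p̃ k b (fer m ∷ xs) {ξ} l = sum-splits-fer m xs _ ∙ cong₂ _+_ refl
  (conv-first m _ (λ x y → sumA-0 (splits xs) (λ p → 0* (zeroʳ _)))) ∙
  by b
  where
  l' = Lin-∘ l (Lin-h̃mul m)
  signed : ∀ b c fs gs → c ≡ (if b then 1 else 0) →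
    sgn (c ℕ.+ shuf fs gs) * θt k b fs * ξ (h̃mul m (mform gs)) ≡ sgn (if b then 1 else 0) * (sgn (shuf fs gs) * θt k b fs * ξ (h̃mul m (mform gs)))
  signed b c fs gs refl = cong (λ x → x * θt k b fs * ξ (h̃mul m (mform gs))) (sgn-+ (if b then 1 else 0) (shuf fs gs)) ∙
    solve 4 (λ a b c d → (a :* b) :* c :* d := a :* (b :* c :* d)) refl _ _ _ _
  passed : ∀ b p → sgn (countᵇ snd (fst p) ℕ.+ shuf (fst p) (snd p)) * θt k b (fst p) * ξ (h̃mul m (mform (snd p)))
    ≡ sgn (if b then 1 else 0) * (sgn (shuf (fst p) (snd p)) * θt k b (fst p) * ξ (h̃mul m (mform (snd p))))
  passed b (fs , gs) with θt-count k b fs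
  ... | inr p = signed b (countᵇ snd fs) fs gs p
  ... | inl p = cong (λ x → sgn (countᵇ snd fs ℕ.+ shuf fs gs) * x * ξ (h̃mul m (mform gs))) p ∙
    solve 3 (λ a b c → a :* con 0# :* c := b :* (a :* con 0# :* c)) refl (sgn (countᵇ snd fs ℕ.+ shuf fs gs)) (sgn (if b then 1 else 0)) (ξ (h̃mul m (mform gs))) ∙
    cong (sgn (if b then 1 else 0) *_) (solve 3 (λ a b c → a :* con 0# :* c := b :* con 0# :* c) refl (sgn (countᵇ snd fs ℕ.+ shuf fs gs)) (sgn (shuf fs gs)) (ξ (h̃mul m (mform gs))) ∙
      cong (λ x → sgn (shuf fs gs) * x * ξ (h̃mul m (mform gs))) (sym p))
  crossing : ∀ b → sumA (splits xs) (λ p → sgn (countᵇ snd (fst p) ℕ.+ shuf (fst p) (snd p)) * θt k b (fst p) * ξ (h̃mul m (mform (snd p))))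
    ≡ sgn (if b then 1 else 0) * ξ (h̃mul m (Θt k b (mform xs)))
  crossing b = sumA-≗ (splits xs) (passed b) ∙ sumA-* (splits xs) _ _ ∙ cong (sgn (if b then 1 else 0) *_) (sum-p̃ k b xs l')
  by : ∀ b → conv m (λ x y → sumA (splits xs) (λ p → sgn (shuf (fst p) (snd p)) * θt k b (fer x ∷ fst p) * ξ (hmul y (mform (snd p)))))
    + sumA (splits xs) (λ p → sgn (countᵇ snd (fst p) ℕ.+ shuf (fst p) (snd p)) * θt k b (fst p) * ξ (h̃mul m (mform (snd p))))
    ≡ ξ (Θt k b (h̃mul m (mform xs)))
  by false = cong₂ _+_ (conv-0 m _ (λ x y _ → sumA-0 (splits xs) (λ p → 0* (zeroʳ _)))) (crossing false) ∙
    solve 1 (λ x → con 0# :+ con 1# :* x := x) refl _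
  by true = cong₂ _+_ (conv-cong m (λ x y _ → sumA-≗ (splits xs) (λ p →
        solve 4 (λ s d t x → s :* (d :* t) :* x := d :* (s :* t :* x)) refl (sgn (shuf (fst p) (snd p))) (δ x k) (θt k false (fst p)) (ξ (hmul y (mform (snd p))))) ∙
        sumA-* (splits xs) (δ x k) _ ∙ cong (δ x k *_) (sum-p̃ k false xs (Lin-∘ l (Lin-hmul y))) ∙ sym (lin-* l (δ x k) _)) ∙
      sym (lin-conv l m _) ∙ lin-cong l (λ w → conv-δ m k (mform xs) w)) (crossing true) ∙
    cong (ξ (hshift m k (mform xs)) +_) (sym (neg-as-* _)) ∙ sym (lin-sub l _ _) ∙ lin-cong l (λ w → sym (h̃mul-fer m k (mform xs) w))

⋆-p̃ : ∀ {ξ} → Lin ξ → ∀ k Γ → IsSP Γ → (mono (k ∷ [] , []) ⋆ co ξ) Γ ≡ ξ (cons (fer k) (mform (canon Γ)))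
⋆-p̃ {ξ} l k Γ isp = ⋆-sum (mono (k ∷ [] , [])) (co ξ) Γ isp ∙ sumA-≗ (splits (canon Γ)) (λ q →
  cong₂ (λ x y → sgn (shuf (fst q) (snd q)) * x * y) (coefMono-mono (k ∷ [] , []) {θt k true (fst q)} tt (fst q) (θt-key k true (fst q))) (coefMono-co l (snd q))) ∙
  sum-p̃ k true (canon Γ) l

πs : List ℕ → Fn → ℚ
πs [] f = f []
πs (r ∷ s) f = πs s (Tp r f)

π : List ℕ → List ℕ → Fn → ℚ
π [] s f = πs s f
π (k ∷ a) s f = π a s (cons (fer k) f)

Lin-πs : ∀ s → Lin (πs s)
Lin-πs [] = Lin-at []
Lin-πs (r ∷ s) = Lin-∘ (Lin-πs s) (Lin-Tp r)

Lin-π : ∀ a s → Lin (π a s)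
Lin-π [] s = Lin-πs s
Lin-π (k ∷ a) s = Lin-∘ (Lin-π a s) (Lin-cons (fer k))

⋆-congʳ : ∀ f {g g' : SymF} → (∀ Γ → IsSP Γ → g Γ ≡ g' Γ) → ∀ Γ → IsSP Γ → (f ⋆ g) Γ ≡ (f ⋆ g') Γ
⋆-congʳ f {g} {g'} p Γ isp = ⋆-sum f g Γ isp ∙ sumA-≗ (splits (canon Γ)) (λ q →
  cong (sgn (shuf (fst q) (snd q)) * coefMono f (fst q) *_) (coefMono-cong p (snd q))) ∙ sym (⋆-sum f g' Γ isp)

⋆-congˡ : ∀ g {f f' : SymF} → (∀ Γ → IsSP Γ → f Γ ≡ f' Γ) → ∀ Γ → IsSP Γ → (f ⋆ g) Γ ≡ (f' ⋆ g) Γ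
⋆-congˡ g {f} {f'} p Γ isp = ⋆-sum f g Γ isp ∙ sumA-≗ (splits (canon Γ)) (λ q →
  cong (λ x → sgn (shuf (fst q) (snd q)) * x * coefMono g (snd q)) (coefMono-cong p (fst q))) ∙ sym (⋆-sum f' g Γ isp)

pSP-co : ∀ a s → All (1 ≤_) s → ∀ Γ → IsSP Γ → pSP (a , s) Γ ≡ co (π a s) Γ
pSP-co [] [] _ ([] , []) isp = refl
pSP-co [] [] _ ([] , x ∷ s) isp with weakDec⇒All x s isp
... | s≤s _ , _ = refl
pSP-co [] [] _ (x ∷ a , s) isp = sym (L̃-[] (fer x) (fers a ++ bosons s) tt)
pSP-co [] (suc r ∷ s) (_ ∷ p) Γ isp = ⋆-congʳ (mono ([] , suc r ∷ [])) (pSP-co [] s p) Γ isp ∙ ⋆-p (Lin-πs s) r Γ isp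
pSP-co (k ∷ a) s p Γ isp = ⋆-congʳ (mono (k ∷ [] , [])) (pSP-co a s p) Γ isp ∙ ⋆-p̃ (Lin-π a s) k Γ isp

-- Orthogonality of the power sums.

dns : ℕ → ℕ → Fn → Fn
dns r k f w = sel r k (λ x → f (bos x ∷ w))

-- Transpose of the derivation of words with h_k ↦ h_{k-r} and p̃_a ↦ 0, that is of r ∂/∂p_r. On the
-- functional of g it is multiplication of g by p_r, whereas `Tp` transposes multiplication of
-- words.
dp : ℕ → Fn → Fn
dp r f [] = 0#
dp r f (bos k ∷ w) = dp r (cons (bos k) f) w + dns r k f w
dp r f (fer a ∷ w) = dp r (cons (fer a) f) w

Lin-dns : ∀ r k → LinOp (dns r k)
Lin-dns r k w = Lin-sel r k (λ x → Lin-at (bos x ∷ w))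

Lin-dp : ∀ r → LinOp (dp r)
Lin-dp r [] = Lin-0
Lin-dp r (bos k ∷ w) = Lin-+ (Lin-∘ (Lin-dp r w) (Lin-cons (bos k))) (Lin-dns r k w)
Lin-dp r (fer a ∷ w) = Lin-∘ (Lin-dp r w) (Lin-cons (fer a))

Symm-dp : ∀ r {f} → Symm f → Symm (dp (suc r) f)
Symm-dp r {f} s .at [] .Front.swap (bos m) (bos n) w = 1*-eq (begin
  _
    ≡⟨ cong₂ (λ x y → (x + y) + dns R m f (bos n ∷ w)) (lin-cong (Lin-dp R w) (λ v → swap-bos s m (bos n) v)) (sel-cong R n (λ x → swap-bos s m (bos x) w)) ⟩
  (dp R (cons (bos m) (cons (bos n) f)) w + dns R n f (bos m ∷ w)) + dns R m f (bos n ∷ w)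
    ≡⟨ cong (λ x → (dp R (cons (bos m) (cons (bos n) f)) w + dns R n f (bos m ∷ w)) + x) (sel-cong R m (λ x → swap-bos s x (bos n) w)) ⟩
  (dp R (cons (bos m) (cons (bos n) f)) w + dns R n f (bos m ∷ w)) + dns R m (cons (bos n) f) w
    ≡⟨ solve 3 (λ a b c → (a :+ b) :+ c := (a :+ c) :+ b) refl _ _ _ ⟩
  _ ∎)
  where R = suc r
Symm-dp r {f} s .at [] .Front.swap (bos m) (fer b) w = 1*-eq (cong₂ _+_ (lin-cong (Lin-dp (suc r) w) (λ v → swap-bos s m (fer b) v))
  (sel-cong (suc r) m (λ x → swap-bos s x (fer b) w)))
Symm-dp r {f} s .at [] .Front.swap (fer a) (bos n) w = 1*-eq (cong₂ _+_ (lin-cong (Lin-dp (suc r) w) (λ v → sym (swap-bos s n (fer a) v)))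
  (sel-cong (suc r) n (λ x → sym (swap-bos s x (fer a) w))))
Symm-dp r {f} s .at [] .Front.swap (fer a) (fer b) w =
  lin-cong (Lin-dp (suc r) w) (λ v → swap-fer s a b v) ∙ lin-neg (Lin-dp (suc r) w) _ ∙ neg-as-* _
Symm-dp r s .at [] .Front.unit w = +-identityʳ _ ∙ lin-cong (Lin-dp (suc r) w) (drop0 s)
Symm-dp r s .at (bos n ∷ u) = Front-+ (at (Symm-dp r (Symm-cons s (bos n))) u) (at (Symm-sel (suc r) n (λ x → Symm-cons s (bos x))) u)
Symm-dp r s .at (fer a ∷ u) = at (Symm-dp r (Symm-cons s (fer a))) u

newton-dns : ∀ {f} → Symm f → ∀ r n w → conv n (λ i j → Tp i (dns r j f) w) + nat r * dns r n f w ≡ nat n * dns r n f w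
newton-dns s zero n w = cong₂ _+_ (newton s n w) (zeroˡ _) ∙ +-identityʳ _
newton-dns {f} s (suc r) zero w = cong (_+ nat (suc r) * 0#) (Tp-0 (λ _ → 0#) w) ∙ solve 1 (λ x → con 0# :+ x :* con 0# := con 0# :* con 0#) refl (nat (suc r))
newton-dns {f} s (suc r) (suc n) w = begin
  _
    ≡⟨ cong (_+ (1# + nat r) * d) (conv-last n (λ i j → Tp i (dns (suc r) j f) w) ∙ +0 (lin-0 (Lin-Tp (suc n) w) (λ _ → refl))) ⟩
  C + (1# + nat r) * d
    ≡⟨ solve 3 (λ c r d → c :+ (con 1# :+ r) :* d := (c :+ r :* d) :+ d) refl C (nat r) d ⟩
  (C + nat r * d) + d
    ≡⟨ cong (_+ d) (newton-dns s r n w) ⟩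
  nat n * d + d
    ≡⟨ solve 2 (λ n d → n :* d :+ d := (con 1# :+ n) :* d) refl (nat n) d ⟩
  _ ∎
  where
  d = dns r n f w
  C = conv n (λ i j → Tp i (dns r j f) w)

conv-δʳ : ∀ r n (G : ℕ → ℚ) → conv n (λ i j → δ r i * G j) ≡ sel r n G
conv-δʳ zero zero G = *-identityˡ _
conv-δʳ (suc r) zero G = zeroˡ _
conv-δʳ zero (suc n) G = cong₂ _+_ (*-identityˡ _) (conv-0 n _ (λ i j _ → zeroˡ _)) ∙ +-identityʳ _
conv-δʳ (suc r) (suc n) G = cong₂ _+_ (zeroˡ _) (conv-δʳ r n G) ∙ +-identityˡ _

-- The Heisenberg relation between p_n and r ∂/∂p_r, reduced by `newton-unique` to its convolution
-- with the h_j.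
Tp-dp : ∀ {f} → Symm f → ∀ n r w → Tp n (dp (suc r) f) w ≡ dp (suc r) (Tp n f) w + (nat (suc r) * δ (suc r) n) * f w
Tp-dp {f} s n r w = solve 3 (λ a b c → a := ((a :- b) :- c) :+ (b :+ c)) refl (Tp n (dp R f) w) (dp R (Tp n f) w) _ ∙
  cong (_+ (dp R (Tp n f) w + (nat R * δ R n) * f w)) (newton-unique U U0 U-conv n s) ∙ +-identityˡ _
  where
  R = suc r
  U : ℕ → Fn → ℚ
  U i f = (Tp i (dp R f) w - dp R (Tp i f) w) - (nat R * δ R i) * f w
  U0 : ∀ i {f} → Symm f → U i (cons (bos 0) f) ≡ U i f
  U0 i s = sub-cong (sub-cong (lin-cong (Lin-Tp i w) (λ v → lin-cong (Lin-dp R v) (drop0 s)))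
    (lin-cong (Lin-dp R w) (λ v → lin-cong (Lin-Tp i v) (drop0 s)))) (cong (nat R * δ R i *_) (drop0 s w))
  U-conv : ∀ n {f} → Symm f → conv n (λ i j → U i (cons (bos j) f)) ≡ 0#
  U-conv n {f} s = begin
    _
      ≡⟨ conv-+ n _ _ ∙ cong₂ _+_ (conv-+ n _ _ ∙ cong₂ _+_ refl (conv-neg n _)) (conv-neg n _) ⟩
    _
      ≡⟨ sub-cong (sub-cong
           (conv-cong n (λ i j _ → lin-cong-sub (Lin-Tp i w) (λ v → solve 2 (λ a b → a := (a :+ b) :- b) refl _ (dns R j f v))) ∙
             conv-+ n _ _ ∙ cong₂ _+_ (newton (Symm-dp r s) n w) (conv-neg n _))
           (sym (lin-conv (Lin-dp R w) n _) ∙ lin-cong-* (Lin-dp R w) (newton s n)))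
         (conv-cong n (λ i j _ → *-assoc _ _ _) ∙ conv-* n (nat R) _ ∙ cong (nat R *_) (conv-δʳ R n (λ x → f (bos x ∷ w)))) ⟩
    ((nat n * (Y + d) - C) - nat n * Y) - nat R * d
      ≡⟨ solve 5 (λ n y d c r → ((n :* (y :+ d) :- c) :- n :* y) :- r :* d := n :* d :- (c :+ r :* d)) refl (nat n) Y d C (nat R) ⟩
    nat n * d - (C + nat R * d)
      ≡⟨ cong (λ x → nat n * d - x) (newton-dns s R n w) ⟩
    nat n * d - nat n * d ≡⟨ -‿inverseʳ _ ⟩
    0# ∎
    where
    Y = dp R (cons (bos n) f) w
    d = dns R n f w
    C = conv n (λ i j → Tp i (dns R j f) w)

Tp-hmul : ∀ n k {f} → Symm f → ∀ w → Tp (suc n) (hmul k f) w ≡ hmul k (Tp (suc n) f) w + sel (suc n) k (λ x → hmul x f w)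
Tp-hmul n k s w = Tp-L̃ n (bos k) s w

-- `Tp` and `dp` are adjoint for `form`; the letters are transferred one by one as in `form-sym`.
Tp-form : ∀ r u w → Tp (suc r) (form u) w ≡ dp (suc r) (form w) u
Tp-form r [] w = Tp-vac (suc r) w
Tp-form r (bos k ∷ u) w = let C , p , q = adjoint (bos k) w in begin
  _
    ≡⟨ Tp-hmul r k (Symm-form u) w ⟩
  hmul k (Tp (suc r) (form u)) w + sel (suc r) k (λ x → hmul x (form u) w)
    ≡⟨ cong₂ _+_ (p _ ∙ ev-cong C (λ v → Tp-form r u v) ∙ sym (lin-ev (Lin-dp (suc r) u) C form) ∙ lin-cong (Lin-dp (suc r) u) (λ x → sym (q x)))
         (sel-cong (suc r) k (λ x → form-sym (bos x ∷ u) w)) ⟩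
  _ ∎
Tp-form r (fer a ∷ u) w = let C , p , q = adjoint (fer a) w in begin
  _
    ≡⟨ Tp-pmul (suc r) a (Symm-form u) w ⟩
  pmul a (Tp (suc r) (form u)) w
    ≡⟨ p _ ∙ ev-cong C (λ v → Tp-form r u v) ∙ sym (lin-ev (Lin-dp (suc r) u) C form) ∙ lin-cong (Lin-dp (suc r) u) (λ x → sym (q x)) ⟩
  _ ∎

pfs : List ℕ → Fn
pfs [] = vac
pfs (r ∷ s) = dp r (pfs s)

pf : List ℕ → List ℕ → Fn
pf [] s = pfs s
pf (k ∷ a) s = pmul k (pf a s)

Symm-pfs : ∀ {s} → All (1 ≤_) s → Symm (pfs s)
Symm-pfs [] = Symm-vac
Symm-pfs {suc r ∷ s} (_ ∷ p) = Symm-dp r (Symm-pfs p)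

Symm-pf : ∀ a {s} → All (1 ≤_) s → Symm (pf a s)
Symm-pf [] p = Symm-pfs p
Symm-pf (k ∷ a) p = Symm-pmul k (Symm-pf a p)

πs-form : ∀ {s} → All (1 ≤_) s → ∀ w → πs s (form w) ≡ pfs s w
πs-form [] w = form-[] w
πs-form {suc r ∷ s} (_ ∷ p) w = let C , q = Lin-dp (suc r) w in begin
  _
    ≡⟨ lin-cong (Lin-πs s) (λ x → Tp-form r w x ∙ q (form x) ∙ ev-cong C (form-sym x)) ⟩
  πs s (λ x → ev C (λ v → form v x)) ≡⟨ lin-ev (Lin-πs s) C form ⟩
  ev C (λ v → πs s (form v)) ≡⟨ ev-cong C (πs-form p) ⟩
  ev C (pfs s) ≡⟨ sym (q (pfs s)) ⟩
  _ ∎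

π-form : ∀ a {s} → All (1 ≤_) s → ∀ w → π a s (form w) ≡ pf a s w
π-form [] p w = πs-form p w
π-form (k ∷ a) {s} p w = let C , q , q' = adjoint (fer k) w in begin
  π a s (cons (fer k) (form w)) ≡⟨ lin-cong (Lin-π a s) q' ⟩
  π a s (λ x → ev C (λ v → form v x)) ≡⟨ lin-ev (Lin-π a s) C form ⟩
  ev C (λ v → π a s (form v)) ≡⟨ ev-cong C (π-form a p) ⟩
  ev C (pf a s) ≡⟨ sym (q (pf a s)) ⟩
  _ ∎

fd : Mono → ℕ
fd [] = 0
fd (fer a ∷ w) = a ℕ.+ fd w
fd (bos _ ∷ w) = fd w

-- The twist by t^{|Λ^a|} that turns ⟨⟨ , ⟩⟩ into ⟨⟨ , ⟩⟩_{t,t}.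
sc : ℚ → Fn → Fn
sc t f w = pow t (fd w) * f w

pow-+ : ∀ t m n → pow t (m ℕ.+ n) ≡ pow t m * pow t n
pow-+ t zero n = sym (*-identityˡ _)
pow-+ t (suc m) n = cong (t *_) (pow-+ t m n) ∙ sym (*-assoc _ _ _)

sc-fer : ∀ t k f w → sc t f (fer k ∷ w) ≡ pow t k * sc t (cons (fer k) f) w
sc-fer t k f w = cong (_* f (fer k ∷ w)) (pow-+ t k (fd w)) ∙ *-assoc _ _ _

hook-sc : ∀ t f i n w → hook i n (sc t f) w ≡ sc t (hook i n f) w
hook-sc t f i zero w = refl
hook-sc t f i (suc n) w = sub-cong (hook-sc t (cons (bos i) f) 1 n w) (hook-sc t f (suc i) n w) ∙
  solve 3 (λ a b c → a :* b :- a :* c := a :* (b :- c)) refl _ _ _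

el-sc : ∀ t f n w → el n (sc t f) w ≡ sc t (el n f) w
el-sc t f zero w = refl
el-sc t f (suc n) w = hook-sc t f 1 n w

Tp-sc : ∀ t f n w → Tp n (sc t f) w ≡ sc t (Tp n f) w
Tp-sc t f n w = conv-cong n (λ i j _ → cong (nat i * sg j *_) (el-sc t f j (bos i ∷ w)) ∙
  solve 3 (λ a b c → a :* (b :* c) := b :* (a :* c)) refl (nat i * sg j) (pow t (fd w)) _) ∙ conv-* n (pow t (fd w)) _

πs-sc : ∀ t s f → πs s (sc t f) ≡ πs s f
πs-sc t [] f = *-identityˡ _
πs-sc t (r ∷ s) f = lin-cong (Lin-πs s) (Tp-sc t f r) ∙ πs-sc t s (Tp r f)

π-sc : ∀ t a s f → π a s (sc t f) ≡ pow t (sum a) * π a s f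
π-sc t [] s f = πs-sc t s f ∙ sym (*-identityˡ _)
π-sc t (k ∷ a) s f = begin
  π a s (cons (fer k) (sc t f)) ≡⟨ lin-cong (Lin-π a s) (sc-fer t k f) ⟩
  π a s (λ w → pow t k * sc t (cons (fer k) f) w) ≡⟨ lin-* (Lin-π a s) _ _ ⟩
  pow t k * π a s (sc t (cons (fer k) f)) ≡⟨ cong (pow t k *_) (π-sc t a s (cons (fer k) f)) ⟩
  pow t k * (pow t (sum a) * π a s (cons (fer k) f)) ≡⟨ sym (*-assoc _ _ _) ∙ cong (_* π a s (cons (fer k) f)) (sym (pow-+ t k (sum a))) ⟩
  _ ∎

pfs-fer : ∀ s k w → pfs s (fer k ∷ w) ≡ 0#
pfs-fer [] k w = refl
pfs-fer (r ∷ s) k w = lin-0 (Lin-dp r w) (pfs-fer s k)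

pf-absent : ∀ {k a} s → All (_≢ k) a → ∀ w → pf a s (fer k ∷ w) ≡ 0#
pf-absent s [] w = pfs-fer s _ w
pf-absent {k} {x ∷ a} s (p ∷ q) w = 0-0 (0* (δ-≢ x k p)) (lin-0 (Lin-pmul x w) (pf-absent s q))

πs-pmul : ∀ s k {g} → Symm g → πs s (pmul k g) ≡ 0#
πs-pmul [] k sy = refl
πs-pmul (r ∷ s) k sy = lin-cong (Lin-πs s) (Tp-pmul r k sy) ∙ πs-pmul s k (Symm-Tp r sy)

π-pmul : ∀ {k a} s → All (_≢ k) a → ∀ {g} → Symm g → π a s (pmul k g) ≡ 0#
π-pmul {k} s [] sy = πs-pmul s k sy
π-pmul {k} {x ∷ a} s (p ∷ q) {g} sy = lin-cong (Lin-π a s) (λ w → cong (λ z → z * g w - pmul k (cons (fer x) g) w) (δ-≢ k x (λ e → p (sym e))) ∙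
    cong (_- pmul k (cons (fer x) g) w) (zeroˡ _) ∙ +-identityˡ _) ∙
  lin-neg (Lin-π a s) (pmul k (cons (fer x) g)) ∙ cong -_ (π-pmul s q (Symm-cons sy (fer x))) ∙ solve 0 (:- con 0# := con 0#) refl

Tp-absent : ∀ {r s} → All (1 ≤_) s → All (_≢ suc r) s → ∀ w → Tp (suc r) (pfs s) w ≡ 0#
Tp-absent {r} [] [] w = Tp-vac (suc r) w
Tp-absent {r} {suc x ∷ s} (_ ∷ pos) (p ∷ q) w = Tp-dp (Symm-pfs pos) (suc r) x w ∙
  0+0 (lin-0 (Lin-dp (suc x) w) (Tp-absent pos q)) (cong (λ z → nat (suc x) * z * pfs s w) (δ-≢ x r (λ e → p (cong suc e))) ∙
    0* (zeroʳ (nat (suc x))))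

πs-dp : ∀ {r s} → All (_≢ suc r) s → ∀ {g} → Symm g → πs s (dp (suc r) g) ≡ 0#
πs-dp [] sy = refl
πs-dp {r} {x ∷ s} (p ∷ q) {g} sy = lin-cong (Lin-πs s) (λ w → Tp-dp sy x r w ∙
    cong (λ z → dp (suc r) (Tp x g) w + nat (suc r) * z * g w) (δ-≢ (suc r) x (λ e → p (sym e))) ∙
      solve 3 (λ a b c → a :+ (b :* con 0#) :* c := a) refl _ (nat (suc r)) (g w)) ∙
  πs-dp q (Symm-Tp x sy)

mult-0 : ∀ {r s} → All (_≢ r) s → mult r s ≡ 0
mult-0 [] = refl
mult-0 {r} {x ∷ s} (p ∷ q) with r ≡ᵇ x in eq
... | true = ⊥-elim (p (sym (≡ᵇ⇒≡ r x (subst T (sym eq) tt))))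
... | false = mult-0 q

mult-head : ∀ r s → mult r (r ∷ s) ≡ suc (mult r s)
mult-head r s rewrite ≡ᵇ-refl r = refl

below-≢ : ∀ {r s} → All (_< r) s → All (_≢ r) s
below-≢ = All.map <⇒≢

above-≢ : ∀ {r y s} → y < r → All (_≤ y) s → All (_≢ r) s
above-≢ lt = All.map (λ q → <⇒≢ (≤-<-trans q lt))

positive-parts : ∀ s → T (weakDecPos s) → All (1 ≤_) s
positive-parts [] _ = []
positive-parts (x ∷ s) t = let p , _ , t' = weakDec⇒All x s t in p ∷ positive-parts s t'

-- Each part equal to r + 1 gives one commutator, hence the multiplicity. Parts decrease, so nothing
-- more arises once a smaller part is reached.
Tp-head : ∀ r s → T (weakDecPos (suc r ∷ s)) → ∀ w → Tp (suc r) (pfs (suc r ∷ s)) w ≡ (nat (suc r) * nat (suc (mult (suc r) s))) * pfs s w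
Tp-head r s t w = Tp-dp (Symm-pfs (positive-parts s t')) (suc r) r w ∙ cong₂ _+_ refl (cong (λ z → (nat (suc r) * z) * pfs s w) (δ-refl r)) ∙ rest s le t'
  where
  le = fst (snd (weakDec⇒All (suc r) s t))
  t' = snd (snd (weakDec⇒All (suc r) s t))
  rest : ∀ s → All (_≤ suc r) s → T (weakDecPos s) →
    dp (suc r) (Tp (suc r) (pfs s)) w + (nat (suc r) * 1#) * pfs s w ≡ (nat (suc r) * nat (suc (mult (suc r) s))) * pfs s w
  alone : ∀ s → (∀ w → Tp (suc r) (pfs s) w ≡ 0#) → mult (suc r) s ≡ 0 →
    dp (suc r) (Tp (suc r) (pfs s)) w + (nat (suc r) * 1#) * pfs s w ≡ (nat (suc r) * nat (suc (mult (suc r) s))) * pfs s w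
  alone s p q = cong₂ _+_ (lin-0 (Lin-dp (suc r) w) p) refl ∙ +-identityˡ _ ∙
    cong (λ z → (nat (suc r) * z) * pfs s w) (sym (cong (λ m → nat (suc m)) q ∙ +-identityʳ 1#))
  rest [] _ _ = alone [] (Tp-vac (suc r)) refl
  rest (y ∷ s) (p ∷ a) t with m≤n⇒m<n∨m≡n p
  ... | inl lt = alone (y ∷ s) (Tp-absent (positive-parts (y ∷ s) t) no-r) (mult-0 no-r)
    where no-r = <⇒≢ lt ∷ above-≢ lt (fst (snd (weakDec⇒All y s t)))
  ... | inr refl = cong (_+ (nat (suc r) * 1#) * pfs (suc r ∷ s) w)
      (lin-cong-* (Lin-dp (suc r) w) (Tp-head r s t)) ∙
    solve 3 (λ r m x → (r :* m) :* x :+ (r :* con 1#) :* x := (r :* (con 1# :+ m)) :* x) refl (nat (suc r)) (nat (suc (mult (suc r) s))) _ ∙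
      cong (λ m → (nat (suc r) * nat (suc m)) * pfs (suc r ∷ s) w) (sym (mult-head (suc r) s))

-- z_λ built part by part, in the form in which `Tp-head` produces it: a further part r contributes
-- r times its new multiplicity. `z-zq` identifies it with `z`.
zq : List ℕ → ℚ
zq [] = 1#
zq (r ∷ s) = (nat r * nat (suc (mult r s))) * zq s

Pairs : SP → SP → ℚ → Set
Pairs Λ Ω x = (Λ ≡ Ω × x ≡ zq (snd Λ)) ⊎ (Λ ≢ Ω × x ≡ 0#)

-- If the largest parts differ, the larger one has no partner on the other side and annihilates it;
-- if they agree, both are removed.
πs-pfs : ∀ s s' → T (weakDecPos s) → T (weakDecPos s') → Pairs ([] , s) ([] , s') (πs s (pfs s'))
πs-pfs [] [] _ _ = inl (refl , refl)
πs-pfs [] (x ∷ s') _ _ = inr ((λ ()) , refl)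
πs-pfs (x ∷ s) s' t t' with weakDec⇒All x s t
πs-pfs (suc x ∷ s) [] t t' | _ = inr ((λ ()) , lin-0 (Lin-πs s) (Tp-vac (suc x)))
πs-pfs (suc x ∷ s) (y ∷ s') t t' | _ , le , ts with weakDec⇒All y s' t'
πs-pfs (suc x ∷ s) (suc y ∷ s') t t' | _ , le , ts | _ , le' , ts' with <-cmp x y
... | tri< lt _ _ = inr ((λ { refl → <-irrefl refl lt }) , πs-dp (<⇒≢ (s≤s lt) ∷ above-≢ (s≤s lt) le) (Symm-pfs (positive-parts s' ts')))
... | tri> _ _ g = inr ((λ { refl → <-irrefl refl g }) , lin-0 (Lin-πs s) (Tp-absent (positive-parts (suc y ∷ s') t') (<⇒≢ (s≤s g) ∷ above-≢ (s≤s g) le')))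
... | tri≈ _ refl _ = go (πs-pfs s s' ts ts')
  where
  value : πs s (Tp (suc x) (pfs (suc x ∷ s'))) ≡ (nat (suc x) * nat (suc (mult (suc x) s'))) * πs s (pfs s')
  value = lin-cong-* (Lin-πs s) (Tp-head x s' t')
  go : Pairs ([] , s) ([] , s') (πs s (pfs s')) → Pairs ([] , suc x ∷ s) ([] , suc x ∷ s') (πs (suc x ∷ s) (pfs (suc x ∷ s')))
  go (inl (refl , p)) = inl (refl , value ∙ cong (nat (suc x) * nat (suc (mult (suc x) s')) *_) p)
  go (inr (n , p)) = inr ((λ { refl → n refl }) , value ∙ *0 p)

π-pf : ∀ a s a' s' → IsSP (a , s) → IsSP (a' , s') → Pairs (a , s) (a' , s') (π a s (pf a' s'))
π-pf [] s [] s' i i' = πs-pfs s s' i i'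
π-pf [] s (k ∷ a') s' i i' = inr ((λ ()) , πs-pmul s k (Symm-pf a' (positive-parts s' (T-∧₂ (strictDec (k ∷ a')) i'))))
π-pf (k ∷ a) s [] s' i i' = inr ((λ ()) , lin-0 (Lin-π a s) (pfs-fer s' k))
π-pf (k ∷ a) s (k' ∷ a') s' i i' with strictDec⇒All k a (T-∧₁ (strictDec (k ∷ a)) i) | strictDec⇒All k' a' (T-∧₁ (strictDec (k' ∷ a')) i') | <-cmp k k'
... | le , t | le' , t' | tri< lt _ _ = inr ((λ { refl → <-irrefl refl lt }) ,
  π-pmul s (<⇒≢ lt ∷ below-≢ (All.map (λ q → <-trans q lt) le)) (Symm-pf a' (positive-parts s' (T-∧₂ (strictDec (k' ∷ a')) i'))))
... | le , t | le' , t' | tri> _ _ g = inr ((λ { refl → <-irrefl refl g }) ,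
  lin-0 (Lin-π a s) (pf-absent s' (<⇒≢ g ∷ below-≢ (All.map (λ q → <-trans q g) le'))))
... | le , t | le' , t' | tri≈ _ refl _ = go (π-pf a s a' s' (T-∧ t (T-∧₂ (strictDec (k ∷ a)) i)) (T-∧ t' (T-∧₂ (strictDec (k ∷ a')) i')))
  where
  value : π a s (cons (fer k) (pmul k (pf a' s'))) ≡ π a s (pf a' s')
  value = lin-cong (Lin-π a s) (λ w → sub-cong (cong (_* pf a' s' w) (δ-refl k) ∙ *-identityˡ _) (lin-0 (Lin-pmul k w) (pf-absent s' (below-≢ le'))) ∙
    solve 1 (λ x → x :- con 0# := x) refl _)
  go : Pairs (a , s) (a' , s') (π a s (pf a' s')) → Pairs (k ∷ a , s) (k ∷ a' , s') (π (k ∷ a) s (pf (k ∷ a') s'))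
  go (inl (refl , p)) = inl (refl , value ∙ p)
  go (inr (n , p)) = inr ((λ { refl → n refl }) , value ∙ p)

-- The constant z_λ.

ℕ→ℚ-suc : ∀ n → ℕ→ℚ (suc n) ≡ 1# + ℕ→ℚ n
ℕ→ℚ-suc n = ℚP.toℚᵘ-injective (ℚᵘP.≃-trans (ℚP.toℚᵘ-fromℚᵘ (ℚᵘ.mkℚᵘ (ℤ.+ suc n) 0)) (ℚᵘP.≃-trans (ℚᵘ.*≡* eq)
  (ℚᵘP.≃-sym (ℚᵘP.≃-trans (ℚP.toℚᵘ-homo-+ 1# (ℕ→ℚ n)) (ℚᵘP.+-cong (ℚᵘP.≃-refl {ℚᵘ.1ℚᵘ}) (ℚP.toℚᵘ-fromℚᵘ (ℚᵘ.mkℚᵘ (ℤ.+ n) 0))))))) ∙ sym (+-raw _ _)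
  where
  eq : ℤ.+ suc n ℤ.* ℤ.+ 1 ≡ (ℤ.+ 1 ℤ.* ℤ.+ 1 ℤ.+ ℤ.+ n ℤ.* ℤ.+ 1) ℤ.* ℤ.+ 1
  eq = cong (ℤ._* ℤ.+ 1) (cong (ℤ._+_ (ℤ.+ 1)) (sym (ℤP.*-identityʳ (ℤ.+ n))))

ℕ→ℚ-nat : ∀ n → ℕ→ℚ n ≡ nat n
ℕ→ℚ-nat zero = refl
ℕ→ℚ-nat (suc n) = ℕ→ℚ-suc n ∙ cong (1# +_) (ℕ→ℚ-nat n)

nat-+ : ∀ m n → nat (m ℕ.+ n) ≡ nat m + nat n
nat-+ zero n = sym (+-identityˡ _)
nat-+ (suc m) n = cong (1# +_) (nat-+ m n) ∙ sym (+-assoc _ _ _)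

nat-* : ∀ m n → nat (m ℕ.* n) ≡ nat m * nat n
nat-* zero n = sym (zeroˡ _)
nat-* (suc m) n = nat-+ n (m ℕ.* n) ∙ cong (nat n +_) (nat-* m n) ∙ solve 2 (λ a b → b :+ a :* b := (con 1# :+ a) :* b) refl (nat m) (nat n)

zk : List ℕ → ℕ → ℕ
zk la k = (k ℕ.^ mult k la) ℕ.* ((mult k la) ℕ.!)

-- The bound N is independent of the list, so that lists of different sums can be compared; beyond
-- the sum every factor is 1.
zN : List ℕ → ℕ → ℕ
zN la zero = 1
zN la (suc N) = zN la N ℕ.* zk la (suc N)

z≡zN : ∀ la N → foldr ℕ._*_ 1 (map (zk la) (map suc (upTo N))) ≡ zN la N
z≡zN la zero = refl
z≡zN la (suc N) = begin
  _
    ≡⟨ cong (λ l → ListAction.product (map (zk la) (map suc l))) (sym (LP.upTo-∷ʳ N)) ⟩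
  ListAction.product (map (zk la) (map suc (upTo N ++ N ∷ [])))
    ≡⟨ cong ListAction.product (cong (map (zk la)) (LP.map-++ suc (upTo N) (N ∷ [])) ∙ LP.map-++ (zk la) (map suc (upTo N)) (suc N ∷ [])) ⟩
  ListAction.product (map (zk la) (map suc (upTo N)) ++ zk la (suc N) ∷ [])
    ≡⟨ ListActionP.product-++ (map (zk la) (map suc (upTo N))) (zk la (suc N) ∷ []) ⟩
  ListAction.product (map (zk la) (map suc (upTo N))) ℕ.* (zk la (suc N) ℕ.* 1)
    ≡⟨ cong₂ ℕ._*_ (z≡zN la N) (ℕP.*-identityʳ _) ⟩
  _ ∎

zk-other : ∀ {r k} s → k ≢ r → zk (r ∷ s) k ≡ zk s k
zk-other {r} {k} s n with k ≡ᵇ r in eq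
... | true = ⊥-elim (n (≡ᵇ⇒≡ k r (subst T (sym eq) tt)))
... | false = refl

zk-same : ∀ r s → zk (r ∷ s) r ≡ (r ℕ.* suc (mult r s)) ℕ.* zk s r
zk-same r s rewrite mult-head r s = ℕ-solve 4 (λ r p m f → (r ℕ:* p) ℕ:* (m ℕ:* f) ⊜ (r ℕ:* m) ℕ:* (p ℕ:* f)) refl r (r ℕ.^ mult r s) (suc (mult r s)) ((mult r s) ℕ.!)
  where open ℕ-Solver using () renaming (_:*_ to _ℕ:*_)

zN-below : ∀ r s N → N < r → zN (r ∷ s) N ≡ zN s N
zN-below r s zero p = refl
zN-below r s (suc N) p = cong₂ ℕ._*_ (zN-below r s N (<-trans (n<1+n N) p)) (zk-other s (<⇒≢ p))

zN-cons : ∀ r s N → 1 ≤ r → r ≤ N → zN (r ∷ s) N ≡ (r ℕ.* suc (mult r s)) ℕ.* zN s N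
zN-cons r s zero p q = ⊥-elim (<⇒≱ p q)
zN-cons r s (suc N) p q with m≤n⇒m<n∨m≡n q
... | inr refl = cong₂ ℕ._*_ (zN-below (suc N) s N ≤-refl) (zk-same (suc N) s) ∙
  ℕ-solve 3 (λ a b c → a ℕ:* (b ℕ:* c) ⊜ b ℕ:* (a ℕ:* c)) refl (zN s N) (suc N ℕ.* suc (mult (suc N) s)) (zk s (suc N))
  where open ℕ-Solver using () renaming (_:*_ to _ℕ:*_)
... | inl (s≤s lt) = cong₂ ℕ._*_ (zN-cons r s N p lt) (zk-other s (>⇒≢ (s≤s lt))) ∙ ℕP.*-assoc (r ℕ.* suc (mult r s)) (zN s N) (zk s (suc N))

parts≤sum : ∀ s → All (_≤ sum s) s
parts≤sum [] = []
parts≤sum (x ∷ s) = m≤m+n x (sum s) ∷ All.map (λ p → ≤-trans p (m≤n+m (sum s) x)) (parts≤sum s)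

zN-stable : ∀ s d → zN s (d ℕ.+ sum s) ≡ zN s (sum s)
zN-stable s zero = refl
zN-stable s (suc d) = cong₂ ℕ._*_ (zN-stable s d) trivial ∙ ℕP.*-identityʳ _
  where
  absent : mult (suc (d ℕ.+ sum s)) s ≡ 0
  absent = mult-0 (All.map (λ p → <⇒≢ (s≤s (≤-trans p (m≤n+m (sum s) d)))) (parts≤sum s))
  trivial : zk s (suc (d ℕ.+ sum s)) ≡ 1
  trivial rewrite absent = refl

z-cons : ∀ r s → 1 ≤ r → z (r ∷ s) ≡ (r ℕ.* suc (mult r s)) ℕ.* z s
z-cons r s p = z≡zN (r ∷ s) (r ℕ.+ sum s) ∙ zN-cons r s _ p (m≤m+n r (sum s)) ∙
  cong ((r ℕ.* suc (mult r s)) ℕ.*_) (zN-stable s r ∙ sym (z≡zN s (sum s)))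

z-zq : ∀ s → All (1 ≤_) s → ℕ→ℚ (z s) ≡ zq s
z-zq [] _ = refl
z-zq (r ∷ s) (p ∷ a) = ℕ→ℚ-nat (z (r ∷ s)) ∙ cong nat (z-cons r s p) ∙ nat-* (r ℕ.* suc (mult r s)) (z s) ∙
  cong₂ _*_ (nat-* r (suc (mult r s))) (sym (ℕ→ℚ-nat (z s)) ∙ z-zq s a)

-- Gradings.

module Grading (c : ℕ) (γ : Letter → ℕ) (γ0 : γ (bos 0) ≡ 0) (γs : ∀ k → γ (bos (suc k)) ≡ c ℕ.+ γ (bos k)) where

  wt : Mono → ℕ
  wt [] = 0
  wt (d ∷ w) = γ d ℕ.+ wt w

  -- The offset s is the weight of the letters already read off by `cons`.
  Gr : ℕ → ℕ → Fn → Set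
  Gr s d f = ∀ w → s ℕ.+ wt w ≢ d → f w ≡ 0#

  Gr-cons : ∀ {s d f} b → Gr s d f → Gr (s ℕ.+ γ b) d (cons b f)
  Gr-cons {s} b g w n = g (b ∷ w) (λ e → n (ℕP.+-assoc s (γ b) (wt w) ∙ e))

  Gr-hmul : ∀ n {s d f} → Gr s d f → Gr s (γ (bos n) ℕ.+ d) (hmul n f)
  Gr-hmul zero {s} {d} g w n = g w (λ e → n (e ∙ sym (cong (ℕ._+ d) γ0)))
  Gr-hmul (suc m) g [] n = refl
  Gr-hmul (suc m) {s} {d} g (bos k ∷ w) n = cong₂ _+_
    (Gr-hmul (suc m) (Gr-cons (bos k) g) w (λ e → n (sym (ℕP.+-assoc s _ _) ∙ e))) (low k n) ∙ +-identityˡ 0#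
    where
    low : ∀ k → s ℕ.+ (γ (bos k) ℕ.+ wt w) ≢ γ (bos (suc m)) ℕ.+ d → dn k (hmul m _) w ≡ 0#
    low zero n = refl
    low (suc k) n = Gr-hmul m g (bos k ∷ w) (λ e → n (cong (λ x → s ℕ.+ (x ℕ.+ wt w)) (γs k) ∙
      ℕ-solve 4 (λ s c g w → s ⊕ ((c ⊕ g) ⊕ w) ⊜ c ⊕ (s ⊕ (g ⊕ w))) refl s c (γ (bos k)) (wt w) ∙
        cong (c ℕ.+_) e ∙ sym (ℕP.+-assoc c _ d) ∙ cong (ℕ._+ d) (sym (γs m))))
  Gr-hmul (suc m) {s} g (fer a ∷ w) n = Gr-hmul (suc m) (Gr-cons (fer a) g) w (λ e → n (sym (ℕP.+-assoc s _ _) ∙ e))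

  Gr-pmul : ∀ a {s d f} → Gr s d f → Gr s (γ (fer a) ℕ.+ d) (pmul a f)
  Gr-pmul a g [] n = refl
  Gr-pmul a {s} g (bos k ∷ w) n = Gr-pmul a (Gr-cons (bos k) g) w (λ e → n (sym (ℕP.+-assoc s _ _) ∙ e))
  Gr-pmul a {s} {d} {f} g (fer b ∷ w) n = 0-0 here' (Gr-pmul a (Gr-cons (fer b) g) w (λ e → n (sym (ℕP.+-assoc s _ _) ∙ e)))
    where
    here' : δ a b * f w ≡ 0#
    here' with a ℕ.≟ b
    ... | no ¬p = 0* (δ-≢ a b ¬p)
    ... | yes refl = *0 (g w (λ e → n (ℕ-solve 3 (λ s b w → s ⊕ (b ⊕ w) ⊜ b ⊕ (s ⊕ w)) refl s (γ (fer b)) (wt w) ∙ cong (γ (fer b) ℕ.+_) e)))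

  Gr-vac : Gr 0 0 vac
  Gr-vac [] n = ⊥-elim (n refl)
  Gr-vac (bos zero ∷ w) n = Gr-vac w (λ e → n (cong (ℕ._+ wt w) γ0 ∙ e))
  Gr-vac (bos (suc k) ∷ w) n = refl
  Gr-vac (fer a ∷ w) n = refl

  Gr-form : ∀ u → Gr 0 (wt u) (form u)
  Gr-form [] = Gr-vac
  Gr-form (bos n ∷ u) = Gr-hmul n (Gr-form u)
  Gr-form (fer a ∷ u) = Gr-pmul a (Gr-form u)

  module Additive (γ+ : ∀ i j → γ (fer i) ℕ.+ γ (bos j) ≡ γ (fer (i ℕ.+ j))) where

    Gr-h̃mul : ∀ a {s d f} → Gr s d f → Gr s (γ (fer a) ℕ.+ d) (h̃mul a f)
    Gr-h̃mul a {s} {d} g w n = conv-0 a _ (λ i j e → Gr-pmul i (Gr-hmul j g) w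
      (λ q → n (q ∙ sym (ℕP.+-assoc (γ (fer i)) _ d) ∙ cong (ℕ._+ d) (γ+ i j ∙ cong (λ x → γ (fer x)) e))))

    Gr-mform : ∀ u → Gr 0 (wt u) (mform u)
    Gr-mform [] = Gr-vac
    Gr-mform (bos n ∷ u) = Gr-hmul n (Gr-mform u)
    Gr-mform (fer a ∷ u) = Gr-h̃mul a (Gr-mform u)

    Gr-A : ∀ {s d f} → Gr s d f → Gr s d (A f)
    Gr-A g [] n = g [] n
    Gr-A {s} g (bos k ∷ w) n = Gr-A (Gr-cons (bos k) g) w (λ e → n (sym (ℕP.+-assoc s _ _) ∙ e))
    Gr-A {s} {d} {f} g (fer a ∷ w) n = Gr-A {s ℕ.+ γ (fer a)} (λ v m → conv-0 a _ (λ i j e → g (fer i ∷ bos j ∷ v)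
        (λ q → m (cong (λ x → (s ℕ.+ γ (fer x)) ℕ.+ wt v) (sym e) ∙ cong (λ x → (s ℕ.+ x) ℕ.+ wt v) (sym (γ+ i j)) ∙
          ℕ-solve 4 (λ s i j v → (s ⊕ (i ⊕ j)) ⊕ v ⊜ s ⊕ (i ⊕ (j ⊕ v))) refl s (γ (fer i)) (γ (bos j)) (wt v) ∙ q))))
      w (λ e → n (sym (ℕP.+-assoc s _ _) ∙ e))

nf1 : Letter → ℕ
nf1 (bos _) = 0
nf1 (fer _) = 1

fd1 : Letter → ℕ
fd1 (bos _) = 0
fd1 (fer a) = a

-- The gradings by total degree, by number of θ's and by |Λ^a|. The product h̃_a = Σ p̃_i h_j is
-- homogeneous for the first two only, so these alone extend to `mform` and `A`.
module GrS = Grading 1 fst refl (λ k → refl)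
module GrN = Grading 0 nf1 refl (λ k → refl)
module GrF = Grading 0 fd1 refl (λ k → refl)
module GrS+ = GrS.Additive (λ i j → refl)
module GrN+ = GrN.Additive (λ i j → refl)

wt-wsize : ∀ w → GrS.wt w ≡ wsize w
wt-wsize [] = refl
wt-wsize (c ∷ w) = cong (fst c ℕ.+_) (wt-wsize w)

wt-nf : ∀ w → GrN.wt w ≡ nf w
wt-nf [] = refl
wt-nf (bos _ ∷ w) = wt-nf w
wt-nf (fer _ ∷ w) = cong suc (wt-nf w)

wt-fd : ∀ w → GrF.wt w ≡ fd w
wt-fd [] = refl
wt-fd (bos _ ∷ w) = wt-fd w
wt-fd (fer a ∷ w) = cong (a ℕ.+_) (wt-fd w)

Deg-split : ∀ {u w} → Deg u ≢ Deg w → (GrS.wt w ≢ GrS.wt u) ⊎ (GrN.wt w ≢ GrN.wt u)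
Deg-split {u} {w} n with GrS.wt w ℕ.≟ GrS.wt u | GrN.wt w ℕ.≟ GrN.wt u
... | no p | _ = inl p
... | yes _ | no p = inr p
... | yes p | yes q = ⊥-elim (n (cong₂ _,_ (sym (wt-wsize u) ∙ sym p ∙ wt-wsize w) (sym (wt-nf u) ∙ sym q ∙ wt-nf w)))

mform-Deg : ∀ u w → Deg u ≢ Deg w → mform u w ≡ 0#
mform-Deg u w n with Deg-split {u} {w} n
... | inl p = GrS+.Gr-mform u w p
... | inr p = GrN+.Gr-mform u w p

A-mform-Deg : ∀ u w → Deg u ≢ Deg w → A (mform u) w ≡ 0#
A-mform-Deg u w n with Deg-split {u} {w} n
... | inl p = GrS+.Gr-A (GrS+.Gr-mform u) w p
... | inr p = GrN+.Gr-A (GrN+.Gr-mform u) w p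

sc-form : ∀ t u w → sc t (form u) w ≡ pow t (fd u) * form u w
sc-form t u w with fd w ℕ.≟ fd u
... | yes p = cong (λ n → pow t n * form u w) p
... | no ¬p = *0 z0 ∙ sym (*0 z0)
  where z0 = GrF.Gr-form u w (λ e → ¬p (sym (wt-fd w) ∙ e ∙ wt-fd u))

Deg-ins : ∀ c v → Deg (ins c v) ≡ Deg (c ∷ v)
Deg-ins c [] = refl
Deg-ins c (d ∷ v) with <ᴸ-cmp c d
... | inl _ = Deg-cons d (ins c v) (c ∷ v) (Deg-ins c v) ∙ Deg-swap d c v
... | inr _ = refl

Deg-norm : ∀ v → Deg (norm v) ≡ Deg v
Deg-norm [] = refl
Deg-norm (bos zero ∷ v) = Deg-norm v
Deg-norm (bos (suc k) ∷ v) = Deg-ins (bos (suc k)) (norm v) ∙ Deg-cons (bos (suc k)) (norm v) v (Deg-norm v)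
Deg-norm (fer k ∷ v) = Deg-ins (fer k) (norm v) ∙ Deg-cons (fer k) (norm v) v (Deg-norm v)

-- From coefficients to functionals on words.

MSpan : (Mono → Set) → Fn → Set
MSpan Q f = Σ Comb λ C → All (λ p → Q (snd p)) C × (∀ w → f w ≡ ev C (λ v → mform v w))

MSpan-0 : ∀ {Q} → MSpan Q (λ _ → 0#)
MSpan-0 = [] , [] , λ w → refl

MSpan-≗ : ∀ {Q f g} → MSpan Q g → (∀ w → f w ≡ g w) → MSpan Q f
MSpan-≗ (C , a , r) p = C , a , λ w → p w ∙ r w

MSpan-at : ∀ {Q : Mono → Set} v → Q v → MSpan Q (mform v)
MSpan-at v q = (1# , v) ∷ [] , q ∷ [] , λ w → solve 1 (λ x → x := con 1# :* x :+ con 0#) refl _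

MSpan-+ : ∀ {Q f g} → MSpan Q f → MSpan Q g → MSpan Q (λ w → f w + g w)
MSpan-+ (C , a , r) (C' , a' , r') = C ++ C' , AllP.++⁺ a a' , λ w → cong₂ _+_ (r w) (r' w) ∙ sym (ev-++ C C' _)

MSpan-* : ∀ {Q f} c → MSpan Q f → MSpan Q (λ w → c * f w)
MSpan-* c (C , a , r) = scaleComb c C , AllP.map⁺ a , λ w → cong (c *_) (r w) ∙ sym (ev-scale c C _)

MSpan-conv : ∀ {Q} n {F : ℕ → ℕ → Fn} → (∀ i j → i ℕ.+ j ≡ n → MSpan Q (F i j)) → MSpan Q (λ w → conv n (λ i j → F i j w))
MSpan-conv zero m = m 0 0 refl
MSpan-conv (suc n) m = MSpan-+ (m 0 (suc n) refl) (MSpan-conv n (λ i j e → m (suc i) j (cong suc e)))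

MSpan-ev : ∀ {Q} C {F : Mono → Fn} → All (λ p → MSpan Q (F (snd p))) C → MSpan Q (λ w → ev C (λ v → F v w))
MSpan-ev [] [] = MSpan-0
MSpan-ev ((c , v) ∷ C) (m ∷ a) = MSpan-+ (MSpan-* c m) (MSpan-ev C a)

-- h̃_a = Σ p̃_i h_{a-i} is solved for p̃_a recursively in a; the bound n only makes the recursion
-- structural.
pmul-mform : ∀ a v → MSpan (λ u → Deg u ≡ Deg (fer a ∷ v)) (pmul a (mform v))
pmul-mform a = go a a ≤-refl
  where
  go : ∀ n a → a ≤ n → ∀ v → MSpan (λ u → Deg u ≡ Deg (fer a ∷ v)) (pmul a (mform v))
  go n zero _ v = MSpan-at (fer 0 ∷ v) refl
  go (suc n) (suc a) (s≤s p) v = MSpan-≗ (MSpan-+ (MSpan-at (fer (suc a) ∷ v) refl) (MSpan-* -1# (MSpan-conv a (λ i j e →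
      subst (λ d → MSpan (λ u → Deg u ≡ d) (pmul i (mform (bos (suc j) ∷ v)))) (degs i j e)
        (go n i (≤-trans (subst (i ≤_) e (m≤m+n i j)) p) (bos (suc j) ∷ v))))))
    (λ w → solve 2 (λ x y → y := (x :+ y) :+ con -1# :* x) refl (conv a (λ i j → pmul i (hmul (suc j) (mform v)) w)) (pmul (suc a) (mform v) w) ∙
      cong (_+ -1# * conv a (λ i j → pmul i (hmul (suc j) (mform v)) w)) (sym (conv-last a (λ i j → pmul i (hmul j (mform v)) w))))
    where
    degs : ∀ i j → i ℕ.+ j ≡ a → Deg (fer i ∷ bos (suc j) ∷ v) ≡ Deg (fer (suc a) ∷ v)
    degs i j e = cong (_, suc (nf v)) (sym (ℕP.+-assoc i (suc j) (wsize v)) ∙ cong (ℕ._+ wsize v) (+-suc i j ∙ cong suc e))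

K : ∀ u → MSpan (λ v → Deg v ≡ Deg u) (form u)
K [] = MSpan-at [] refl
K (bos n ∷ u) = let C , a , r = K u in consComb (bos n) C ,
  AllP.map⁺ (All.map (λ {p} q → Deg-cons (bos n) (snd p) u q) a) ,
  λ w → lin-cong (Lin-hmul n w) r ∙ lin-ev (Lin-hmul n w) C mform ∙ sym (ev-consComb (bos n) C (λ v → mform v w))
K (fer k ∷ u) = let C , a , r = K u in MSpan-≗
  (MSpan-ev C (All.map (λ {p} q → let C' , a' , r' = pmul-mform k (snd p) in C' , All.map (λ e → e ∙ Deg-cons (fer k) (snd p) u q) a' , r') a))
  (λ w → lin-cong (Lin-pmul k w) r ∙ lin-ev (Lin-pmul k w) C mform)

-- The functional w ↦ ⟨⟨d , w⟩⟩. By `K`, the form of w is a combination of monomial coefficient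
-- functionals, and these are evaluated on the coefficients of d.
hat : SymF → Fn
hat d w = ev (fst (K w)) (coefMono d)

hat-cong : ∀ {f g : SymF} → (∀ Γ → IsSP Γ → f Γ ≡ g Γ) → ∀ w → hat f w ≡ hat g w
hat-cong p w = ev-cong (fst (K w)) (coefMono-cong p)

hat-co : ∀ {ξ} → Lin ξ → ∀ w → hat (co ξ) w ≡ ξ (form w)
hat-co {ξ} l w = ev-cong (fst (K w)) (coefMono-co l) ∙ sym (lin-ev l (fst (K w)) mform) ∙ lin-cong l (λ x → sym (snd (snd (K w)) x))

-- Singles out the coefficient functions of finite combinations of words; an arbitrary `SymF` may
-- have infinite support.
record Lift (f : SymF) : Set where
  field
    fun : Fn → ℚ
    lin : Lin fun
    coef : ∀ Γ → IsSP Γ → f Γ ≡ co fun Γ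

hat-lift : ∀ {f} (l : Lift f) w → hat f w ≡ Lift.fun l (form w)
hat-lift l w = hat-cong (Lift.coef l) w ∙ hat-co (Lift.lin l) w

dual-form : ∀ {η} ((C , _) : Lin η) w → η (form w) ≡ ev C (λ u → form u w)
dual-form (C , r) w = r (form w) ∙ ev-cong C (λ u → form-sym w u)

Symm-hat : ∀ {f} → Lift f → Symm (hat f)
Symm-hat l = Symm-≗ (λ w → hat-lift l w ∙ dual-form (Lift.lin l) w) (Symm-ev (fst (Lift.lin l)) Symm-form)

agree : ∀ {dg f ζ ζ'} → Lin ζ → Lin ζ' → (∀ v → Valid v → Deg v ≡ dg → ζ (mform v) ≡ ζ' (mform v)) →
  MSpan (λ v → Deg v ≡ dg) f → ζ f ≡ ζ' f
agree {dg} {f} {ζ} {ζ'} l l' p (C , a , r) = lin-cong l r ∙ lin-ev l C mform ∙ go C a ∙ sym (lin-cong l' r ∙ lin-ev l' C mform)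
  where
  one-word : ∀ v → Deg v ≡ dg → ζ (mform v) ≡ ζ' (mform v)
  one-word v e = let x , q = norm-mform v in at-norm x q (norm-valid v)
    where
    at-norm : ∀ x → (∀ w → mform v w ≡ x * mform (norm v) w) → Valid (norm v) ⊎ (∀ w → mform v w ≡ 0#) → ζ (mform v) ≡ ζ' (mform v)
    at-norm x q (inr z0) = lin-0 l z0 ∙ sym (lin-0 l' z0)
    at-norm x q (inl val) = lin-cong l q ∙ lin-* l x _ ∙ cong (x *_) (p (norm v) val (Deg-norm v ∙ e)) ∙ sym (lin-cong-* l' q)
  go : ∀ C → All (λ q → Deg (snd q) ≡ dg) C → ev C (λ v → ζ (mform v)) ≡ ev C (λ v → ζ' (mform v))
  go [] [] = refl
  go ((c , v) ∷ C) (e ∷ a) = cong₂ _+_ (cong (c *_) (one-word v e)) (go C a)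

OffDeg : ℕ × ℕ → SymF → Set
OffDeg dg d = ∀ Γ → IsSP Γ → Deg (toW Γ) ≢ dg → d Γ ≡ 0#

Deg≟ : (d e : ℕ × ℕ) → d ≡ e ⊎ d ≢ e
Deg≟ (a , b) (a' , b') with a ℕ.≟ a' | b ℕ.≟ b'
... | yes refl | yes refl = inl refl
... | no p | _ = inr (λ e → p (cong fst e))
... | _ | no p = inr (λ e → p (cong snd e))

word-value : ∀ {f} (l : Lift f) v → Valid v → Lift.fun l (mform v) ≡ f (fromW v)
word-value l v val = lin-cong (Lift.lin l) (λ w → sym (mform-canon v w)) ∙ sym (Lift.coef l (fromW v) (fromW-SP val))

hat-off : ∀ {f dg} (l : Lift f) → OffDeg dg f → ∀ w → Deg w ≢ dg → hat f w ≡ 0#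
hat-off {f} {dg} l off w n = hat-lift l w ∙ agree (Lift.lin l) Lin-0
  (λ v val e → word-value l v val ∙ off (fromW v) (fromW-SP val) (λ q → n (sym e ∙ cong Deg (sym (toW-fromW val)) ∙ q))) (K w) ∙ refl

-- On each `form u` the twist is a scalar (`sc-form`), so it stays within the span. Words u of other
-- degrees occurring in the lift cancel in total and are dropped by `kept`.
hat-span : ∀ {f dg} (l : Lift f) → OffDeg dg f → ∀ t → MSpan (λ v → Deg v ≡ dg) (sc t (hat f))
hat-span {f} {dg} l off t = MSpan-≗ (restrict (fst (Lift.lin l))) pointwise
  where
  C = fst (Lift.lin l)
  kept : Mono → Fn
  kept u w with Deg≟ (Deg u) dg
  ... | inl _ = pow t (fd u) * form u w
  ... | inr _ = 0#
  restrict : ∀ C → MSpan (λ v → Deg v ≡ dg) (λ w → ev C (λ u → kept u w))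
  restrict C = MSpan-ev C (All.universal (λ p → one-word (snd p)) C)
    where
    one-word : ∀ u → MSpan (λ v → Deg v ≡ dg) (kept u)
    one-word u with Deg≟ (Deg u) dg
    ... | inl e = MSpan-* (pow t (fd u)) (let C' , a , r = K u in C' , All.map (λ q → q ∙ e) a , r)
    ... | inr _ = MSpan-0
  form-Deg : ∀ u w → Deg u ≢ Deg w → form u w ≡ 0#
  form-Deg u w n with Deg-split {u} {w} n
  ... | inl p = GrS.Gr-form u w p
  ... | inr p = GrN.Gr-form u w p
  kept-on : ∀ u w → Deg w ≡ dg → kept u w ≡ pow t (fd u) * form u w
  kept-on u w e with Deg≟ (Deg u) dg
  ... | inl _ = refl
  ... | inr n = sym (*0 (form-Deg u w (λ q → n (q ∙ e))))
  kept-off : ∀ u w → Deg w ≢ dg → kept u w ≡ 0#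
  kept-off u w n with Deg≟ (Deg u) dg
  ... | inl e = *0 (form-Deg u w (λ q → n (sym q ∙ e)))
  ... | inr _ = refl
  pointwise : ∀ w → sc t (hat f) w ≡ ev C (λ u → kept u w)
  pointwise w with Deg≟ (Deg w) dg
  ... | inl e = cong (pow t (fd w) *_) (hat-lift l w ∙ dual-form (Lift.lin l) w) ∙ sym (ev-* C (pow t (fd w)) (λ u → form u w)) ∙
    ev-cong C (λ u → sc-form t u w ∙ sym (kept-on u w e))
  ... | inr n = *0 (hat-off l off w n) ∙ sym (ev-0 C (λ u → kept u w) (All.universal (λ p → kept-off (snd p) w n) C))

-- h̃-words are dual to monomials.
A-form-bos : ∀ n u → (∀ w → A (form w) u ≡ mform u w) → ∀ w → A (λ x → form w (bos n ∷ x)) u ≡ hmul n (mform u) w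
A-form-bos n u ih w = let C , p , q = adjoint (bos n) w in
  lin-cong (Lin-A u) q ∙ lin-ev (Lin-A u) C form ∙ ev-cong C ih ∙ sym (p (mform u))

A-form : ∀ u w → A (form w) u ≡ mform u w
A-form [] w = form-[] w
A-form (bos n ∷ u) w = A-form-bos n u (A-form u) w
A-form (fer a ∷ u) w = lin-conv (Lin-A u) a (λ i j x → form w (fer i ∷ bos j ∷ x)) ∙ conv-cong a (λ i j _ →
  let C , p , q = adjoint (fer i) w in
  lin-cong (Lin-A u) (λ x → q (bos j ∷ x)) ∙ lin-ev (Lin-A u) C (λ v x → form v (bos j ∷ x)) ∙
    ev-cong C (A-form-bos j u (A-form u)) ∙ sym (p (hmul j (mform u))))

A-hat : ∀ {f} (l : Lift f) v → A (hat f) v ≡ Lift.fun l (mform v)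
A-hat l v = let C , r = Lift.lin l in
  lin-cong (Lin-A v) (λ w → hat-lift l w ∙ dual-form (Lift.lin l) w) ∙ lin-ev (Lin-A v) C form ∙
    ev-cong C (A-form v) ∙ sym (r (mform v))

-- The scalar products.

lift-p : ∀ {f L c} → PExp f L c → Lift f
lift-p {f} {L} {c} (_ , sps , p) = record
  { fun = λ g → sumA L (λ Λ → c Λ * π (fst Λ) (snd Λ) g)
  ; lin = linear L
  ; coef = λ Γ isp → p Γ isp ∙ sumℚ-sumA L _ ∙ terms L sps Γ isp }
  where
  linear : ∀ L → Lin (λ g → sumA L (λ Λ → c Λ * π (fst Λ) (snd Λ) g))
  linear [] = Lin-0
  linear (Λ ∷ L) = Lin-+ (Lin-* (c Λ) (Lin-π (fst Λ) (snd Λ))) (linear L)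
  terms : ∀ L → All IsSP L → ∀ Γ → IsSP Γ → sumA L (λ Λ → c Λ ℚ.* pSP Λ Γ) ≡ sumA L (λ Λ → c Λ * co (π (fst Λ) (snd Λ)) Γ)
  terms [] [] Γ isp = refl
  terms (Λ ∷ L) (i ∷ is) Γ isp = cong₂ _+_ (sym (*-raw (c Λ) _) ∙ cong (c Λ *_) (pSP-co (fst Λ) (snd Λ) (positive-parts (snd Λ) (T-∧₂ (strictDec (fst Λ)) i)) Γ isp))
    (terms L is Γ isp)

sumA-pick : ∀ {A : Set} {x : A} L (g : A → ℚ) → Unique L → x ∈ L → (∀ y → y ≢ x → g y ≡ 0#) → sumA L g ≡ g x
sumA-pick (x ∷ L) g (n ∷ _) (Any.here refl) p = cong (g x +_) (none L n) ∙ +-identityʳ _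
  where
  none : ∀ L → All (x ≢_) L → sumA L g ≡ 0#
  none [] [] = refl
  none (y ∷ L) (n ∷ ns) = 0+0 (p y (λ e → n (sym e))) (none L ns)
sumA-pick (y ∷ L) g (n ∷ u) (Any.there i) p = cong₂ _+_ (p y (λ { refl → All.lookup n i refl })) (sumA-pick L g u i p) ∙ +-identityˡ _

sumA-∈ : ∀ {A : Set} (L : List A) {f g : A → ℚ} → (∀ x → x ∈ L → f x ≡ g x) → sumA L f ≡ sumA L g
sumA-∈ [] p = refl
sumA-∈ (x ∷ L) p = cong₂ _+_ (p x (Any.here refl)) (sumA-∈ L (λ y i → p y (Any.there i)))

IsWeight : ℚ → (SP → ℚ) → Set
IsWeight t W = ∀ Λ → IsSP Λ → W Λ ≡ pow t (sum (fst Λ)) * zq (snd Λ)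

-- Trades the expansions in power sums for functionals: by orthogonality, p_Λ evaluated at the
-- twisted `hat g` gives the coefficient of g at p_Λ times t^{|Λ^a|} z.
scalar : ∀ {t W} → IsWeight t W → ∀ {f g v} → ScalarProd W f g v → Σ (Lift f) λ l → Lift g × v ≡ Lift.fun l (sc t (hat g))
scalar {t} {W} wt {f} {g} {v} (L , cf , cg , pf₁ , pg₁ , vv) = lift-p {c = cf} pf₁ , lift-p {c = cg} pg₁ , (begin
  v ≡⟨ vv ∙ sumℚ-sumA L _ ∙ sumA-∈ L (λ Λ i → sym (*-raw _ _) ∙ cong (_* W Λ) (sym (*-raw (cf Λ) (cg Λ))) ∙ term Λ i) ⟩
  _ ∎)
  where
  sps = fst (snd pf₁)
  Π : SP → Fn → ℚ
  Π Λ = π (fst Λ) (snd Λ)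
  hat-g : ∀ w → hat g w ≡ sumA L (λ Ω → cg Ω * pf (fst Ω) (snd Ω) w)
  hat-g w = hat-lift (lift-p {c = cg} pg₁) w ∙ sumA-∈ L (λ Ω i → cong (cg Ω *_)
    (π-form (fst Ω) (positive-parts (snd Ω) (T-∧₂ (strictDec (fst Ω)) (All.lookup sps i))) w))
  lin-sum : ∀ {ξ} → Lin ξ → ∀ L (F : SP → Fn) → ξ (λ w → sumA L (λ Ω → F Ω w)) ≡ sumA L (λ Ω → ξ (F Ω))
  lin-sum l [] F = lin-0 l (λ _ → refl)
  lin-sum l (Ω ∷ L) F = lin-+ l (F Ω) _ ∙ cong₂ _+_ refl (lin-sum l L F)
  Π-value : ∀ Λ → Λ ∈ L → Π Λ (sc t (hat g)) ≡ pow t (sum (fst Λ)) * (cg Λ * zq (snd Λ))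
  Π-value Λ i = begin
    Π Λ (sc t (hat g)) ≡⟨ π-sc t (fst Λ) (snd Λ) (hat g) ⟩
    pow t (sum (fst Λ)) * Π Λ (hat g)
      ≡⟨ cong (pow t (sum (fst Λ)) *_) (lin-cong lΛ hat-g ∙ lin-sum lΛ L _ ∙
           sumA-∈ L (λ Ω j → lin-* lΛ (cg Ω) _) ∙ sumA-∈ L {g = part} (λ Ω j → separate Ω (snd (value Ω j)))) ⟩
    pow t (sum (fst Λ)) * sumA L part
      ≡⟨ cong (pow t (sum (fst Λ)) *_) (sumA-pick L part (fst pf₁) i (λ Ω n → part-0 Ω n) ∙ part-1) ⟩
    _ ∎
    where
    lΛ = Lin-π (fst Λ) (snd Λ)
    part : SP → ℚ
    part Ω with Λ ≟SP Ω
    ... | yes _ = cg Ω * zq (snd Λ)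
    ... | no _ = 0#
    part-0 : ∀ Ω → Ω ≢ Λ → part Ω ≡ 0#
    part-0 Ω n with Λ ≟SP Ω
    ... | yes p = ⊥-elim (n (sym p))
    ... | no _ = refl
    part-1 : part Λ ≡ cg Λ * zq (snd Λ)
    part-1 with Λ ≟SP Λ
    ... | yes _ = refl
    ... | no n = ⊥-elim (n refl)
    value : ∀ Ω → Ω ∈ L → ⊤ × Pairs Λ Ω (Π Λ (pf (fst Ω) (snd Ω)))
    value Ω j = tt , π-pf (fst Λ) (snd Λ) (fst Ω) (snd Ω) (All.lookup sps i) (All.lookup sps j)
    separate : ∀ Ω → Pairs Λ Ω (Π Λ (pf (fst Ω) (snd Ω))) → cg Ω * Π Λ (pf (fst Ω) (snd Ω)) ≡ part Ω
    separate Ω (inl (e , p)) with Λ ≟SP Ω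
    ... | yes _ = cong (cg Ω *_) p
    ... | no n = ⊥-elim (n e)
    separate Ω (inr (n , p)) with Λ ≟SP Ω
    ... | yes e = ⊥-elim (n e)
    ... | no _ = *0 p
  term : ∀ Λ → Λ ∈ L → cf Λ * cg Λ * W Λ ≡ cf Λ * Π Λ (sc t (hat g))
  term Λ i = cong (cf Λ * cg Λ *_) (wt Λ (All.lookup sps i)) ∙
    solve 4 (λ a b c d → (a :* b) :* (c :* d) := a :* (c :* (b :* d))) refl (cf Λ) (cg Λ) (pow t (sum (fst Λ))) (zq (snd Λ)) ∙
      cong (cf Λ *_) (sym (Π-value Λ i))

-- Elimination within one degree.

Pos? : ∀ c → Pos c ⊎ ¬ Pos c
Pos? (fer k) = inl tt
Pos? (bos zero) = inr (λ ())
Pos? (bos (suc k)) = inl (s≤s z≤n)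

Valid? : ∀ v → Valid v ⊎ ¬ Valid v
Valid? [] = inl []
Valid? ((k , b) ∷ v) with Pos? (k , b) | under? k v | Valid? v
... | inl p | inl q | inl r = inl (row p q r)
... | inr p | _ | _ = inr (λ { (row p' _ _) → p p' })
... | _ | inr q | _ = inr (λ { (row _ q' _) → q q' })
... | _ | _ | inr r = inr (λ { (row _ _ r') → r r' })

lettersUpTo : ℕ → List Letter
lettersUpTo K = map (λ k → bos k) (upTo (suc K)) ++ map (λ k → fer k) (upTo (suc K))

wordsUpTo : ℕ → ℕ → List Mono
wordsUpTo K zero = [] ∷ []
wordsUpTo K (suc N) = [] ∷ concatMap (λ c → map (c ∷_) (wordsUpTo K N)) (lettersUpTo K)

∈-letters : ∀ {K} c → fst c ≤ K → c ∈ lettersUpTo K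
∈-letters (bos k) p = ∈-++⁺ˡ (∈-map⁺ (λ k → bos k) (∈-upTo⁺ (s≤s p)))
∈-letters {K} (fer k) p = ∈-++⁺ʳ (map (λ k → bos k) (upTo (suc K))) (∈-map⁺ (λ k → fer k) (∈-upTo⁺ (s≤s p)))

∈-words : ∀ {K N} v → All (λ c → fst c ≤ K) v → length v ≤ N → v ∈ wordsUpTo K N
∈-words {N = zero} [] _ _ = Any.here refl
∈-words {N = suc N} [] _ _ = Any.here refl
∈-words {N = suc N} (c ∷ v) (p ∷ a) (s≤s q) = Any.there (∈-concatMap⁺ (λ c → map (c ∷_) (wordsUpTo _ N))
  (Any.map (λ { refl → ∈-map⁺ (c ∷_) (∈-words v a q) }) (∈-letters c p)))

letters≤ : ∀ v → All (λ c → fst c ≤ wsize v) v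
letters≤ [] = []
letters≤ ((k , b) ∷ v) = m≤m+n k _ ∷ All.map (λ p → ≤-trans p (m≤n+m _ k)) (letters≤ v)

length≤ : ∀ {v} → Valid v → length v ≤ wsize v ℕ.+ nf v
length≤ [] = z≤n
length≤ (row {suc k} {false} pos top val) = s≤s (≤-trans (length≤ val) (+-monoˡ-≤ _ (m≤n+m _ k)))
length≤ (row {k} {true} {w} pos top val) = ≤-trans (s≤s (length≤ val))
  (≤-trans (≤-reflexive (sym (+-suc (wsize w) (nf w)))) (+-monoˡ-≤ _ (m≤n+m (wsize w) k)))

module Elimination (n m : ℕ) where

  dg : ℕ × ℕ
  dg = n , m

  In : Mono → Set
  In v = Valid v × Deg v ≡ dg

  In? : ∀ v → In v ⊎ ¬ In v
  In? v with Valid? v | Deg≟ (Deg v) dg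
  ... | inl p | inl q = inl (p , q)
  ... | inr p | _ = inr (λ q → p (fst q))
  ... | _ | inr q = inr (λ p → q (snd p))

  ≺? : ∀ v w → v ≺ w ⊎ ¬ (v ≺ w)
  ≺? v w with ≺-cmp v w
  ... | inl p = inl p
  ... | inr (inl refl) = inr ≺-irrefl
  ... | inr (inr q) = inr (λ p → ≺-irrefl (≺-trans p q))

  all-words : List Mono
  all-words = wordsUpTo n (n ℕ.+ m)

  listed : ∀ {v} → In v → v ∈ all-words
  listed {v} (val , refl) = ∈-words v (letters≤ v) (length≤ val)

  maxBelow : ∀ w vs → (∀ v → v ∈ vs → In v → ¬ (v ≺ w)) ⊎ (Σ Mono λ M → In M × M ≺ w × (∀ v → v ∈ vs → In v → v ≺ w → v ≼ M))
  maxBelow w [] = inl (λ v ())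
  maxBelow w (u ∷ vs) with maxBelow w vs | In? u | ≺? u w
  ... | inl p | inr q | _ = inl (λ { v (Any.here refl) i → ⊥-elim (q i) ; v (Any.there j) i → p v j i })
  ... | inl p | inl q | inr r = inl (λ { v (Any.here refl) i → r ; v (Any.there j) i → p v j i })
  ... | inl p | inl q | inl r = inr (u , q , r , λ { v (Any.here refl) i lt → inl refl ; v (Any.there j) i lt → ⊥-elim (p v j i lt) })
  ... | inr (M , i₀ , lt₀ , p) | inr q | _ = inr (M , i₀ , lt₀ , λ { v (Any.here refl) i lt → ⊥-elim (q i) ; v (Any.there j) i lt → p v j i lt })
  ... | inr (M , i₀ , lt₀ , p) | inl q | inr r = inr (M , i₀ , lt₀ , λ { v (Any.here refl) i lt → ⊥-elim (r lt) ; v (Any.there j) i lt → p v j i lt })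
  ... | inr (M , i₀ , lt₀ , p) | inl q | inl r with ≺-cmp u M
  ... | inl s = inr (M , i₀ , lt₀ , λ { v (Any.here refl) i lt → inr s ; v (Any.there j) i lt → p v j i lt })
  ... | inr (inl s) = inr (M , i₀ , lt₀ , λ { v (Any.here refl) i lt → inl s ; v (Any.there j) i lt → p v j i lt })
  ... | inr (inr s) = inr (u , q , r , λ { v (Any.here refl) i lt → inl refl ; v (Any.there j) i lt → inr (≼-≺-trans (p v j i lt) s) })

  Supp : Mono → SymF → Set
  Supp w d = ∀ Γ → IsSP Γ → ¬ (Deg (toW Γ) ≡ dg × toW Γ ≺ w) → d Γ ≡ 0#

  Unitriangular : (Mono → SymF) → Set
  Unitriangular B = ∀ M → In M → B M (fromW M) ≡ 1# × (∀ Γ → IsSP Γ → ¬ (Deg (toW Γ) ≡ dg × toW Γ ≼ M) → B M Γ ≡ 0#)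

  module _ {B : Mono → SymF} (ut : Unitriangular B) (R : Mono → SymF → Set)
    (base : ∀ w d → (∀ Γ → IsSP Γ → d Γ ≡ 0#) → R w d)
    (step : ∀ w d M → In M → M ≺ w → (a : ℚ) → R M (λ Γ → d Γ - a * B M Γ) → R w d) where

    -- Gaussian elimination as an induction principle: M is the largest word below w, and
    -- subtracting d(M) B_M moves the support below M. The predicate R varies with the use: lifts,
    -- pairings, detection of zero, annihilators.
    elim : ∀ {w} → Acc _⊏_ w → ∀ d → Supp w d → R w d
    elim {w} (acc rs) d supp with maxBelow w all-words
    ... | inl p = base w d (λ Γ isp → supp Γ isp (λ (e , lt) → p (toW Γ) (listed (fst (toW-SP Γ isp) , e)) (fst (toW-SP Γ isp) , e) lt))
    ... | inr (M , i , lt , p) = step w d M i lt (d (fromW M)) (elim (rs (fst i , lt)) _ supp')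
      where
      supp' : Supp M (λ Γ → d Γ - d (fromW M) * B M Γ)
      supp' Γ isp n with ≺-cmp (toW Γ) M | Deg≟ (Deg (toW Γ)) dg
      ... | inl q | inl e = ⊥-elim (n (e , q))
      ... | inr (inl q) | _ = cong₂ (λ x y → d x - d (fromW M) * y) ΓM (cong (B M) ΓM ∙ fst (ut M i)) ∙
        solve 1 (λ x → x :- x :* con 1# := con 0#) refl _
        where ΓM = sym (snd (toW-SP Γ isp)) ∙ cong fromW q
      ... | inr (inr q) | inl e = sub-cong
          (supp Γ isp (λ (_ , r) → ≺-irrefl (≺-≼-trans q (p (toW Γ) (listed (fst (toW-SP Γ isp) , e)) (fst (toW-SP Γ isp) , e) r))))
          (*0 (snd (ut M i) Γ isp (λ { (_ , inl r) → ≺-irrefl (subst (M ≺_) r q) ; (_ , inr r) → ≺-irrefl (≺-trans q r) }))) ∙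
        -‿inverseʳ 0#
      ... | _ | inr e = 0-0 (supp Γ isp (λ (r , _) → e r)) (*0 (snd (ut M i) Γ isp (λ (r , _) → e r)))

-- Limits.

Eventually : (ℚ → Set) → Set
Eventually Q = ∃ λ δ → 0# ℚ.< δ × (∀ t → 0# ℚ.< t → t ℚ.< δ → Q t)

Ev-∧ : ∀ {Q R} → Eventually Q → Eventually R → Eventually (λ t → Q t × R t)
Ev-∧ (a , pa , fa) (b , pb , fb) with ℚP.≤-total a b
... | inl le = a , pa , λ t p q → fa t p q , fb t p (ℚP.<-≤-trans q le)
... | inr le = b , pb , λ t p q → fa t p (ℚP.<-≤-trans q le) , fb t p q

Ev-map : ∀ {Q R : ℚ → Set} → (∀ t → 0# ℚ.< t → Q t → R t) → Eventually Q → Eventually R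
Ev-map f (a , pa , fa) = a , pa , λ t p q → f t p (fa t p q)

Ev-now : ∀ {Q : Set} → Eventually (λ _ → Q) → Q
Ev-now (a , pa , f) = let m , p , q = ℚP.<-dense pa in f m p q

Null : (ℚ → ℚ) → Set
Null φ = ∀ ε → 0# ℚ.< ε → Eventually (λ t → ℚ.∣ φ t ∣ ℚ.< ε)

Null-≗ : ∀ {φ ψ} → Null ψ → Eventually (λ t → φ t ≡ ψ t) → Null φ
Null-≗ n e ε p = Ev-map (λ t _ (x , y) → subst (λ z → ℚ.∣ z ∣ ℚ.< ε) (sym y) x) (Ev-∧ (n ε p) e)

always : ∀ {Q : ℚ → Set} → (∀ t → 0# ℚ.< t → Q t) → Eventually Q
always f = 1# , ℚP.positive⁻¹ 1# , λ t p _ → f t p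

Null-0 : Null (λ _ → 0#)
Null-0 ε p = always (λ _ _ → p)

½-pos : ∀ {ε} → 0# ℚ.< ε → 0# ℚ.< ½ * ε
½-pos {ε} p = subst (0# ℚ.<_) (sym (*-raw ½ ε)) (ℚP.positive⁻¹ (½ ℚ.* ε) {{ℚP.pos*pos⇒pos ½ ε {{ℚ.positive p}}}})

Null-+ : ∀ {φ ψ} → Null φ → Null ψ → Null (λ t → φ t + ψ t)
Null-+ {φ} {ψ} n m ε p = Ev-map (λ t _ (x , y) → subst₂ (λ a b → ℚ.∣ a ∣ ℚ.< b) (sym (+-raw (φ t) (ψ t)))
    (sym (+-raw _ _) ∙ solve 1 (λ x → con ½ :* x :+ con ½ :* x := x) refl ε)
    (ℚP.≤-<-trans (ℚP.∣p+q∣≤∣p∣+∣q∣ (φ t) (ψ t)) (ℚP.+-mono-< x y)))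
  (Ev-∧ (n (½ * ε) (½-pos p)) (m (½ * ε) (½-pos p)))

inv : ℚ → ℚ
inv t with t ℚP.≟ 0#
... | yes _ = 0#
... | no p = (ℚ.1/ t) {{ℚ.≢-nonZero p}}

inv-* : ∀ {t} → 0# ℚ.< t → inv t ℚ.* t ≡ 1#
inv-* {t} p with t ℚP.≟ 0#
... | yes e = ⊥-elim (ℚP.<⇒≢ p (sym e))
... | no n = ℚP.*-inverseˡ t {{ℚ.≢-nonZero n}}

inv-pos : ∀ {t} → 0# ℚ.< t → 0# ℚ.< inv t
inv-pos {t} p with ℚP.<-cmp 0# (inv t)
... | tri< lt _ _ = lt
... | tri≈ _ e _ = ⊥-elim (0≢1 (sym (ℚP.*-zeroˡ t) ∙ cong (ℚ._* t) e ∙ inv-* p))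
  where
  0≢1 : 0# ≢ 1#
  0≢1 ()
... | tri> _ _ g = ⊥-elim (ℚP.<-asym (ℚP.positive⁻¹ 1#) (subst₂ ℚ._<_ (inv-* p) (ℚP.*-zeroˡ t) (ℚP.*-monoˡ-<-pos t {{ℚ.positive p}} g)))

norm+1 : ℚ → ℚ
norm+1 a = ℚ.∣ a ∣ ℚ.+ 1#

norm<norm+1 : ∀ a → ℚ.∣ a ∣ ℚ.< norm+1 a
norm<norm+1 a = subst (ℚ._< norm+1 a) (ℚP.+-identityʳ ℚ.∣ a ∣) (ℚP.+-monoʳ-< ℚ.∣ a ∣ (ℚP.positive⁻¹ 1#))

norm+1-pos : ∀ a → 0# ℚ.< norm+1 a
norm+1-pos a = ℚP.≤-<-trans (ℚP.0≤∣p∣ a) (norm<norm+1 a)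

Null-* : ∀ {φ} a → Null φ → Null (λ t → a * φ t)
Null-* {φ} a n ε p = Ev-map (λ t _ lt → subst₂ ℚ._<_ (sym (cong ℚ.∣_∣ (*-raw a (φ t)) ∙ ℚP.∣p*q∣≡∣p∣*∣q∣ a (φ t))) scaled
    (ℚP.≤-<-trans (ℚP.*-monoʳ-≤-nonNeg ℚ.∣ φ t ∣ {{ℚ.nonNegative (ℚP.0≤∣p∣ (φ t))}} (ℚP.<⇒≤ (norm<norm+1 a)))
      (ℚP.*-monoʳ-<-pos c {{ℚ.positive (norm+1-pos a)}} lt)))
  (n ε' ε'-pos)
  where
  -- One more than |a|, so that it can be inverted even when a = 0.
  c = norm+1 a
  ε' = inv c ℚ.* ε
  ε'-pos : 0# ℚ.< ε'
  ε'-pos = ℚP.positive⁻¹ ε' {{ℚP.pos*pos⇒pos (inv c) {{ℚ.positive (inv-pos (norm+1-pos a))}} ε {{ℚ.positive p}}}}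
  scaled : c ℚ.* ε' ≡ ε
  scaled = sym (ℚP.*-assoc c (inv c) ε) ∙ cong (ℚ._* ε) (ℚP.*-comm c (inv c) ∙ inv-* (norm+1-pos a)) ∙ ℚP.*-identityˡ ε

Null-Null : ∀ {φ ψ} → Null φ → Null ψ → Null (λ t → φ t * ψ t)
Null-Null {φ} {ψ} n m ε p = Ev-map (λ t _ (x , y) → subst₂ ℚ._<_ (sym (cong ℚ.∣_∣ (*-raw (φ t) (ψ t)) ∙ ℚP.∣p*q∣≡∣p∣*∣q∣ (φ t) (ψ t))) (ℚP.*-identityˡ ε)
    (ℚP.≤-<-trans (ℚP.*-monoʳ-≤-nonNeg ℚ.∣ ψ t ∣ {{ℚ.nonNegative (ℚP.0≤∣p∣ (ψ t))}} (ℚP.<⇒≤ x)) (ℚP.*-monoʳ-<-pos 1# y)))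
  (Ev-∧ (n 1# (ℚP.positive⁻¹ 1#)) (m ε p))

Lim : (ℚ → ℚ) → ℚ → Set
Lim φ L = Null (λ t → φ t - L)

Lim-≗ : ∀ {φ ψ L} → Lim ψ L → Eventually (λ t → φ t ≡ ψ t) → Lim φ L
Lim-≗ l e = Null-≗ l (Ev-map (λ t _ q → cong (_- _) q) e)

Lim-const : ∀ c → Lim (λ _ → c) c
Lim-const c = Null-≗ Null-0 (always (λ _ _ → -‿inverseʳ c))

Lim-id : Lim (λ t → t) 0#
Lim-id ε p = ε , p , λ t q lt → subst (ℚ._< ε) (sym (cong ℚ.∣_∣ (solve 1 (λ x → x :- con 0# := x) refl t) ∙ ℚP.0≤p⇒∣p∣≡p (ℚP.<⇒≤ q))) lt

Lim-+ : ∀ {φ ψ L M} → Lim φ L → Lim ψ M → Lim (λ t → φ t + ψ t) (L + M)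
Lim-+ {φ} {ψ} {L} {M} l m = Null-≗ (Null-+ l m) (always (λ t _ → solve 4 (λ a b c d → (a :+ b) :- (c :+ d) := (a :- c) :+ (b :- d)) refl (φ t) (ψ t) L M))

Lim-* : ∀ {φ ψ L M} → Lim φ L → Lim ψ M → Lim (λ t → φ t * ψ t) (L * M)
Lim-* {φ} {ψ} {L} {M} l m = Null-≗ (Null-+ (Null-Null l m) (Null-+ (Null-* L m) (Null-* M l)))
  (always (λ t _ → solve 4 (λ a b c d → a :* b :- c :* d := (a :- c) :* (b :- d) :+ (c :* (b :- d) :+ d :* (a :- c))) refl (φ t) (ψ t) L M))

Lim-neg : ∀ {φ L} → Lim φ L → Lim (λ t → - φ t) (- L)
Lim-neg {φ} {L} l = Null-≗ (Null-* -1# l) (always (λ t _ → solve 2 (λ a b → :- a :- :- b := con -1# :* (a :- b)) refl (φ t) L))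

Lim-sub : ∀ {φ ψ L M} → Lim φ L → Lim ψ M → Lim (λ t → φ t - ψ t) (L - M)
Lim-sub l m = Lim-+ l (Lim-neg m)

Lim-unique : ∀ {φ L} → Lim φ L → Eventually (λ t → φ t ≡ 0#) → L ≡ 0#
Lim-unique {φ} {L} l e with L ℚP.≟ 0#
... | yes p = p
... | no n = ⊥-elim (Ev-now (Ev-map (λ t _ (x , y) → ℚP.<-irrefl refl (subst (ℚ._< ℚ.∣ L ∣)
    (cong ℚ.∣_∣ (cong (_- L) y ∙ +-identityˡ _ ∙ neg-raw L) ∙ ℚP.∣-p∣≡∣p∣ L) x)) (Ev-∧ (l ℚ.∣ L ∣ pos) e)))
  where
  pos : 0# ℚ.< ℚ.∣ L ∣
  pos with ℚP.<-cmp 0# ℚ.∣ L ∣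
  ... | tri< q _ _ = q
  ... | tri≈ _ q _ = ⊥-elim (n (ℚP.∣p∣≡0⇒p≡0 L (sym q)))
  ... | tri> _ _ q = ⊥-elim (ℚP.<-irrefl refl (ℚP.<-≤-trans q (ℚP.0≤∣p∣ L)))

Lim-ev : ∀ C {F : ℚ → Fn} {f : Fn} → (∀ v → Lim (λ t → F t v) (f v)) → Lim (λ t → ev C (F t)) (ev C f)
Lim-ev [] l = Lim-const 0#
Lim-ev ((c , v) ∷ C) l = Lim-+ (Lim-* (Lim-const c) (l v)) (Lim-ev C l)

sub-raw : ∀ x y → x ℚ.- y ≡ x - y
sub-raw x y = sym (+-raw x (- y) ∙ cong (x ℚ.+_) (neg-raw y))

fromLimAt0⁺ : ∀ {φ L} → LimAt0⁺ φ L → Lim φ L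
fromLimAt0⁺ {φ} {L} l ε p = let δ , q , f = l ε p in δ , q , λ t a b → subst (λ z → ℚ.∣ z ∣ ℚ.< ε) (sub-raw (φ t) L) (f t a b)

p≤∣p∣ : ∀ p → p ℚ.≤ ℚ.∣ p ∣
p≤∣p∣ p with ℚP.≤-total 0# p
... | inl q = ℚP.≤-reflexive (sym (ℚP.0≤p⇒∣p∣≡p q))
... | inr q = ℚP.≤-trans q (ℚP.0≤∣p∣ p)

-- Large t are reached as t = 1/τ with τ → 0⁺; the bound |T| + 1 ensures both t > T and t > 1.
Ev-large : ∀ {Q : ℚ → Set} T → (∀ t → T ℚ.< t → 1# ℚ.< t → Q t) → Eventually (λ τ → Q (inv τ))
Ev-large {Q} T f = inv c , inv-pos (norm+1-pos T) , λ τ p lt → f (inv τ)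
    (ℚP.≤-<-trans (p≤∣p∣ T) (ℚP.<-trans (norm<norm+1 T) (large τ p lt)))
    (ℚP.≤-<-trans (subst (ℚ._≤ c) (ℚP.+-identityˡ 1#) (ℚP.+-mono-≤ (ℚP.0≤∣p∣ T) (ℚP.≤-refl {1#}))) (large τ p lt))
  where
  c = norm+1 T
  large : ∀ τ → 0# ℚ.< τ → τ ℚ.< inv c → c ℚ.< inv τ
  large τ p lt = ℚP.*-cancelʳ-<-nonNeg τ {{ℚ.nonNegative (ℚP.<⇒≤ p)}} (subst₂ ℚ._<_ (ℚP.*-comm τ c) (inv-* (norm+1-pos T) ∙ sym (inv-* p))
    (ℚP.*-monoˡ-<-pos c {{ℚ.positive (norm+1-pos T)}} lt))

fromLimAtInf : ∀ {φ L} → LimAtInf φ L → Lim (λ τ → φ (inv τ)) L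
fromLimAtInf {φ} {L} l ε p = let T , f = l ε p in Ev-large {λ t → ℚ.∣ φ t - L ∣ ℚ.< ε} T (λ t q _ → subst (λ z → ℚ.∣ z ∣ ℚ.< ε) (sub-raw (φ t) L) (f t q))

-- Weights.

powℚ-pow : ∀ t n → powℚ t n ≡ pow t n
powℚ-pow t zero = refl
powℚ-pow t (suc n) = cong (t ℚ.*_) (powℚ-pow t n) ∙ sym (*-raw t (pow t n))

divℚ-self : ∀ x → x ≢ 0# → divℚ x x ≡ 1#
divℚ-self x n with x ℚP.≟ 0#
... | yes p = ⊥-elim (n p)
... | no p = ℚP.*-inverseʳ x {{ℚ.≢-nonZero p}}

pow-small : ∀ {t} → 0# ℚ.< t → t ℚ.< 1# → ∀ n → 0# ℚ.≤ powℚ t n × powℚ t n ℚ.≤ 1#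
pow-small p q zero = ℚP.<⇒≤ (ℚP.positive⁻¹ 1#) , ℚP.≤-refl
pow-small {t} p q (suc n) = let a , b = pow-small p q n in
  subst (ℚ._≤ t ℚ.* powℚ t n) (ℚP.*-zeroʳ t) (ℚP.*-monoˡ-≤-nonNeg t {{ℚ.nonNegative (ℚP.<⇒≤ p)}} a) ,
  ℚP.≤-trans (subst (t ℚ.* powℚ t n ℚ.≤_) (ℚP.*-identityʳ t) (ℚP.*-monoˡ-≤-nonNeg t {{ℚ.nonNegative (ℚP.<⇒≤ p)}} b)) (ℚP.<⇒≤ q)

pow-large : ∀ {t} → 1# ℚ.< t → ∀ n → 1# ℚ.≤ powℚ t n
pow-large q zero = ℚP.≤-refl
pow-large {t} q (suc n) = ℚP.≤-trans (ℚP.<⇒≤ q) (subst (ℚ._≤ t ℚ.* powℚ t n) (ℚP.*-identityʳ t)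
  (ℚP.*-monoˡ-≤-nonNeg t {{ℚ.nonNegative (ℚP.<⇒≤ (ℚP.<-trans (ℚP.positive⁻¹ 1#) q))}} (pow-large q n)))

pow≢1 : ∀ {t} → 0# ℚ.< t → (t ℚ.< 1# ⊎ 1# ℚ.< t) → ∀ n → powℚ t (suc n) ≢ 1#
pow≢1 {t} p (inl q) n e = ℚP.<⇒≢ (ℚP.≤-<-trans (subst (t ℚ.* powℚ t n ℚ.≤_) (ℚP.*-identityʳ t)
  (ℚP.*-monoˡ-≤-nonNeg t {{ℚ.nonNegative (ℚP.<⇒≤ p)}} (snd (pow-small p q n)))) q) e
pow≢1 {t} p (inr q) n e = ℚP.<⇒≢ (ℚP.<-≤-trans q (subst (ℚ._≤ t ℚ.* powℚ t n) (ℚP.*-identityʳ t)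
  (ℚP.*-monoˡ-≤-nonNeg t {{ℚ.nonNegative (ℚP.<⇒≤ p)}} (pow-large q n)))) (sym e)

-- At q = t each factor (1 - q^k)/(1 - t^k) is 1, and a positive t other than 1 keeps the
-- denominators nonzero.
weightQT-IsWeight : ∀ {t} → 0# ℚ.< t → (t ℚ.< 1# ⊎ 1# ℚ.< t) → IsWeight t (weightQT t t)
weightQT-IsWeight {t} p c (a , s) isp = cong (powℚ t (sum a) ℚ.* ℕ→ℚ (z s) ℚ.*_) (factors s pos) ∙
  ℚP.*-identityʳ _ ∙ sym (*-raw _ _) ∙ cong₂ _*_ (powℚ-pow t (sum a)) (z-zq s pos)
  where
  pos = positive-parts s (T-∧₂ (strictDec a) isp)
  nonzero : ∀ k → 1# ℚ.- powℚ t (suc k) ≢ 0#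
  nonzero k e = pow≢1 p c k (solve 1 (λ x → x := con 1# :- (con 1# :- x)) refl (powℚ t (suc k)) ∙
    cong (λ z → 1# - z) (sym (sub-raw 1# (powℚ t (suc k))) ∙ e) ∙ solve 0 (con 1# :- con 0# := con 1#) refl)
  factors : ∀ s → All (1 ≤_) s → prodℚ (map (λ k → divℚ (1# ℚ.- powℚ t k) (1# ℚ.- powℚ t k)) s) ≡ 1#
  factors [] [] = refl
  factors (suc k ∷ s) (_ ∷ q) = cong₂ ℚ._*_ (divℚ-self _ (nonzero k)) (factors s q)

weight-IsWeight : IsWeight 1# weight
weight-IsWeight (a , s) isp = z-zq s (positive-parts s (T-∧₂ (strictDec a) isp)) ∙
  sym (*-identityˡ _) ∙ cong (_* zq s) (sym (pow-1 (sum a)))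

-- Deleting fermionic letters.

φ-hmul : ∀ n k g w → φ k (hmul n g) w ≡ hmul n (φ k g) w
φ-hmul zero k g w = refl
φ-hmul (suc n) k g [] = refl
φ-hmul (suc n) k g (bos zero ∷ w) = begin
  _
    ≡⟨ φ-bos k 0 (hmul (suc n) g) w ∙ sub-cong (lin-cong (Lin-φ k w) (λ v → +-identityʳ _)) (lin-0 (Lin-φ (suc k) w) (λ _ → refl)) ⟩
  φ k (hmul (suc n) (cons (bos 0) g)) w - 0#
    ≡⟨ sub-cong (φ-hmul (suc n) k (cons (bos 0) g) w) refl ⟩
  hmul (suc n) (φ k (cons (bos 0) g)) w - 0#
    ≡⟨ solve 1 (λ x → x :- con 0# := x :+ con 0#) refl _ ⟩
  hmul (suc n) (φ k (cons (bos 0) g)) w + 0#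
    ≡⟨ cong (_+ 0#) (lin-cong (Lin-hmul (suc n) w) (λ v → sym (φ-bos k 0 g v ∙ sub-cong refl (lin-0 (Lin-φ (suc k) v) (λ _ → refl)) ∙ solve 1 (λ x → x :- con 0# := x) refl _))) ⟩
  _ ∎
φ-hmul (suc n) k g (bos (suc m) ∷ w) = begin
  _
    ≡⟨ φ-bos k (suc m) (hmul (suc n) g) w ∙ sub-cong (lin-+ (Lin-φ k w) _ _) (lin-cong (Lin-φ (suc k) w) (hmul-bos (suc n) m g) ∙ lin-+ (Lin-φ (suc k) w) _ _) ⟩
  _
    ≡⟨ sub-cong (cong₂ _+_ (φ-hmul (suc n) k (cons (bos (suc m)) g) w)
         (x≡x-y+y (φ-bos k m (hmul n g) w) ∙ cong (_+ φ (suc k) (dn m (hmul n g)) w) (φ-hmul n k g (bos m ∷ w))))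
         (cong (_+ φ (suc k) (dn m (hmul n g)) w) (φ-hmul (suc n) (suc k) (cons (bos m) g) w)) ⟩
  (X₁ + (Y + Z)) - (W + Z)
    ≡⟨ solve 4 (λ x y z w → (x :+ (y :+ z)) :- (w :+ z) := (x :- w) :+ y) refl X₁ Y Z W ⟩
  (X₁ - W) + Y
    ≡⟨ cong (_+ Y) (sym (lin-sub (Lin-hmul (suc n) w) _ _) ∙ lin-cong (Lin-hmul (suc n) w) (λ v → sym (φ-bos k (suc m) g v))) ⟩
  _ ∎
  where
  X₁ = hmul (suc n) (φ k (cons (bos (suc m)) g)) w
  Y = hmul n (φ k g) (bos m ∷ w)
  Z = φ (suc k) (dn m (hmul n g)) w
  W = hmul (suc n) (φ (suc k) (cons (bos m) g)) w
φ-hmul (suc n) k g (fer a ∷ w) = cong -_ (φ-hmul (suc n) k (cons (fer a) g) w) ∙ sym (lin-neg (Lin-hmul (suc n) w) _)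

φ-hshift : ∀ a i k g w → φ k (hshift a i g) w ≡ hshift a i (φ k g) w
φ-hshift a zero k g w = φ-hmul a k g w
φ-hshift zero (suc i) k g w = lin-0 (Lin-φ k w) (λ _ → refl)
φ-hshift (suc a) (suc i) k g w = φ-hshift a i k g w

δ1 : ℕ → ℕ → ℚ
δ1 zero k = 0#
δ1 (suc a) k = δ a k

hshift-[] : ∀ a k g → hshift a k g [] ≡ δ a k * g []
hshift-[] zero zero g = sym (*-identityˡ _)
hshift-[] (suc a) zero g = sym (zeroˡ _)
hshift-[] zero (suc k) g = sym (zeroˡ _)
hshift-[] (suc a) (suc k) g = hshift-[] a k g

h̃mul-[] : ∀ a g → h̃mul a g [] ≡ 0#
h̃mul-[] a g = conv-0 a _ (λ i j _ → refl)

-- The coefficient of a monomial in Φ_k w is a signed sum, over the variables carrying θ x^k, of the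
-- coefficient in w of the monomial without that variable. So φ k deletes factors h̃_k as an
-- antiderivation.
φ-h̃mul : ∀ a k g w → φ k (h̃mul a g) w ≡ δ a k * g w - h̃mul a (φ k g) w
φ-h̃mul a k g [] = h̃mul-fer a k g [] ∙ sub-cong (hshift-[] a k g) (h̃mul-[] a (cons (fer k) g) ∙ sym (h̃mul-[] a (φ k g)))
φ-h̃mul a k g (bos zero ∷ w) = begin
  _
    ≡⟨ φ-bos k 0 (h̃mul a g) w ∙ sub-cong (lin-cong (Lin-φ k w) (λ v → h̃mul-bos a 0 g v ∙ +-identityʳ _)) (lin-0 (Lin-φ (suc k) w) (λ _ → refl)) ⟩
  φ k (h̃mul a (cons (bos 0) g)) w - 0#
    ≡⟨ solve 1 (λ x → x :- con 0# := x) refl _ ∙ φ-h̃mul a k (cons (bos 0) g) w ⟩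
  δ a k * g (bos 0 ∷ w) - h̃mul a (φ k (cons (bos 0) g)) w
    ≡⟨ cong (λ z → δ a k * g (bos 0 ∷ w) - z) (lin-cong (Lin-h̃mul a w) (λ v → sym (φ-bos k 0 g v ∙ sub-cong refl (lin-0 (Lin-φ (suc k) v) (λ _ → refl)) ∙ solve 1 (λ x → x :- con 0# := x) refl _)) ∙
         sym (h̃mul-bos a 0 (φ k g) w ∙ +-identityʳ _)) ⟩
  _ ∎
φ-h̃mul a k g (bos (suc m) ∷ w) = begin
  _
    ≡⟨ φ-bos k (suc m) (h̃mul a g) w ∙ sub-cong (lin-cong (Lin-φ k w) (h̃mul-suc a m g) ∙ lin-+ (Lin-φ k w) _ _)
         (lin-cong (Lin-φ (suc k) w) (h̃mul-bos a m g) ∙ lin-+ (Lin-φ (suc k) w) _ _) ⟩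
  _
    ≡⟨ sub-cong (cong₂ _+_ (φ-h̃mul a k (cons (bos (suc m)) g) w)
         (x≡x-y+y (φ-bos k m (h̃m1 a g) w) ∙ cong (_+ Z) (low a)))
         (cong (_+ Z) (φ-h̃mul a (suc k) (cons (bos m) g) w ∙ cong (λ d → d * g (bos m ∷ w) - h̃mul a (φ (suc k) (cons (bos m) g)) w) (δδ a))) ⟩
  ((d₀ - X₁) + ((d₁ - Y) + Z)) - ((d₁ - W) + Z)
    ≡⟨ solve 6 (λ p x q y z w → ((p :- x) :+ ((q :- y) :+ z)) :- ((q :- w) :+ z) := p :- ((x :- w) :+ y)) refl d₀ X₁ d₁ Y Z W ⟩
  d₀ - ((X₁ - W) + Y)
    ≡⟨ cong (λ z → d₀ - z) (cong (_+ Y) (sym (lin-sub (Lin-h̃mul a w) _ _) ∙ lin-cong (Lin-h̃mul a w) (λ v → sym (φ-bos k (suc m) g v))) ∙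
         sym (h̃mul-suc a m (φ k g) w)) ⟩
  _ ∎
  where
  d₀ = δ a k * g (bos (suc m) ∷ w)
  d₁ = δ1 a k * g (bos m ∷ w)
  X₁ = h̃mul a (φ k (cons (bos (suc m)) g)) w
  Y = h̃m1 a (φ k g) (bos m ∷ w)
  Z = φ (suc k) (dn m (h̃m1 a g)) w
  W = h̃mul a (φ (suc k) (cons (bos m) g)) w
  δδ : ∀ a → δ a (suc k) ≡ δ1 a k
  δδ zero = refl
  δδ (suc a) = refl
  low : ∀ a → φ k (h̃m1 a g) (bos m ∷ w) ≡ δ1 a k * g (bos m ∷ w) - h̃m1 a (φ k g) (bos m ∷ w)
  low zero = lin-0 (Lin-φ k (bos m ∷ w)) (λ _ → refl) ∙ solve 1 (λ x → con 0# := con 0# :* x :- con 0#) refl (g (bos m ∷ w))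
  low (suc a) = φ-h̃mul a k g (bos m ∷ w)
φ-h̃mul a k g (fer i ∷ w) = begin
  _
    ≡⟨ cong -_ (lin-cong (Lin-φ k w) (h̃mul-fer a i g) ∙ lin-sub (Lin-φ k w) _ _ ∙ sub-cong (φ-hshift a i k g w) (φ-h̃mul a k (cons (fer i) g) w)) ⟩
  - (hshift a i (φ k g) w - (δ a k * g (fer i ∷ w) - h̃mul a (φ k (cons (fer i) g)) w))
    ≡⟨ solve 3 (λ s d h → :- (s :- (d :- h)) := d :- (s :- :- h)) refl _ _ _ ⟩
  δ a k * g (fer i ∷ w) - (hshift a i (φ k g) w - - h̃mul a (φ k (cons (fer i) g)) w)
    ≡⟨ cong (λ z → δ a k * g (fer i ∷ w) - (hshift a i (φ k g) w - z)) (sym (lin-neg (Lin-h̃mul a w) _)) ⟩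
  δ a k * g (fer i ∷ w) - (hshift a i (φ k g) w - h̃mul a (λ v → - φ k (cons (fer i) g) v) w)
    ≡⟨ cong (λ z → δ a k * g (fer i ∷ w) - z) (sym (h̃mul-fer a i (φ k g) w)) ⟩
  _ ∎

ins-mono : ∀ c {u v} → u ≺ v → ins c u ≺ ins c v
ins-mono c {[]} {d ∷ v} []≺ with <ᴸ-cmp c d
... | inl p = here p
... | inr _ = there []≺
ins-mono c {x ∷ u} {d ∷ v} (here p) with <ᴸ-cmp c x | <ᴸ-cmp c d
... | inl q | inl r = here p
... | inl q | inr (inl refl) = ⊥-elim (<ᴸ-irrefl (<ᴸ-trans q p))
... | inl q | inr (inr r) = ⊥-elim (<ᴸ-irrefl (<ᴸ-trans q (<ᴸ-trans p r)))
... | inr _ | inl r = here r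
... | inr _ | inr _ = there (here p)
ins-mono c {x ∷ u} {.x ∷ v} (there p) with <ᴸ-cmp c x
... | inl _ = there (ins-mono c p)
... | inr _ = there (there p)

insAll : List ℕ → Mono → Mono
insAll [] v = v
insAll (k ∷ a) v = ins (fer k) (insAll a v)

insAll-mono : ∀ a {u v} → u ≼ v → insAll a u ≼ insAll a v
insAll-mono [] p = p
insAll-mono (k ∷ a) p with insAll-mono a p
... | inl q = inl (cong (ins (fer k)) q)
... | inr q = inr (ins-mono (fer k) q)

data Del (k : ℕ) : Mono → Mono → Set where
  here : ∀ {v} → Del k (fer k ∷ v) v
  there : ∀ {c v u} → Del k v u → Del k (c ∷ v) (c ∷ u)

insz-comm : ∀ c k v → insz c (ins (fer k) v) ≡ ins (fer k) (insz c v)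
insz-comm (bos n) k v = insb-comm n (fer k) v
insz-comm (fer a) k v = ins-comm (fer a) (fer k) v

norm-Del : ∀ {k v u} → Del k v u → norm v ≡ ins (fer k) (norm u)
norm-Del here = refl
norm-Del {k} {c ∷ v} {.c ∷ u} (there d) = cong (insz c) (norm-Del d) ∙ insz-comm c k (norm u)

Dels : List ℕ → Mono → Mono → Set
Dels [] v u = v ≡ u
Dels (k ∷ a) v u = Σ Mono λ x → Del k v x × Dels a x u

norm-Dels : ∀ a {v u} → Dels a v u → norm v ≡ insAll a (norm u)
norm-Dels [] refl = refl
norm-Dels (k ∷ a) (x , d , ds) = norm-Del d ∙ cong (ins (fer k)) (norm-Dels a ds)

-- Common to two situations in which Δ_k deletes a letter fer k: φ k acting on `mform`, and
-- `cons (fer k)` acting on `form`. They serve the test functions before and in the limit.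
module Deletion (𝓕 : Mono → Fn) (𝓛 : Letter → Fn → Fn) (𝓕-[] : ∀ w → 𝓕 [] w ≡ vac w) (𝓕-cons : ∀ c v w → 𝓕 (c ∷ v) w ≡ 𝓛 c (𝓕 v) w)
  (L𝓛 : ∀ c → LinOp (𝓛 c)) (Δ : ℕ → Fn → Fn) (LΔ : ∀ k → LinOp (Δ k)) (Δ-vac : ∀ k w → Δ k vac w ≡ 0#)
  (Δ-bos : ∀ k n f w → Δ k (𝓛 (bos n) f) w ≡ 𝓛 (bos n) (Δ k f) w)
  (Δ-fer : ∀ k a f w → Δ k (𝓛 (fer a) f) w ≡ δ a k * f w - 𝓛 (fer a) (Δ k f) w) where

  delete-0 : ∀ k v {ξ} → Lin ξ → (∀ u → Del k v u → ξ (𝓕 u) ≡ 0#) → ξ (Δ k (𝓕 v)) ≡ 0#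
  delete-0 k [] l p = lin-0 l (λ w → lin-cong (LΔ k w) 𝓕-[] ∙ Δ-vac k w)
  delete-0 k (bos n ∷ v) l p = lin-cong l (λ w → lin-cong (LΔ k w) (𝓕-cons (bos n) v) ∙ Δ-bos k n (𝓕 v) w) ∙
    delete-0 k v (Lin-∘ l (L𝓛 (bos n))) (λ u d → lin-cong l (λ w → sym (𝓕-cons (bos n) u w)) ∙ p (bos n ∷ u) (there d))
  delete-0 k (fer a ∷ v) {ξ} l p = lin-cong l (λ w → lin-cong (LΔ k w) (𝓕-cons (fer a) v) ∙ Δ-fer k a (𝓕 v) w) ∙ lin-sub l _ _ ∙
    0-0 (lin-* l (δ a k) _ ∙ deleted) (delete-0 k v (Lin-∘ l (L𝓛 (fer a))) (λ u d → lin-cong l (λ w → sym (𝓕-cons (fer a) u w)) ∙ p (fer a ∷ u) (there d)))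
    where
    deleted : δ a k * ξ (𝓕 v) ≡ 0#
    deleted with a ℕ.≟ k
    ... | yes refl = *0 (p v here)
    ... | no ¬q = 0* (δ-≢ a k ¬q)

  Δs : List ℕ → Fn → Fn
  Δs [] f = f
  Δs (k ∷ a) f = Δs a (Δ k f)

  Lin-Δs : ∀ a → LinOp (Δs a)
  Lin-Δs [] w = Lin-at w
  Lin-Δs (k ∷ a) w = Lin-∘ (Lin-Δs a w) (LΔ k)

  deletes-0 : ∀ a v {ξ} → Lin ξ → (∀ u → Dels a v u → ξ (𝓕 u) ≡ 0#) → ξ (Δs a (𝓕 v)) ≡ 0#
  deletes-0 [] v l p = p v refl
  deletes-0 (k ∷ a) v l p = delete-0 k v (Lin-∘ l (Lin-Δs a)) (λ x d → deletes-0 a x l (λ u ds → p u (x , d , ds)))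

  -- Reinserting the deleted letters recovers `norm v`, and insertion is monotone; hence what is
  -- left of a v above `insAll a b` lies above b.
  above-0 : ∀ a b {ξ} → Lin ξ → (∀ u → b ≺ norm u → ξ (𝓕 u) ≡ 0#) → ∀ v → insAll a b ≺ norm v → ξ (Δs a (𝓕 v)) ≡ 0#
  above-0 a b {ξ} l p v lt = deletes-0 a v l (λ u ds → vanish u ds (≺-cmp b (norm u)))
    where
    vanish : ∀ u → Dels a v u → _ → ξ (𝓕 u) ≡ 0#
    vanish u ds (inl q) = p u q
    vanish u ds (inr q) = ⊥-elim (≺-irrefl (≺-≼-trans lt (subst (_≼ insAll a b) (sym (norm-Dels a ds)) (insAll-mono a (flip' q)))))
      where
      flip' : b ≡ norm u ⊎ norm u ≺ b → norm u ≼ b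
      flip' (inl e) = inl (sym e)
      flip' (inr r) = inr r

φ-vac : ∀ k w → φ k vac w ≡ 0#
φ-vac k [] = refl
φ-vac k (bos zero ∷ w) = φ-bos k 0 vac w ∙ 0-0 (φ-vac k w) (lin-0 (Lin-φ (suc k) w) (λ _ → refl))
φ-vac k (bos (suc zero) ∷ w) = φ-bos k 1 vac w ∙ 0-0 (lin-0 (Lin-φ k w) (λ _ → refl)) (φ-vac (suc k) w)
φ-vac k (bos (suc (suc n)) ∷ w) = φ-bos k (suc (suc n)) vac w ∙ 0-0 (lin-0 (Lin-φ k w) (λ _ → refl)) (lin-0 (Lin-φ (suc k) w) (λ _ → refl))
φ-vac k (fer a ∷ w) = cong -_ (lin-0 (Lin-φ k w) (λ _ → refl)) ∙ solve 0 (:- con 0# := con 0#) refl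

module Δφ = Deletion mform L̃ (λ w → refl) (λ c v w → refl) Lin-L̃ φ Lin-φ φ-vac (λ k n f w → φ-hmul n k f w) (λ k a f w → φ-h̃mul a k f w)

module Δc = Deletion form L (λ w → refl) (λ c v w → refl) Lin-L (λ k → cons (fer k)) (λ k → Lin-cons (fer k)) (λ k w → refl)
  (λ k n f w → hmul-fer n k f w) (λ k a f w → refl)

Bosonic : Mono → Set
Bosonic = All (λ c → snd c ≡ false)

-- On words without θ the functionals `form v` and `mform v` agree and the twist is trivial, so a
-- bosonic test sees neither difference.
_≈ᵇ_ : Fn → Fn → Set
f ≈ᵇ g = ∀ w → Bosonic w → f w ≡ g w

hmul-≈ᵇ : ∀ n {f g} → f ≈ᵇ g → hmul n f ≈ᵇ hmul n g
hmul-≈ᵇ zero p w b = p w b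
hmul-≈ᵇ (suc n) p [] b = refl
hmul-≈ᵇ (suc n) p (bos zero ∷ w) (refl ∷ b) = cong (_+ 0#) (hmul-≈ᵇ (suc n) (λ v c → p (bos 0 ∷ v) (refl ∷ c)) w b)
hmul-≈ᵇ (suc n) p (bos (suc k) ∷ w) (refl ∷ b) = cong₂ _+_ (hmul-≈ᵇ (suc n) (λ v c → p (bos (suc k) ∷ v) (refl ∷ c)) w b) (hmul-≈ᵇ n p (bos k ∷ w) (refl ∷ b))

pmul-≈ᵇ : ∀ a f → pmul a f ≈ᵇ (λ _ → 0#)
pmul-≈ᵇ a f [] b = refl
pmul-≈ᵇ a f (bos k ∷ w) (refl ∷ b) = pmul-≈ᵇ a (cons (bos k) f) w b

form≈mform : ∀ v → form v ≈ᵇ mform v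
form≈mform [] w b = refl
form≈mform (bos n ∷ v) w b = hmul-≈ᵇ n (form≈mform v) w b
form≈mform (fer a ∷ v) w b = pmul-≈ᵇ a (form v) w b ∙ sym (conv-0 a _ (λ i j _ → pmul-≈ᵇ i (hmul j (mform v)) w b))

hook-≈ᵇ : ∀ i n {f g} → f ≈ᵇ g → hook i n f ≈ᵇ hook i n g
hook-≈ᵇ i zero p w b = p (bos i ∷ w) (refl ∷ b)
hook-≈ᵇ i (suc n) p w b = sub-cong (hook-≈ᵇ 1 n (λ v c → p (bos i ∷ v) (refl ∷ c)) w b) (hook-≈ᵇ (suc i) n p w b)

el-≈ᵇ : ∀ n {f g} → f ≈ᵇ g → el n f ≈ᵇ el n g
el-≈ᵇ zero p = p
el-≈ᵇ (suc n) p = hook-≈ᵇ 1 n p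

has0-bosonic : ∀ {w} → Valid w → Bosonic w → has0 w ≡ false
has0-bosonic [] [] = refl
has0-bosonic (row {zero} {false} () _ _) _
has0-bosonic (row {zero} {true} _ _ _) (() ∷ _)
has0-bosonic (row {suc k} _ _ val) (_ ∷ b) = has0-bosonic val b

strip-bosonic : ∀ {w} → Bosonic w → Bosonic (strip w)
strip-bosonic {[]} [] = []
strip-bosonic {(zero , _) ∷ w} (_ ∷ b) = strip-bosonic b
strip-bosonic {(suc zero , false) ∷ w} (_ ∷ b) = strip-bosonic b
strip-bosonic {(suc (suc k) , _) ∷ w} (p ∷ b) = p ∷ strip-bosonic b

E-≈ᵇ : ∀ N {w} → Valid w → Bosonic w → ∀ {f g} → f ≈ᵇ g → E 1# N w f ≡ E 1# N w g
E-≈ᵇ zero val b p = p [] []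
E-≈ᵇ (suc N) {w} val b {f} {g} p rewrite has0-bosonic val b =
  cong (signF false (strip w) *_) (E-≈ᵇ N (strip-valid val) (strip-bosonic b) (el-≈ᵇ (rows w) p))

sc-≈ᵇ : ∀ t f → sc t f ≈ᵇ f
sc-≈ᵇ t f w b = cong (λ n → pow t n * f w) (fd-0 b) ∙ *-identityˡ _
  where
  fd-0 : ∀ {w} → Bosonic w → fd w ≡ 0
  fd-0 [] = refl
  fd-0 {bos _ ∷ w} (refl ∷ b) = fd-0 b

sc-dn : ∀ t n f w → dn n (sc t f) w ≡ sc t (dn n f) w
sc-dn t zero f w = sym (zeroʳ _)
sc-dn t (suc n) f w = refl

-- Each unit of exponent that Φ moves onto the fermionic variable costs a factor t; besides the
-- overall t^k this changes the parameter from 1 to t.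
Φ-sc : ∀ t k f w → φ k (sc t f) w ≡ pow t k * sc t (Φ t k f) w
Φ-sc t k f [] = sc-fer t k f [] ∙ refl
Φ-sc t k f (bos n ∷ w) = φ-bos k n (sc t f) w ∙ sub-cong (Φ-sc t k (cons (bos n) f) w)
    (lin-cong (Lin-φ (suc k) w) (sc-dn t n f) ∙ Φ-sc t (suc k) (dn n f) w) ∙
  solve 5 (λ p q x y t → p :* (q :* x) :- (t :* p) :* (q :* y) := p :* (q :* (x :- t :* y))) refl (pow t k) (pow t (fd w)) _ _ t
Φ-sc t k f (fer a ∷ w) = cong -_ (lin-cong (Lin-φ k w) (sc-fer t a f) ∙ lin-* (Lin-φ k w) (pow t a) _ ∙ cong (pow t a *_) (Φ-sc t k (cons (fer a) f) w)) ∙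
  solve 4 (λ a k p x → :- (a :* (k :* (p :* x))) := k :* ((a :* p) :* :- x)) refl (pow t a) (pow t k) (pow t (fd w)) _ ∙
    cong (λ z → pow t k * (z * - Φ t k (cons (fer a) f) w)) (sym (pow-+ t a (fd w)))

Φs : ℚ → List ℕ → Fn → Fn
Φs τ [] f = f
Φs τ (k ∷ a) f = Φs τ a (Φ τ k f)

Φs-sc : ∀ t a f w → Δφ.Δs a (sc t f) w ≡ pow t (sum a) * sc t (Φs t a f) w
Φs-sc t [] f w = sym (*-identityˡ _)
Φs-sc t (k ∷ a) f w = lin-cong (Δφ.Lin-Δs a w) (Φ-sc t k f) ∙ lin-* (Δφ.Lin-Δs a w) (pow t k) _ ∙
  cong (pow t k *_) (Φs-sc t a (Φ t k f) w) ∙ sym (*-assoc _ _ _) ∙ cong (_* sc t (Φs t a (Φ t k f)) w) (sym (pow-+ t k (sum a)))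

Φ-0 : ∀ {f} → Symm f → ∀ k w → Φ 0# k f w ≡ f (fer k ∷ w)
Φ-0 s k [] = refl
Φ-0 {f} s k (bos n ∷ w) = sub-cong (Φ-0 (Symm-cons s (bos n)) k w) (zeroˡ _) ∙ solve 1 (λ x → x :- con 0# := x) refl _ ∙ swap-bos s n (fer k) w
Φ-0 s k (fer a ∷ w) = cong -_ (Φ-0 (Symm-cons s (fer a)) k w ∙ swap-fer s a k w) ∙ solve 1 (λ x → :- :- x := x) refl _

Φs-0 : ∀ {f} → Symm f → ∀ a w → Φs 0# a f w ≡ Δc.Δs a f w
Φs-0 s [] w = refl
Φs-0 {f} s (k ∷ a) w = Φs-0 (Symm-Φ 0# k s) a w ∙ lin-cong (Δc.Lin-Δs a w) (Φ-0 s k)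

-- The test function p̃_{Γ^a} e_{(Γ^s)'} attached to a word Γ.
module Test {Γ : Mono} (vΓ : Valid Γ) where
  a s : List ℕ
  a = ferL Γ
  s = bosL Γ
  private
    ispΓ : IsSP (a , s)
    ispΓ = fromW-SP vΓ
    isps : IsSP ([] , s)
    isps = T-∧₂ (strictDec a) ispΓ
  b : Mono
  b = toW ([] , s)
  vb : Valid b
  vb = fst (toW-SP ([] , s) isps)
  bb : Bosonic b
  bb = norm-All (all-bos s)
    where
    all-bos : ∀ s → Bosonic (bosons s)
    all-bos [] = []
    all-bos (x ∷ s) = refl ∷ all-bos s
  Tb : Fn → ℚ
  Tb = E 1# (bound b) b
  lT : Lin Tb
  lT = Lin-E 1# (bound b) b
  insAll-Γ : insAll a b ≡ Γ
  insAll-Γ = go a ∙ toW-fromW vΓ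
    where
    go : ∀ a → insAll a b ≡ toW (a , s)
    go [] = refl
    go (k ∷ a) = cong (ins (fer k)) (go a)
  Tb-0 : ∀ u → b ≺ norm u → Tb (mform u) ≡ 0#
  Tb-0 u lt = let x , p = norm-mform u in at-norm x p (norm-valid u)
    where
    at-norm : ∀ x → (∀ w → mform u w ≡ x * mform (norm u) w) → Valid (norm u) ⊎ (∀ w → mform u w ≡ 0#) → Tb (mform u) ≡ 0#
    at-norm x p (inr q) = lin-0 lT q
    at-norm x p (inl v) = lin-cong lT p ∙ lin-* lT x _ ∙ *0 (E-mform-0 (bound b) vb (bounded b) v lt)
  Tb-form : ∀ u → Tb (form u) ≡ Tb (mform u)
  Tb-form u = E-≈ᵇ (bound b) vb bb (form≈mform u)
  -- `G` is built with φ and is triangular in the monomials, as orthogonality at finite t requires.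
  -- `H` is built with multiplication by the p̃'s, which φ becomes in the limit, and is triangular
  -- in the words.
  G : Fn → ℚ
  G f = Tb (Δφ.Δs a f)
  lG : Lin G
  lG = Lin-∘ lT (Δφ.Lin-Δs a)
  G-above : ∀ v → Γ ≺ norm v → G (mform v) ≡ 0#
  G-above v lt = Δφ.above-0 a b lT Tb-0 v (subst (_≺ norm v) (sym insAll-Γ) lt)
  H : Fn → ℚ
  H f = Tb (Δc.Δs a f)
  lH : Lin H
  lH = Lin-∘ lT (Δc.Lin-Δs a)
  H-above : ∀ v → Γ ≺ norm v → H (form v) ≡ 0#
  H-above v lt = Δc.above-0 a b lT (λ u q → Tb-form u ∙ Tb-0 u q) v (subst (_≺ norm v) (sym insAll-Γ) lt)
  H-diag : H (form Γ) ≡ 1#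
  H-diag = begin
    Tb (Δc.Δs a (form Γ)) ≡⟨ lin-cong lT (λ w → lin-cong (Δc.Lin-Δs a w) (λ v → sym (form-canon Γ v)) ∙ deleted a (T-∧₁ (strictDec a) ispΓ) w) ⟩
    Tb (form (bosons s)) ≡⟨ Tb-form (bosons s) ⟩
    Tb (mform (bosons s)) ≡⟨ lin-cong lT (mform-toW ([] , s) isps) ⟩
    Tb (mform b) ≡⟨ E-mform-1 (bound b) vb (bounded b) ⟩
    1# ∎
    where
    past : ∀ k a v x → form (fers a ++ bos k ∷ v) x ≡ hmul k (form (fers a ++ v)) x
    past k [] v x = refl
    past k (y ∷ a) v x = lin-cong (Lin-pmul y x) (past k a v) ∙ sym (hmul-pmul k y _ x)
    form-canon : ∀ w x → form (canon (fromW w)) x ≡ form w x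
    form-canon [] x = refl
    form-canon (fer k ∷ w) x = lin-cong (Lin-pmul k x) (form-canon w)
    form-canon (bos k ∷ w) x = past k (ferL w) _ x ∙ lin-cong (Lin-hmul k x) (form-canon w)
    absent-bos : ∀ s k w → form (bosons s) (fer k ∷ w) ≡ 0#
    absent-bos [] k w = refl
    absent-bos (x ∷ s) k w = hmul-fer x k _ w ∙ lin-0 (Lin-hmul x w) (absent-bos s k)
    absent : ∀ {k} a → All (_≢ k) a → ∀ w → form (fers a ++ bosons s) (fer k ∷ w) ≡ 0#
    absent {k} [] [] w = absent-bos s k w
    absent {k} (x ∷ a) (p ∷ q) w = 0-0 (0* (δ-≢ x k p)) (lin-0 (Lin-pmul x w) (absent a q))
    deleted : ∀ a → T (strictDec a) → ∀ w → Δc.Δs a (form (fers a ++ bosons s)) w ≡ form (bosons s) w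
    deleted [] t w = refl
    deleted (k ∷ a) t w = lin-cong (Δc.Lin-Δs a w) (λ v → sub-cong (cong (_* form (fers a ++ bosons s) v) (δ-refl k) ∙ *-identityˡ _)
        (lin-0 (Lin-pmul k v) (absent a (below-≢ (fst (strictDec⇒All k a t))))) ∙ solve 1 (λ x → x :- con 0# := x) refl _) ∙
      deleted a (snd (strictDec⇒All k a t)) w
  value : SymF → ℚ
  value d = Tb (Φs 0# a (hat d))

Lin-Φs : ∀ a → LinOp (Φs 0# a)
Lin-Φs [] w = Lin-at w
Lin-Φs (k ∷ a) w = Lin-∘ (Lin-Φs a w) (Lin-Φ 0# k)

norm-id : ∀ {M} → Valid M → norm M ≡ M
norm-id [] = refl
norm-id (row {zero} {false} () _ _)
norm-id (row {suc k} {false} _ tp val) = cong (ins (bos (suc k))) (norm-id val) ∙ ins-above (suc k) false _ tp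
norm-id (row {k} {true} _ tp val) = cong (ins (fer k)) (norm-id val) ∙ ins-above k true _ tp

S-Deg : ∀ {w} → Valid w → ∀ u → Deg u ≢ Deg w → S w (mform u) ≡ 0#
S-Deg {w} val u n = let C , a , r = S-above val in
  solve 2 (λ x y → x := (x :- y) :+ y) refl (S w (mform u)) (mform u w) ∙
    0+0 (r (Symm-mform u) ∙ ev-0 C (mform u) (All.map (λ {p} q → mform-Deg u (snd p) (λ e → n (e ∙ snd q))) a)) (mform-Deg u w n)

size-wsize : ∀ Λ → IsSP Λ → size Λ ≡ wsize (toW Λ)
size-wsize Λ isp = cong size (sym (snd (toW-SP Λ isp))) ∙ cong sum (star-fromW (fst (toW-SP Λ isp))) ∙ sum-rowLens (toW Λ)

fdeg-nf : ∀ Λ → IsSP Λ → fdeg Λ ≡ nf (toW Λ)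
fdeg-nf Λ isp = cong fdeg (sym (snd (toW-SP Λ isp))) ∙ length-ferL (toW Λ)

-- Orthogonal families in one degree, and detection by tests.

module Degree (n m : ℕ) where
  open Elimination n m public

  in-SP : ∀ Γ → IsSP Γ → Deg (toW Γ) ≡ dg → In (toW Γ)
  in-SP Γ isp e = fst (toW-SP Γ isp) , e

  S-unitriangular : Unitriangular (λ M → co (S M))
  S-unitriangular M (val , e) = trans (lin-cong (Lin-S M) (mform-canon M)) (S-mform-1 val) , off
    where
    off : ∀ Γ → IsSP Γ → ¬ (Deg (toW Γ) ≡ dg × toW Γ ≼ M) → co (S M) Γ ≡ 0#
    off Γ isp n with Deg≟ (Deg (toW Γ)) dg | ≺-cmp (toW Γ) M
    ... | inr q | _ = lin-cong (Lin-S M) (mform-toW Γ isp) ∙ S-Deg val (toW Γ) (λ r → q (r ∙ e))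
    ... | inl q | inl r = ⊥-elim (n (q , inr r))
    ... | inl q | inr (inl r) = ⊥-elim (n (q , inl r))
    ... | inl q | inr (inr r) = lin-cong (Lin-S M) (mform-toW Γ isp) ∙ S-mform-0 (⊏-wf val) val (fst (toW-SP Γ isp)) r

  lift-supp : ∀ {w} → Acc _⊏_ w → ∀ d → Supp w d → Lift d
  lift-supp = elim S-unitriangular (λ _ d → Lift d) (λ w d p → record { fun = λ _ → 0# ; lin = Lin-0 ; coef = p })
    (λ w d M i lt a l → record { fun = λ f → Lift.fun l f + a * S M f ; lin = Lin-+ (Lift.lin l) (Lin-* a (Lin-S M))
      ; coef = λ Γ isp → solve 2 (λ x y → x := (x :- y) :+ y) refl (d Γ) (a * co (S M) Γ) ∙ cong (_+ a * co (S M) Γ) (Lift.coef l Γ isp) })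

  -- A single row too long for the degree, hence above every word of that degree.
  top : Mono
  top = bos (suc n) ∷ []

  v-top : Valid top
  v-top = row (s≤s z≤n) [] []

  below-top : ∀ {v} → In v → v ≺ top
  below-top {[]} _ = []≺
  below-top {bos k ∷ v} (_ , e) = here (s≤s (subst (k ≤_) (cong fst e) (m≤m+n k _)))
  below-top {fer k ∷ v} (_ , e) = here (s≤s (subst (k ≤_) (cong fst e) (m≤m+n k _)))

  Supp-top : ∀ {d} → OffDeg dg d → Supp top d
  Supp-top off Γ isp q with Deg≟ (Deg (toW Γ)) dg
  ... | inl e = ⊥-elim (q (e , below-top (in-SP Γ isp e)))
  ... | inr e = off Γ isp e

  lift-off : ∀ {d} → OffDeg dg d → Lift d
  lift-off off = lift-supp (⊏-wf v-top) _ (Supp-top off)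

  module Family {t W} (wt : IsWeight t W) {B : Mono → SymF} (ut : Unitriangular B)
    (orth : ∀ M N → In M → In N → M ≢ N → ScalarProd W (B M) (B N) 0#) where

    B-off : ∀ M → In M → OffDeg dg (B M)
    B-off M i Γ isp n = snd (ut M i) Γ isp (λ (e , _) → n e)

    -- Elimination writes ζ, whose monomials lie below w ≼ N, through the functions B_M with M ≺ N,
    -- all orthogonal to B_N.
    pairing-0 : ∀ {N} → In N → ∀ {ζ w} → Lin ζ → Valid w → w ≼ N → (∀ v → In v → ¬ (v ≺ w) → ζ (mform v) ≡ 0#) → ζ (sc t (hat (B N))) ≡ 0#
    pairing-0 {N} iN {ζ} {w} l vw le p = elim ut R base stepR (⊏-wf vw) d supp le l d-value
      where
      span = hat-span (lift-off (B-off N iN)) (B-off N iN) t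
      R : Mono → SymF → Set
      R w d = w ≼ N → ∀ {ζ} → Lin ζ → (∀ v → In v → ζ (mform v) ≡ d (fromW v)) → ζ (sc t (hat (B N))) ≡ 0#
      base : ∀ w d → (∀ Γ → IsSP Γ → d Γ ≡ 0#) → R w d
      base w d z _ l q = agree l Lin-0 (λ v val e → q v (val , e) ∙ z (fromW v) (fromW-SP val)) span
      stepR : ∀ w d M → In M → M ≺ w → ∀ a → R M (λ Γ → d Γ - a * B M Γ) → R w d
      stepR w d M i lt a r le {ζ} l q = let M≺N = ≺-≼-trans lt le ; lM , _ , v = scalar wt (orth M N i iN (λ { refl → ≺-irrefl M≺N })) in begin
        _
          ≡⟨ solve 3 (λ x a y → x := (x :- a :* y) :+ a :* y) refl _ a (Lift.fun lM (sc t (hat (B N)))) ⟩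
        (ζ (sc t (hat (B N))) - a * Lift.fun lM (sc t (hat (B N)))) + a * Lift.fun lM (sc t (hat (B N)))
          ≡⟨ cong₂ _+_ (r (inr M≺N) {λ f → ζ f - a * Lift.fun lM f} (Lin-sub l (Lin-* a (Lift.lin lM))) (λ v j → sub-cong (q v j) (cong (a *_) (word-value lM v (fst j)))))
               (*0 (sym v)) ⟩
        0# + 0# ≡⟨ +-identityˡ 0# ⟩
        0# ∎
      d : SymF
      d Γ with Deg≟ (Deg (toW Γ)) dg
      ... | inl _ = ζ (mform (toW Γ))
      ... | inr _ = 0#
      d-value : ∀ v → In v → ζ (mform v) ≡ d (fromW v)
      d-value v (val , e) with Deg≟ (Deg (toW (fromW v))) dg
      ... | inl _ = cong (λ u → ζ (mform u)) (sym (toW-fromW val))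
      ... | inr n = ⊥-elim (n (cong Deg (toW-fromW val) ∙ e))
      supp : Supp w d
      supp Γ isp n with Deg≟ (Deg (toW Γ)) dg
      ... | inl e = p (toW Γ) (in-SP Γ isp e) (λ lt → n (e , lt))
      ... | inr _ = refl

  on-S : ∀ {Γ} (i : In Γ) M → Test.value (fst i) (co (S M)) ≡ Test.H (fst i) (λ w → S M (form w))
  on-S i M = lin-cong (Test.lT (fst i)) (λ w → Φs-0 symmS (Test.a (fst i)) w ∙ lin-cong (Δc.Lin-Δs (Test.a (fst i)) w) (hat-co (Lin-S M)))
    where symmS = Symm-hat {co (S M)} (record { fun = S M ; lin = Lin-S M ; coef = λ _ _ → refl })
  -- S_M is the word M plus larger words (`S-above`), and H_Γ vanishes on words above Γ; only the
  -- leading word can contribute.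
  H-S : ∀ {Γ M} (i : In Γ) → In M → Γ ≼ M → Test.H (fst i) (λ w → S M (form w)) ≡ Test.H (fst i) (form M)
  H-S {Γ} {M} i j le = let C , a , r = S-above (fst j) ; l = Test.lH (fst i) in
    lin-cong l (λ w → solve 2 (λ x y → x := y :+ (x :- y)) refl (S M (form w)) (form w M) ∙
        cong₂ _+_ (form-sym w M) (r (Symm-form w) ∙ ev-cong C (form-sym w))) ∙
      lin-+ l (form M) _ ∙ +0 (lin-ev l C form ∙
        ev-0 C (λ v → Test.H (fst i) (form v)) (All.map (λ {p} q → Test.H-above (fst i) (snd p) (≼-≺-trans le (fst q))) a))
  below : ∀ {Γ M} (i : In Γ) → In M → Γ ≺ M → Test.value (fst i) (co (S M)) ≡ 0#
  below {Γ} {M} i j lt = on-S i M ∙ H-S i j (inr lt) ∙ Test.H-above (fst i) M (subst (Γ ≺_) (sym (norm-id (fst j))) lt)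
  value-sub : ∀ {Γ} (i : In Γ) d a M → Test.value (fst i) (λ Ω → d Ω - a * co (S M) Ω) ≡ Test.value (fst i) d - a * Test.value (fst i) (co (S M))
  value-sub i d a M = lin-cong l hat-sub ∙ lin-sub l (hat d) (λ w → a * hat (co (S M)) w) ∙ cong (λ z → Test.value (fst i) d - z) (lin-* l a (hat (co (S M))))
    where
    l = Lin-∘ (Test.lT (fst i)) (Lin-Φs (Test.a (fst i)))
    coef-sub : ∀ v → coefMono (λ Ω → d Ω - a * co (S M) Ω) v ≡ coefMono d v - a * coefMono (co (S M)) v
    coef-sub v with isSP (keyOf v)
    ... | true = sym (*-raw _ _) ∙ solve 4 (λ s x a y → s :* (x :- a :* y) := s :* x :- a :* (s :* y)) refl (sgn (invs v)) (d (keyOf v)) a (co (S M) (keyOf v)) ∙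
      cong₂ (λ x y → x - a * y) (*-raw _ _) (*-raw _ _)
    ... | false = solve 1 (λ a → con 0# := con 0# :- a :* con 0#) refl a
    hat-sub : ∀ w → hat (λ Ω → d Ω - a * co (S M) Ω) w ≡ hat d w - a * hat (co (S M)) w
    hat-sub w = ev-cong C coef-sub ∙ lin-sub (C , λ _ → refl) (coefMono d) (λ v → a * coefMono (co (S M)) v) ∙ cong (λ z → hat d w - z) (ev-* C a (coefMono (co (S M))))
      where C = fst (K w)

  -- The tests are unitriangular against the S_M, by `below` and `H-diag`. Once the remainder is
  -- known to vanish, d = a S_M, and the test at M gives a = 0.
  detect : ∀ {w} → Acc _⊏_ w → ∀ d → Supp w d → (∀ Γ (i : In Γ) → Γ ≺ w → Test.value (fst i) d ≡ 0#) → ∀ Γ → IsSP Γ → d Γ ≡ 0#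
  detect ac d supp = elim S-unitriangular R (λ w d z _ → z) stepR ac d supp
    where
    R : Mono → SymF → Set
    R w d = (∀ Γ (i : In Γ) → Γ ≺ w → Test.value (fst i) d ≡ 0#) → ∀ Γ → IsSP Γ → d Γ ≡ 0#
    stepR : ∀ w d M → In M → M ≺ w → ∀ a → R M (λ Γ → d Γ - a * co (S M) Γ) → R w d
    stepR w d M i lt a r tests Γ isp = d≡ Γ isp ∙ 0* a≡0
      where
      d≡ : ∀ Γ → IsSP Γ → d Γ ≡ a * co (S M) Γ
      d≡ Γ isp = solve 2 (λ x y → x := (x :- y) :+ y) refl (d Γ) (a * co (S M) Γ) ∙ cong (_+ a * co (S M) Γ)
        (r (λ Ω j lt' → value-sub j d a M ∙ 0-0 (tests Ω j (≺-trans lt' lt)) (*0 (below j i lt'))) Γ isp) ∙ +-identityˡ _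
      a≡0 : a ≡ 0#
      a≡0 = solve 2 (λ a v → a := (a :* con 1# :- v) :+ v) refl a (Test.value (fst i) d) ∙ cong₂ _+_
        (sub-cong (cong (a *_) (sym (on-S i M ∙ H-S i i (inl refl) ∙ Test.H-diag (fst i))) ∙
             refl) refl ∙ solve 2 (λ x v → x :- v := :- (v :- x)) refl _ (Test.value (fst i) d) ∙ cong -_ (sym (value-sub i d a M) ∙ zero-value) ∙ solve 0 (:- con 0# := con 0#) refl)
        (tests M i lt) ∙ +-identityˡ 0#
        where
        zero-value : Test.value (fst i) (λ Ω → d Ω - a * co (S M) Ω) ≡ 0#
        zero-value = lin-0 (Lin-∘ (Test.lT (fst i)) (Lin-Φs (Test.a (fst i)))) (λ w → hat-cong {g = λ _ → 0#} (λ Γ isp → sub-cong (d≡ Γ isp) refl ∙ -‿inverseʳ _) w ∙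
            ev-cong (fst (K w)) (coef-0) ∙ ev-0 (fst (K w)) (λ _ → 0#) (All.universal (λ _ → refl) _))
          where
          coef-0 : ∀ v → coefMono (λ _ → 0#) v ≡ 0#
          coef-0 v with isSP (keyOf v)
          ... | true = sym (*-raw (sgn (invs v)) 0#) ∙ zeroʳ (sgn (invs v))
          ... | false = refl

-- The limits t → 0 and t → ∞.

LimFn : (ℚ → Fn) → Fn → Set
LimFn F f = ∀ w → Lim (λ t → F t w) (f w)

Lim-Φ : ∀ k {F f} → LimFn F f → LimFn (λ t → Φ t k (F t)) (Φ 0# k f)
Lim-Φ k l [] = l (fer k ∷ [])
Lim-Φ k {F} {f} l (bos n ∷ w) = Lim-sub (Lim-Φ k (λ v → l (bos n ∷ v)) w) (Lim-* Lim-id (Lim-Φ (suc k) {λ t → dn n (F t)} (low n) w))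
  where
  low : ∀ n v → Lim (λ t → dn n (F t) v) (dn n f v)
  low zero v = Lim-const 0#
  low (suc n) v = l (bos n ∷ v)
Lim-Φ k l (fer a ∷ w) = Lim-neg (Lim-Φ k (λ v → l (fer a ∷ v)) w)

Lim-Φs : ∀ a {F f} → LimFn F f → LimFn (λ t → Φs t a (F t)) (Φs 0# a f)
Lim-Φs [] l = l
Lim-Φs (k ∷ a) l = Lim-Φs a (Lim-Φ k l)

Lim-Lin : ∀ {ξ} → Lin ξ → ∀ {F f} → LimFn F f → Lim (λ t → ξ (F t)) (ξ f)
Lim-Lin {ξ} (C , r) {F} {f} l = subst (Lim (λ t → ξ (F t))) (sym (r f)) (Lim-≗ (Lim-ev C l) (always (λ t _ → r (F t))))

Lim-pow : ∀ n → Lim (λ t → pow t n) (pow 0# n)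
Lim-pow zero = Lim-const 1#
Lim-pow (suc n) = Lim-* Lim-id (Lim-pow n)

Lim-ẽ : ∀ i n {F f} → LimFn F f → LimFn (λ t → ẽ t i n (F t)) (ẽ 0# i n f)
Lim-ẽ i zero l w = l (fer i ∷ w)
Lim-ẽ i (suc n) l w = Lim-sub (Lim-* (Lim-pow (suc n)) (Lim-Lin (Lin-el (suc n) w) (λ v → l (fer i ∷ v)))) (Lim-ẽ (suc i) n l w)

Lim-Oτ : ∀ b r {F f} → LimFn F f → LimFn (λ t → Oτ t b r (F t)) (Oτ 0# b r f)
Lim-Oτ false r l w = Lim-Lin (Lin-el r w) l
Lim-Oτ true r l = Lim-ẽ 0 r l

Lim-E : ∀ N w {F f} → LimFn F f → Lim (λ t → E t N w (F t)) (E 0# N w f)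
Lim-E zero w l = l []
Lim-E (suc N) w l = Lim-* (Lim-const _) (Lim-E N (strip w) (Lim-Oτ (has0 w) (rows w) l))

Lim-hat : ∀ {F : ℚ → SymF} {f} → (∀ Γ → IsSP Γ → Lim (λ t → F t Γ) (f Γ)) → LimFn (λ t → hat (F t)) (hat f)
Lim-hat {F} {f} l w = Lim-ev (fst (K w)) coefs
  where
  coefs : ∀ v → Lim (λ t → coefMono (F t) v) (coefMono f v)
  coefs v with isSP (keyOf v) in eq
  ... | true = subst (Lim _) (*-raw _ _) (Lim-≗ (Lim-* (Lim-const (sgn (invs v))) (l (keyOf v) (subst T (sym eq) tt))) (always (λ t _ → sym (*-raw _ _))))
  ... | false = Lim-const 0#

Lim-value : ∀ {φ L c} → Lim φ L → Eventually (λ t → φ t ≡ c) → L ≡ c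
Lim-value {φ} {L} {c} l e = solve 2 (λ x c → x := (x :- c) :+ c) refl L c ∙ cong (_+ c)
  (Lim-unique (Lim-sub l (Lim-const c)) (Ev-map (λ t _ p → cong (_- c) p ∙ -‿inverseʳ c) e)) ∙ +-identityˡ c

pow-inverse : ∀ {t u} → u * t ≡ 1# → ∀ n → pow u n * pow t n ≡ 1#
pow-inverse p zero = *-identityˡ _
pow-inverse {t} {u} p (suc n) = solve 4 (λ u a t b → (u :* a) :* (t :* b) := (u :* t) :* (a :* b)) refl u (pow u n) t (pow t n) ∙
  cong₂ _*_ p (pow-inverse p n) ∙ *-identityˡ 1#

pow-cancel : ∀ {t} → 0# ℚ.< t → ∀ n {x} → pow t n * x ≡ 0# → x ≡ 0#
pow-cancel {t} p n {x} q = sym (cong (_* x) (pow-inverse (*-raw (inv t) t ∙ inv-* p) n) ∙ *-identityˡ x) ∙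
  *-assoc _ _ _ ∙ *0 q

module _ (n m : ℕ) where
  open Degree n m

  triangular : ∀ {B : Mono → SymF} → (∀ M → In M → B M (fromW M) ≡ 1# × (∀ Γ → B M Γ ≢ 0# → Γ ≡ fromW M ⊎ Γ <SP fromW M)) → Unitriangular B
  triangular {B} h M i = fst (h M i) , off
    where
    off : ∀ Γ → IsSP Γ → ¬ (Deg (toW Γ) ≡ dg × toW Γ ≼ M) → B M Γ ≡ 0#
    off Γ isp outside with B M Γ ℚP.≟ 0#
    ... | yes e = e
    ... | no ne with snd (h M i) Γ ne
    ... | inl refl = ⊥-elim (outside (trans (cong Deg (toW-fromW (fst i))) (snd i) , inl (toW-fromW (fst i))))
    ... | inr lt = ⊥-elim (outside (trans (<SP-Deg {Γ} {fromW M} (fst lt)) (cong Deg (toW-fromW (fst i)) ∙ snd i) , inr (subst (toW Γ ≺_) (toW-fromW (fst i)) (<SP⇒≺ {Γ} {fromW M} lt))))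

  Lim-unitriangular : ∀ {B : ℚ → Mono → SymF} {B∞ : Mono → SymF} → Eventually (λ t → Unitriangular (B t)) →
    (∀ M → In M → ∀ Γ → IsSP Γ → Lim (λ t → B t M Γ) (B∞ M Γ)) → Unitriangular B∞
  Lim-unitriangular e l M i = Lim-value (l M i (fromW M) (fromW-SP (fst i))) (Ev-map (λ t _ u → fst (u M i)) e) ,
    λ Γ isp outside → Lim-value (l M i Γ isp) (Ev-map (λ t _ u → snd (u M i) Γ isp outside) e)

  degree-of : ∀ {M} → In M → size (fromW M) ≡ n × fdeg (fromW M) ≡ m
  degree-of {M} (val , e) = trans (size-wsize (fromW M) (fromW-SP val)) (cong fst (cong Deg (toW-fromW val) ∙ e)) ,
    fdeg-nf (fromW M) (fromW-SP val) ∙ cong snd (cong Deg (toW-fromW val) ∙ e)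

  fromW-injective : ∀ {M N} → In M → In N → M ≢ N → fromW M ≢ fromW N
  fromW-injective i j ne e = ne (sym (toW-fromW (fst i)) ∙ cong toW e ∙ toW-fromW (fst j))

  Orthogonal : ℚ → (Mono → SymF) → Set
  Orthogonal t B = IsWeight t (weightQT t t) × Unitriangular B × (∀ M N → In M → In N → M ≢ N → ScalarProd (weightQT t t) (B M) (B N) 0#)

  family : ∀ {A : SP → Set} {t P} → 0# ℚ.< t → (t ℚ.< 1# ⊎ 1# ℚ.< t) → IsPFamilyOn A (weightQT t t) P → (∀ M → In M → A (fromW M)) → Orthogonal t (λ M → P (fromW M))
  family p c (tri , orth) a = weightQT-IsWeight p c , triangular (λ M i → tri (fromW M) (fromW-SP (fst i)) (a M i)) ,
    λ M N i j ne → orth (fromW M) (fromW N) (fromW-SP (fst i)) (fromW-SP (fst j)) (a M i) (a N j) (fromW-injective i j ne)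

  module _ {s} (basis : IsSBasis s) where
    private
      δ₀ = fst basis
      P₀ = fst (snd basis)
      B : ℚ → Mono → SymF
      B t M = P₀ t (fromW M)
      eventually : Eventually (λ t → Orthogonal t (B t))
      eventually = Ev-map (λ t p (q , r) → family p (inl r) (fst (snd (snd (snd basis))) t p)
          (λ M i → subst₂ (λ x y → t ℚ.< δ₀ x y) (sym (fst (degree-of i))) (sym (snd (degree-of i))) q))
        (Ev-∧ (δ₀ n m , fst (snd (snd basis)) n m , λ t _ q → q) (1# , ℚP.positive⁻¹ 1# , λ t _ q → q))
      limits : ∀ M → In M → ∀ Γ → IsSP Γ → Lim (λ t → B t M Γ) (s (fromW M) Γ)
      limits M i Γ isp = fromLimAt0⁺ (snd (snd (snd (snd basis))) (fromW M) Γ (fromW-SP (fst i)))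
      ut : Unitriangular (λ M → s (fromW M))
      ut = Lim-unitriangular (Ev-map (λ t _ o → fst (snd o)) eventually) limits

      -- For Γ ≺ w the functional `G` is orthogonal to P_w(t,t). Extracting the twist leaves a power
      -- of t, which is cancelled before the limit is taken.
      value-0 : ∀ {w} → In w → ∀ Γ (i : In Γ) → Γ ≺ w → Test.value (fst i) (s (fromW w)) ≡ 0#
      value-0 {w} j Γ i lt = Lim-unique (Lim-Lin (Test.lT (fst i)) (Lim-Φs (Test.a (fst i)) (Lim-hat (λ Ω isp → limits w j Ω isp))))
        (Ev-map (λ t p o → pow-cancel p (sum (Test.a (fst i))) (untwisted t o)) eventually)
        where
        untwisted : ∀ t → Orthogonal t (B t) → pow t (sum (Test.a (fst i))) * Test.Tb (fst i) (Φs t (Test.a (fst i)) (hat (B t w))) ≡ 0#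
        untwisted t (wt , u , orth) = cong (pow t (sum (Test.a (fst i))) *_)
            (sym (E-≈ᵇ (bound (Test.b (fst i))) (Test.vb (fst i)) (Test.bb (fst i)) (sc-≈ᵇ t (Φs t (Test.a (fst i)) (hat (B t w)))))) ∙
          sym (lin-cong-* (Test.lT (fst i)) (Φs-sc t (Test.a (fst i)) (hat (B t w)))) ∙
            Family.pairing-0 wt u orth j (Test.lG (fst i)) (fst j) (inl refl) vanish
          where
          vanish : ∀ v → In v → ¬ (v ≺ w) → Test.G (fst i) (mform v) ≡ 0#
          vanish v k outside = Test.G-above (fst i) v (subst (Γ ≺_) (sym (norm-id (fst k))) above)
            where
            above : Γ ≺ v
            above with ≺-cmp v w
            ... | inl q = ⊥-elim (outside q)
            ... | inr (inl refl) = lt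
            ... | inr (inr q) = ≺-trans lt q

    -- Both functions have coefficient 1 at w and nothing above it, so their difference is supported
    -- below w, where `detect` applies.
    s≡S : ∀ {w} → In w → ∀ Γ → IsSP Γ → s (fromW w) Γ ≡ co (S w) Γ
    s≡S {w} j Γ isp = solve 2 (λ x y → x := (x :- con 1# :* y) :+ y) refl (s (fromW w) Γ) (co (S w) Γ) ∙
      cong (_+ co (S w) Γ) (detect (⊏-wf (fst j)) d supp tests Γ isp) ∙ +-identityˡ _
      where
      d : SymF
      d Γ = s (fromW w) Γ - 1# * co (S w) Γ
      supp : Supp w d
      supp Γ isp outside with ≺-cmp (toW Γ) w
      ... | inr (inl e) = cong₂ (λ x y → x - 1# * y) (cong (s (fromW w)) Γw ∙ fst (ut w j)) (cong (co (S w)) Γw ∙ fst (S-unitriangular w j)) ∙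
        solve 0 (con 1# :- con 1# :* con 1# := con 0#) refl
        where Γw = sym (snd (toW-SP Γ isp)) ∙ cong fromW e
      ... | inl q = cong₂ (λ x y → x - 1# * y) (snd (ut w j) Γ isp (λ (e , _) → outside (e , q))) (snd (S-unitriangular w j) Γ isp (λ (e , _) → outside (e , q))) ∙
        solve 0 (con 0# :- con 1# :* con 0# := con 0#) refl
      ... | inr (inr q) = cong₂ (λ x y → x - 1# * y) (snd (ut w j) Γ isp (λ (_ , r) → ≺-irrefl (≺-≼-trans q r))) (snd (S-unitriangular w j) Γ isp (λ (_ , r) → ≺-irrefl (≺-≼-trans q r))) ∙
        solve 0 (con 0# :- con 1# :* con 0# := con 0#) refl
      tests : ∀ Γ (i : In Γ) → Γ ≺ w → Test.value (fst i) d ≡ 0#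
      tests Γ i lt = value-sub i (s (fromW w)) 1# w ∙ cong₂ (λ x y → x - 1# * y) (value-0 j Γ i lt) (below i j lt) ∙
        solve 0 (con 0# :- con 1# :* con 0# := con 0#) refl

-- Column tests and the dual basis at t → ∞.

-- Under the twist, ẽ acquires a power of t and becomes the deformed ẽ at τ = 1/t.

ẽ-sc : ∀ {t τ} → t * τ ≡ 1# → ∀ i n f w → ẽ 1# i n (sc t f) w ≡ pow t (i ℕ.+ n) * sc t (ẽ τ i n f) w
ẽ-sc {t} p i zero f w = sc-fer t i f w ∙ cong (λ k → pow t k * sc t (cons (fer i) f) w) (sym (ℕP.+-identityʳ i))
ẽ-sc {t} {τ} p i (suc n) f w = begin
  _
    ≡⟨ ẽ-suc i n (sc t f) w ⟩
  el (suc n) (cons (fer i) (sc t f)) w - ẽ 1# (suc i) n (sc t f) w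
    ≡⟨ sub-cong (lin-cong (Lin-el (suc n) w) (sc-fer t i f) ∙ lin-* (Lin-el (suc n) w) (pow t i) _ ∙ cong (pow t i *_) (el-sc t (cons (fer i) f) (suc n) w))
         (ẽ-sc p (suc i) n f w ∙ cong (λ k → pow t k * sc t (ẽ τ (suc i) n f) w) (sym (+-suc i n))) ⟩
  pow t i * (F * X₁) - pow t (i ℕ.+ suc n) * (F * Y)
    ≡⟨ cong (λ z → z * (F * X₁) - pow t (i ℕ.+ suc n) * (F * Y)) shift ⟩
  (pow t (i ℕ.+ suc n) * pow τ (suc n)) * (F * X₁) - pow t (i ℕ.+ suc n) * (F * Y)
    ≡⟨ solve 5 (λ a b f x y → (a :* b) :* (f :* x) :- a :* (f :* y) := a :* (f :* (b :* x :- y))) refl (pow t (i ℕ.+ suc n)) (pow τ (suc n)) F X₁ Y ⟩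
  _ ∎
  where
  F = pow t (fd w)
  X₁ = el (suc n) (cons (fer i) f) w
  Y = ẽ τ (suc i) n f w
  shift : pow t i ≡ pow t (i ℕ.+ suc n) * pow τ (suc n)
  shift = sym (cong (_* pow τ (suc n)) (pow-+ t i (suc n)) ∙ *-assoc _ _ _ ∙ cong (pow t i *_) (pow-inverse p (suc n)) ∙ *-identityʳ _)

-- The total height of the columns of w that end in a circle; each such factor ẽ yields its height
-- as a power of t.
twist : ℕ → Mono → ℕ
twist zero w = 0
twist (suc N) w = (if has0 w then rows w else 0) ℕ.+ twist N (strip w)

E-sc : ∀ {t τ} → t * τ ≡ 1# → ∀ N w f → E 1# N w (sc t f) ≡ pow t (twist N w) * E τ N w f
E-sc p zero w f = refl
E-sc {t} {τ} p (suc N) w f = cong (signF (has0 w) (strip w) *_) (lin-cong l (twisted (has0 w)) ∙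
    lin-* l _ _ ∙ cong (pow t (if has0 w then rows w else 0) *_) (E-sc p N (strip w) (Oτ τ (has0 w) (rows w) f))) ∙
  solve 4 (λ s a b x → s :* (a :* (b :* x)) := (a :* b) :* (s :* x)) refl (signF (has0 w) (strip w)) (pow t (if has0 w then rows w else 0)) (pow t (twist N (strip w))) _ ∙
    cong (_* (signF (has0 w) (strip w) * E τ N (strip w) (Oτ τ (has0 w) (rows w) f))) (sym (pow-+ t (if has0 w then rows w else 0) (twist N (strip w))))
  where
  l = Lin-E 1# N (strip w)
  twisted : ∀ b v → Oτ 1# b (rows w) (sc t f) v ≡ pow t (if b then rows w else 0) * sc t (Oτ τ b (rows w) f) v
  twisted false v = el-sc t f (rows w) v ∙ sym (*-identityˡ _)
  twisted true v = ẽ-sc p 0 (rows w) f v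

-- Precomposition with A turns every factor m_{(0;1^r)} into (-1)^r p̃_r, which is the limit of the
-- deformed factor; this is what A is made for.
E-A : ∀ N w {f} → Symm f → E 1# N w (A f) ≡ E 0# N w f
E-A zero w s = refl
E-A (suc N) w {f} s = cong (signF (has0 w) (strip w) *_) (lin-cong (Lin-E 1# N (strip w)) (moved (has0 w)) ∙ E-A N (strip w) (Symm-Oτ 0# (has0 w) (rows w) s))
  where
  moved : ∀ b v → Oτ 1# b (rows w) (A f) v ≡ A (Oτ 0# b (rows w) f) v
  moved false v = sym (A-el f (rows w) v)
  moved true v = ẽ-A-0 s (rows w) v

SA : Mono → Fn → ℚ
SA w f = S w (A f)

Lin-SA : ∀ w → Lin (SA w)
Lin-SA w = Lin-∘ (Lin-S w) Lin-A

-- Inverting the triangular relation of `E-lead`, S_w lies in the span of the E_u with u ≼ w.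
S-below : ∀ {w} → Acc _⊏_ w → Valid w → ∀ {f} → Symm f → (∀ u → Valid u → u ≼ w → E 1# (bound u) u f ≡ 0#) → S w f ≡ 0#
S-below {w} (acc rs) vw {f} s p = let C , a , r = S-from-E vw s in
  solve 2 (λ x y → x := (x :+ y) :- y) refl (S w f) (ev C (λ v → S v f)) ∙
    0-0 (sym r ∙ p w vw (inl refl)) (ev-0 C (λ v → S v f) (All.map (λ (vu , q) → S-below (rs (vu , q)) vu s (λ u vu' le → p u vu' (inr (≼-≺-trans le q)))) a))

module _ (n m : ℕ) where
  open Degree n m

  module _ {sb} (basis : IsSbarBasis sb) where
    private
      T₀ = fst basis
      P₀ = fst (snd basis)
      B : ℚ → Mono → SymF
      B τ M = P₀ (inv τ) (fromW M)
      x̄ : Mono → SymF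
      x̄ M = sb (fromW M)
      eventually : Eventually (λ τ → Orthogonal n m (inv τ) (B τ))
      eventually = Ev-large {λ t → Orthogonal n m t (λ M → P₀ t (fromW M))} (T₀ n m) (λ t q r → family n m (ℚP.<-trans (ℚP.positive⁻¹ 1#) r) (inr r) (fst (snd (snd basis)) t)
        (λ M i → subst₂ (λ x y → T₀ x y ℚ.< t) (sym (fst (degree-of n m i))) (sym (snd (degree-of n m i))) q))
      limits : ∀ M → In M → ∀ Γ → IsSP Γ → Lim (λ τ → B τ M Γ) (x̄ M Γ)
      limits M i Γ isp = fromLimAtInf {λ t → P₀ t (fromW M) Γ} (snd (snd (snd basis)) (fromW M) Γ (fromW-SP (fst i)))
    x̄-unitriangular : Unitriangular x̄
    x̄-unitriangular = Lim-unitriangular n m (Ev-map (λ t _ o → fst (snd o)) eventually) limits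

    x̄-off : ∀ M → In M → OffDeg dg (x̄ M)
    x̄-off M i Γ isp outside = snd (x̄-unitriangular M i) Γ isp (λ (e , _) → outside e)

    x̄-lift : ∀ M → In M → Lift (x̄ M)
    x̄-lift M i = lift-off (x̄-off M i)

    -- For u ≺ M the monomials of E_u lie below M, so E_u is orthogonal to P_M(t,t). Removing the
    -- twist leaves the factors at parameter τ = 1/t; as τ → 0 they become those at 0, and `E-A`
    -- rewrites them with A.
    E-x̄ : ∀ {M} → In M → ∀ u → Valid u → u ≺ M → E 1# (bound u) u (A (hat (x̄ M))) ≡ 0#
    E-x̄ {M} i u vu lt = E-A (bound u) u (Symm-hat (x̄-lift M i)) ∙ Lim-unique (Lim-E (bound u) u (Lim-hat (λ Γ isp → limits M i Γ isp)))
      (Ev-map (λ τ p o → pow-cancel (inv-pos p) (twist (bound u) u) (untwisted τ p o)) eventually)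
      where
      untwisted : ∀ τ → 0# ℚ.< τ → Orthogonal n m (inv τ) (B τ) → pow (inv τ) (twist (bound u) u) * E τ (bound u) u (hat (B τ M)) ≡ 0#
      untwisted τ p (wt , ut , orth) = sym (E-sc (*-raw (inv τ) τ ∙ inv-* p) (bound u) u (hat (B τ M))) ∙
        Family.pairing-0 wt ut orth i (Lin-E 1# (bound u) u) (fst i) (inl refl) vanish
        where
        vanish : ∀ v → In v → ¬ (v ≺ M) → E 1# (bound u) u (mform v) ≡ 0#
        vanish v k outside = E-mform-0 (bound u) vu (bounded u) (fst k) above
          where
          above : u ≺ v
          above with ≺-cmp v M
          ... | inl q = ⊥-elim (outside q)
          ... | inr (inl refl) = lt
          ... | inr (inr q) = ≺-trans lt q

    A-x̄ : ∀ {M} (i : In M) v → Valid v → A (hat (x̄ M)) v ≡ x̄ M (fromW v)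
    A-x̄ {M} i v val = A-hat (x̄-lift M i) v ∙ word-value (x̄-lift M i) v val

    A-x̄-0 : ∀ {M} (i : In M) v → (Deg v ≡ dg → M ≺ norm v) → A (hat (x̄ M)) v ≡ 0#
    A-x̄-0 {M} i v far = A-hat l v ∙ at-norm x p (norm-valid v)
      where
      l = x̄-lift M i
      x = fst (norm-mform v)
      p = snd (norm-mform v)
      at-norm : ∀ x → (∀ w → mform v w ≡ x * mform (norm v) w) → Valid (norm v) ⊎ (∀ w → mform v w ≡ 0#) → Lift.fun l (mform v) ≡ 0#
      at-norm x p (inr q) = lin-0 (Lift.lin l) q
      at-norm x p (inl val) = lin-cong (Lift.lin l) p ∙ lin-* (Lift.lin l) x _ ∙ *0 (word-value l (norm v) val ∙
        snd (x̄-unitriangular M i) (fromW (norm v)) (fromW-SP val) far')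
        where
        far' : ¬ (Deg (toW (fromW (norm v))) ≡ dg × toW (fromW (norm v)) ≼ M)
        far' (e , le) = ≺-irrefl (≺-≼-trans (far (sym (Deg-norm v) ∙ cong Deg (sym (toW-fromW val)) ∙ e)) (subst (_≼ M) (toW-fromW val) le))

    SA-leading : ∀ {M w} (i : In M) → Valid w → (Deg w ≡ dg → M ≼ w) → SA w (hat (x̄ M)) ≡ A (hat (x̄ M)) w
    SA-leading {M} {w} i vw le = let C , a , r = S-above vw in
      solve 2 (λ x y → x := (x :- y) :+ y) refl (SA w (hat (x̄ M))) (A (hat (x̄ M)) w) ∙
        cong (_+ A (hat (x̄ M)) w) (r (Symm-A (Symm-hat (x̄-lift M i))) ∙
          ev-0 C (A (hat (x̄ M))) (All.map (λ {p} q → A-x̄-0 i (snd p) (λ e → ≼-≺-trans (le (sym (snd q) ∙ e)) (fst q))) a)) ∙ +-identityˡ _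

    -- Two triangularities meet. For w below M the pairing vanishes by `E-x̄`; for w equal to or
    -- above M it reduces by `SA-leading` to the coefficient of x̄_M at w, which is 1 or 0.
    SA-dual : ∀ {M} (i : In M) Λ → IsSP Λ → SA (toW Λ) (hat (x̄ M)) ≡ δSP Λ (fromW M)
    SA-dual {M} i Λ isp = compare (Λ ≟SP fromW M) (≺-cmp w M) (Deg≟ (Deg w) dg)
      where
      w = toW Λ
      vw = fst (toW-SP Λ isp)
      δ-yes : Λ ≡ fromW M → δSP Λ (fromW M) ≡ 1#
      δ-yes e with Λ ≟SP fromW M
      ... | yes _ = refl
      ... | no ne = ⊥-elim (ne e)
      δ-no : Λ ≢ fromW M → δSP Λ (fromW M) ≡ 0#
      δ-no ne with Λ ≟SP fromW M
      ... | yes e = ⊥-elim (ne e)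
      ... | no _ = refl
      to-M : Λ ≡ fromW M → w ≡ M
      to-M e = cong toW e ∙ toW-fromW (fst i)
      compare : _ → _ → _ → SA w (hat (x̄ M)) ≡ δSP Λ (fromW M)
      compare (yes e) _ _ = SA-leading i vw (λ _ → inl (sym (to-M e))) ∙ A-x̄ i w vw ∙
        cong (x̄ M) (snd (toW-SP Λ isp) ∙ e) ∙ fst (x̄-unitriangular M i) ∙ sym (δ-yes e)
      compare (no ne) (inr (inl e)) _ = ⊥-elim (ne (sym (snd (toW-SP Λ isp)) ∙ cong fromW e))
      compare (no ne) (inl lt) _ = S-below (⊏-wf vw) vw (Symm-A (Symm-hat (x̄-lift M i))) (λ u vu le → E-x̄ i u vu (≼-≺-trans le lt)) ∙ sym (δ-no ne)
      compare (no ne) (inr (inr g)) _ = SA-leading i vw (λ _ → inr g) ∙ A-x̄ i w vw ∙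
        snd (x̄-unitriangular M i) (fromW w) (fromW-SP vw) (λ (_ , le) → ≺-irrefl (≺-≼-trans g (subst (_≼ M) (toW-fromW vw) le))) ∙ sym (δ-no ne)

    -- By `A-form`, `mform v` is the pairing with the combination of words behind χ; elimination
    -- expresses χ through the x̄_M.
    annihilator : ∀ {ζ} → Lin ζ → (∀ M (i : In M) → ζ (hat (x̄ M)) ≡ 0#) → ∀ v → In v → ζ (mform v) ≡ 0#
    annihilator {ζ} l p v j = lin-cong l (λ w → sym (A-form v w)) ∙
      elim x̄-unitriangular R base' step' (⊏-wf v-top) (co χ) (Supp-top off) lχ (λ Γ isp → refl)
      where
      χ : Fn → ℚ
      χ f = A f v
      lχ : Lin χ
      lχ = Lin-A v
      off : OffDeg dg (co χ)
      off Γ isp outside = lin-cong (Lin-A v) (mform-toW Γ isp) ∙ A-mform-Deg (toW Γ) v (λ e → outside (e ∙ snd j))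
      R : Mono → SymF → Set
      R w d = ∀ {χ} → Lin χ → (∀ Γ → IsSP Γ → co χ Γ ≡ d Γ) → ζ (λ w → χ (form w)) ≡ 0#
      base' : ∀ w d → (∀ Γ → IsSP Γ → d Γ ≡ 0#) → R w d
      base' w d z0 lχ q = lin-0 l (λ w → sym (hat-co lχ w) ∙ hat-cong {g = co (λ _ → 0#)} (λ Γ isp → q Γ isp ∙ z0 Γ isp) w ∙ hat-co Lin-0 w)
      step' : ∀ w d M → In M → M ≺ w → ∀ a → R M (λ Γ → d Γ - a * x̄ M Γ) → R w d
      step' w d M i lt a r {χ} lχ q = lin-cong l (λ w → solve 3 (λ x a y → x := (x :- a :* y) :+ a :* y) refl (χ (form w)) a (Lift.fun lM (form w))) ∙
        lin-+ l _ _ ∙ 0+0 (r {λ f → χ f - a * Lift.fun lM f} (Lin-sub lχ (Lin-* a (Lift.lin lM))) (λ Γ isp → sub-cong (q Γ isp) (cong (a *_) (sym (Lift.coef lM Γ isp))))) (lin-* l a _ ∙ *0 (lin-cong l (λ w → sym (hat-lift lM w)) ∙ p M i))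
        where lM = x̄-lift M i

    sb*≡SA-degree : ∀ {sd} → IsDual sd sb → ∀ Λ → IsSP Λ → ∀ Γ → IsSP Γ → Deg (toW Γ) ≡ dg → sd Λ Γ ≡ co (SA (toW Λ)) Γ
    sb*≡SA-degree {sd} dual Λ iΛ Γ isp e = Lift.coef lΛ Γ isp ∙ solve 2 (λ x y → x := (x :- y) :+ y) refl (co (Lift.fun lΛ) Γ) (co (SA (toW Λ)) Γ) ∙
      cong (_+ co (SA (toW Λ)) Γ) (lin-cong lζ (mform-toW Γ isp) ∙ annihilator lζ killed (toW Γ) (in-SP Γ isp e)) ∙ +-identityˡ _
      where
      lΛ : Lift (sd Λ)
      lΛ = fst (scalar weight-IsWeight (dual Λ Λ iΛ iΛ))
      ζ : Fn → ℚ
      ζ f = Lift.fun lΛ f - SA (toW Λ) f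
      lζ : Lin ζ
      lζ = Lin-sub (Lift.lin lΛ) (Lin-SA (toW Λ))
      sc-1 : ∀ f w → sc 1# f w ≡ f w
      sc-1 f w = cong (_* f w) (pow-1 (fd w)) ∙ *-identityˡ _
      killed : ∀ M (i : In M) → ζ (hat (x̄ M)) ≡ 0#
      -- Each instance of the duality brings its own expansion of `sd Λ`; `agree` identifies the
      -- resulting lifts on this degree, so the fixed lift can be paired with every x̄_M.
      killed M i = let l' , _ , v = scalar weight-IsWeight (dual Λ (fromW M) iΛ (fromW-SP (fst i))) in
        sub-cong (lin-cong (Lift.lin lΛ) (λ w → sym (sc-1 (hat (x̄ M)) w)) ∙
            agree (Lift.lin lΛ) (Lift.lin l') (λ u val _ → word-value lΛ u val ∙ sym (word-value l' u val)) (hat-span (x̄-lift M i) (x̄-off M i) 1#) ∙ sym v)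
          (SA-dual i Λ iΛ) ∙ -‿inverseʳ _

-- Identification of the two bases and the Pieri rules.

s≡co-S : ∀ {s} → IsSBasis s → ∀ Λ → IsSP Λ → ∀ Γ → IsSP Γ → s Λ Γ ≡ co (S (toW Λ)) Γ
s≡co-S {s} basis Λ iΛ Γ isp = cong (λ Ω → s Ω Γ) (sym (snd (toW-SP Λ iΛ))) ∙ s≡S _ _ basis (fst (toW-SP Λ iΛ) , refl) Γ isp

sb*≡co-SA : ∀ {sb sd} → IsSbarBasis sb → IsDual sd sb → ∀ Λ → IsSP Λ → ∀ Γ → IsSP Γ → sd Λ Γ ≡ co (SA (toW Λ)) Γ
sb*≡co-SA basis dual Λ iΛ Γ isp = sb*≡SA-degree _ _ basis dual Λ iΛ Γ isp refl

theorem4p4 : (s sbar sbarStar : SP → SymF)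
    → IsSBasis s → IsSbarBasis sbar → IsDual sbarStar sbar
    → ∀ Λ ℓ → IsSP Λ → 1 ≤ ℓ
    → (∀ (L : List SP) → Unique L → (∀ Ω → (Ω ∈ L) ⇔ PieriH Λ ℓ Ω)
         → ∀ Γ → IsSP Γ → (sbarStar Λ ⋆ h ℓ) Γ ≡ sumℚ (map (λ Ω → sbarStar Ω Γ) L))
    × (∀ (L : List SP) → Unique L → (∀ Ω → (Ω ∈ L) ⇔ PieriV Λ ℓ Ω)
         → ∀ Γ → IsSP Γ → (s Λ ⋆ e ℓ) Γ ≡ sumℚ (map (λ Ω → s Ω Γ) L))
theorem4p4 s sbar sbarStar basis basis̄ dual Λ ℓ iΛ _ = horizontal , vertical
  where
  vΛ = fst (toW-SP Λ iΛ)
  horizontal : ∀ (L : List SP) → Unique L → (∀ Ω → (Ω ∈ L) ⇔ PieriH Λ ℓ Ω)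
    → ∀ Γ → IsSP Γ → (sbarStar Λ ⋆ h ℓ) Γ ≡ sumℚ (map (λ Ω → sbarStar Ω Γ) L)
  horizontal L uL mem Γ isp = begin
    (sbarStar Λ ⋆ h ℓ) Γ ≡⟨ ⋆-congˡ (h ℓ) (sb*≡co-SA basis̄ dual Λ iΛ) Γ isp ⟩
    (co (SA (toW Λ)) ⋆ h ℓ) Γ ≡⟨ ⋆-h (Lin-SA (toW Λ)) ℓ Γ isp ⟩
    -- A is h-linear: h_ℓ passes through it by its defining clause, and only `S` remains to be
    -- expanded.
    S (toW Λ) (cons (bos ℓ) (A (mform (canon Γ)))) ≡⟨ S-h vΛ ℓ (Symm-A (Symm-mform (canon Γ))) ⟩
    sumL (P (toW Λ) ℓ) (λ v → S v (A (mform (canon Γ))))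
      ≡⟨ sumL-cong (P (toW Λ) ℓ) (λ v i → sym (let vv = All.lookup (fst (P-valid vΛ ℓ)) i in
           sb*≡co-SA basis̄ dual (fromW v) (fromW-SP vv) Γ isp ∙ cong (λ u → co (SA u) Γ) (toW-fromW vv))) ⟩
    sumL (P (toW Λ) ℓ) (λ v → sbarStar (fromW v) Γ) ≡⟨ sym (PieriH-sum Λ ℓ iΛ uL mem (λ Ω → sbarStar Ω Γ)) ⟩
    _ ∎
  vertical : ∀ (L : List SP) → Unique L → (∀ Ω → (Ω ∈ L) ⇔ PieriV Λ ℓ Ω)
    → ∀ Γ → IsSP Γ → (s Λ ⋆ e ℓ) Γ ≡ sumℚ (map (λ Ω → s Ω Γ) L)
  vertical L uL mem Γ isp = begin
    (s Λ ⋆ e ℓ) Γ ≡⟨ ⋆-congˡ (e ℓ) (s≡co-S basis Λ iΛ) Γ isp ⟩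
    (co (S (toW Λ)) ⋆ e ℓ) Γ ≡⟨ ⋆-e (Lin-S (toW Λ)) ℓ Γ isp ⟩
    S (toW Λ) (el ℓ (mform (canon Γ))) ≡⟨ S-el ℓ vΛ (Symm-mform (canon Γ)) ⟩
    sumL (V (toW Λ) ℓ) (λ v → S v (mform (canon Γ)))
      ≡⟨ sumL-cong (V (toW Λ) ℓ) (λ v i → sym (let vv = fst (All.lookup (V-valid ℓ vΛ) i) in
           s≡co-S basis (fromW v) (fromW-SP vv) Γ isp ∙ cong (λ u → co (S u) Γ) (toW-fromW vv))) ⟩
    sumL (V (toW Λ) ℓ) (λ v → s (fromW v) Γ) ≡⟨ sym (PieriV-sum Λ ℓ iΛ uL mem (λ Ω → s Ω Γ)) ⟩
    _ ∎
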